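{- Let $n\ge 10$. The complexes $\Delta(I)$, $I\in\mathcal{I}_n$, are pairwise non-isomorphic. In particular, there is a constant $c>0$ such that there are at least $c\cdot2^n$ pairwise non-isomorphic centrally symmetric combinatorial $3$-spheres on the vertex set $V_{n+1}$ that are cs-$2$-neighborly.
   Context: Simplicial complexes are finite abstract simplicial complexes; $\overline{A}$ is the simplex of all subsets of a finite set $A$. $V_m=\{\pm1,\dots,\pm m\}$; $-\sigma=\{ -v:v\in\sigma\}$, $-\Gamma=\{ -\sigma:\sigma\in\Gamma\}$. The join is $\Gamma*\Gamma'=\{\sigma\cup\tau\}$, $\Gamma*v:=\Gamma*\overline{\{v\}}$; a path/cycle $(v_1,\dots,v_m)$ is the 1-dimensional complex with edges $\{v_j,v_{j+1}\}$. $\partial C^*_m$ is the complex of all subsets of $V_m$ with no pair $\{j,-j\}$. For pure $\Delta$ and pure full-dimensional subcomplex $\Gamma$, $\Delta\setminus\Gamma$ is generated by facets of $\Delta$ not in $\Gamma$; $\partial B$ is the boundary of a combinatorial ball $B$. Recursive definition: $\Delta^1_n=(1,\dots,n,-1,\dots,-n,1)$; $\Delta^d_{d+1}=\partial C^*_{d+1}$; $B^{d,j}_n=\emptyset$ for $j<0$; $B^{1,0}_n=\overline{\{ -1,n\}}$; $B^{2k-1,k}_n=\Delta^{2k-1}_n\setminus B^{2k-1,k-1}_n$ ($k\ge1$, $n\ge 2k$); $B^{d,i}_n=(B^{d-1,i}_{n-1}*n)\cup((-B^{d-1,i-1}_{n-1})*(-n))$ ($d\ge2$, $n\ge d+1$,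 $i\le\lfloor d/2\rfloor$); $\Delta^d_{n+1}$ is obtained from $\Delta^d_n$ by replacing $B=B^{d,\lceil d/2\rceil-1}_n$ with $\partial B*(n+1)$ and $-B$ with $\partial(-B)*(-n-1)$ (known to be well defined; $\Delta^3_n$ is a combinatorial 3-sphere on $V_n$). Let $\mathcal{I}_n$ be the collection of all sets $I=\{i_1<\dots<i_p\}\subseteq\{3,\dots,n-6\}$ ($p\ge0$) with $i_2-i_1>1$ if $p\ge2$; set $i_{p+1}:=n-2$. Let $B(I)$ be the pure 3-dimensional complex whose facets are: $\{1,2,i,i+2\}$ for $3\le i\le n-2$; $\{1,2,n-1,n\}$; $\{1,-n+2,n-1,n\}$, $\{1,-n+2,-n+1,n\}$, $\{1,-n+2,-n+1,-n\}$; $\{ -n+m+1,-n+m,n-1,n\}$ for $2\le m\le i_1$ (if $p=0$, for $2\le m\le n-2$); and for each $1\le j\le p$: $\{1,-n+i_j+2,n-i_j-1,n-i_j+1\}$ and $\{ -n+m+1,-n+m,n-i_j-1,n-i_j+1\}$ for $i_j+2\le m\le i_{j+1}$. Let $\partial B(I)$ be the complex generated by the 2-faces of $B(I)$ lying in exactly one facet of $B(I)$. $\Delta(I)$ is the complex whose facets are the facets of $\Delta^3_n$ not in $B(I)\cup-B(I)$, together with $\tau\cup\{n+1\}$ and $-\tau\cup\{ -n-1\}$ for all facets $\tau$ of $\partial B(I)$. A complex on $V_m$ is centrally symmetric if it is closed under $\sigma\mapsto-\sigma$ and no face contains a pair $\{v,-v\}$; it is cs-$i$-neighborly if every subset of $V_m$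 of size $\le i$ with no pair $\{v,-v\}$ is a face. -}

module Defs where

open import Data.Bool using (Bool; true; false; _∧_; not; if_then_else_)
open import Data.Nat as ℕ using (ℕ; zero; suc; _∸_; _≤_; _^_)
import Data.Nat.Properties as ℕP
open import Data.Integer as ℤ using (ℤ; +_; -_; ∣_∣)
open import Data.Integer.Properties using (_≟_)
open import Data.List using (List; []; _∷_; _++_; map; concatMap; filterᵇ; deduplicateᵇ; length; upTo)
open import Data.Bool.ListAction using (any; all)
open import Data.List.Relation.Unary.Any using (Any)
open import Data.List.Relation.Unary.All using (All)
open import Data.List.Relation.Binary.Subset.Propositional using (_⊆_)
open import Data.List.Membership.Propositional using (_∈_)
open import Data.Product using (Σ; _×_; ∃)
open import Relation.Nullary using (does; ¬_)
open import Relation.Binary.PropositionalEquality using (_≡_; _≢_)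

-- Representation.
-- A vertex is an integer; a simplex is a finite list of vertices (read as
-- the set of its entries).  A (finite abstract simplicial) complex is given
-- by a list of generating faces ("facets"); its faces are all subsets of
-- the generators.

Simplex : Set
Simplex = List ℤ

Cx : Set
Cx = List Simplex

Face : Cx → Simplex → Set
Face K σ = Any (σ ⊆_) K

eqᵇ : ℤ → ℤ → Bool
eqᵇ x y = does (x ≟ y)

memᵇ : ℤ → Simplex → Bool
memᵇ x τ = any (eqᵇ x) τ

subᵇ : Simplex → Simplex → Bool
subᵇ σ τ = all (λ x → memᵇ x τ) σ

seteqᵇ : Simplex → Simplex → Bool
seteqᵇ σ τ = subᵇ σ τ ∧ subᵇ τ σ

faceᵇ : Cx → Simplex → Bool
faceᵇ K σ = any (subᵇ σ) K

normal : Cx → Cx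
normal K = deduplicateᵇ seteqᵇ K

remove : ℤ → Simplex → Simplex
remove x τ = filterᵇ (λ y → not (eqᵇ x y)) τ

count : Simplex → Cx → ℕ
count ρ K = length (filterᵇ (subᵇ ρ) K)

cone : ℤ → Cx → Cx
cone v K = map (v ∷_) K

neg : Cx → Cx
neg K = map (map -_) K

minus : Cx → Cx → Cx
minus Δ Γ = filterᵇ (λ τ → not (faceᵇ Γ τ)) Δ

-- ∂B : generated by the codimension-one faces of B (of the pure complex B)
-- lying in exactly one facet of B
bd : Cx → Cx
bd B = normal (concatMap (λ τ → filterᵇ (λ ρ → ℕ._≡ᵇ_ (count ρ F) 1)
                                        (map (λ x → remove x τ) τ)) F)
  where
  F = normal B

range : ℕ → ℕ → List ℕ
range a b = map (a ℕ.+_) (upTo (suc b ∸ a))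

-- Δ^1_m = the cycle (1,…,m,-1,…,-m,1)
Δ1 : ℕ → Cx
Δ1 m = map (λ j → (+ j) ∷ (+ suc j) ∷ []) (range 1 (m ∸ 1))
    ++ ((+ m) ∷ (- (+ 1)) ∷ [])
     ∷ map (λ j → (- (+ j)) ∷ (- (+ suc j)) ∷ []) (range 1 (m ∸ 1))
    ++ ((- (+ m)) ∷ (+ 1) ∷ []) ∷ []

B1₀ : ℕ → Cx
B1₀ m = ((- (+ 1)) ∷ (+ m) ∷ []) ∷ []

B1₁ : ℕ → Cx
B1₁ m = minus (Δ1 m) (B1₀ m)

-- B^{2,0}_m = (B^{1,0}_{m-1} * m) ∪ ((-B^{1,-1}_{m-1}) * (-m)),  B^{1,-1} = ∅
B2₀ : ℕ → Cx
B2₀ m = cone (+ m) (B1₀ (m ∸ 1))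

B2₁ : ℕ → Cx
B2₁ m = cone (+ m) (B1₁ (m ∸ 1)) ++ cone (- (+ m)) (neg (B1₀ (m ∸ 1)))

B3₁ : ℕ → Cx
B3₁ n = cone (+ n) (B2₁ (n ∸ 1)) ++ cone (- (+ n)) (neg (B2₀ (n ∸ 1)))

cross : ℕ → Cx
cross zero    = [] ∷ []
cross (suc m) = concatMap (λ τ → ((+ suc m) ∷ τ) ∷ ((- (+ suc m)) ∷ τ) ∷ []) (cross m)

step3 : ℕ → Cx → Cx
step3 n Δ = minus Δ (B ++ neg B) ++ cone (+ suc n) (bd B) ++ cone (- (+ suc n)) (bd (neg B))
  where
  B = B3₁ n

-- Δ^3_n  (defined for n ≥ 4; the values for n < 4 are irrelevant dummies)
Δ3 : ℕ → Cx
Δ3 0 = []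
Δ3 1 = []
Δ3 2 = []
Δ3 3 = []
Δ3 4 = cross 4
Δ3 (suc (suc (suc (suc (suc k))))) = step3 (suc (suc (suc (suc k)))) (Δ3 (suc (suc (suc (suc k)))))

-- I = {i_1 < … < i_p} ⊆ {3,…,n-6}, given as a strictly increasing list
data StrictInc : List ℕ → Set where
  []  : StrictInc []
  [_] : ∀ x → StrictInc (x ∷ [])
  _∷_ : ∀ {x y xs} → x ℕ.< y → StrictInc (y ∷ xs) → StrictInc (x ∷ y ∷ xs)

GapCond : List ℕ → Set
GapCond (i₁ ∷ i₂ ∷ _) = suc i₁ ℕ.< i₂
GapCond _             = Data.Unit.⊤
  where import Data.Unit

InI : ℕ → List ℕ → Set
InI n I = StrictInc I × All (λ i → 3 ≤ i × i ≤ n ∸ 6) I × GapCond I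

-- blocks of facets of B(I)
-- consecutive pairs (i_j , i_{j+1}) for 1 ≤ j ≤ p, with i_{p+1} = n-2
pairs : ℕ → List ℕ → List (ℕ Data.Product.× ℕ)
pairs n []            = []
pairs n (i ∷ [])      = (i Data.Product., n ∸ 2) ∷ []
pairs n (i ∷ j ∷ js)  = (i Data.Product., j) ∷ pairs n (j ∷ js)

first : ℕ → List ℕ → ℕ
first n []      = n ∸ 2
first n (i ∷ _) = i

z : ℕ → ℤ
z = +_

BI : ℕ → List ℕ → Cx
BI n I =
     map (λ i → z 1 ∷ z 2 ∷ z i ∷ z (i ℕ.+ 2) ∷ []) (range 3 (n ∸ 2))
  ++ (z 1 ∷ z 2 ∷ z (n ∸ 1) ∷ z n ∷ [])
   ∷ (z 1 ∷ (- z n ℤ.+ z 2) ∷ z (n ∸ 1) ∷ z n ∷ [])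
   ∷ (z 1 ∷ (- z n ℤ.+ z 2) ∷ (- z n ℤ.+ z 1) ∷ z n ∷ [])
   ∷ (z 1 ∷ (- z n ℤ.+ z 2) ∷ (- z n ℤ.+ z 1) ∷ - z n ∷ [])
   ∷ map (λ m → (- z n ℤ.+ z m ℤ.+ z 1) ∷ (- z n ℤ.+ z m) ∷ z (n ∸ 1) ∷ z n ∷ [])
         (range 2 (first n I))
  ++ concatMap (λ p → block (Data.Product.proj₁ p) (Data.Product.proj₂ p)) (pairs n I)
  where
  -- for i = i_j, i' = i_{j+1}; note n - i - 1, n - i + 1 are computed in ℤ
  block : ℕ → ℕ → Cx
  block i i' =
      (z 1 ∷ (- z n ℤ.+ z i ℤ.+ z 2) ∷ (z n ℤ.- z i ℤ.- z 1) ∷ (z n ℤ.- z i ℤ.+ z 1) ∷ [])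
    ∷ map (λ m → (- z n ℤ.+ z m ℤ.+ z 1) ∷ (- z n ℤ.+ z m)
                 ∷ (z n ℤ.- z i ℤ.- z 1) ∷ (z n ℤ.- z i ℤ.+ z 1) ∷ [])
          (range (i ℕ.+ 2) i')

ΔI : ℕ → List ℕ → Cx
ΔI n I = minus (Δ3 n) (BI n I ++ neg (BI n I))
      ++ cone (z (suc n)) (bd (BI n I))
      ++ cone (- z (suc n)) (neg (bd (BI n I)))

Isomorphic : Cx → Cx → Set
Isomorphic K L = Σ (ℤ → ℤ) λ f → Σ (ℤ → ℤ) λ g →
  (∀ x → g (f x) ≡ x) × (∀ y → f (g y) ≡ y) ×
  (∀ σ → (Face K σ → Face L (map f σ)) × (Face L (map f σ) → Face K σ))

InV : ℕ → ℤ → Set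
InV m v = (v ≢ + 0) × (∣ v ∣ ≤ m)

NoAntipodal : Simplex → Set
NoAntipodal σ = ∀ v → v ∈ σ → - v ∈ σ → Data.Empty.⊥
  where import Data.Empty

OnVertexSet : ℕ → Cx → Set
OnVertexSet m K = ∀ v → (Face K (v ∷ []) → InV m v) × (InV m v → Face K (v ∷ []))

CentrallySymmetric : Cx → Set
CentrallySymmetric K = (∀ σ → Face K σ → Face K (map -_ σ)) × (∀ σ → Face K σ → NoAntipodal σ)

CsNeighborly : ℕ → ℕ → Cx → Set
CsNeighborly i m K = ∀ σ → All (InV m) σ → length σ ≤ i → NoAntipodal σ → Face K σ

-- Combinatorial spheres.
-- Stellar subdivision of K at a (nonempty) face σ with a new vertex v:
-- the star of σ is replaced by v * ∂σ * lk σ.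
stellar : Cx → Simplex → ℤ → Cx
stellar K σ v = filterᵇ (λ τ → not (subᵇ σ τ)) K
             ++ concatMap (λ τ → map (λ x → v ∷ remove x τ) σ) (filterᵇ (subᵇ σ) K)

-- stellar (= combinatorial / PL) equivalence: generated by isomorphisms,
-- stellar subdivisions and their inverses (stellar welds)
data StellarEq : Cx → Cx → Set where
  iso   : ∀ {K L} → Isomorphic K L → StellarEq K L
  sub   : ∀ {K} σ v → σ ≢ [] → Face K σ → ¬ Face K (v ∷ []) → StellarEq K (stellar K σ v)
  symm  : ∀ {K L} → StellarEq K L → StellarEq L K
  trans : ∀ {K L M} → StellarEq K L → StellarEq L M → StellarEq K M

∂simplex : ℕ → Cx
∂simplex d = map (λ x → remove x vs) vs
  where vs = map +_ (range 1 (d ℕ.+ 2))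

CombinatorialSphere : ℕ → Cx → Set
CombinatorialSphere d K = StellarEq K (∂simplex d)

{-# OPTIONS --safe #-}

-- The balls B³ₙ,₁ and B(I) are stacked, meet every vertex and share no facet
-- with their antipodes. Exchanging a stacked ball B for v ∗ ∂B is a sequence of
-- bistellar flips, so spheres stay spheres; and since a stacked ball has no
-- interior edges, every edge that v needs is created and none is lost, so
-- cs-2-neighborliness is inherited.
--
-- An isomorphism Δ(I) → Δ(J) commutes with the antipode, because antipodal
-- pairs are the only missing edges. Up to sign, {n-2, n} and possibly {2, 3} are
-- the only edges whose link contains all but at most one of the available
-- vertices, and the link of {n-2, n} does contain them. Following this link, a
-- cycle through almost all vertices, shows that the isomorphism is ± the
-- identity. It then remains to read off I: i ∈ I if and only if
-- {n+1, 1, -(n-i-2)} is a face of Δ(I).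
--
-- The claims that hold for all n at once concern families of simplices whose
-- vertices are ±(parameter + constant), hence reduce to difference constraints,
-- which a verified decision procedure refutes by evaluation.

module Submission where

open import Defs hiding (iso; sub; symm; trans)
open import Data.Bool using (Bool; true; false; T; not; if_then_else_) renaming (_∧_ to _&&_; _∨_ to _||_)
open import Data.Bool.Properties using (T?; T-∧; T-≡)
open import Data.Empty using (⊥; ⊥-elim)
open import Data.Unit using (⊤; tt)
open import Data.Nat as ℕ using (ℕ; zero; suc; _+_; _*_; _^_; _∸_; _≤_; _<_; z≤n; s≤s; _≤ᵇ_; _≡ᵇ_)
import Data.Nat.Properties as ℕP
open import Data.Integer as ℤ using (ℤ; +_; -_; ∣_∣; -[1+_])
import Data.Integer.Properties as ℤP
open import Data.Integer.Properties using (_≟_)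
open import Data.List using (List; []; _∷_; _++_; map; filter; filterᵇ; length; upTo; lookup)
open import Data.Bool.ListAction using (any; all)
open import Data.List.Relation.Unary.Any as Any using (Any; here; there)
import Data.List.Relation.Unary.Any.Properties as AnyP
open import Data.List.Relation.Unary.All as All using (All; []; _∷_)
import Data.List.Relation.Unary.All.Properties as AllP
open import Data.List.Relation.Unary.AllPairs using (AllPairs; []; _∷_; allPairs?)
import Data.List.Relation.Unary.AllPairs.Properties as AllPairsP
open import Data.List.Relation.Binary.Subset.Propositional using (_⊆_)
open import Data.List.Membership.Propositional using (_∈_; _∉_; find; lose)
open import Data.List.Membership.Propositional.Properties
open import Data.List.Properties using (map-∘; map-id; length-map; length-++; filter-notAll)
open import Data.Fin using (Fin)
open import Data.Product using (Σ; _×_; _,_; proj₁; proj₂; ∃; ∃₂)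
open import Data.Sum using (_⊎_; inj₁; inj₂; [_,_]′)
open import Function using (_∘_; id; case_of_; Equivalence)
import Relation.Binary
open import Relation.Nullary using (¬_; Dec; yes; no)
open import Relation.Nullary.Decidable using (_×-dec_; _⊎-dec_; ¬?; True; False; toWitness; toWitnessFalse)
open import Relation.Binary.PropositionalEquality using (_≡_; _≢_; refl; sym; trans; cong; cong₂; subst; subst₂)

-- Lists stand for sets, so simplices are compared by `≈` and complexes by `≅`. Two substitutes
-- carry the topology. `Thin` says that of any three facets through a triangle two coincide, which
-- needs no counting. `Stacked` records a gluing order in which every tetrahedron brings a new
-- vertex; the exchange follows this order with one flip per tetrahedron, and thinness guarantees
-- that each flip meets exactly the two facets it expects.
--
-- The obstacle is that B(I) is explicit while Δ³_n is recursive. To locate B(I) inside Δ³_n, a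
-- closed form of all facets of Δ³_n is carried through the recursion, together with the boundary of
-- the ball exchanged at each step (`Closed`). Subtraction is kept out of the indices by using N = n
-- - 2 or t = n - 3 as the parameter and N - i in place of i.
--
-- Cs-2-neighborliness makes all vertices look alike in the edge graph, so rigidity has to start
-- from triangles, that is, from the sizes of links of edges.

infix 4 _≈_ _∈~_ _≅_

_≈_ : Simplex → Simplex → Set
σ ≈ τ = σ ⊆ τ × τ ⊆ σ

≈-refl : ∀ {σ} → σ ≈ σ
≈-refl = id , id

≈-sym : ∀ {σ τ} → σ ≈ τ → τ ≈ σ
≈-sym (p , q) = q , p

≈-trans : ∀ {σ τ υ} → σ ≈ τ → τ ≈ υ → σ ≈ υ
≈-trans (p , q) (r , s) = r ∘ p , q ∘ s

_∈~_ : Simplex → Cx → Set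
σ ∈~ K = ∃ λ κ → κ ∈ K × σ ≈ κ

∈⇒∈~ : ∀ {σ K} → σ ∈ K → σ ∈~ K
∈⇒∈~ p = _ , p , ≈-refl

∈~-resp : ∀ {σ τ K} → σ ≈ τ → τ ∈~ K → σ ∈~ K
∈~-resp e (κ , p , q) = κ , p , ≈-trans e q

_≅_ : Cx → Cx → Set
K ≅ L = (∀ {κ} → κ ∈ K → κ ∈~ L) × (∀ {κ} → κ ∈ L → κ ∈~ K)

≅-sym : ∀ {K L} → K ≅ L → L ≅ K
≅-sym (p , q) = q , p

≅-refl : ∀ {K} → K ≅ K
≅-refl = ∈⇒∈~ , ∈⇒∈~

face⁺ : ∀ {K σ κ} → κ ∈ K → σ ⊆ κ → Face K σ
face⁺ = lose

face⁻ : ∀ {K σ} → Face K σ → ∃ λ κ → κ ∈ K × σ ⊆ κ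
face⁻ = find

face~ : ∀ {K σ κ} → κ ∈~ K → σ ⊆ κ → Face K σ
face~ (λ' , p , q) s = face⁺ p (proj₁ q ∘ s)

face-⊆ : ∀ {K σ τ} → σ ⊆ τ → Face K τ → Face K σ
face-⊆ s f with face⁻ f
... | κ , p , q = face⁺ p (q ∘ s)

face-≅ : ∀ {K L σ} → (∀ {κ} → κ ∈ K → κ ∈~ L) → Face K σ → Face L σ
face-≅ h f with face⁻ f
... | κ , p , q = face~ (h p) q

≅⇒Isomorphic : ∀ {K L} → K ≅ L → Isomorphic K L
≅⇒Isomorphic {K} {L} (p , q) = id , id , (λ _ → refl) , (λ _ → refl) , λ σ →
  (λ f → subst (Face L) (sym (map-id σ)) (face-≅ p f)) ,
  (λ f → face-≅ q (subst (Face L) (map-id σ) f))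

-- Boolean tests and the relations they decide

eqᵇ⇒≡ : ∀ x y → T (eqᵇ x y) → x ≡ y
eqᵇ⇒≡ x y t with x ≟ y
... | yes e = e

≡⇒eqᵇ : ∀ x y → x ≡ y → T (eqᵇ x y)
≡⇒eqᵇ x y e with x ≟ y
... | yes _ = tt
... | no ne = ne e

memᵇ⇒∈ : ∀ {x} τ → T (memᵇ x τ) → x ∈ τ
memᵇ⇒∈ {x} τ t = Any.map (eqᵇ⇒≡ x _) (AnyP.any⁻ (eqᵇ x) τ t)

∈⇒memᵇ : ∀ {x τ} → x ∈ τ → T (memᵇ x τ)
∈⇒memᵇ {x} p = AnyP.any⁺ (eqᵇ x) (Any.map (≡⇒eqᵇ x _) p)

subᵇ⇒⊆ : ∀ σ τ → T (subᵇ σ τ) → σ ⊆ τ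
subᵇ⇒⊆ σ τ t x∈ = memᵇ⇒∈ τ (All.lookup (AllP.all⁺ (λ x → memᵇ x τ) σ t) x∈)

⊆⇒subᵇ : ∀ {σ τ} → σ ⊆ τ → T (subᵇ σ τ)
⊆⇒subᵇ {σ} {τ} s = AllP.all⁻ (λ x → memᵇ x τ) (All.tabulate (λ x∈ → ∈⇒memᵇ (s x∈)))

seteqᵇ⇒≈ : ∀ σ τ → T (seteqᵇ σ τ) → σ ≈ τ
seteqᵇ⇒≈ σ τ t with Equivalence.to T-∧ t
... | a , b = subᵇ⇒⊆ σ τ a , subᵇ⇒⊆ τ σ b

≈⇒seteqᵇ : ∀ {σ τ} → σ ≈ τ → T (seteqᵇ σ τ)
≈⇒seteqᵇ (a , b) = Equivalence.from T-∧ (⊆⇒subᵇ a , ⊆⇒subᵇ b)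

faceᵇ⇒Face : ∀ K σ → T (faceᵇ K σ) → Face K σ
faceᵇ⇒Face K σ t = Any.map (λ {τ} → subᵇ⇒⊆ σ τ) (AnyP.any⁻ (subᵇ σ) K t)

Face⇒faceᵇ : ∀ {K σ} → Face K σ → T (faceᵇ K σ)
Face⇒faceᵇ {K} {σ} f = AnyP.any⁺ (subᵇ σ) (Any.map ⊆⇒subᵇ f)

T-not⁺ : ∀ b → ¬ T b → T (not b)
T-not⁺ true n = n tt
T-not⁺ false n = tt

T-not⁻ : ∀ b → T (not b) → ¬ T b
T-not⁻ false _ ()

⊆? : ∀ σ τ → Dec (σ ⊆ τ)
⊆? σ τ with T? (subᵇ σ τ)
... | yes t = yes (subᵇ⇒⊆ σ τ t)
... | no n = no (n ∘ ⊆⇒subᵇ)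

≈? : ∀ σ τ → Dec (σ ≈ τ)
≈? σ τ = ⊆? σ τ ×-dec ⊆? τ σ

Face? : ∀ K σ → Dec (Face K σ)
Face? K σ with T? (faceᵇ K σ)
... | yes t = yes (faceᵇ⇒Face K σ t)
... | no n = no (n ∘ Face⇒faceᵇ)

abstract
  -- Opaque, so that goals stay folded; outside the abstract blocks it is known only through
  -- membership lemmas. The same holds for `∂`, `starred` and `exchange`.
  del : ℤ → Simplex → Simplex
  del = remove

  ∈-remove⁻ : ∀ x τ {y} → y ∈ del x τ → y ∈ τ × y ≢ x
  ∈-remove⁻ x τ {y} p with ∈-filter⁻ (λ z → T? (not (eqᵇ x z))) {xs = τ} p
  ... | a , b = a , λ e → T-not⁻ (eqᵇ x y) b (≡⇒eqᵇ x y (sym e))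

  ∈-remove⁺ : ∀ x {y τ} → y ∈ τ → y ≢ x → y ∈ del x τ
  ∈-remove⁺ x {y} p n = ∈-filter⁺ (λ z → T? (not (eqᵇ x z))) p (T-not⁺ (eqᵇ x y) (λ t → n (sym (eqᵇ⇒≡ x y t))))

  remove-⊆ : ∀ x τ → del x τ ⊆ τ
  remove-⊆ x τ p = proj₁ (∈-remove⁻ x τ p)

  remove-mono : ∀ x {σ τ} → σ ⊆ τ → del x σ ⊆ del x τ
  remove-mono x {σ} s p with ∈-remove⁻ x σ p
  ... | a , b = ∈-remove⁺ x (s a) b

  remove-≈ : ∀ x {σ τ} → σ ≈ τ → del x σ ≈ del x τ
  remove-≈ x (a , b) = remove-mono x a , remove-mono x b

  length-del-< : ∀ x {σ} → x ∈ σ → length (del x σ) < length σ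
  length-del-< x {σ} p = filter-notAll (λ z → T? (not (eqᵇ x z))) σ
    (Any.map (λ { refl t → T-not⁻ (eqᵇ x x) t (≡⇒eqᵇ x x refl) }) p)

  unique-del : ∀ x {σ} → AllPairs _≢_ σ → AllPairs _≢_ (del x σ)
  unique-del x = AllPairsP.filter⁺ _

-- Membership in differences, boundaries and stellar subdivisions

∈-minus⁻ : ∀ K L {κ} → κ ∈ minus K L → κ ∈ K × ¬ Face L κ
∈-minus⁻ K L {κ} p with ∈-filter⁻ (λ z → T? (not (faceᵇ L z))) {xs = K} p
... | a , b = a , λ f → T-not⁻ (faceᵇ L κ) b (Face⇒faceᵇ f)

∈-minus⁺ : ∀ {K L κ} → κ ∈ K → ¬ Face L κ → κ ∈ minus K L
∈-minus⁺ {K} {L} {κ} p n = ∈-filter⁺ (λ z → T? (not (faceᵇ L z))) p (T-not⁺ (faceᵇ L κ) (n ∘ faceᵇ⇒Face L κ))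

normal-∈ : ∀ K {κ} → κ ∈ normal K → κ ∈ K
normal-∈ (x ∷ K) (here e) = here e
normal-∈ (x ∷ K) (there p) = there (normal-∈ K (proj₁ (∈-filter⁻ _ {xs = normal K} p)))

normal-cover : ∀ K {κ} → κ ∈ K → κ ∈~ normal K
normal-cover (x ∷ K) (here refl) = x , here refl , ≈-refl
normal-cover (x ∷ K) {κ} (there p) with normal-cover K p
... | υ , q , e with T? (seteqᵇ x υ)
...   | yes t = x , here refl , ≈-trans e (≈-sym (seteqᵇ⇒≈ x υ t))
...   | no n  = υ , there (∈-filter⁺ _ q n) , e

normal-distinct : ∀ K → AllPairs (λ σ τ → ¬ σ ≈ τ) (normal K)
normal-distinct [] = []
normal-distinct (x ∷ K) =
  All.tabulate (λ p e → proj₂ (∈-filter⁻ _ {xs = normal K} p) (≈⇒seteqᵇ e))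
  ∷ AllPairsP.filter⁺ _ (normal-distinct K)

-- The set-level meaning of `count ρ (normal B) ≡ᵇ 1`: deduplication makes list entries correspond
-- to facets up to `≈`, so a ridge is counted once when all facets containing it are the same set.
Only : Cx → Simplex → Simplex → Set
Only B ρ τ = ∀ {κ} → κ ∈ B → ρ ⊆ κ → κ ≈ τ

count-one⁻ : ∀ ρ K → T (count ρ K ≡ᵇ 1) → ∀ {κ λ'} → κ ∈ K → λ' ∈ K → ρ ⊆ κ → ρ ⊆ λ' → κ ≡ λ'
count-one⁻ ρ K c {κ} {λ'} p q r s = unique (filterᵇ (subᵇ ρ) K) c (inF p r) (inF q s)
  where
  inF : ∀ {κ} → κ ∈ K → ρ ⊆ κ → κ ∈ filterᵇ (subᵇ ρ) K
  inF p r = ∈-filter⁺ (λ κ → T? (subᵇ ρ κ)) p (⊆⇒subᵇ r)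
  unique : ∀ (L : Cx) → T (length L ≡ᵇ 1) → ∀ {κ λ'} → κ ∈ L → λ' ∈ L → κ ≡ λ'
  unique (x ∷ []) _ (here refl) (here refl) = refl

count-one⁺ : ∀ ρ K τ → AllPairs (λ σ τ → ¬ σ ≈ τ) K → τ ∈ K → ρ ⊆ τ → Only K ρ τ → T (count ρ K ≡ᵇ 1)
count-one⁺ ρ K τ d p r only =
  single (filterᵇ (subᵇ ρ) K) (AllPairsP.filter⁺ _ d) (∈-filter⁺ _ p (⊆⇒subᵇ r))
    (λ q → let a , b = ∈-filter⁻ _ {xs = K} q in only a (subᵇ⇒⊆ ρ _ b))
  where
  single : ∀ (L : Cx) → AllPairs (λ σ τ → ¬ σ ≈ τ) L → τ ∈ L → (∀ {κ} → κ ∈ L → κ ≈ τ) → T (length L ≡ᵇ 1)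
  single (x ∷ []) _ _ _ = tt
  single (x ∷ y ∷ L) ((n ∷ _) ∷ _) _ h = n (≈-trans (h (here refl)) (≈-sym (h (there (here refl)))))

abstract
  ∂ : Cx → Cx
  ∂ = bd

  ∂≡bd : ∀ B → ∂ B ≡ bd B
  ∂≡bd B = refl

  bd⁻ : ∀ B {ρ} → ρ ∈ ∂ B → ∃ λ τ → τ ∈ B × ∃ λ x → x ∈ τ × ρ ≡ del x τ × Only B ρ τ
  bd⁻ B {ρ} p with find (∈-concatMap⁻ _ {xs = normal B} (normal-∈ _ p))
  ... | τ , τ∈ , q with ∈-filter⁻ (λ ρ → T? (count ρ (normal B) ≡ᵇ 1)) {xs = map (λ x → del x τ) τ} q
  ...   | r , c with ∈-map⁻ (λ x → del x τ) r
  ...     | x , x∈ , refl = τ , normal-∈ B τ∈ , x , x∈ , refl , only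
    where
    only : Only B (del x τ) τ
    only k s with normal-cover B k
    ... | κ' , k' , e with count-one⁻ (del x τ) (normal B) c k' τ∈ (proj₁ e ∘ s) (remove-⊆ x τ)
    ...   | refl = e

  bd⁺ : ∀ {B τ x} → τ ∈ B → x ∈ τ → Only B (del x τ) τ → del x τ ∈~ ∂ B
  -- Deduplication may keep another representative τ' of the facet τ, hence a result only up to `≈`.
  bd⁺ {B} {τ} {x} p x∈ only with normal-cover B p
  ... | τ' , p' , e = ∈~-resp {remove x τ} {remove x τ'} (remove-≈ x e)
    (normal-cover _ (∈-concatMap⁺ ridges (lose p' (∈-filter⁺ (λ ρ → T? (count ρ (normal B) ≡ᵇ 1))
      (∈-map⁺ (λ x → del x τ') (proj₁ e x∈))
      (count-one⁺ (del x τ') (normal B) τ' (normal-distinct B) p' (remove-⊆ x τ')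
        (λ k s → ≈-trans (only (normal-∈ B k) (s ∘ remove-mono x (proj₁ e))) e))))))
    where
    ridges : Simplex → Cx
    ridges τ = filterᵇ (λ ρ → count ρ (normal B) ≡ᵇ 1) (map (λ x → del x τ) τ)

abstract
  ∈-stellar⁻ : ∀ K σ w {κ} → κ ∈ stellar K σ w →
    (κ ∈ K × ¬ σ ⊆ κ) ⊎ (∃ λ τ → τ ∈ K × σ ⊆ τ × ∃ λ x → x ∈ σ × κ ≡ w ∷ del x τ)
  ∈-stellar⁻ K σ w {κ} p with ∈-++⁻ (filterᵇ (λ τ → not (subᵇ σ τ)) K) p
  ... | inj₁ q = let a , b = ∈-filter⁻ (λ τ → T? (not (subᵇ σ τ))) {xs = K} q
                 in inj₁ (a , λ s → T-not⁻ (subᵇ σ κ) b (⊆⇒subᵇ s))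
  ... | inj₂ q with find (∈-concatMap⁻ _ {xs = filterᵇ (subᵇ σ) K} q)
  ...   | τ , r , s = let a , b = ∈-filter⁻ (λ τ → T? (subᵇ σ τ)) {xs = K} r
                          x , c , d = ∈-map⁻ (λ x → w ∷ del x τ) s
                      in inj₂ (τ , a , subᵇ⇒⊆ σ τ b , x , c , d)

  ∈-stellarˡ : ∀ {K σ w κ} → κ ∈ K → ¬ σ ⊆ κ → κ ∈ stellar K σ w
  ∈-stellarˡ {K} {σ} {w} {κ} p n = ∈-++⁺ˡ
    (∈-filter⁺ (λ τ → T? (not (subᵇ σ τ))) p (T-not⁺ (subᵇ σ κ) (λ t → n (subᵇ⇒⊆ σ κ t))))

  ∈-stellarʳ : ∀ {K σ w τ x} → τ ∈ K → σ ⊆ τ → x ∈ σ → w ∷ del x τ ∈ stellar K σ w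
  ∈-stellarʳ {K} {σ} {w} {τ} p s q = ∈-++⁺ʳ (filterᵇ (λ τ → not (subᵇ σ τ)) K)
    (∈-concatMap⁺ (λ τ → map (λ x → w ∷ del x τ) σ)
      (lose (∈-filter⁺ (λ τ → T? (subᵇ σ τ)) p (⊆⇒subᵇ s)) (∈-map⁺ (λ x → w ∷ del x τ) q)))

∈-cone⁻ : ∀ {v K κ} → κ ∈ cone v K → ∃ λ ρ → ρ ∈ K × κ ≡ v ∷ ρ
∈-cone⁻ = ∈-map⁻ (_ ∷_)

∈-cone⁺ : ∀ {v K ρ} → ρ ∈ K → v ∷ ρ ∈ cone v K
∈-cone⁺ = ∈-map⁺ (_ ∷_)

∷-≈ : ∀ {v σ τ} → σ ≈ τ → v ∷ σ ≈ v ∷ τ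
∷-≈ {v} (a , b) = f a , f b
  where
  f : ∀ {σ τ} → σ ⊆ τ → v ∷ σ ⊆ v ∷ τ
  f s (here e) = here e
  f s (there p) = there (s p)

-- Simplices of fixed size, fresh vertices and the bistellar flip

Unique : Simplex → Set
Unique = AllPairs _≢_

IsSimplex : ℕ → Simplex → Set
IsSimplex k σ = Unique σ × length σ ≡ k

_∈?_ : ∀ x (σ : Simplex) → Dec (x ∈ σ)
x ∈? σ = Any.any? (x ≟_) σ

remove-here : ∀ x {σ} → x ∉ σ → del x (x ∷ σ) ≈ σ
remove-here x {σ} n = f , λ p → ∈-remove⁺ x (there p) (λ { refl → n p })
  where
  f : del x (x ∷ σ) ⊆ σ
  f p with ∈-remove⁻ x (x ∷ σ) p
  ... | here e , ne = ⊥-elim (ne e)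
  ... | there q , _ = q

remove-there : ∀ a x {σ} → a ≢ x → del a (x ∷ σ) ≈ x ∷ del a σ
remove-there a x {σ} n = f , g
  where
  f : del a (x ∷ σ) ⊆ x ∷ del a σ
  f p with ∈-remove⁻ a (x ∷ σ) p
  ... | here e , _ = here e
  ... | there q , ne = there (∈-remove⁺ a q ne)
  g : x ∷ del a σ ⊆ del a (x ∷ σ)
  g (here refl) = ∈-remove⁺ a (here refl) (n ∘ sym)
  g (there p) with ∈-remove⁻ a σ p
  ... | q , ne = ∈-remove⁺ a (there q) ne

unique-head : ∀ {x : ℤ} {σ} → Unique (x ∷ σ) → x ∉ σ
unique-head (a ∷ _) p = All.lookup a p refl

unique-∷ : ∀ {x : ℤ} {σ} → x ∉ σ → Unique σ → Unique (x ∷ σ)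
unique-∷ n u = All.tabulate (λ { p refl → n p }) ∷ u

unique-⊆-length : ∀ {σ τ} → Unique σ → σ ⊆ τ → length σ ≤ length τ
unique-⊆-length {[]} u s = z≤n
unique-⊆-length {x ∷ σ} {τ} (a ∷ u) s = ℕP.≤-trans
  (s≤s (unique-⊆-length u (λ p → ∈-remove⁺ x (s (there p)) (λ { refl → unique-head (a ∷ u) p }))))
  (length-del-< x (s (here refl)))

pigeonhole : ∀ {σ τ} → Unique σ → σ ⊆ τ → length τ ≤ length σ → τ ⊆ σ
pigeonhole {σ} {τ} u s l {x} p with x ∈? σ
... | yes q = q
... | no n = ⊥-elim (ℕP.<⇒≱ (unique-⊆-length (unique-∷ n u) (λ { (here refl) → p ; (there q) → s q })) l)

extra : ∀ {σ τ} → Unique τ → length σ < length τ → ∃ λ y → y ∈ τ × y ∉ σ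
extra {σ} {τ} u l with All.all? (_∈? σ) τ
... | yes a = ⊥-elim (ℕP.<⇒≱ l (unique-⊆-length u (All.lookup a)))
... | no n = find (AllP.¬All⇒Any¬ (_∈? σ) τ n)

isSimplex-remove : ∀ {k τ x} → IsSimplex (suc k) τ → x ∈ τ → IsSimplex k (del x τ)
isSimplex-remove {k} {τ} {x} (u , l) p = unique-del x u , ℕP.≤-antisym
  (ℕP.≤-pred (subst (suc (length (del x τ)) ≤_) l (length-del-< x p)))
  (ℕP.≤-pred (subst (_≤ suc (length (del x τ))) l (unique-⊆-length {τ} {x ∷ del x τ} u g)))
  where
  g : τ ⊆ x ∷ del x τ
  g {y} q with y ≟ x
  ... | yes e = here e
  ... | no n = there (∈-remove⁺ x q n)

same-size : ∀ {k σ τ} → IsSimplex k σ → IsSimplex k τ → σ ⊆ τ → τ ⊆ σ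
same-size (u , l) (_ , l') s = pigeonhole u s (ℕP.≤-reflexive (trans l' (sym l)))

Fresh : ℤ → Cx → Set
Fresh v K = ∀ {κ} → κ ∈ K → v ∉ κ

fresh⇒¬Face : ∀ {v K} → Fresh v K → ¬ Face K (v ∷ [])
fresh⇒¬Face n f with face⁻ f
... | κ , p , s = n p (s (here refl))

-- Supplies the auxiliary vertex of `flip`: one more than the sum of all absolute values exceeds
-- every vertex in absolute value.
∃-fresh : ∀ K → ∃ λ v → Fresh v K
∃-fresh K = + suc (bound K) , λ p q → ℕP.<-irrefl refl (bounded K p q)
  where
  size : Simplex → ℕ
  size [] = 0
  size (x ∷ σ) = ∣ x ∣ + size σ
  bound : Cx → ℕ
  bound [] = 0
  bound (σ ∷ K) = size σ + bound K
  sized : ∀ σ {x} → x ∈ σ → ∣ x ∣ ≤ size σ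
  sized (x ∷ σ) (here refl) = ℕP.m≤m+n _ _
  sized (x ∷ σ) (there p) = ℕP.≤-trans (sized σ p) (ℕP.m≤n+m _ _)
  bounded : ∀ K {κ x} → κ ∈ K → x ∈ κ → ∣ x ∣ ≤ bound K
  bounded (σ ∷ K) (here refl) q = ℕP.≤-trans (sized σ q) (ℕP.m≤m+n _ _)
  bounded (σ ∷ K) (there p) q = ℕP.≤-trans (bounded K p q) (ℕP.m≤n+m _ _)

-- The bistellar move exchanging {x}∗A, {v}∗A for {x,v}∗∂A: starring A on the
-- left and the edge {x,v} on the right gives the same complex.
flip : ∀ {K L A x v} → x ∉ A → v ∉ A → x ≢ v → A ≢ [] → (∃ λ a → a ∈ A) →
  (∀ {κ} → κ ∈ K → A ⊆ κ → κ ≈ x ∷ A ⊎ κ ≈ v ∷ A) → x ∷ A ∈~ K → v ∷ A ∈~ K →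
  (∀ {κ} → κ ∈ L → x ∷ v ∷ [] ⊆ κ → ∃ λ a → a ∈ A × κ ≈ x ∷ v ∷ del a A) →
  (∀ {a} → a ∈ A → x ∷ v ∷ del a A ∈~ L) →
  (∀ {κ} → κ ∈ K → ¬ A ⊆ κ → κ ∈~ L × ¬ x ∷ v ∷ [] ⊆ κ) →
  (∀ {κ} → κ ∈ L → ¬ x ∷ v ∷ [] ⊆ κ → κ ∈~ K × ¬ A ⊆ κ) →
  StellarEq K L
flip {K} {L} {A} {x} {v} x∉ v∉ x≢v ne (a₀ , a₀∈) star xA vA edge Axv to from with ∃-fresh (K ++ L)
... | w , fr = StellarEq.trans (StellarEq.sub A w ne (face~ xA there) (fresh⇒¬Face (fr ∘ ∈-++⁺ˡ)))
              (StellarEq.trans (StellarEq.iso (≅⇒Isomorphic (f , g)))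
                (StellarEq.symm (StellarEq.sub (x ∷ v ∷ []) w (λ ()) (face~ (Axv a₀∈) xv⊆) (fresh⇒¬Face (fr ∘ ∈-++⁺ʳ K)))))
  where
  xv⊆ : ∀ {ρ} → x ∷ v ∷ [] ⊆ x ∷ v ∷ ρ
  xv⊆ (here e) = here e
  xv⊆ (there (here e)) = there (here e)
  ⊆-≈ : ∀ {σ κ λ' : Simplex} → σ ⊆ κ → κ ≈ λ' → σ ⊆ λ'
  ⊆-≈ s e = proj₁ e ∘ s
  x∈A : ∀ {a} → a ∈ A → a ≢ x
  x∈A p refl = x∉ p
  v∈A : ∀ {a} → a ∈ A → a ≢ v
  v∈A p refl = v∉ p
  rem-v : ∀ {a} → a ∈ A → del v (x ∷ v ∷ del a A) ≈ x ∷ del a A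
  rem-v {a} p = ≈-trans (remove-there v x (x≢v ∘ sym)) (∷-≈ (remove-here v (v∉ ∘ remove-⊆ a A)))
  rem-x : ∀ {a} → a ∈ A → del x (x ∷ v ∷ del a A) ≈ v ∷ del a A
  rem-x {a} p = remove-here x λ { (here e) → x≢v e ; (there q) → x∉ (remove-⊆ a A q) }
  f : ∀ {κ} → κ ∈ stellar K A w → κ ∈~ stellar L (x ∷ v ∷ []) w
  f p with ∈-stellar⁻ K A w p
  ... | inj₁ (k , n) with to k n
  ...   | (l , l∈ , e) , m = l , ∈-stellarˡ l∈ (λ s → m (⊆-≈ s (≈-sym e))) , e
  f p | inj₂ (τ , τ∈ , s , a , a∈ , refl) with Axv a∈
  ... | l , l∈ , e with star τ∈ s
  ...   | inj₁ t = w ∷ del v l , ∈-stellarʳ l∈ (⊆-≈ xv⊆ e) (there (here refl)) ,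
                   ∷-≈ (≈-trans (remove-≈ a t) (≈-trans (remove-there a x (x∈A a∈))
                     (≈-trans (≈-sym (rem-v a∈)) (remove-≈ v e))))
  ...   | inj₂ t = w ∷ del x l , ∈-stellarʳ l∈ (⊆-≈ xv⊆ e) (here refl) ,
                   ∷-≈ (≈-trans (remove-≈ a t) (≈-trans (remove-there a v (v∈A a∈))
                     (≈-trans (≈-sym (rem-x a∈)) (remove-≈ x e))))
  g : ∀ {κ} → κ ∈ stellar L (x ∷ v ∷ []) w → κ ∈~ stellar K A w
  g p with ∈-stellar⁻ L (x ∷ v ∷ []) w p
  ... | inj₁ (k , n) with from k n
  ...   | (l , l∈ , e) , m = l , ∈-stellarˡ l∈ (λ s → m (⊆-≈ s (≈-sym e))) , e
  g p | inj₂ (τ , τ∈ , s , y , y∈ , refl) with edge τ∈ s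
  g p | inj₂ (τ , τ∈ , s , .x , here refl , refl) | a , a∈ , t = let l , l∈ , e = vA in
                     w ∷ del a l , ∈-stellarʳ l∈ (⊆-≈ there e) a∈ ,
                     ∷-≈ (≈-trans (remove-≈ x t) (≈-trans (rem-x a∈)
                       (≈-trans (≈-sym (remove-there a v (v∈A a∈))) (remove-≈ a e))))
  g p | inj₂ (τ , τ∈ , s , .v , there (here refl) , refl) | a , a∈ , t = let l , l∈ , e = xA in
                     w ∷ del a l , ∈-stellarʳ l∈ (⊆-≈ there e) a∈ ,
                     ∷-≈ (≈-trans (remove-≈ v t) (≈-trans (rem-v a∈)
                       (≈-trans (≈-sym (remove-there a x (x∈A a∈))) (remove-≈ a e))))

-- Thin complexes

Two : Simplex → Simplex → Simplex → Set
Two a b c = a ≈ b ⊎ b ≈ c ⊎ a ≈ c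

two-12 : ∀ {a b c} → Two a b c → Two b a c
two-12 (inj₁ e) = inj₁ (≈-sym e)
two-12 (inj₂ (inj₁ e)) = inj₂ (inj₂ e)
two-12 (inj₂ (inj₂ e)) = inj₂ (inj₁ e)

two-23 : ∀ {a b c} → Two a b c → Two a c b
two-23 (inj₁ e) = inj₂ (inj₂ e)
two-23 (inj₂ (inj₁ e)) = inj₂ (inj₁ (≈-sym e))
two-23 (inj₂ (inj₂ e)) = inj₁ e

-- `Two` is symmetric in its three arguments, so only the number of facets of each kind matters:
-- four cases instead of eight.
two-cases : {C D : Simplex → Set} →
  (∀ {a b c} → C a → C b → C c → Two a b c) → (∀ {a b c} → C a → C b → D c → Two a b c) →
  (∀ {a b c} → C a → D b → D c → Two a b c) → (∀ {a b c} → D a → D b → D c → Two a b c) →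
  ∀ {a b c} → C a ⊎ D a → C b ⊎ D b → C c ⊎ D c → Two a b c
two-cases p q r s (inj₁ a) (inj₁ b) (inj₁ c) = p a b c
two-cases p q r s (inj₁ a) (inj₁ b) (inj₂ c) = q a b c
two-cases p q r s (inj₁ a) (inj₂ b) (inj₁ c) = two-23 (q a c b)
two-cases p q r s (inj₁ a) (inj₂ b) (inj₂ c) = r a b c
two-cases p q r s (inj₂ a) (inj₁ b) (inj₁ c) = two-12 (two-23 (q b c a))
two-cases p q r s (inj₂ a) (inj₁ b) (inj₂ c) = two-12 (r b a c)
two-cases p q r s (inj₂ a) (inj₂ b) (inj₁ c) = two-23 (two-12 (r c a b))
two-cases p q r s (inj₂ a) (inj₂ b) (inj₂ c) = s a b c

two-resp : ∀ {a b c a' b' c'} → a ≈ a' → b ≈ b' → c ≈ c' → Two a' b' c' → Two a b c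
two-resp p q r (inj₁ e) = inj₁ (≈-trans p (≈-trans e (≈-sym q)))
two-resp p q r (inj₂ (inj₁ e)) = inj₂ (inj₁ (≈-trans q (≈-trans e (≈-sym r))))
two-resp p q r (inj₂ (inj₂ e)) = inj₂ (inj₂ (≈-trans p (≈-trans e (≈-sym r))))

-- The weak pseudomanifold condition, a ridge with k vertices lying in at most two facets, phrased
-- by three facets so that repetitions in the list do no harm.
Thin : ℕ → Cx → Set
Thin k K = ∀ {A} → IsSimplex k A → ∀ {κ λ' μ} → κ ∈ K → λ' ∈ K → μ ∈ K →
  A ⊆ κ → A ⊆ λ' → A ⊆ μ → Two κ λ' μ

thin-mono : ∀ {k K L} → (∀ {κ} → κ ∈ L → κ ∈~ K) → Thin k K → Thin k L
thin-mono h t sA p q r a b c with h p | h q | h r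
... | _ , p' , e | _ , q' , f | _ , r' , g =
  two-resp e f g (t sA p' q' r' (proj₁ e ∘ a) (proj₁ f ∘ b) (proj₁ g ∘ c))

Pure : ℕ → Cx → Set
Pure k K = ∀ {κ} → κ ∈ K → IsSimplex k κ

bd-pure : ∀ {k B} → Pure (suc k) B → Pure k (∂ B)
bd-pure {k} {B} h p with bd⁻ B p
... | τ , τ∈ , x , x∈ , refl , _ = isSimplex-remove (h τ∈) x∈

-- Stacked balls and their boundaries

-- A tetrahedron is glued along exactly one triangle A, its apex x being new. `reorder` separates
-- the gluing order from the order in which the definitions list the facets.
data Stacked : Cx → Set where
  simplex : ∀ {τ} → IsSimplex 4 τ → Stacked (τ ∷ [])
  stack   : ∀ {B x A τ} → Stacked B → Fresh x B → IsSimplex 3 A → τ ∈ B → A ⊆ τ →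
            Stacked ((x ∷ A) ∷ B)
  reorder : ∀ {B B'} → Stacked B → B ≅ B' → Pure 4 B' → Stacked B'

isSimplex-∷ : ∀ {k x A} → x ∉ A → IsSimplex k A → IsSimplex (suc k) (x ∷ A)
isSimplex-∷ n (u , l) = unique-∷ n u , cong suc l

stacked-pure : ∀ {B} → Stacked B → Pure 4 B
stacked-pure (simplex s) (here refl) = s
stacked-pure (stack st fr sA τ∈ s) (here refl) = isSimplex-∷ (fr τ∈ ∘ s) sA
stacked-pure (stack st fr sA τ∈ s) (there p) = stacked-pure st p
stacked-pure (reorder _ _ pure) p = pure p

bd-resp : ∀ {B B'} → B ≅ B' → ∀ {ρ} → ρ ∈ ∂ B → ρ ∈~ ∂ B'
bd-resp {B} (f , g) p with bd⁻ B p
... | τ , t , x , x∈ , refl , only with f t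
...   | τ' , t' , e = ∈~-resp (remove-≈ x e) (bd⁺ t' (proj₁ e x∈) λ k s →
          let κ , k' , e' = g k in
          ≈-trans e' (≈-trans (only k' (proj₁ e' ∘ s ∘ proj₁ (remove-≈ x e))) e))

module Stack {B x A τ} (st : Stacked B) (fr : Fresh x B) (sA : IsSimplex 3 A) (τ∈ : τ ∈ B) (A⊆τ : A ⊆ τ)
  (thin : Thin 3 ((x ∷ A) ∷ B)) where

  F : Simplex
  F = x ∷ A

  x∉A : x ∉ A
  x∉A = fr τ∈ ∘ A⊆τ

  A≢x : ∀ {y} → y ∈ A → y ≢ x
  A≢x p refl = x∉A p

  F≉ : ∀ {κ} → κ ∈ B → ¬ F ⊆ κ
  F≉ p s = fr p (s (here refl))

  -- One side of the triangle A is taken by F, so thinness leaves room for a single facet of B on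
  -- the other side. Hence A is a boundary triangle before the gluing.
  A-only : ∀ {κ} → κ ∈ B → A ⊆ κ → κ ≈ τ
  A-only k s with thin sA (here refl) (there τ∈) (there k) there A⊆τ s
  ... | inj₁ e = ⊥-elim (F≉ τ∈ (proj₁ e))
  ... | inj₂ (inj₁ e) = ≈-sym e
  ... | inj₂ (inj₂ e) = ⊥-elim (F≉ k (proj₁ e))

  ⊆F⇒⊆A : ∀ {ρ} → x ∉ ρ → ρ ⊆ F → ρ ⊆ A
  ⊆F⇒⊆A n s p with s p
  ... | here refl = ⊥-elim (n p)
  ... | there q = q

  bd-simplex : Pure 3 (∂ B)
  bd-simplex = bd-pure (stacked-pure st)

  bd-fresh : Fresh x (∂ B)
  bd-fresh p q with bd⁻ B p
  ... | κ , k , y , _ , refl , _ = fr k (remove-⊆ y κ q)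

  A∈bd : A ∈~ ∂ B
  A∈bd with extra {A} {τ} (proj₁ (stacked-pure st τ∈))
               (subst₂ _<_ (sym (proj₂ sA)) (sym (proj₂ (stacked-pure st τ∈))) ℕP.≤-refl)
  ... | z , z∈ , z∉ = ∈~-resp e (bd⁺ τ∈ z∈ (λ k s → A-only k (s ∘ proj₁ e)))
    where
    A⊆ : A ⊆ del z τ
    A⊆ p = ∈-remove⁺ z (A⊆τ p) (λ { refl → z∉ p })
    e : A ≈ del z τ
    e = A⊆ , same-size sA (isSimplex-remove (stacked-pure st τ∈) z∈) A⊆

  new : ∀ {y} → y ∈ A → del y F ∈~ ∂ (F ∷ B)
  new {y} p = bd⁺ (here refl) (there p) λ
    { (here refl) _ → ≈-refl
    ; (there k) s → ⊥-elim (fr k (s (∈-remove⁺ y (here refl) (A≢x p ∘ sym)))) }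

  old : ∀ {ρ} → ρ ∈ ∂ B → ¬ A ⊆ ρ → ρ ∈~ ∂ (F ∷ B)
  old {ρ} p n with bd⁻ B p
  ... | κ , k , y , y∈ , refl , only = bd⁺ (there k) y∈ λ
    { (here refl) s → ⊥-elim (n (same-size (bd-simplex p) sA (⊆F⇒⊆A (bd-fresh p) s)))
    ; (there l) s → only l s }

  -- Gluing F trades A for the three other triangles of F: A now lies in both F and τ, and no other
  -- ridge of B is contained in F.
  inv : ∀ {ρ} → ρ ∈ ∂ (F ∷ B) → (∃ λ y → y ∈ A × ρ ≡ del y F) ⊎ (ρ ∈~ ∂ B × ¬ A ⊆ ρ)
  inv p with bd⁻ (F ∷ B) p
  ... | .F , here refl , .x , here refl , refl , only =
    ⊥-elim (F≉ τ∈ (proj₂ (only (there τ∈) (A⊆τ ∘ proj₁ (remove-here x x∉A)))))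
  ... | .F , here refl , y , there y∈ , refl , only = inj₁ (y , y∈ , refl)
  ... | κ , there k , y , y∈ , refl , only = inj₂ (bd⁺ k y∈ (only ∘ there) , λ s →
    F≉ k (proj₁ (only (here refl) (there ∘ same-size sA (isSimplex-remove (stacked-pure st k) y∈) s))))

-- Needed to keep the cone over ∂B thin. The triangles around an edge e are either new (`N`, ridges
-- of F other than A) or old (`O`), and the argument goes by how many of three are new.
stacked-thin-bd : ∀ {B} → Stacked B → Thin 3 B → Thin 2 (∂ B)
stacked-thin-bd {B} (simplex {τ} sτ) _ {e} (ue , le) p q r a b c with bd⁻ B p | bd⁻ B q | bd⁻ B r
... | _ , here refl , y₁ , m₁ , refl , _ | _ , here refl , y₂ , m₂ , refl , _ | _ , here refl , y₃ , m₃ , refl , _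
  with y₁ ≟ y₂ | y₂ ≟ y₃ | y₁ ≟ y₃
... | yes refl | _ | _ = inj₁ ≈-refl
... | no _ | yes refl | _ = inj₂ (inj₁ ≈-refl)
... | no _ | no _ | yes refl = inj₂ (inj₂ ≈-refl)
-- Three different removed vertices and the two of e would be five vertices of one tetrahedron.
... | no n₁ | no n₂ | no n₃ = ⊥-elim (ℕP.<⇒≱ {4} {5} ℕP.≤-refl
  (subst₂ _≤_ (cong (λ l → 3 + l) le) (proj₂ sτ)
    (unique-⊆-length {y₁ ∷ y₂ ∷ y₃ ∷ e} {τ}
      (unique-∷ (λ { (here e) → n₁ e ; (there (here e)) → n₃ e ; (there (there m)) → out y₁ (a m) })
        (unique-∷ (λ { (here e) → n₂ e ; (there m) → out y₂ (b m) }) (unique-∷ (out y₃ ∘ c) ue)))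
      λ { (here refl) → m₁ ; (there (here refl)) → m₂ ; (there (there (here refl))) → m₃
        ; (there (there (there m))) → remove-⊆ y₁ τ (a m) })))
  where
  out : ∀ y → y ∉ del y τ
  out y m = proj₂ (∈-remove⁻ y τ m) refl
stacked-thin-bd (reorder st e _) thin =
  thin-mono (bd-resp (≅-sym e)) (stacked-thin-bd st (thin-mono (proj₁ e) thin))
stacked-thin-bd (stack {B'} {x} {A} st fr sA τ∈ s) thin {e} (ue , le) {κ} p q r a b c = main (cls p a) (cls q b) (cls r c)
  where
  open Stack st fr sA τ∈ s thin
  N O : Simplex → Set
  N ρ = (∃ λ y → y ∈ A × ρ ≡ del y F) × e ⊆ ρ
  O ρ = (ρ ∈~ ∂ B' × ¬ A ⊆ ρ) × e ⊆ ρ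
  cls : ∀ {ρ} → ρ ∈ ∂ (F ∷ B') → e ⊆ ρ → N ρ ⊎ O ρ
  cls p s with inv p
  ... | inj₁ n = inj₁ (n , s)
  ... | inj₂ o = inj₂ (o , s)
  IH = stacked-thin-bd st (thin-mono (∈⇒∈~ ∘ there) thin)
  x∉O : ∀ {ρ} → O ρ → x ∉ ρ
  x∉O (((_ , m , eq) , _) , _) k = bd-fresh m (proj₁ eq k)
  out : ∀ y → y ∉ del y F
  out y m = proj₂ (∈-remove⁻ y F m) refl
  e⊆A : ∀ {ρ σ} → N ρ → O σ → e ⊆ A
  e⊆A ((y , _ , refl) , s) o@(_ , t) = ⊆F⇒⊆A (x∉O o ∘ t) (remove-⊆ y F ∘ s)
  nnn : ∀ {ρ σ τ} → N ρ → N σ → N τ → Two ρ σ τ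
  nnn ((y₁ , m₁ , refl) , a) ((y₂ , m₂ , refl) , b) ((y₃ , m₃ , refl) , c) with y₁ ≟ y₂ | y₂ ≟ y₃ | y₁ ≟ y₃
  ... | yes refl | _ | _ = inj₁ ≈-refl
  ... | no _ | yes refl | _ = inj₂ (inj₁ ≈-refl)
  ... | no _ | no _ | yes refl = inj₂ (inj₂ ≈-refl)
  ... | no n₁ | no n₂ | no n₃ = ⊥-elim (ℕP.<⇒≱ {4} {5} ℕP.≤-refl
    (subst₂ _≤_ (cong (λ l → 3 + l) le) (cong suc (proj₂ sA))
      (unique-⊆-length {y₁ ∷ y₂ ∷ y₃ ∷ e} {F}
        (unique-∷ (λ { (here e) → n₁ e ; (there (here e)) → n₃ e ; (there (there m)) → out y₁ (a m) })
          (unique-∷ (λ { (here e) → n₂ e ; (there m) → out y₂ (b m) }) (unique-∷ (out y₃ ∘ c) ue)))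
        λ { (here refl) → there m₁ ; (there (here refl)) → there m₂ ; (there (there (here refl))) → there m₃
          ; (there (there (there m))) → remove-⊆ y₁ F (a m) })))
  nno : ∀ {ρ σ τ} → N ρ → N σ → O τ → Two ρ σ τ
  nno n@((y₁ , m₁ , refl) , a) ((y₂ , m₂ , refl) , b) o with y₁ ≟ y₂
  ... | yes refl = inj₁ ≈-refl
  -- The old triangle keeps e away from x, so e and the two removed vertices would be four vertices
  -- of A.
  ... | no n₁ = ⊥-elim (ℕP.<⇒≱ {3} {4} ℕP.≤-refl
    (subst₂ _≤_ (cong (λ l → 2 + l) le) (proj₂ sA)
      (unique-⊆-length {y₁ ∷ y₂ ∷ e} {A}
        (unique-∷ (λ { (here e) → n₁ e ; (there m) → out y₁ (a m) }) (unique-∷ (out y₂ ∘ b) ue))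
        λ { (here refl) → m₁ ; (there (here refl)) → m₂ ; (there (there m)) → e⊆A n o m })))
  noo : ∀ {ρ σ τ} → N ρ → O σ → O τ → Two ρ σ τ
  -- Here e lies in A, a boundary triangle of the smaller ball. The induction hypothesis for A and
  -- the two old triangles forces the latter to agree, since neither of them contains A.
  noo n o@(((_ , m , p) , k) , s) (((_ , m' , p') , k') , s') with A∈bd
  ... | _ , mA , pA with IH (ue , le) mA m m' (proj₁ pA ∘ e⊆A n o) (proj₁ p ∘ s) (proj₁ p' ∘ s')
  ...   | inj₁ q = ⊥-elim (k (proj₂ p ∘ proj₁ q ∘ proj₁ pA))
  ...   | inj₂ (inj₁ q) = inj₂ (inj₁ (≈-trans p (≈-trans q (≈-sym p'))))
  ...   | inj₂ (inj₂ q) = ⊥-elim (k' (proj₂ p' ∘ proj₁ q ∘ proj₁ pA))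
  ooo : ∀ {ρ σ τ} → O ρ → O σ → O τ → Two ρ σ τ
  ooo (((_ , m₁ , p₁) , _) , s₁) (((_ , m₂ , p₂) , _) , s₂) (((_ , m₃ , p₃) , _) , s₃) =
    two-resp p₁ p₂ p₃ (IH (ue , le) m₁ m₂ m₃ (proj₁ p₁ ∘ s₁) (proj₁ p₂ ∘ s₂) (proj₁ p₃ ∘ s₃))
  main : ∀ {ρ σ τ} → N ρ ⊎ O ρ → N σ ⊎ O σ → N τ ⊎ O τ → Two ρ σ τ
  main = two-cases nnn nno noo ooo

-- An edge of F omits some vertex of A, hence lies in the new boundary triangle opposite to it. An
-- edge of B lies in an old boundary triangle; the only one that disappears is A, and then the edge
-- belongs to F.
stacked-edge : ∀ {B} → Stacked B → Thin 3 B → ∀ {κ u w} → κ ∈ B → u ∈ κ → w ∈ κ →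
  ∃ λ ρ → ρ ∈ ∂ B × u ∈ ρ × w ∈ ρ
stacked-edge {B} (simplex {τ} sτ) thin {u = u} {w} (here refl) pu pw
  with extra {u ∷ w ∷ []} {τ} (proj₁ sτ) (subst (2 <_) (sym (proj₂ sτ)) (s≤s (s≤s (s≤s z≤n))))
... | y , y∈ , n with bd⁺ {B} (here refl) y∈ (λ { (here refl) _ → ≈-refl })
...   | ρ , ρ∈ , e = ρ , ρ∈ , proj₁ e (∈-remove⁺ y pu (λ { refl → n (here refl) })) ,
                     proj₁ e (∈-remove⁺ y pw (λ { refl → n (there (here refl)) }))
stacked-edge (reorder st e _) thin k p q with proj₂ e k
... | κ' , k' , e' with stacked-edge st (thin-mono (proj₁ e) thin) k' (proj₁ e' p) (proj₁ e' q)
...   | ρ , r , a , b with bd-resp e r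
...     | ρ' , r' , e'' = ρ' , r' , proj₁ e'' a , proj₁ e'' b
stacked-edge (stack {B} {x} {A} st fr sA τ∈ s) thin {κ} {u} {w} k pu pw = go k
  where
  open Stack st fr sA τ∈ s thin
  inF : u ∈ F → w ∈ F → ∃ λ ρ → ρ ∈ ∂ (F ∷ B) × u ∈ ρ × w ∈ ρ
  inF pu pw with extra {u ∷ w ∷ []} {A} (proj₁ sA) (subst (2 <_) (sym (proj₂ sA)) ℕP.≤-refl)
  ... | y , y∈ , n with new y∈
  ...   | ρ , ρ∈ , e = ρ , ρ∈ , proj₁ e (∈-remove⁺ y pu (λ { refl → n (here refl) })) ,
                       proj₁ e (∈-remove⁺ y pw (λ { refl → n (there (here refl)) }))
  go : κ ∈ F ∷ B → ∃ λ ρ → ρ ∈ ∂ (F ∷ B) × u ∈ ρ × w ∈ ρ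
  go (here refl) = inF pu pw
  go (there k) with stacked-edge st (thin-mono (∈⇒∈~ ∘ there) thin) k pu pw
  ... | ρ , ρ∈ , a , b with ⊆? A ρ
  ...   | yes t = inF (there (same-size sA (bd-simplex ρ∈) t a)) (there (same-size sA (bd-simplex ρ∈) t b))
  ...   | no n with old ρ∈ n
  ...     | ρ' , ρ'∈ , e = ρ' , ρ'∈ , proj₁ e a , proj₁ e b

-- Exchanging a stacked ball for the cone over its boundary

Good : Cx → Set
Good K = Pure 4 K × Thin 3 K

abstract
  starred : Cx → Cx → ℤ → Cx
  starred K B v = minus K B ++ cone v (∂ B)

  starred⁻ : ∀ K B v {κ} → κ ∈ starred K B v → (κ ∈ K × ¬ Face B κ) ⊎ (∃ λ ρ → ρ ∈ ∂ B × κ ≡ v ∷ ρ)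
  starred⁻ K B v p with ∈-++⁻ (minus K B) p
  ... | inj₁ q = inj₁ (∈-minus⁻ K B q)
  ... | inj₂ q = inj₂ (∈-cone⁻ q)

  starredˡ : ∀ {K B v κ} → κ ∈ K → ¬ Face B κ → κ ∈ starred K B v
  starredˡ k n = ∈-++⁺ˡ (∈-minus⁺ k n)

  starredʳ : ∀ {K B v ρ} → ρ ∈~ ∂ B → v ∷ ρ ∈~ starred K B v
  starredʳ {K} {B} (ρ' , m , e) = _ , ∈-++⁺ʳ (minus K B) (∈-cone⁺ m) , ∷-≈ e

  starred-cone : ∀ {K B v ρ} → ρ ∈ ∂ B → v ∷ ρ ∈ starred K B v
  starred-cone {K} {B} p = ∈-++⁺ʳ (minus K B) (∈-cone⁺ p)

module _ {K v} (good : Good K) (v-fresh : Fresh v K) where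

  private
    B-fresh : ∀ {B} → (∀ {κ} → κ ∈ B → κ ∈~ K) → Fresh v B
    B-fresh B⊆K k p with B⊆K k
    ... | _ , k' , e = v-fresh k' (proj₁ e p)

  bd-B-fresh : ∀ {B} → (∀ {κ} → κ ∈ B → κ ∈~ K) → Fresh v (∂ B)
  bd-B-fresh {B} B⊆K p q with bd⁻ B p
  ... | κ , k , y , _ , refl , _ = B-fresh B⊆K k (remove-⊆ y κ q)

  -- Three facets through A are sorted into kept ones (`C`) and cones (`D`). With two kept ones and
  -- a cone, A is a boundary triangle of B, so a facet of B competes for it and thinness of K
  -- identifies the kept ones. With three cones and v in A, the claim is `stacked-thin-bd` for A
  -- without v.
  starred-good : ∀ {B} → Stacked B → (∀ {κ} → κ ∈ B → κ ∈~ K) → Good (starred K B v)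
  starred-good {B} st B⊆K = pure , thin
    where
    thinB : Thin 3 B
    thinB = thin-mono B⊆K (proj₂ good)
    pure : Pure 4 (starred K B v)
    pure p with starred⁻ K B v p
    ... | inj₁ (k , _) = proj₁ good k
    ... | inj₂ (ρ , m , refl) = isSimplex-∷ (bd-B-fresh B⊆K m) (bd-pure (stacked-pure st) m)
    thin : Thin 3 (starred K B v)
    thin {A} sA p q r a b c = two-cases ccc ccd cdd ddd (cls p a) (cls q b) (cls r c)
      where
      C D : Simplex → Set
      C κ = (κ ∈ K × ¬ Face B κ) × A ⊆ κ
      D κ = (∃ λ ρ → ρ ∈ ∂ B × κ ≡ v ∷ ρ) × A ⊆ κ
      cls : ∀ {κ} → κ ∈ starred K B v → A ⊆ κ → C κ ⊎ D κ
      cls p s with starred⁻ K B v p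
      ... | inj₁ x = inj₁ (x , s)
      ... | inj₂ x = inj₂ (x , s)
      v∉A : ∀ {κ} → C κ → v ∉ A
      v∉A ((k , _) , s) = v-fresh k ∘ s
      A≈ : ∀ {ρ} → v ∉ A → ρ ∈ ∂ B → A ⊆ v ∷ ρ → A ≈ ρ
      A≈ {ρ} n m s = t , same-size sA (bd-pure (stacked-pure st) m) t
        where
        t : A ⊆ ρ
        t x∈ with s x∈
        ... | here refl = ⊥-elim (n x∈)
        ... | there y = y
      ccc : ∀ {κ λ' μ} → C κ → C λ' → C μ → Two κ λ' μ
      ccc ((k , _) , a) ((l , _) , b) ((m , _) , c) = proj₂ good sA k l m a b c
      ccd : ∀ {κ λ' μ} → C κ → C λ' → D μ → Two κ λ' μ
      ccd cκ@((k , n) , a) ((l , n') , b) ((ρ , m , refl) , c) with bd⁻ B m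
      ... | τ , t , y , _ , refl , _ with B⊆K t
      ...   | τ' , t' , e with proj₂ good sA k l t' a b (proj₁ e ∘ remove-⊆ y τ ∘ proj₁ (A≈ (v∉A cκ) m c))
      ...     | inj₁ q = inj₁ q
      ...     | inj₂ (inj₁ q) = ⊥-elim (n' (face⁺ t (proj₂ e ∘ proj₁ q)))
      ...     | inj₂ (inj₂ q) = ⊥-elim (n (face⁺ t (proj₂ e ∘ proj₁ q)))
      cdd : ∀ {κ λ' μ} → C κ → D λ' → D μ → Two κ λ' μ
      cdd cκ ((ρ , m , refl) , b) ((ρ' , m' , refl) , c) =
        inj₂ (inj₁ (∷-≈ (≈-trans (≈-sym (A≈ (v∉A cκ) m b)) (A≈ (v∉A cκ) m' c))))
      ddd : ∀ {κ λ' μ} → D κ → D λ' → D μ → Two κ λ' μ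
      ddd ((ρ₁ , m₁ , refl) , a) ((ρ₂ , m₂ , refl) , b) ((ρ₃ , m₃ , refl) , c) with v ∈? A
      ... | no n = inj₁ (∷-≈ (≈-trans (≈-sym (A≈ n m₁ a)) (A≈ n m₂ b)))
      ... | yes v∈ with stacked-thin-bd st thinB (isSimplex-remove sA v∈) m₁ m₂ m₃ (low a) (low b) (low c)
        where
        low : ∀ {ρ} → A ⊆ v ∷ ρ → del v A ⊆ ρ
        low s p with ∈-remove⁻ v A p
        ... | q , n with s q
        ...   | here e = ⊥-elim (n e)
        ...   | there r = r
      ...   | inj₁ e = inj₁ (∷-≈ e)
      ...   | inj₂ (inj₁ e) = inj₂ (inj₁ (∷-≈ e))
      ...   | inj₂ (inj₂ e) = inj₂ (inj₂ (∷-≈ e))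

  -- Induction on the gluing order. For one tetrahedron the exchange is a stellar subdivision. Once
  -- B is exchanged, the next tetrahedron x ∗ A is still present and v ∗ A is a cone facet, since A
  -- lies on ∂B; flipping these two gives the exchange of the enlarged ball.
  starred-sphere : ∀ {B} → Stacked B → (∀ {κ} → κ ∈ B → κ ∈~ K) → StellarEq K (starred K B v)
  starred-sphere (simplex {τ} sτ) B⊆K = StellarEq.trans
    (StellarEq.sub τ v ne (face~ (B⊆K (here refl)) id) (fresh⇒¬Face v-fresh))
    (StellarEq.iso (≅⇒Isomorphic (f , g)))
    where
    ne : τ ≢ []
    ne refl with proj₂ sτ
    ... | ()
    only : ∀ x {κ} → κ ∈ τ ∷ [] → del x τ ⊆ κ → κ ≈ τ
    only x (here refl) _ = ≈-refl
    f : ∀ {κ} → κ ∈ stellar K τ v → κ ∈~ starred K (τ ∷ []) v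
    f p with ∈-stellar⁻ K τ v p
    ... | inj₁ (k , n) = ∈⇒∈~ (starredˡ k λ { (here s) → n (same-size (proj₁ good k) sτ s) ; (there ()) })
    ... | inj₂ (κ , k , s , x , x∈ , refl) =
      ∈~-resp (∷-≈ (remove-≈ x (same-size sτ (proj₁ good k) s , s))) (starredʳ (bd⁺ (here refl) x∈ (only x)))
    g : ∀ {κ} → κ ∈ starred K (τ ∷ []) v → κ ∈~ stellar K τ v
    g p with starred⁻ K (τ ∷ []) v p
    ... | inj₁ (k , n) = ∈⇒∈~ (∈-stellarˡ k λ s → n (here (same-size sτ (proj₁ good k) s)))
    ... | inj₂ (ρ , m , refl) with bd⁻ (τ ∷ []) m
    ...   | _ , here refl , x , x∈ , refl , _ with B⊆K (here refl)
    ...     | κ , k , e = _ , ∈-stellarʳ k (proj₁ e) x∈ , ∷-≈ (remove-≈ x e)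
  starred-sphere (reorder {B} {B'} st (f , g) _) B⊆K =
    StellarEq.trans (starred-sphere st (λ k → let κ , k' , e = f k in ∈~-resp e (B⊆K k')))
      (StellarEq.iso (≅⇒Isomorphic (to , from)))
    where
    to : ∀ {κ} → κ ∈ starred K B v → κ ∈~ starred K B' v
    to p with starred⁻ K B v p
    ... | inj₁ (k , n) = ∈⇒∈~ (starredˡ k (n ∘ face-≅ g))
    ... | inj₂ (ρ , r , refl) = starredʳ (bd-resp (f , g) r)
    from : ∀ {κ} → κ ∈ starred K B' v → κ ∈~ starred K B v
    from p with starred⁻ K B' v p
    ... | inj₁ (k , n) = ∈⇒∈~ (starredˡ k (n ∘ face-≅ f))
    ... | inj₂ (ρ , r , refl) = starredʳ (bd-resp (g , f) r)
  starred-sphere (stack {B} {x} {A} {τ} st fr sA τ∈ s) B⊆K = StellarEq.trans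
    (starred-sphere st (B⊆K ∘ there))
    (flip x∉A v∉A x≢v ne (let y , y∈ , _ = extra {[]} (proj₁ sA) (subst (0 <_) (sym (proj₂ sA)) (s≤s z≤n)) in y , y∈)
      star xA (starredʳ A∈bd) edge Axv to from)
    where
    open Stack st fr sA τ∈ s (thin-mono B⊆K (proj₂ good))
    v∉A : v ∉ A
    v∉A = B-fresh B⊆K (there τ∈) ∘ s
    x≢v : x ≢ v
    x≢v refl = B-fresh B⊆K (here refl) (here refl)
    ne : A ≢ []
    ne refl with proj₂ sA
    ... | ()
    F∉B : ¬ Face B F
    F∉B f with face⁻ f
    ... | κ , k , t = F≉ k t
    xA : F ∈~ starred K B v
    xA with B⊆K (here refl)
    ... | κ , k , e = κ , starredˡ k (F∉B ∘ face-⊆ (proj₁ e)) , e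
    star : ∀ {κ} → κ ∈ starred K B v → A ⊆ κ → κ ≈ x ∷ A ⊎ κ ≈ v ∷ A
    star p t with starred⁻ K B v p
    ... | inj₂ (ρ , m , refl) = inj₂ (∷-≈ (same-size sA (bd-simplex m) u , u))
      where
      u : A ⊆ ρ
      u a with t a
      ... | here refl = ⊥-elim (v∉A a)
      ... | there b = b
    ... | inj₁ (k , n) with B⊆K (here refl) | B⊆K (there τ∈)
    ...   | F' , F'∈ , e | τ' , τ'∈ , e' with proj₂ good sA k F'∈ τ'∈ t (proj₁ e ∘ there) (proj₁ e' ∘ s)
    ...     | inj₁ q = inj₁ (≈-trans q (≈-sym e))
    ...     | inj₂ (inj₁ q) = ⊥-elim (F≉ τ∈ (proj₂ e' ∘ proj₁ q ∘ proj₁ e))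
    ...     | inj₂ (inj₂ q) = ⊥-elim (n (face⁺ τ∈ (proj₂ e' ∘ proj₁ q)))
    rem : ∀ {a} → a ∈ A → del a F ≈ x ∷ del a A
    rem {a} a∈ = remove-there a x (A≢x a∈)
    swap : ∀ {p q : ℤ} {ρ} → p ∷ q ∷ ρ ≈ q ∷ p ∷ ρ
    swap = h , h
      where
      h : ∀ {p q : ℤ} {ρ} → p ∷ q ∷ ρ ⊆ q ∷ p ∷ ρ
      h (here e) = there (here e)
      h (there (here e)) = here e
      h (there (there m)) = there (there m)
    edge : ∀ {κ} → κ ∈ starred K (F ∷ B) v → x ∷ v ∷ [] ⊆ κ → ∃ λ a → a ∈ A × κ ≈ x ∷ v ∷ del a A
    edge p t with starred⁻ K (F ∷ B) v p
    ... | inj₁ (k , _) = ⊥-elim (v-fresh k (t (there (here refl))))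
    ... | inj₂ (ρ , m , refl) with inv m
    ...   | inj₁ (a , a∈ , refl) = a , a∈ , ≈-trans (∷-≈ (rem a∈)) swap
    ...   | inj₂ ((_ , m' , e) , _) with t (here refl)
    ...     | here q = ⊥-elim (x≢v q)
    ...     | there q = ⊥-elim (bd-fresh m' (proj₁ e q))
    Axv : ∀ {a} → a ∈ A → x ∷ v ∷ del a A ∈~ starred K (F ∷ B) v
    Axv a∈ = ∈~-resp (≈-trans swap (∷-≈ (≈-sym (rem a∈)))) (starredʳ (new a∈))
    to : ∀ {κ} → κ ∈ starred K B v → ¬ A ⊆ κ → κ ∈~ starred K (F ∷ B) v × ¬ x ∷ v ∷ [] ⊆ κ
    to p n with starred⁻ K B v p
    ... | inj₁ (k , nB) = ∈⇒∈~ (starredˡ k λ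
            { (here t) → n (same-size (proj₁ good k) (isSimplex-∷ x∉A sA) t ∘ there) ; (there f) → nB f })
          , λ t → v-fresh k (t (there (here refl)))
    ... | inj₂ (ρ , m , refl) = starredʳ (old m (λ t → n (λ a → there (t a)))) , λ t → case t (here refl) of λ
            { (here q) → x≢v q ; (there q) → bd-fresh m q }
    from : ∀ {κ} → κ ∈ starred K (F ∷ B) v → ¬ x ∷ v ∷ [] ⊆ κ → κ ∈~ starred K B v × ¬ A ⊆ κ
    from p n with starred⁻ K (F ∷ B) v p
    ... | inj₁ (k , nB) = ∈⇒∈~ (starredˡ k (nB ∘ there)) , notA
      where
      notA : ¬ A ⊆ _
      notA t with star (starredˡ k (nB ∘ there)) t
      ... | inj₁ e = nB (here (proj₁ e))
      ... | inj₂ e = v-fresh k (proj₂ e (here refl))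
    ... | inj₂ (ρ , m , refl) with inv m
    ...   | inj₁ (a , a∈ , refl) = ⊥-elim (n λ
              { (here refl) → there (∈-remove⁺ a (here refl) (A≢x a∈ ∘ sym)) ; (there (here refl)) → here refl })
    ...   | inj₂ (m' , nA) = starredʳ m' , λ t → nA λ a → case t a of λ
              { (here refl) → ⊥-elim (v∉A a) ; (there b) → b }

-- The antipodal map

∈-neg⁺ : ∀ {x σ} → x ∈ σ → - x ∈ map -_ σ
∈-neg⁺ = ∈-map⁺ -_

∈-neg⁻ : ∀ {x σ} → x ∈ map -_ σ → - x ∈ σ
∈-neg⁻ {σ = σ} p with ∈-map⁻ -_ p
... | y , q , refl = subst (_∈ σ) (sym (ℤP.neg-involutive y)) q

∈-neg⁻′ : ∀ {x σ} → - x ∈ map -_ σ → x ∈ σ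
∈-neg⁻′ {x} {σ} p = subst (_∈ σ) (ℤP.neg-involutive x) (∈-neg⁻ p)

∈-neg⁺′ : ∀ {x σ} → - x ∈ σ → x ∈ map -_ σ
∈-neg⁺′ {x} {σ} p = subst (_∈ map -_ σ) (ℤP.neg-involutive x) (∈-neg⁺ p)

neg-⊆ : ∀ {σ τ} → σ ⊆ τ → map -_ σ ⊆ map -_ τ
neg-⊆ s p = ∈-neg⁺′ (s (∈-neg⁻ p))

neg-⊆⁻ : ∀ {σ τ} → map -_ σ ⊆ map -_ τ → σ ⊆ τ
neg-⊆⁻ s p = ∈-neg⁻′ (s (∈-neg⁺ p))

neg-⊆′ : ∀ {σ τ} → σ ⊆ map -_ τ → map -_ σ ⊆ τ
neg-⊆′ s p = ∈-neg⁻′ (s (∈-neg⁻ p))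

neg-≈ : ∀ {σ τ} → σ ≈ τ → map -_ σ ≈ map -_ τ
neg-≈ (a , b) = neg-⊆ a , neg-⊆ b

neg-neg : ∀ σ → map -_ (map -_ σ) ≡ σ
neg-neg [] = refl
neg-neg (x ∷ σ) = cong₂ _∷_ (ℤP.neg-involutive x) (neg-neg σ)

neg-negᶜ : ∀ K → neg (neg K) ≡ K
neg-negᶜ [] = refl
neg-negᶜ (σ ∷ K) = cong₂ _∷_ (neg-neg σ) (neg-negᶜ K)

∈-negᶜ⁺ : ∀ {κ K} → κ ∈ K → map -_ κ ∈ neg K
∈-negᶜ⁺ = ∈-map⁺ (map -_)

∈-negᶜ⁻ : ∀ {κ K} → κ ∈ neg K → ∃ λ λ' → λ' ∈ K × κ ≡ map -_ λ'
∈-negᶜ⁻ = ∈-map⁻ (map -_)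

neg-∈~ : ∀ {κ K} → κ ∈~ K → map -_ κ ∈~ neg K
neg-∈~ (λ' , p , e) = _ , ∈-negᶜ⁺ p , neg-≈ e

remove-neg : ∀ x τ → map -_ (del x τ) ≈ del (- x) (map -_ τ)
remove-neg x τ = f , g
  where
  f : map -_ (del x τ) ⊆ del (- x) (map -_ τ)
  f p with ∈-remove⁻ x τ (∈-neg⁻ p)
  ... | a , b = ∈-remove⁺ (- x) (∈-neg⁺′ a) (λ e → b (trans (cong -_ e) (ℤP.neg-involutive x)))
  g : del (- x) (map -_ τ) ⊆ map -_ (del x τ)
  g p with ∈-remove⁻ (- x) (map -_ τ) p
  ... | a , b = ∈-neg⁺′ (∈-remove⁺ x (∈-neg⁻ a) (λ e → b (trans (sym (ℤP.neg-involutive _)) (cong -_ e))))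

bd-neg : ∀ B {ρ} → ρ ∈ ∂ B → map -_ ρ ∈~ ∂ (neg B)
bd-neg B p with bd⁻ B p
... | τ , t , x , x∈ , refl , only = ∈~-resp (remove-neg x τ) (bd⁺ (∈-negᶜ⁺ t) (∈-neg⁺ x∈) only')
  where
  only' : Only (neg B) (del (- x) (map -_ τ)) (map -_ τ)
  only' k s with ∈-negᶜ⁻ k
  ... | κ , k' , refl = neg-≈ (only k' (neg-⊆⁻ (s ∘ proj₁ (remove-neg x τ))))

neg-bd : ∀ B → neg (∂ B) ≅ ∂ (neg B)
neg-bd B = f , g
  where
  f : ∀ {κ} → κ ∈ neg (∂ B) → κ ∈~ ∂ (neg B)
  f p with ∈-negᶜ⁻ p
  ... | ρ , r , refl = bd-neg B r
  g : ∀ {κ} → κ ∈ ∂ (neg B) → κ ∈~ neg (∂ B)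
  g {κ} p = subst (_∈~ neg (∂ B)) (neg-neg κ)
    (neg-∈~ (subst (λ L → map -_ κ ∈~ ∂ L) (neg-negᶜ B) (bd-neg (neg B) p)))

unique-neg : ∀ {σ} → Unique σ → Unique (map -_ σ)
unique-neg [] = []
unique-neg (a ∷ u) = unique-∷ (unique-head (a ∷ u) ∘ ∈-neg⁻′) (unique-neg u)

isSimplex-neg : ∀ {k σ} → IsSimplex k σ → IsSimplex k (map -_ σ)
isSimplex-neg {σ = σ} (u , l) = unique-neg u , trans (length-map -_ σ) l

fresh-neg : ∀ {x B} → Fresh x B → Fresh (- x) (neg B)
fresh-neg fr p q with ∈-negᶜ⁻ p
... | κ , k , refl = fr k (∈-neg⁻′ q)

stacked-neg : ∀ {B} → Stacked B → Stacked (neg B)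
stacked-neg (simplex s) = simplex (isSimplex-neg s)
stacked-neg (reorder {B} {B'} st (f , g) pure) = reorder (stacked-neg st)
  ((λ p → let κ , k , e = ∈-negᶜ⁻ p in subst (_∈~ neg B') (sym e) (neg-∈~ (f k))) ,
   (λ p → let κ , k , e = ∈-negᶜ⁻ p in subst (_∈~ neg B) (sym e) (neg-∈~ (g k))))
  (λ p → let κ , k , e = ∈-negᶜ⁻ p in subst (IsSimplex 4) (sym e) (isSimplex-neg (pure k)))
stacked-neg (stack st fr sA t s) = stack (stacked-neg st) (fresh-neg fr) (isSimplex-neg sA) (∈-negᶜ⁺ t) (neg-⊆ s)

-- Centrally symmetric spheres and the simultaneous exchange of B and -B

InV-neg : ∀ {m v} → InV m v → InV m (- v)
InV-neg {m} {v} (a , b) = (λ e → a (trans (sym (ℤP.neg-involutive v)) (cong -_ e))) ,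
  subst (_≤ m) (sym (ℤP.∣-i∣≡∣i∣ v)) b

InV-suc : ∀ {m v} → InV m v → InV (suc m) v
InV-suc (a , b) = a , ℕP.m≤n⇒m≤1+n b

InV-split : ∀ {m v} → InV (suc m) v → InV m v ⊎ v ≡ + suc m ⊎ v ≡ -[1+ m ]
InV-split {m} {v} (a , b) with ∣ v ∣ ℕ.≤? m
... | yes c = inj₁ (a , c)
InV-split {m} {+ k} (a , b) | no n = inj₂ (inj₁ (cong +_ (ℕP.≤-antisym b (ℕP.≰⇒> n))))
InV-split {m} { -[1+ k ] } (a , b) | no n = inj₂ (inj₂ (cong -[1+_] (ℕP.≤-antisym (ℕP.≤-pred b) (ℕP.≤-pred (ℕP.≰⇒> n)))))

InV-top : ∀ {m v} → InV m v → v ≢ + suc m × v ≢ -[1+ m ]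
InV-top (_ , b) = (λ { refl → ℕP.<-irrefl refl b }) , (λ { refl → ℕP.<-irrefl refl b })

-- The invariant preserved by every exchange. The instance u = w of `neighborly` says that all of
-- V_m are vertices.
record Sphere (m : ℕ) (K : Cx) : Set where
  field
    good  : Good K
    symmetric : ∀ {κ} → κ ∈ K → map -_ κ ∈~ K
    noAnti : ∀ {κ} → κ ∈ K → NoAntipodal κ
    vertices : ∀ {κ v} → κ ∈ K → v ∈ κ → InV m v
    neighborly : ∀ {u w} → InV m u → InV m w → u ≢ - w → Face K (u ∷ w ∷ [])
    sphere : CombinatorialSphere 3 K

neighborly-onVertexSet : ∀ {m K} → Sphere m K → OnVertexSet m K
neighborly-onVertexSet S v = f , g
  where
  open Sphere S
  f : _ → _
  f F with face⁻ F
  ... | κ , k , s = vertices k (s (here refl))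
  g : _ → _
  g i = face-⊆ (λ { (here e) → here e }) (neighborly i i (nonself v (proj₁ i)))
    where
    nonself : ∀ v → v ≢ + 0 → v ≢ - v
    nonself (+ 0) n e = n refl
    nonself (+ suc k) n ()
    nonself -[1+ k ] n ()

sphere-symmetric : ∀ {m K} → Sphere m K → ∀ {σ} → Face K σ → Face K (map -_ σ)
sphere-symmetric S F with face⁻ F
... | κ , k , s = face~ (Sphere.symmetric S k) (neg-⊆ s)

sphere-cs : ∀ {m K} → Sphere m K → CentrallySymmetric K
sphere-cs S = (λ σ → sphere-symmetric S) , h
  where
  open Sphere S
  h : ∀ σ → Face _ σ → NoAntipodal σ
  h σ F v p q with face⁻ F
  ... | κ , k , s = noAnti k v (s p) (s q)

sphere-neighborly : ∀ {m K κ} → κ ∈ K → Sphere m K → CsNeighborly 2 m K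
sphere-neighborly k S [] _ _ _ = face⁺ k (λ ())
sphere-neighborly k S (u ∷ []) (i ∷ []) _ _ = proj₂ (neighborly-onVertexSet S u) i
sphere-neighborly k S (u ∷ w ∷ []) (i ∷ j ∷ []) _ n = Sphere.neighborly S i j
  (λ { refl → n w (there (here refl)) (here refl) })
sphere-neighborly k S (_ ∷ _ ∷ _ ∷ _) _ (s≤s (s≤s ()))

abstract
  -- Q stands for the boundary of -B, which the two constructions write differently: as `bd (neg B)`
  -- in Δ³_n and as `neg (bd B)` in Δ(I).
  exchange : ℕ → Cx → Cx → Cx → Cx
  exchange m K B Q = minus K (B ++ neg B) ++ cone (+ suc m) (∂ B) ++ cone -[1+ m ] Q

  exchange≡ : ∀ m K B Q → exchange m K B Q ≡ minus K (B ++ neg B) ++ cone (+ suc m) (bd B) ++ cone -[1+ m ] Q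
  exchange≡ m K B Q = cong (λ P → minus K (B ++ neg B) ++ cone (+ suc m) P ++ cone -[1+ m ] Q) (∂≡bd B)

  exchange⁻ : ∀ m K B Q {κ} → κ ∈ exchange m K B Q → (κ ∈ K × ¬ Face B κ × ¬ Face (neg B) κ) ⊎
    (∃ λ ρ → ρ ∈ ∂ B × κ ≡ + suc m ∷ ρ) ⊎ (∃ λ ρ → ρ ∈ Q × κ ≡ -[1+ m ] ∷ ρ)
  exchange⁻ m K B Q p with ∈-++⁻ (minus K (B ++ neg B)) p
  ... | inj₁ q = let k , n = ∈-minus⁻ K (B ++ neg B) q in
                 inj₁ (k , (λ f → n (AnyP.++⁺ˡ f)) , (λ f → n (AnyP.++⁺ʳ B f)))
  ... | inj₂ q with ∈-++⁻ (cone (+ suc m) (∂ B)) q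
  ...   | inj₁ r = inj₂ (inj₁ (∈-cone⁻ r))
  ...   | inj₂ r = inj₂ (inj₂ (∈-cone⁻ r))

  exchange-old : ∀ m K B Q {κ} → κ ∈ K → ¬ Face B κ → ¬ Face (neg B) κ → κ ∈ exchange m K B Q
  exchange-old m K B Q k n n' = ∈-++⁺ˡ (∈-minus⁺ k (λ f → [ n , n' ]′ (AnyP.++⁻ B f)))

  exchange-top : ∀ m K B Q {ρ} → ρ ∈~ ∂ B → + suc m ∷ ρ ∈~ exchange m K B Q
  exchange-top m K B Q (ρ' , r , e) = _ , ∈-++⁺ʳ (minus K (B ++ neg B)) (∈-++⁺ˡ (∈-cone⁺ r)) , ∷-≈ e

  exchange-bot : ∀ m K B Q {ρ} → ρ ∈ Q → -[1+ m ] ∷ ρ ∈~ exchange m K B Q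
  exchange-bot m K B Q r =
    ∈⇒∈~ (∈-++⁺ʳ (minus K (B ++ neg B)) (∈-++⁺ʳ (cone (+ suc m) (∂ B)) (∈-cone⁺ r)))

module Step {m K B Q} (S : Sphere m K) (st : Stacked B) (B⊆K : ∀ {κ} → κ ∈ B → κ ∈~ K)
  (disj : ∀ {κ λ'} → κ ∈ B → λ' ∈ B → ¬ κ ≈ map -_ λ')
  (cover : ∀ {v} → InV m v → ∃ λ κ → κ ∈ B × v ∈ κ)
  (Q≅ : Q ≅ ∂ (neg B)) (Q-pure : Pure 3 Q) where

  open Sphere S

  v v' : ℤ
  v = + suc m
  v' = -[1+ m ]

  thinK : Thin 3 K
  thinK = proj₂ good

  thinB : Thin 3 B
  thinB = thin-mono B⊆K thinK

  B-vertices : ∀ {κ u} → κ ∈ B → u ∈ κ → InV m u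
  B-vertices k p with B⊆K k
  ... | _ , k' , e = vertices k' (proj₁ e p)

  negB⊆K : ∀ {κ} → κ ∈ neg B → κ ∈~ K
  negB⊆K p with ∈-negᶜ⁻ p
  ... | κ , k , refl with B⊆K k
  ...   | κ' , k' , e = ∈~-resp (neg-≈ e) (symmetric k')

  bd-vertices : ∀ {ρ u} → ρ ∈ ∂ B → u ∈ ρ → InV m u
  bd-vertices r p with bd⁻ B r
  ... | τ , t , x , _ , refl , _ = B-vertices t (remove-⊆ x τ p)

  Q-in-neg : ∀ {ρ} → ρ ∈ Q → ∃ λ τ → τ ∈ B × map -_ ρ ⊆ τ
  Q-in-neg q with proj₁ Q≅ q
  ... | ρ' , r , e with bd⁻ (neg B) r
  ...   | τ , t , x , _ , refl , _ with ∈-negᶜ⁻ t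
  ...     | τ' , t' , refl = τ' , t' , neg-⊆′ (remove-⊆ x (map -_ τ') ∘ proj₁ e)

  Q-vertices : ∀ {ρ u} → ρ ∈ Q → u ∈ ρ → InV m u
  Q-vertices {u = u} q p with Q-in-neg q
  ... | τ , t , s = subst (InV m) (ℤP.neg-involutive u) (InV-neg (B-vertices t (s (∈-neg⁺ p))))

  v-fresh : Fresh v K
  v-fresh k p = proj₁ (InV-top (vertices k p)) refl

  v'-fresh : Fresh v' K
  v'-fresh k p = proj₂ (InV-top (vertices k p)) refl

  K₁ K₂ : Cx
  K₁ = starred K B v
  K₂ = starred K₁ (neg B) v'

  D : Cx
  D = exchange m K B Q

  D≡ : D ≡ minus K (B ++ neg B) ++ cone v (bd B) ++ cone v' Q
  D≡ = exchange≡ m K B Q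

  D⁻ : ∀ {κ} → κ ∈ D → (κ ∈ K × ¬ Face B κ × ¬ Face (neg B) κ) ⊎
    (∃ λ ρ → ρ ∈ ∂ B × κ ≡ v ∷ ρ) ⊎ (∃ λ ρ → ρ ∈ Q × κ ≡ v' ∷ ρ)
  D⁻ = exchange⁻ m K B Q

  D-old : ∀ {κ} → κ ∈ K → ¬ Face B κ → ¬ Face (neg B) κ → κ ∈ D
  D-old = exchange-old m K B Q

  D-top : ∀ {ρ} → ρ ∈~ ∂ B → v ∷ ρ ∈~ D
  D-top = exchange-top m K B Q

  D-bot : ∀ {ρ} → ρ ∈~ ∂ (neg B) → v' ∷ ρ ∈~ D
  D-bot (_ , r , e) = let _ , q , e' = proj₂ Q≅ r in ∈~-resp (∷-≈ (≈-trans e e')) (exchange-bot m K B Q q)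

  -- The two exchanges are done one after the other. The facets of -B survive the first one because
  -- B and -B share none.
  K₁-neg : ∀ {κ} → κ ∈ neg B → κ ∈~ K₁
  K₁-neg {κ} p with negB⊆K p
  ... | κ' , k' , e = κ' , starredˡ k' n , e
    where
    n : ¬ Face B κ'
    n f with face⁻ f | ∈-negᶜ⁻ p
    ... | λ' , l , s | μ , m' , refl = disj l m'
      (proj₂ e ∘ same-size (proj₁ good k') (stacked-pure st l) s , s ∘ proj₁ e)

  good₁ : Good K₁
  good₁ = starred-good good v-fresh st B⊆K

  v'-fresh₁ : Fresh v' K₁
  v'-fresh₁ p q with starred⁻ K B v p
  ... | inj₁ (k , _) = v'-fresh k q
  v'-fresh₁ p (there q) | inj₂ (ρ , r , refl) = proj₂ (InV-top (bd-vertices r q)) refl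

  good₂ : Good K₂
  good₂ = starred-good good₁ v'-fresh₁ (stacked-neg st) K₁-neg

  D≅K₂ : D ≅ K₂
  D≅K₂ = f , g
    where
    f : ∀ {κ} → κ ∈ D → κ ∈~ K₂
    f p with D⁻ p
    ... | inj₁ (k , n , n') = ∈⇒∈~ (starredˡ (starredˡ k n) n')
    ... | inj₂ (inj₁ (ρ , r , refl)) = ∈⇒∈~ (starredˡ (starred-cone r) λ F →
          let κ , k , s = face⁻ F ; κ' , k' , e = negB⊆K k in v-fresh k' (proj₁ e (s (here refl))))
    ... | inj₂ (inj₂ (ρ , r , refl)) = starredʳ (proj₁ Q≅ r)
    g : ∀ {κ} → κ ∈ K₂ → κ ∈~ D
    g p with starred⁻ K₁ (neg B) v' p
    ... | inj₂ (ρ , r , refl) = D-bot (∈⇒∈~ r)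
    ... | inj₁ (k , n') with starred⁻ K B v k
    ...   | inj₁ (k' , n) = ∈⇒∈~ (D-old k' n n')
    ...   | inj₂ (ρ , r , refl) = D-top (∈⇒∈~ r)

  D-good : Good D
  D-good = pure , thin-mono (proj₁ D≅K₂) (proj₂ good₂)
    where
    pure : Pure 4 D
    pure p with D⁻ p
    ... | inj₁ (k , _) = proj₁ good k
    ... | inj₂ (inj₁ (ρ , r , refl)) =
      isSimplex-∷ (λ q → proj₁ (InV-top (bd-vertices r q)) refl) (bd-pure (stacked-pure st) r)
    ... | inj₂ (inj₂ (ρ , r , refl)) =
      isSimplex-∷ (λ q → proj₂ (InV-top (Q-vertices r q)) refl) (Q-pure r)

  D-sphere : CombinatorialSphere 3 D
  D-sphere = StellarEq.trans (StellarEq.iso (≅⇒Isomorphic D≅K₂))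
    (StellarEq.trans (StellarEq.symm (starred-sphere good₁ v'-fresh₁ (stacked-neg st) K₁-neg))
    (StellarEq.trans (StellarEq.symm (starred-sphere good v-fresh st B⊆K)) sphere))

  D-symmetric : ∀ {κ} → κ ∈ D → map -_ κ ∈~ D
  D-symmetric p with D⁻ p
  ... | inj₁ (k , n , n') with symmetric k
  ...   | λ' , l , e = λ' , D-old l a b , e
    where
    a : ¬ Face B λ'
    a F with face⁻ F
    ... | μ , q , s = n' (face⁺ (∈-negᶜ⁺ q) (λ x∈ → ∈-neg⁺′ (s (proj₁ e (∈-neg⁺ x∈)))))
    b : ¬ Face (neg B) λ'
    b F with face⁻ F
    ... | μ , q , s with ∈-negᶜ⁻ q
    ...   | μ' , q' , refl = n (face⁺ q' (neg-⊆⁻ (s ∘ proj₁ e)))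
  D-symmetric p | inj₂ (inj₁ (ρ , r , refl)) = D-bot (bd-neg B r)
  D-symmetric p | inj₂ (inj₂ (ρ , r , refl)) with proj₁ Q≅ r
  ... | ρ' , r' , e = D-top (∈~-resp (neg-≈ e)
        (subst (λ L → map -_ ρ' ∈~ ∂ L) (neg-negᶜ B) (bd-neg (neg B) r')))

  D-vertices : ∀ {κ u} → κ ∈ D → u ∈ κ → InV (suc m) u
  D-vertices p q with D⁻ p
  ... | inj₁ (k , _) = InV-suc (vertices k q)
  D-vertices p (here refl) | inj₂ (inj₁ (ρ , r , refl)) = (λ ()) , ℕP.≤-refl
  D-vertices p (there q) | inj₂ (inj₁ (ρ , r , refl)) = InV-suc (bd-vertices r q)
  D-vertices p (here refl) | inj₂ (inj₂ (ρ , r , refl)) = (λ ()) , ℕP.≤-refl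
  D-vertices p (there q) | inj₂ (inj₂ (ρ , r , refl)) = InV-suc (Q-vertices r q)

  D-noAnti : ∀ {κ} → κ ∈ D → NoAntipodal κ
  D-noAnti p u a b with D⁻ p
  ... | inj₁ (k , _) = noAnti k u a b
  D-noAnti p u (here refl) (there b) | inj₂ (inj₁ (ρ , r , refl)) = proj₂ (InV-top (bd-vertices r b)) refl
  D-noAnti p u (there a) (here e) | inj₂ (inj₁ (ρ , r , refl)) =
    proj₂ (InV-top (bd-vertices r a)) (trans (sym (ℤP.neg-involutive u)) (cong -_ e))
  D-noAnti p u (there a) (there b) | inj₂ (inj₁ (ρ , r , refl)) with bd⁻ B r
  ... | τ , t , x , _ , refl , _ with B⊆K t
  ...   | τ' , t' , e = noAnti t' u (proj₁ e (remove-⊆ x τ a)) (proj₁ e (remove-⊆ x τ b))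
  D-noAnti p u (here refl) (there b) | inj₂ (inj₂ (ρ , r , refl)) = proj₁ (InV-top (Q-vertices r b)) refl
  D-noAnti p u (there a) (here e) | inj₂ (inj₂ (ρ , r , refl)) =
    proj₁ (InV-top (Q-vertices r a)) (trans (sym (ℤP.neg-involutive _)) (cong -_ e))
  D-noAnti p u (there a) (there b) | inj₂ (inj₂ (ρ , r , refl)) with Q-in-neg r
  ... | τ , t , s with B⊆K t
  ...   | τ' , t' , e = noAnti t' (- u) (proj₁ e (s (∈-neg⁺ a))) (proj₁ e (s (∈-neg⁺ b)))

  top-vertex : ∀ {u} → InV m u → Face D (v ∷ u ∷ [])
  top-vertex i with cover i
  -- A vertex is treated as the degenerate edge {u, u}.
  ... | κ , k , p with stacked-edge st thinB k p p
  ...   | ρ , r , q , _ = face~ (D-top (∈⇒∈~ r)) λ { (here refl) → here refl ; (there (here refl)) → there q }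

  D-face-neg : ∀ {σ} → Face D σ → Face D (map -_ σ)
  D-face-neg F with face⁻ F
  ... | κ , k , s = face~ (D-symmetric k) (neg-⊆ s)

  D-face-neg⁻ : ∀ {σ} → Face D (map -_ σ) → Face D σ
  D-face-neg⁻ {σ} F = subst (Face D) (neg-neg σ) (D-face-neg F)

  bot-vertex : ∀ {u} → InV m u → Face D (v' ∷ u ∷ [])
  bot-vertex {u} i = D-face-neg⁻ {v' ∷ u ∷ []} (top-vertex (InV-neg i))

  top-top : Face D (v ∷ v ∷ [])
  top-top with nonempty st
    where
    nonempty : ∀ {B} → Stacked B → ∃ λ κ → κ ∈ B × ∃ λ u → u ∈ κ
    nonempty (simplex {x ∷ τ} s) = _ , here refl , x , here refl
    nonempty (stack _ _ _ _ _) = _ , here refl , _ , here refl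
    nonempty (reorder st (f , _) _) with nonempty st
    ... | κ , k , u , p = let κ' , k' , e = f k in κ' , k' , u , proj₁ e p
  ... | κ , k , u , p = face-⊆ (λ { (here refl) → here refl ; (there (here refl)) → here refl })
                               (top-vertex (B-vertices k p))

  B-edge : ∀ {κ u w} → κ ∈ B → u ∈ κ → w ∈ κ → Face D (u ∷ w ∷ [])
  B-edge k p q with stacked-edge st thinB k p q
  ... | ρ , r , a , b = face~ (D-top (∈⇒∈~ r)) λ { (here refl) → there a ; (there (here refl)) → there b }

  private
    flip₂ : ∀ {x y} → Face D (x ∷ y ∷ []) → Face D (y ∷ x ∷ [])
    flip₂ = face-⊆ λ { (here e) → there (here e) ; (there (here e)) → here e }

  -- Edges at the new vertices come from B covering all old vertices. An old edge whose facet is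
  -- removed lies in B or -B, hence on the boundary, and remains in a cone.
  D-neighborly : ∀ {u w} → InV (suc m) u → InV (suc m) w → u ≢ - w → Face D (u ∷ w ∷ [])
  D-neighborly i j n with InV-split i | InV-split j
  ... | inj₁ i | inj₂ (inj₁ refl) = flip₂ (top-vertex i)
  ... | inj₁ i | inj₂ (inj₂ refl) = flip₂ (bot-vertex i)
  ... | inj₂ (inj₁ refl) | inj₁ j = top-vertex j
  ... | inj₂ (inj₂ refl) | inj₁ j = bot-vertex j
  ... | inj₂ (inj₁ refl) | inj₂ (inj₂ refl) = ⊥-elim (n refl)
  ... | inj₂ (inj₂ refl) | inj₂ (inj₁ refl) = ⊥-elim (n refl)
  ... | inj₂ (inj₁ refl) | inj₂ (inj₁ refl) = top-top
  ... | inj₂ (inj₂ refl) | inj₂ (inj₂ refl) = D-face-neg top-top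
  D-neighborly {u} {w} _ _ n | inj₁ i | inj₁ j with face⁻ (neighborly i j n)
  ... | κ , k , s with Face? B κ | Face? (neg B) κ
  ...   | no a | no b = face⁺ (D-old k a b) s
  ...   | yes F | _ = let τ , t , s' = face⁻ F in B-edge t (s' (s (here refl))) (s' (s (there (here refl))))
  ...   | no _ | yes F with face⁻ F
  ...     | τ , t , s' with ∈-negᶜ⁻ t
  ...       | τ' , t' , refl = D-face-neg⁻ {u ∷ w ∷ []}
                (B-edge t' (∈-neg⁻ (s' (s (here refl)))) (∈-neg⁻ (s' (s (there (here refl))))))

  stepped : Sphere (suc m) D
  stepped = record { good = D-good ; symmetric = D-symmetric ; noAnti = D-noAnti ; vertices = D-vertices
    ; neighborly = D-neighborly ; sphere = D-sphere }

  -- Used to refute faces: the cones rest on faces of ±B, so among old vertices the exchange creates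
  -- nothing.
  face-old : ∀ {σ} → (∀ {u} → u ∈ σ → InV m u) → Face D σ → Face K σ
  face-old {σ} i F with face⁻ F
  ... | κ , k , s with D⁻ k
  ...   | inj₁ (k' , _) = face⁺ k' s
  ...   | inj₂ (inj₁ (ρ , r , refl)) with bd⁻ B r
  ...     | τ , t , x , _ , refl , _ = face~ (B⊆K t) λ p → case s p of λ
              { (here refl) → ⊥-elim (proj₁ (InV-top (i p)) refl) ; (there q) → remove-⊆ x τ q }
  face-old {σ} i F | κ , k , s | inj₂ (inj₂ (ρ , r , refl)) with Q-in-neg r
  ...     | τ , t , s' = face~ (negB⊆K (∈-negᶜ⁺ t)) λ p → case s p of λ
              { (here refl) → ⊥-elim (proj₂ (InV-top (i p)) refl) ; (there q) → ∈-neg⁺′ (s' (∈-neg⁺ q)) }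

  -- The facets at the new vertex are cones over ridges of B, so a refutation of a face containing
  -- it takes place inside B.
  face-top : ∀ {σ} → (∀ {u} → u ∈ σ → InV m u) → Face D (v ∷ σ) → Face B σ
  face-top {σ} i F with face⁻ F
  ... | κ , k , s with D⁻ k
  ...   | inj₁ (k' , _) = ⊥-elim (v-fresh k' (s (here refl)))
  ...   | inj₂ (inj₁ (ρ , r , refl)) with bd⁻ B r
  ...     | τ , t , x , _ , refl , _ = face⁺ t λ p → case s (there p) of λ
              { (here refl) → ⊥-elim (proj₁ (InV-top (i p)) refl) ; (there q) → remove-⊆ x τ q }
  face-top {σ} i F | κ , k , s | inj₂ (inj₂ (ρ , r , refl)) with s (here refl)
  ...     | there q = ⊥-elim (proj₁ (InV-top (Q-vertices r q)) refl)

  -- Thinness leaves A no facet of K besides two facets of B. So no kept facet contains A, A is not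
  -- a boundary triangle of B, and a facet of -B through A would coincide with one of B.
  interior : ∀ {A κ λ'} → IsSimplex 3 A → κ ∈ B → λ' ∈ B → A ⊆ κ → A ⊆ λ' → ¬ κ ≈ λ' → ¬ Face D A
  interior {A} {κ} {λ'} sA k l a b n F with face⁻ F
  ... | μ , m∈ , s with D⁻ m∈
  ...   | inj₁ (m' , nB , _) with B⊆K k | B⊆K l
  ...     | κ' , k' , e | λ'' , l' , e' with thinK sA m' k' l' s (proj₁ e ∘ a) (proj₁ e' ∘ b)
  ...       | inj₁ q = nB (face⁺ k (proj₂ e ∘ proj₁ q))
  ...       | inj₂ (inj₁ q) = n (≈-trans e (≈-trans q (≈-sym e')))
  ...       | inj₂ (inj₂ q) = nB (face⁺ l (proj₂ e' ∘ proj₁ q))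
  interior {A} {κ} {λ'} sA k l a b n F | μ , m∈ , s | inj₂ (inj₁ (ρ , r , refl)) with bd⁻ B r
  ...   | τ , t , x , x∈ , refl , only = n (≈-trans (only k (a ∘ ρ⊆A)) (≈-sym (only l (b ∘ ρ⊆A))))
    where
    A⊆ρ : A ⊆ del x τ
    A⊆ρ p with s p
    ... | here refl = ⊥-elim (proj₁ (InV-top (B-vertices k (a p))) refl)
    ... | there q = q
    ρ⊆A : del x τ ⊆ A
    ρ⊆A = same-size sA (bd-pure (stacked-pure st) r) A⊆ρ
  interior {A} {κ} {λ'} sA k l a b n F | μ , m∈ , s | inj₂ (inj₂ (ρ , r , refl)) with Q-in-neg r
  ...   | τ , t , s' with B⊆K k | B⊆K l | negB⊆K (∈-negᶜ⁺ t)
  ...     | κ' , k' , e | λ'' , l' , e' | τ' , t' , e'' with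
              thinK sA k' l' t' (proj₁ e ∘ a) (proj₁ e' ∘ b) (λ p → proj₁ e'' (∈-neg⁺′ (s' (∈-neg⁺ (A⊆ρ p)))))
    where
    A⊆ρ : A ⊆ ρ
    A⊆ρ p with s p
    ... | here refl = ⊥-elim (proj₂ (InV-top (B-vertices k (a p))) refl)
    ... | there q = q
  ...       | inj₁ q = n (≈-trans e (≈-trans q (≈-sym e')))
  ...       | inj₂ (inj₁ q) = disj l t (≈-trans e' (≈-trans q (≈-sym e'')))
  ...       | inj₂ (inj₂ q) = disj k t (≈-trans e (≈-trans q (≈-sym e'')))

-- The cross-polytope, by evaluation

unique? : ∀ σ → Dec (Unique σ)
unique? = allPairs? (λ x y → ¬? (x ≟ y))

isSimplex? : ∀ k σ → Dec (IsSimplex k σ)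
isSimplex? k σ = unique? σ ×-dec (length σ ℕ.≟ k)

∈~? : ∀ σ K → Dec (Any (σ ≈_) K)
∈~? σ K = Any.any? (≈? σ) K

any⇒∈~ : ∀ {σ K} → Any (σ ≈_) K → σ ∈~ K
any⇒∈~ = find

private
  common : Simplex → Simplex → Simplex
  common σ τ = filter (_∈? τ) σ

  thin? : ∀ K → Dec (All (λ κ → All (λ λ' → length (common κ λ') ≤ 2 ⊎
                       All (λ μ → length (common (common κ λ') μ) ≤ 2 ⊎ Two κ λ' μ) K) K) K)
  thin? K = All.all? (λ κ → All.all? (λ λ' → (length (common κ λ') ℕ.≤? 2) ⊎-dec
    All.all? (λ μ → (length (common (common κ λ') μ) ℕ.≤? 2) ⊎-dec (≈? κ λ' ⊎-dec (≈? λ' μ ⊎-dec ≈? κ μ))) K) K) K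

  -- Facets with at most two common vertices share no triangle, so the finite test inspects
  -- intersections instead of all triangles.
  thin-check : ∀ {K} → True (thin? K) → Thin 3 K
  thin-check {K} t {A} (u , l) {κ} {λ'} {μ} p q r a b c
    with All.lookup (All.lookup (toWitness t) p) q
  ... | inj₁ small = ⊥-elim (ℕP.<⇒≱ (s≤s small) (subst (_≤ length (common κ λ')) l
          (unique-⊆-length u (λ x∈ → ∈-filter⁺ (_∈? λ') (a x∈) (b x∈)))))
  ... | inj₂ h with All.lookup h r
  ...   | inj₂ two = two
  ...   | inj₁ small = ⊥-elim (ℕP.<⇒≱ (s≤s small) (subst (_≤ length (common (common κ λ') μ)) l
          (unique-⊆-length u (λ x∈ → ∈-filter⁺ (_∈? μ) (∈-filter⁺ (_∈? λ') (a x∈) (b x∈)) (c x∈)))))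

  V₄ : Simplex
  V₄ = + 1 ∷ + 2 ∷ + 3 ∷ + 4 ∷ -[1+ 0 ] ∷ -[1+ 1 ] ∷ -[1+ 2 ] ∷ -[1+ 3 ] ∷ []

  InV-V₄ : ∀ {v} → InV 4 v → v ∈ V₄
  InV-V₄ {+ 0} (n , _) = ⊥-elim (n refl)
  InV-V₄ {+ 1} _ = here refl
  InV-V₄ {+ 2} _ = there (here refl)
  InV-V₄ {+ 3} _ = there (there (here refl))
  InV-V₄ {+ 4} _ = there (there (there (here refl)))
  InV-V₄ {+ suc (suc (suc (suc (suc _))))} (_ , s≤s (s≤s (s≤s (s≤s ()))))
  InV-V₄ { -[1+ 0 ]} _ = there (there (there (there (here refl))))
  InV-V₄ { -[1+ 1 ]} _ = there (there (there (there (there (here refl)))))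
  InV-V₄ { -[1+ 2 ]} _ = there (there (there (there (there (there (here refl))))))
  InV-V₄ { -[1+ 3 ]} _ = there (there (there (there (there (there (there (here refl)))))))
  InV-V₄ { -[1+ suc (suc (suc (suc _))) ]} (_ , s≤s (s≤s (s≤s (s≤s ()))))

  star-at : ∀ K σ v → {True (Face? K σ)} → {False (Face? K (v ∷ []))} → σ ≢ [] → StellarEq K (stellar K σ v)
  star-at K σ v {f} {n} ne = StellarEq.sub σ v ne (toWitness f) (toWitnessFalse n)

  ≅? : ∀ K L → Dec (All (λ κ → Any (κ ≈_) L) K × All (λ κ → Any (κ ≈_) K) L)
  ≅? K L = All.all? (λ κ → ∈~? κ L) K ×-dec All.all? (λ κ → ∈~? κ K) L

  ≅-check : ∀ {K L} → True (≅? K L) → K ≅ L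
  ≅-check t = (λ p → any⇒∈~ (All.lookup (proj₁ (toWitness t)) p)) , λ p → any⇒∈~ (All.lookup (proj₂ (toWitness t)) p)

  -- Starring at a vertex renames it, and starring an edge turns a factor
  -- ∂(edge ∪ τ) of a join into ∂edge ∗ ∂(v ∪ τ).
  stage₁ stage₂ stage₃ stage₄ stage₅ stage₆ : Cx
  stage₁ = stellar (∂simplex 3) (+ 2 ∷ []) -[1+ 0 ]
  stage₂ = stellar stage₁ (+ 4 ∷ []) -[1+ 2 ]
  stage₃ = stellar stage₂ (+ 5 ∷ []) (+ 2)
  stage₄ = stellar stage₃ (+ 1 ∷ -[1+ 0 ] ∷ []) -[1+ 1 ]
  stage₅ = stellar stage₄ (+ 3 ∷ -[1+ 2 ] ∷ []) (+ 4)
  stage₆ = stellar stage₅ (+ 2 ∷ -[1+ 1 ] ∷ []) -[1+ 3 ]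

cross-sphere : CombinatorialSphere 3 (cross 4)
cross-sphere = StellarEq.symm
  (StellarEq.trans (star-at (∂simplex 3) (+ 2 ∷ []) -[1+ 0 ] (λ ()))
  (StellarEq.trans (star-at stage₁ (+ 4 ∷ []) -[1+ 2 ] (λ ()))
  (StellarEq.trans (star-at stage₂ (+ 5 ∷ []) (+ 2) (λ ()))
  (StellarEq.trans (star-at stage₃ (+ 1 ∷ -[1+ 0 ] ∷ []) -[1+ 1 ] (λ ()))
  (StellarEq.trans (star-at stage₄ (+ 3 ∷ -[1+ 2 ] ∷ []) (+ 4) (λ ()))
  (StellarEq.trans (star-at stage₅ (+ 2 ∷ -[1+ 1 ] ∷ []) -[1+ 3 ] (λ ()))
    (StellarEq.iso (≅⇒Isomorphic {stage₆} {cross 4} (≅-check tt)))))))))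

cross-Sphere : Sphere 4 (cross 4)
cross-Sphere = record
  { good = (λ p → All.lookup (toWitness {a? = All.all? (isSimplex? 4) (cross 4)} tt) p) , thin-check {cross 4} tt
  ; symmetric = λ p → any⇒∈~ (All.lookup (toWitness {a? = All.all? (λ κ → ∈~? (map -_ κ) (cross 4)) (cross 4)} tt) p)
  ; noAnti = λ p v a b → All.lookup (All.lookup
      (toWitness {a? = All.all? (λ κ → All.all? (λ v → ¬? ((- v) ∈? κ)) κ) (cross 4)} tt) p) a b
  ; vertices = λ p q → All.lookup (All.lookup
      (toWitness {a? = All.all? (λ κ → All.all? (λ v → ¬? (v ≟ + 0) ×-dec (∣ v ∣ ℕ.≤? 4)) κ) (cross 4)} tt) p) q
  ; neighborly = λ {u} {w} i j n → [ (λ e → ⊥-elim (n e)) , id ]′ (All.lookup (All.lookup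
      (toWitness {a? = All.all? (λ u → All.all? (λ w → (u ≟ - w) ⊎-dec Face? (cross 4) (u ∷ w ∷ [])) V₄) V₄} tt)
      (InV-V₄ i)) (InV-V₄ j))
  ; sphere = cross-sphere
  }

-- Difference constraints

-- A decision procedure for difference constraints over ℕ and equations
-- between signed vertices. The term (i , c) stands for c plus the i-th
-- variable, and variable 0 is the constant 0.
Term : Set
Term = ℕ × ℕ

nth : ℕ → List ℕ → ℕ
nth i [] = 0
nth zero (x ∷ xs) = x
nth (suc i) (x ∷ xs) = nth i xs

var : List ℕ → ℕ → ℕ
var xs zero = 0
var xs (suc i) = nth i xs

⟦_⟧ᵗ : Term → List ℕ → ℕ
⟦ i , c ⟧ᵗ xs = c + var xs i

data Vertex : Set where
  pos neg′ : Term → Vertex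

⟦_⟧ᵛ : Vertex → List ℕ → ℤ
⟦ pos t ⟧ᵛ xs = + ⟦ t ⟧ᵗ xs
⟦ neg′ t ⟧ᵛ xs = - (+ ⟦ t ⟧ᵗ xs)

infix 5 _≼_ _≐_
infixr 4 _∧_
infixr 3 _∨_

data Formula : Set where
  _≼_     : Term → Term → Formula
  _≐_     : Vertex → Vertex → Formula
  _∧_ _∨_ : Formula → Formula → Formula
  tt′ ff′ : Formula

⟦_⟧ : Formula → List ℕ → Set
⟦ t ≼ u ⟧ xs = ⟦ t ⟧ᵗ xs ≤ ⟦ u ⟧ᵗ xs
⟦ v ≐ w ⟧ xs = ⟦ v ⟧ᵛ xs ≡ ⟦ w ⟧ᵛ xs
⟦ φ ∧ ψ ⟧ xs = ⟦ φ ⟧ xs × ⟦ ψ ⟧ xs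
⟦ φ ∨ ψ ⟧ xs = ⟦ φ ⟧ xs ⊎ ⟦ ψ ⟧ xs
⟦ tt′ ⟧ xs = ⊤
⟦ ff′ ⟧ xs = ⊥

1+ : Term → Term
1+ (i , c) = i , suc c

-- A positive and a negative vertex agree only if both are 0, so their difference means that one of
-- the two terms is at least 1.
negate : Formula → Formula
negate (t ≼ u) = 1+ u ≼ t
negate (pos t ≐ pos u) = (1+ t ≼ u) ∨ (1+ u ≼ t)
negate (neg′ t ≐ neg′ u) = (1+ t ≼ u) ∨ (1+ u ≼ t)
negate (pos t ≐ neg′ u) = ((0 , 1) ≼ t) ∨ ((0 , 1) ≼ u)
negate (neg′ t ≐ pos u) = ((0 , 1) ≼ t) ∨ ((0 , 1) ≼ u)
negate (φ ∧ ψ) = negate φ ∨ negate ψ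
negate (φ ∨ ψ) = negate φ ∧ negate ψ
negate tt′ = ff′
negate ff′ = tt′

-- con i a j b is the constraint a + xᵢ ≤ b + xⱼ.
data Constraint : Set where
  con : (i a j b : ℕ) → Constraint

Holds : List ℕ → Constraint → Set
Holds xs (con i a j b) = a + var xs i ≤ b + var xs j

Store : Set
Store = List Constraint

-- Implication between constraints on the same two variables: a - b ≤ a' - b', rearranged to avoid
-- subtraction.
dominated : Constraint → Constraint → Bool
dominated (con i a j b) (con i' a' j' b') = (i ≡ᵇ i') && ((j ≡ᵇ j') && (b' + a ≤ᵇ b + a'))

trivial absurd : Constraint → Bool
trivial (con i a j b) = (i ≡ᵇ j) && (a ≤ᵇ b)
absurd (con i a j b) = (i ≡ᵇ j) && (suc b ≤ᵇ a)

infixl 5 _⨾_ _⨾*_ _*⨾_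

_⨾_ : Constraint → Constraint → Constraint
con i a j b ⨾ con j' a' k c = if j ≡ᵇ j' then con i (a + a') k (b + c) else con i a j b

meets : Constraint → Constraint → Bool
meets (con i a j b) (con j' a' k c) = j ≡ᵇ j'

_⨾*_ : Constraint → Store → Store
c ⨾* [] = []
c ⨾* (s ∷ S) = if meets c s then (c ⨾ s) ∷ (c ⨾* S) else c ⨾* S

_*⨾_ : Store → Constraint → Store
[] *⨾ c = []
(s ∷ S) *⨾ c = if meets s c then (s ⨾ c) ∷ (S *⨾ c) else S *⨾ c

through : Store → Store → Store
through [] S = []
through (c ∷ L) S = c ∷ (c ⨾* S) ++ through L S

insert : Store → Store → Store
insert [] S = S
insert (c ∷ L) S = if any (dominated c) S || trivial c then insert L S else insert L (c ∷ S)

-- Incremental path closure: the new constraint is composed with stored ones on both sides, and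
-- inconsistency shows as a cycle from a variable to itself with a > b. Only soundness is proved, so
-- discarding redundant constraints needs no justification.
assume : Constraint → (Store → Bool) → Store → Bool
assume c k S = if any (dominated c) S || trivial c then k S else
  (let new = through (c ∷ (S *⨾ c)) S in if any absurd new then true else k (insert new S))

refute : Formula → (Store → Bool) → Store → Bool
refute ((i , a) ≼ (j , b)) k = assume (con i a j b) k
refute (pos (i , a) ≐ pos (j , b)) k = assume (con i a j b) (assume (con j b i a) k)
refute (neg′ (i , a) ≐ neg′ (j , b)) k = assume (con i a j b) (assume (con j b i a) k)
refute (pos (i , a) ≐ neg′ (j , b)) k = assume (con i a 0 0) (assume (con j b 0 0) k)
refute (neg′ (i , a) ≐ pos (j , b)) k = assume (con i a 0 0) (assume (con j b 0 0) k)
refute (φ ∧ ψ) k = refute φ (refute ψ k)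
refute (φ ∨ ψ) k S = refute φ k S && refute ψ k S
refute tt′ k = k
refute ff′ k S = true

nonneg : ℕ → Store
nonneg zero = []
nonneg (suc i) = con 0 0 (suc i) 0 ∷ nonneg i

-- The final continuation answers `false`: a branch that ends without contradiction may have a
-- countermodel.
valid : ℕ → Formula → Formula → Bool
valid m φ ψ = refute (φ ∧ negate ψ) (λ _ → false) (nonneg m)

private
  if-case : ∀ {A : Set} {P : A → Set} b {x y : A} → P x → P y → P (if b then x else y)
  if-case true p q = p
  if-case false p q = q

  T-if : ∀ b {x y} → T (if b then x else y) → (T b × T x) ⊎ T y
  T-if true t = inj₁ (tt , t)
  T-if false t = inj₂ t

  T-&& : ∀ {a b} → T (a && b) → T a × T b
  T-&& = Equivalence.to T-∧

  ⨾-holds : ∀ {xs} c d → Holds xs c → Holds xs d → Holds xs (c ⨾ d)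
  ⨾-holds {xs} (con i a j b) (con j' a' k c) p q with j ≡ᵇ j' in eq
  ... | false = p
  ... | true with ℕP.≡ᵇ⇒≡ j j' (Equivalence.from T-≡ eq)
  ...   | refl = begin
    a + a' + X i   ≡⟨ cong (_+ X i) (ℕP.+-comm a a') ⟩
    a' + a + X i   ≡⟨ ℕP.+-assoc a' a (X i) ⟩
    a' + (a + X i) ≤⟨ ℕP.+-monoʳ-≤ a' p ⟩
    a' + (b + X j) ≡⟨ ℕP.+-assoc a' b (X j) ⟨
    a' + b + X j   ≡⟨ cong (_+ X j) (ℕP.+-comm a' b) ⟩
    b + a' + X j   ≡⟨ ℕP.+-assoc b a' (X j) ⟩
    b + (a' + X j) ≤⟨ ℕP.+-monoʳ-≤ b q ⟩
    b + (c + X k)  ≡⟨ ℕP.+-assoc b c (X k) ⟨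
    b + c + X k    ∎
    where
    open ℕP.≤-Reasoning
    X = var xs

  ⨾*-holds : ∀ {xs} c S → Holds xs c → All (Holds xs) S → All (Holds xs) (c ⨾* S)
  ⨾*-holds c [] p [] = []
  ⨾*-holds {xs} c (s ∷ S) p (q ∷ qs) =
    if-case {P = All (Holds xs)} (meets c s) (⨾-holds c s p q ∷ ⨾*-holds c S p qs) (⨾*-holds c S p qs)

  *⨾-holds : ∀ {xs} c S → Holds xs c → All (Holds xs) S → All (Holds xs) (S *⨾ c)
  *⨾-holds c [] p [] = []
  *⨾-holds {xs} c (s ∷ S) p (q ∷ qs) =
    if-case {P = All (Holds xs)} (meets s c) (⨾-holds s c q p ∷ *⨾-holds c S p qs) (*⨾-holds c S p qs)

  through-holds : ∀ {xs} L S → All (Holds xs) L → All (Holds xs) S → All (Holds xs) (through L S)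
  through-holds [] S [] qs = []
  through-holds (c ∷ L) S (p ∷ ps) qs = p ∷ AllP.++⁺ (⨾*-holds c S p qs) (through-holds L S ps qs)

  insert-holds : ∀ {xs} L S → All (Holds xs) L → All (Holds xs) S → All (Holds xs) (insert L S)
  insert-holds [] S [] qs = qs
  insert-holds {xs} (c ∷ L) S (p ∷ ps) qs =
    if-case {P = All (Holds xs)} (any (dominated c) S || trivial c) (insert-holds L S ps qs) (insert-holds L (c ∷ S) ps (p ∷ qs))

  absurd-holds : ∀ {xs} c → T (absurd c) → ¬ Holds xs c
  absurd-holds {xs} (con i a j b) t p with T-&& {i ≡ᵇ j} t
  ... | e , l with ℕP.≡ᵇ⇒≡ i j e
  ...   | refl = ℕP.<⇒≱ (ℕP.≤ᵇ⇒≤ (suc b) a l) (ℕP.+-cancelʳ-≤ (var xs i) a b p)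

  no-absurd : ∀ {xs} S → All (Holds xs) S → ¬ T (any absurd S)
  no-absurd S h t with find (AnyP.any⁻ absurd S t)
  ... | c , c∈ , a = absurd-holds c a (All.lookup h c∈)

  Sound : List ℕ → (Store → Bool) → Set
  Sound xs k = ∀ S → All (Holds xs) S → ¬ T (k S)

  assume-sound : ∀ {xs} c k → Holds xs c → Sound xs k → Sound xs (assume c k)
  assume-sound {xs} c k p s S h t with T-if (any (dominated c) S || trivial c) t
  ... | inj₁ (_ , r) = s S h r
  ... | inj₂ r with T-if (any absurd (through (c ∷ (S *⨾ c)) S)) r
  ...   | inj₁ (e , _) = no-absurd _ (through-holds (c ∷ (S *⨾ c)) S (p ∷ *⨾-holds c S p h) h) e
  ...   | inj₂ q = s _ (insert-holds (through (c ∷ (S *⨾ c)) S) S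
                     (through-holds (c ∷ (S *⨾ c)) S (p ∷ *⨾-holds c S p h) h) h) q

  neg-pos : ∀ a b → - (+ a) ≡ + b → a ≤ 0 × b ≤ 0
  neg-pos zero zero e = z≤n , z≤n

  both : ∀ {xs} c d k → Holds xs c → Holds xs d → Sound xs k → Sound xs (assume c (assume d k))
  both c d k p q s = assume-sound c (assume d k) p (assume-sound d k q s)

  refute-sound : ∀ {xs} φ k → ⟦ φ ⟧ xs → Sound xs k → Sound xs (refute φ k)
  refute-sound ((i , a) ≼ (j , b)) k p s = assume-sound (con i a j b) k p s
  refute-sound (pos (i , a) ≐ pos (j , b)) k p s =
    both (con i a j b) (con j b i a) k (ℕP.≤-reflexive (ℤP.+-injective p)) (ℕP.≤-reflexive (sym (ℤP.+-injective p))) s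
  refute-sound (neg′ (i , a) ≐ neg′ (j , b)) k p s =
    both (con i a j b) (con j b i a) k (ℕP.≤-reflexive (ℤP.+-injective (ℤP.neg-injective p)))
      (ℕP.≤-reflexive (sym (ℤP.+-injective (ℤP.neg-injective p)))) s
  refute-sound {xs} (pos (i , a) ≐ neg′ (j , b)) k p s with neg-pos (b + var xs j) (a + var xs i) (sym p)
  ... | q , r = both (con i a 0 0) (con j b 0 0) k r q s
  refute-sound {xs} (neg′ (i , a) ≐ pos (j , b)) k p s with neg-pos (a + var xs i) (b + var xs j) p
  ... | q , r = both (con i a 0 0) (con j b 0 0) k q r s
  refute-sound (φ ∧ ψ) k (p , q) s = refute-sound φ (refute ψ k) p (refute-sound ψ k q s)
  refute-sound (φ ∨ ψ) k (inj₁ p) s S h t = refute-sound φ k p s S h (proj₁ (T-&& {refute φ k S} t))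
  refute-sound (φ ∨ ψ) k (inj₂ p) s S h t = refute-sound ψ k p s S h (proj₂ (T-&& {refute φ k S} t))
  refute-sound tt′ k p s = s

  ≢⇒< : ∀ {a b} → a ≢ b → suc a ≤ b ⊎ suc b ≤ a
  ≢⇒< {a} {b} n with ℕP.<-cmp a b
  ... | Relation.Binary.tri< l _ _ = inj₁ l
  ... | Relation.Binary.tri≈ _ e _ = ⊥-elim (n e)
  ... | Relation.Binary.tri> _ _ g = inj₂ g

  nonzero : ∀ a b → + a ≢ - (+ b) → 1 ≤ a ⊎ 1 ≤ b
  nonzero (suc a) b n = inj₁ (s≤s z≤n)
  nonzero zero (suc b) n = inj₂ (s≤s z≤n)
  nonzero zero zero n = ⊥-elim (n refl)

  decide : ∀ φ xs → ⟦ φ ⟧ xs ⊎ ⟦ negate φ ⟧ xs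
  decide (t ≼ u) xs with ⟦ t ⟧ᵗ xs ℕ.≤? ⟦ u ⟧ᵗ xs
  ... | yes p = inj₁ p
  ... | no n = inj₂ (ℕP.≰⇒> n)
  decide (pos t ≐ pos u) xs with ⟦ pos t ⟧ᵛ xs ≟ ⟦ pos u ⟧ᵛ xs
  ... | yes p = inj₁ p
  ... | no n = inj₂ (≢⇒< (λ e → n (cong +_ e)))
  decide (neg′ t ≐ neg′ u) xs with ⟦ neg′ t ⟧ᵛ xs ≟ ⟦ neg′ u ⟧ᵛ xs
  ... | yes p = inj₁ p
  ... | no n = inj₂ (≢⇒< (λ e → n (cong (λ a → - (+ a)) e)))
  decide (pos t ≐ neg′ u) xs with ⟦ pos t ⟧ᵛ xs ≟ ⟦ neg′ u ⟧ᵛ xs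
  ... | yes p = inj₁ p
  ... | no n = inj₂ (nonzero _ _ n)
  decide (neg′ t ≐ pos u) xs with ⟦ neg′ t ⟧ᵛ xs ≟ ⟦ pos u ⟧ᵛ xs
  ... | yes p = inj₁ p
  ... | no n = inj₂ ([ inj₂ , inj₁ ]′ (nonzero _ _ (n ∘ sym)))
  decide (φ ∧ ψ) xs with decide φ xs | decide ψ xs
  ... | inj₁ p | inj₁ q = inj₁ (p , q)
  ... | inj₂ p | _ = inj₂ (inj₁ p)
  ... | inj₁ _ | inj₂ q = inj₂ (inj₂ q)
  decide (φ ∨ ψ) xs with decide φ xs | decide ψ xs
  ... | inj₁ p | _ = inj₁ (inj₁ p)
  ... | inj₂ _ | inj₁ q = inj₁ (inj₂ q)
  ... | inj₂ p | inj₂ q = inj₂ (p , q)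
  decide tt′ xs = inj₁ tt
  decide ff′ xs = inj₂ tt

  nonneg-holds : ∀ xs m → All (Holds xs) (nonneg m)
  nonneg-holds xs zero = []
  nonneg-holds xs (suc m) = z≤n ∷ nonneg-holds xs m

-- The implicit argument evaluates to `⊤` when the check succeeds, so for closed formulas it is
-- filled in by computation.
prove : ∀ xs φ ψ → {T (valid (length xs) φ ψ)} → ⟦ φ ⟧ xs → ⟦ ψ ⟧ xs
prove xs φ ψ {t} p with decide ψ xs
... | inj₁ q = q
... | inj₂ n = ⊥-elim (refute-sound (φ ∧ negate ψ) (λ _ → false) (p , n) (λ _ _ ())
                 (nonneg (length xs)) (nonneg-holds xs (length xs)) t)

-- Symbolic simplices, families and coverings between families

inst : List Vertex → List ℕ → Simplex
inst t xs = map (λ v → ⟦ v ⟧ᵛ xs) t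

mem : Vertex → List Vertex → Formula
mem x [] = ff′
mem x (y ∷ τ) = (x ≐ y) ∨ mem x τ

sub : List Vertex → List Vertex → Formula
sub [] τ = tt′
sub (x ∷ σ) τ = mem x τ ∧ sub σ τ

apart : Vertex → List Vertex → Formula
apart x [] = tt′
apart x (y ∷ τ) = negate (x ≐ y) ∧ apart x τ

distinct : List Vertex → Formula
distinct [] = tt′
distinct (x ∷ τ) = apart x τ ∧ distinct τ

mem⁺ : ∀ {xs} x τ → ⟦ x ⟧ᵛ xs ∈ inst τ xs → ⟦ mem x τ ⟧ xs
mem⁺ x (y ∷ τ) (here e) = inj₁ e
mem⁺ x (y ∷ τ) (there p) = inj₂ (mem⁺ x τ p)

mem⁻ : ∀ {xs} x τ → ⟦ mem x τ ⟧ xs → ⟦ x ⟧ᵛ xs ∈ inst τ xs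
mem⁻ x (y ∷ τ) (inj₁ e) = here e
mem⁻ x (y ∷ τ) (inj₂ p) = there (mem⁻ x τ p)

sub⁺ : ∀ {xs} σ τ → inst σ xs ⊆ inst τ xs → ⟦ sub σ τ ⟧ xs
sub⁺ [] τ s = tt
sub⁺ (x ∷ σ) τ s = mem⁺ x τ (s (here refl)) , sub⁺ σ τ (λ p → s (there p))

sub⁻ : ∀ {xs} σ τ → ⟦ sub σ τ ⟧ xs → inst σ xs ⊆ inst τ xs
sub⁻ (x ∷ σ) τ (a , b) (here refl) = mem⁻ x τ a
sub⁻ (x ∷ σ) τ (a , b) (there p) = sub⁻ σ τ b p

negate-sound : ∀ {xs} φ → ⟦ negate φ ⟧ xs → ¬ ⟦ φ ⟧ xs
negate-sound (t ≼ u) n p = ℕP.<⇒≱ n p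
negate-sound (pos t ≐ pos u) (inj₁ n) p = ℕP.<⇒≢ n (ℤP.+-injective p)
negate-sound (pos t ≐ pos u) (inj₂ n) p = ℕP.<⇒≢ n (sym (ℤP.+-injective p))
negate-sound (neg′ t ≐ neg′ u) (inj₁ n) p = ℕP.<⇒≢ n (ℤP.+-injective (ℤP.neg-injective p))
negate-sound (neg′ t ≐ neg′ u) (inj₂ n) p = ℕP.<⇒≢ n (sym (ℤP.+-injective (ℤP.neg-injective p)))
negate-sound {xs} (pos t ≐ neg′ u) n p with ⟦ t ⟧ᵗ xs | ⟦ u ⟧ᵗ xs
negate-sound (pos t ≐ neg′ u) (inj₁ ()) refl | .0 | zero
negate-sound (pos t ≐ neg′ u) (inj₂ ()) refl | .0 | zero
negate-sound {xs} (neg′ t ≐ pos u) n p with ⟦ t ⟧ᵗ xs | ⟦ u ⟧ᵗ xs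
negate-sound (neg′ t ≐ pos u) (inj₁ ()) refl | zero | .0
negate-sound (neg′ t ≐ pos u) (inj₂ ()) refl | zero | .0
negate-sound (φ ∧ ψ) (inj₁ n) (p , q) = negate-sound φ n p
negate-sound (φ ∧ ψ) (inj₂ n) (p , q) = negate-sound ψ n q
negate-sound (φ ∨ ψ) (n , m) (inj₁ p) = negate-sound φ n p
negate-sound (φ ∨ ψ) (n , m) (inj₂ q) = negate-sound ψ m q
negate-sound ff′ n ()

distinct⁻ : ∀ {xs} τ → ⟦ distinct τ ⟧ xs → Unique (inst τ xs)
distinct⁻ [] d = []
distinct⁻ (x ∷ τ) (a , d) = unique-∷ (go τ a) (distinct⁻ τ d)
  where
  go : ∀ {xs} τ → ⟦ apart x τ ⟧ xs → ⟦ x ⟧ᵛ xs ∉ inst τ xs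
  go (y ∷ τ) (n , a) (here e) = negate-sound (x ≐ y) n e
  go (y ∷ τ) (n , a) (there p) = go τ a p

Subst : Set
Subst = ℕ → Term

_⟪_⟫ᵗ : Term → Subst → Term
(i , c) ⟪ s ⟫ᵗ = proj₁ (s i) , c + proj₂ (s i)

_⟪_⟫ᵛ : Vertex → Subst → Vertex
pos t ⟪ s ⟫ᵛ = pos (t ⟪ s ⟫ᵗ)
neg′ t ⟪ s ⟫ᵛ = neg′ (t ⟪ s ⟫ᵗ)

_⟪_⟫ : Formula → Subst → Formula
(t ≼ u) ⟪ s ⟫ = t ⟪ s ⟫ᵗ ≼ u ⟪ s ⟫ᵗ
(v ≐ w) ⟪ s ⟫ = v ⟪ s ⟫ᵛ ≐ w ⟪ s ⟫ᵛ
(φ ∧ ψ) ⟪ s ⟫ = φ ⟪ s ⟫ ∧ ψ ⟪ s ⟫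
(φ ∨ ψ) ⟪ s ⟫ = φ ⟪ s ⟫ ∨ ψ ⟪ s ⟫
tt′ ⟪ s ⟫ = tt′
ff′ ⟪ s ⟫ = ff′

_⟪_⟫ˢ : List Vertex → Subst → List Vertex
t ⟪ s ⟫ˢ = map (_⟪ s ⟫ᵛ) t

module _ {s : Subst} {xs ys} (agree : ∀ i → ⟦ s i ⟧ᵗ xs ≡ var ys i) where

  term-subst : ∀ t → ⟦ t ⟪ s ⟫ᵗ ⟧ᵗ xs ≡ ⟦ t ⟧ᵗ ys
  term-subst (i , c) = trans (ℕP.+-assoc c (proj₂ (s i)) (var xs (proj₁ (s i)))) (cong (λ k → c + k) (agree i))

  vertex-subst : ∀ v → ⟦ v ⟪ s ⟫ᵛ ⟧ᵛ xs ≡ ⟦ v ⟧ᵛ ys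
  vertex-subst (pos t) = cong +_ (term-subst t)
  vertex-subst (neg′ t) = cong (λ k → - (+ k)) (term-subst t)

  inst-subst : ∀ t → inst (t ⟪ s ⟫ˢ) xs ≡ inst t ys
  inst-subst [] = refl
  inst-subst (v ∷ t) = cong₂ _∷_ (vertex-subst v) (inst-subst t)

  formula-subst⁻ : ∀ φ → ⟦ φ ⟪ s ⟫ ⟧ xs → ⟦ φ ⟧ ys
  formula-subst⁻ (t ≼ u) p = subst₂ _≤_ (term-subst t) (term-subst u) p
  formula-subst⁻ (v ≐ w) p = trans (sym (vertex-subst v)) (trans p (vertex-subst w))
  formula-subst⁻ (φ ∧ ψ) (p , q) = formula-subst⁻ φ p , formula-subst⁻ ψ q
  formula-subst⁻ (φ ∨ ψ) (inj₁ p) = inj₁ (formula-subst⁻ φ p)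
  formula-subst⁻ (φ ∨ ψ) (inj₂ q) = inj₂ (formula-subst⁻ ψ q)
  formula-subst⁻ tt′ p = tt

  formula-subst⁺ : ∀ φ → ⟦ φ ⟧ ys → ⟦ φ ⟪ s ⟫ ⟧ xs
  formula-subst⁺ (t ≼ u) p = subst₂ _≤_ (sym (term-subst t)) (sym (term-subst u)) p
  formula-subst⁺ (v ≐ w) p = trans (vertex-subst v) (trans p (sym (vertex-subst w)))
  formula-subst⁺ (φ ∧ ψ) (p , q) = formula-subst⁺ φ p , formula-subst⁺ ψ q
  formula-subst⁺ (φ ∨ ψ) (inj₁ p) = inj₁ (formula-subst⁺ φ p)
  formula-subst⁺ (φ ∨ ψ) (inj₂ q) = inj₂ (formula-subst⁺ ψ q)
  formula-subst⁺ tt′ p = tt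

-- A family of simplices: variable 1 is the global parameter N, variables 2
-- and 3 are the parameters of the family.
Family : Set
Family = Formula × List Vertex

Is : ℕ → Family → Simplex → Set
Is N (φ , t) τ = ∃₂ λ p q → ⟦ φ ⟧ (N ∷ p ∷ q ∷ []) × τ ≡ inst t (N ∷ p ∷ q ∷ [])

In : ℕ → List Family → Simplex → Set
In N Fs τ = Any (λ F → Is N F τ) Fs

x₁ x₂ x₃ x₄ x₅ x₆ : Term
x₁ = 1 , 0
x₂ = 2 , 0
x₃ = 3 , 0
x₄ = 4 , 0
x₅ = 5 , 0
x₆ = 6 , 0

infixl 9 _↑_
_↑_ : Term → ℕ → Term
(i , c) ↑ k = i , k + c

# : ℕ → Term
# k = 0 , k

at : Term → Term → Term → Subst
at M P Q 1 = M
at M P Q 2 = P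
at M P Q 3 = Q
at M P Q _ = # 0

at-agree : ∀ M P Q xs i → ⟦ at M P Q i ⟧ᵗ xs ≡ var (⟦ M ⟧ᵗ xs ∷ ⟦ P ⟧ᵗ xs ∷ ⟦ Q ⟧ᵗ xs ∷ []) i
at-agree M P Q xs 0 = refl
at-agree M P Q xs 1 = refl
at-agree M P Q xs 2 = refl
at-agree M P Q xs 3 = refl
at-agree M P Q xs (suc (suc (suc (suc i)))) = refl

instance-of : ∀ {xs} F M P Q → ⟦ proj₁ F ⟪ at M P Q ⟫ ⟧ xs → Is (⟦ M ⟧ᵗ xs) F (inst (proj₂ F ⟪ at M P Q ⟫ˢ) xs)
instance-of {xs} (φ , t) M P Q h = _ , _ , formula-subst⁻ (at-agree M P Q xs) φ h , inst-subst (at-agree M P Q xs) t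

module _ {N F τ} (i : Is N F τ) where
  private
    p q : ℕ
    p = proj₁ i
    q = proj₁ (proj₂ i)
  module _ (zs : List ℕ) where
    private
      xs : List ℕ
      xs = N ∷ p ∷ q ∷ zs
      agree : ∀ i → ⟦ at x₁ x₂ x₃ i ⟧ᵗ xs ≡ var (N ∷ p ∷ q ∷ []) i
      agree = at-agree x₁ x₂ x₃ xs
    is-bound : ⟦ proj₁ F ⟪ at x₁ x₂ x₃ ⟫ ⟧ xs
    is-bound = formula-subst⁺ agree (proj₁ F) (proj₁ (proj₂ (proj₂ i)))
    is-inst : τ ≡ inst (proj₂ F ⟪ at x₁ x₂ x₃ ⟫ˢ) xs
    is-inst = trans (proj₂ (proj₂ (proj₂ i))) (sym (inst-subst agree (proj₂ F)))

pick : ℕ → List Family → Family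
pick k [] = ff′ , []
pick zero (F ∷ Fs) = F
pick (suc k) (F ∷ Fs) = pick k Fs

pick-in : ∀ {N τ} k Fs → Is N (pick k Fs) τ → In N Fs τ
pick-in k [] (_ , _ , () , _)
pick-in zero (F ∷ Fs) i = here i
pick-in (suc k) (F ∷ Fs) i = there (pick-in k Fs i)

in-find : ∀ {N Fs τ} → In N Fs τ → ∃ λ F → F ∈ Fs × Is N F τ
in-find = find

check-all : ∀ {A : Set} (p : A → Bool) {Fs F} → T (all p Fs) → F ∈ Fs → T (p F)
check-all p {Fs} t F∈ = All.lookup (AllP.all⁺ p Fs t) F∈

-- What containing the simplex σ (over N and the variables 4, 5, …) entails
-- for the members of a list of families.
consequence? : List Family → ℕ → Formula → List Vertex → (List Vertex → Formula) → Bool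
consequence? Fs m h σ g = all (λ F → let s = at x₁ x₂ x₃ ; t = proj₂ F ⟪ s ⟫ˢ in
  valid (3 + m) (proj₁ F ⟪ s ⟫ ∧ h ∧ sub σ t) (g t)) Fs

consequence : ∀ Fs N zs h σ g → {T (consequence? Fs (length zs) h σ g)} →
  (∀ p q → ⟦ h ⟧ (N ∷ p ∷ q ∷ zs)) → ∀ {κ} → In N Fs κ →
  (∀ p q → inst σ (N ∷ p ∷ q ∷ zs) ⊆ κ) →
  ∃₂ λ p q → ∃ λ t → κ ≡ inst t (N ∷ p ∷ q ∷ zs) × ⟦ g t ⟧ (N ∷ p ∷ q ∷ zs)
consequence Fs N zs h σ g {c} hyp i s with in-find i
... | F , F∈ , j@(p , q , _) = p , q , _ , is-inst {F = F} j zs ,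
  prove (N ∷ p ∷ q ∷ zs) (proj₁ F ⟪ at x₁ x₂ x₃ ⟫ ∧ h ∧ sub σ (proj₂ F ⟪ at x₁ x₂ x₃ ⟫ˢ)) (g _)
    {check-all _ {Fs} c F∈}
    (is-bound {F = F} j zs , hyp p q , sub⁺ σ _ (subst (_ ⊆_) (is-inst {F = F} j zs) (s p q)))

-- The two members have independent parameters, so those of the second move to `x₄` and `x₅`.
apart? : List Family → List Family → Formula → Bool
apart? Fs Gs h = all (λ F → all (λ G → valid 5 (proj₁ F ⟪ at x₁ x₂ x₃ ⟫ ∧ proj₁ G ⟪ at x₁ x₄ x₅ ⟫ ∧ h
  ∧ sub (proj₂ F ⟪ at x₁ x₂ x₃ ⟫ˢ) (proj₂ G ⟪ at x₁ x₄ x₅ ⟫ˢ)) ff′) Gs) Fs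

families-apart : ∀ Fs Gs h → {T (apart? Fs Gs h)} → ∀ {N} → (∀ xs → ⟦ h ⟧ (N ∷ xs)) →
  ∀ {σ τ} → In N Fs σ → In N Gs τ → ¬ σ ⊆ τ
families-apart Fs Gs h {c} {N} hyp i j s with in-find i | in-find j
... | F , F∈ , i'@(p , q , _) | G , G∈ , (p' , q' , b , refl) =
  prove (N ∷ p ∷ q ∷ p' ∷ q' ∷ []) _ ff′ {check-all _ {Gs} (check-all _ {Fs} c F∈) G∈}
    (is-bound {F = F} i' (p' ∷ q' ∷ []) , formula-subst⁺ agree (proj₁ G) b , hyp _ ,
     sub⁺ (proj₂ F ⟪ at x₁ x₂ x₃ ⟫ˢ) (proj₂ G ⟪ at x₁ x₄ x₅ ⟫ˢ)
       (subst₂ _⊆_ (is-inst {F = F} i' (p' ∷ q' ∷ [])) (sym (inst-subst agree (proj₂ G))) s))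
  where
  agree = at-agree x₁ x₄ x₅ (N ∷ p ∷ q ∷ p' ∷ q' ∷ [])

-- A hint for an existential claim, as the procedure finds no witnesses: under `condition`, the
-- simplex is to be contained in the member of family number `target` with parameters P and Q.
record Case : Set where
  constructor case_then_at_,_
  field
    condition : Formula
    target : ℕ
    P Q : Term

disjunction : List Formula → Formula
disjunction [] = ff′
disjunction (φ ∷ φs) = φ ∨ disjunction φs

-- M is the offset between the two global parameters: the source lives over N and the target over M
-- + N, with M = 1 in the passage from Δ³_n to the next complex.
outcome : ℕ → List Vertex → List Family → Case → Formula
outcome M σ Gs (case _ then k at P , Q) = let G = pick k Gs ; s = at (1 , M) P Q in
  proj₁ G ⟪ s ⟫ ∧ sub σ (proj₂ G ⟪ s ⟫ˢ)

case? : ℕ → ℕ → Formula → List Vertex → List Family → Case → Bool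
case? m M φ σ Gs c = valid m (φ ∧ Case.condition c) (outcome M σ Gs c)

covers? : ℕ → ℕ → Formula → List Vertex → List Family → List Case → Bool
covers? m M φ σ Gs cs = valid m φ (disjunction (map Case.condition cs)) && all (case? m M φ σ Gs) cs

case-covers : ∀ N zs M φ σ Gs c → T (case? (suc (length zs)) M φ σ Gs c) →
  ⟦ φ ⟧ (N ∷ zs) → ⟦ Case.condition c ⟧ (N ∷ zs) → ∃ λ τ → In (M + N) Gs τ × inst σ (N ∷ zs) ⊆ τ
case-covers N zs M φ σ Gs c@(case _ then k at P , Q) t h d
  with prove (N ∷ zs) (φ ∧ Case.condition c) (outcome M σ Gs c) {t} (h , d)
... | b , s = _ , pick-in k Gs (instance-of (pick k Gs) (1 , M) P Q b) ,
              sub⁻ σ (proj₂ (pick k Gs) ⟪ at (1 , M) P Q ⟫ˢ) s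

covers : ∀ N zs M φ σ Gs cs → T (covers? (suc (length zs)) M φ σ Gs cs) → ⟦ φ ⟧ (N ∷ zs) →
  ∃ λ τ → In (M + N) Gs τ × inst σ (N ∷ zs) ⊆ τ
covers N zs M φ σ Gs cs t h with Equivalence.to (T-∧ {valid (suc (length zs)) φ (disjunction (map Case.condition cs))}) t
... | v , a = go cs a (prove (N ∷ zs) φ (disjunction (map Case.condition cs)) {v} h)
  where
  go : ∀ cs → T (all (case? (suc (length zs)) M φ σ Gs) cs) → ⟦ disjunction (map Case.condition cs) ⟧ (N ∷ zs) →
    ∃ λ τ → In (M + N) Gs τ × inst σ (N ∷ zs) ⊆ τ
  go (c ∷ cs) a (inj₂ d) = go cs (proj₂ (Equivalence.to (T-∧ {case? (suc (length zs)) M φ σ Gs c}) a)) d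
  go (c ∷ cs) a (inj₁ d) =
    case-covers N zs M φ σ Gs c (proj₁ (Equivalence.to (T-∧ {case? (suc (length zs)) M φ σ Gs c}) a)) h d

predecessor : Term → Term → Formula
predecessor t u = (t ≼ # 0) ∨ (t ≼ u ↑ 1 ∧ u ↑ 1 ≼ t)

bound : Family → Formula
bound F = proj₁ F ⟪ at x₁ x₂ x₃ ⟫ ∧ predecessor x₂ x₄ ∧ predecessor x₁ x₅

template : Family → List Vertex
template F = proj₂ F ⟪ at x₁ x₂ x₃ ⟫ˢ

-- Terms cannot subtract, so the predecessors of the parameter x₂ and of N are
-- supplied as extra variables x₄ and x₅.
parameters : ∀ {N F τ} → Is N F τ → List ℕ
parameters {N} (p , q , _) = p ∷ q ∷ ℕ.pred p ∷ ℕ.pred N ∷ []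

bound-holds : ∀ {N F τ} (i : Is N F τ) → ⟦ bound F ⟧ (N ∷ parameters i) × τ ≡ inst (template F) (N ∷ parameters i)
bound-holds {N} {F} i@(p , q , _) =
  (is-bound {F = F} i (ℕ.pred p ∷ ℕ.pred N ∷ []) , pr p , pr N) , is-inst {F = F} i (ℕ.pred p ∷ ℕ.pred N ∷ [])
  where
  pr : ∀ n → n ≤ 0 ⊎ (n ≤ 1 + ℕ.pred n × 1 + ℕ.pred n ≤ n)
  pr zero = inj₁ z≤n
  pr (suc n) = inj₂ (ℕP.≤-refl , ℕP.≤-refl)

all-cover? : ℕ → Formula → List Family → List Family → List (List Case) → Bool
all-cover? M h [] Gs css = true
all-cover? M h (F ∷ Fs) Gs [] = false
all-cover? M h (F ∷ Fs) Gs (cs ∷ css) = covers? 5 M (bound F ∧ h) (template F) Gs cs && all-cover? M h Fs Gs css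

all-cover : ∀ M h Fs Gs css → {T (all-cover? M h Fs Gs css)} → ∀ {N} → (∀ xs → ⟦ h ⟧ (N ∷ xs)) → ∀ {σ} → In N Fs σ →
  ∃ λ τ → In (M + N) Gs τ × σ ⊆ τ
all-cover M h (F ∷ Fs) Gs (cs ∷ css) {t} {N} hyp (here i)
  with covers N (parameters i) M (bound F ∧ h) (template F) Gs cs (proj₁ (Equivalence.to T-∧ t)) (proj₁ (bound-holds i) , hyp _)
... | τ , j , s = τ , j , subst (_⊆ τ) (sym (proj₂ (bound-holds i))) s
all-cover M h (F ∷ Fs) Gs (cs ∷ css) {t} hyp (there i) =
  all-cover M h Fs Gs css {proj₂ (Equivalence.to (T-∧ {covers? 5 M (bound F ∧ h) (template F) Gs cs}) t)} hyp i

-- For the way back from N + 1 to N: `all-cover` raises the parameter of its targets only, so here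
-- the sources are rewritten over N.
shifted : ℕ → Family → Family
shifted M F = proj₁ F ⟪ at (1 , M) x₂ x₃ ⟫ , proj₂ F ⟪ at (1 , M) x₂ x₃ ⟫ˢ

in-shifted : ∀ M {N} Fs {τ} → In (M + N) Fs τ → In N (map (shifted M) Fs) τ
in-shifted M (F ∷ Fs) (here (p , q , b , refl)) = here (p , q ,
  formula-subst⁺ (at-agree (1 , M) x₂ x₃ _) (proj₁ F) b , sym (inst-subst (at-agree (1 , M) x₂ x₃ _) (proj₂ F)))
in-shifted M (F ∷ Fs) (there i) = there (in-shifted M Fs i)

simplices? : Formula → List Family → Bool
simplices? h = all (λ F → valid 3 (proj₁ F ∧ h) (distinct (proj₂ F)) && (length (proj₂ F) ≡ᵇ 4))

simplices : ∀ h Fs → {T (simplices? h Fs)} → ∀ {N} → (∀ xs → ⟦ h ⟧ (N ∷ xs)) → ∀ {τ} → In N Fs τ → IsSimplex 4 τ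
simplices h Fs {c} {N} hyp i with in-find i
... | F , F∈ , (p , q , b , refl) with Equivalence.to (T-∧ {valid 3 (proj₁ F ∧ h) (distinct (proj₂ F))}) (check-all _ {Fs} c F∈)
...   | v , l = distinct⁻ (proj₂ F) (prove (N ∷ p ∷ q ∷ []) (proj₁ F ∧ h) (distinct (proj₂ F)) {v} (b , hyp _)) ,
                trans (length-map _ (proj₂ F)) (ℕP.≡ᵇ⇒≡ (length (proj₂ F)) 4 l)

dropAt : ∀ {A : Set} → ℕ → List A → List A
dropAt r [] = []
dropAt zero (x ∷ t) = t
dropAt (suc r) (x ∷ t) = x ∷ dropAt r t

module _ (f : Vertex → ℤ) where

  remove-index : ∀ t {x} → x ∈ map f t → ∃ λ r → T (suc r ≤ᵇ length t) × del x (map f t) ⊆ map f (dropAt r t)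
  remove-index (v ∷ t) (here refl) = 0 , tt , λ {y} p →
    case ∈-remove⁻ (f v) (map f (v ∷ t)) p of λ { (here e , n) → ⊥-elim (n e) ; (there q , _) → q }
  remove-index (v ∷ t) {x} (there p) with remove-index t p
  ... | r , l , s = suc r , l , λ {y} q → case ∈-remove⁻ x (map f (v ∷ t)) q of λ
    { (here e , n) → here e ; (there q' , n) → there (s (∈-remove⁺ x q' n)) }

  index-remove : ∀ t r → T (suc r ≤ᵇ length t) → Unique (map f t) →
    ∃ λ x → x ∈ map f t × del x (map f t) ≈ map f (dropAt r t)
  index-remove (v ∷ t) zero _ u = f v , here refl , remove-here (f v) (unique-head u)
  index-remove (v ∷ t) (suc r) l (a ∷ u) with index-remove t r l u
  ... | x , x∈ , e = x , there x∈ ,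
    ≈-trans (remove-there x (f v) (λ { refl → unique-head (a ∷ u) x∈ })) (∷-≈ e)

negateᵛ : Vertex → Vertex
negateᵛ (pos t) = neg′ t
negateᵛ (neg′ t) = pos t

mirror : List Family → List Family
mirror = map (λ F → proj₁ F , map negateᵛ (proj₂ F))

inst-neg : ∀ t xs → inst (map negateᵛ t) xs ≡ map -_ (inst t xs)
inst-neg [] xs = refl
inst-neg (pos t ∷ ts) xs = cong (_ ∷_) (inst-neg ts xs)
inst-neg (neg′ t ∷ ts) xs = cong₂ _∷_ (sym (ℤP.neg-involutive _)) (inst-neg ts xs)

in-mirror : ∀ {N Fs τ} → In N Fs τ → In N (mirror Fs) (map -_ τ)
in-mirror (here {x = F} (p , q , b , refl)) = here (p , q , b , sym (inst-neg (proj₂ F) _))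
in-mirror (there i) = there (in-mirror i)

in-mirror⁻ : ∀ {N} Fs {τ} → In N (mirror Fs) τ → ∃ λ σ → In N Fs σ × τ ≡ map -_ σ
in-mirror⁻ (F ∷ Fs) (here (p , q , b , refl)) = _ , here (p , q , b , refl) , inst-neg (proj₂ F) _
in-mirror⁻ (F ∷ Fs) (there i) with in-mirror⁻ Fs i
... | σ , j , e = σ , there j , e

-- Runs of simplices as gluing orders

∈-range⁻ : ∀ a b {j} → j ∈ range a b → a ≤ j × j ≤ b
∈-range⁻ a b p with ∈-map⁻ (λ i → a + i) p
... | i , q , refl = ℕP.m≤m+n a i , ℕP.≤-pred (ℕP.≤-trans (s≤s (ℕP.≤-reflexive (ℕP.+-comm a i)))
        (subst (suc (i + a) ≤_) (ℕP.m∸n+n≡m (a≤ (∈-upTo⁻ q))) (ℕP.+-monoˡ-≤ a (∈-upTo⁻ q))))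
  where
  a≤ : ∀ {i} → i < suc b ∸ a → a ≤ suc b
  a≤ {i} l with a ℕ.≤? suc b
  ... | yes h = h
  ... | no n = ⊥-elim (ℕP.n≮0 (subst (i <_) (ℕP.m≤n⇒m∸n≡0 (ℕP.<⇒≤ (ℕP.≰⇒> n))) l))

∈-range⁺ : ∀ {a b j} → a ≤ j → j ≤ b → j ∈ range a b
∈-range⁺ {a} {b} {j} p q = subst (_∈ range a b) (ℕP.m+[n∸m]≡n p)
  (∈-map⁺ (λ i → a + i) (∈-upTo⁺ (subst (suc (j ∸ a) ≤_) (sym (ℕP.+-∸-assoc 1 (ℕP.≤-trans p q)))
    (s≤s (ℕP.∸-monoˡ-≤ a q)))))

-- Puts f p, ..., f (p + d - 1) in front of B. Since `stack` adds at the front, this reads as a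
-- gluing order in which the largest index comes first.
down : (ℕ → Simplex) → ℕ → ℕ → Cx → Cx
down f p zero B = B
down f p (suc d) B = f p ∷ down f (suc p) d B

∈-down⁻ : ∀ f p d {B κ} → κ ∈ down f p d B → κ ∈ B ⊎ ∃ λ i → p ≤ i × i < p + d × κ ≡ f i
∈-down⁻ f p zero k = inj₁ k
∈-down⁻ f p (suc d) (here e) = inj₂ (p , ℕP.≤-refl , ℕP.m<m+n p (s≤s z≤n) , e)
∈-down⁻ f p (suc d) (there k) with ∈-down⁻ f (suc p) d k
... | inj₁ b = inj₁ b
... | inj₂ (i , a , b , e) = inj₂ (i , ℕP.<⇒≤ a , subst (i <_) (sym (ℕP.+-suc p d)) b , e)

∈-downˡ : ∀ f p d {B κ} → κ ∈ B → κ ∈ down f p d B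
∈-downˡ f p zero k = k
∈-downˡ f p (suc d) k = there (∈-downˡ f (suc p) d k)

∈-downʳ : ∀ f p d {B} i → p ≤ i → i < p + d → f i ∈ down f p d B
∈-downʳ f p zero i a b = ⊥-elim (ℕP.<⇒≱ b (subst (_≤ i) (sym (ℕP.+-identityʳ p)) a))
∈-downʳ f p (suc d) i a b with p ℕ.≟ i
... | yes refl = here refl
... | no n = there (∈-downʳ f (suc p) d i (ℕP.≤∧≢⇒< a n) (subst (i <_) (ℕP.+-suc p d) b))

-- The base A i must already be present when x i is added, that is, lie in B or in a member of
-- larger index.
stacked-down : ∀ (x : ℕ → ℤ) (A : ℕ → Simplex) {B} → Stacked B → ∀ p d →
  (∀ i → p ≤ i → i < p + d → Fresh (x i) B) →
  (∀ i j → p ≤ i → i < j → j < p + d → x i ∉ x j ∷ A j) →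
  (∀ i → p ≤ i → i < p + d → IsSimplex 3 (A i)) →
  (∀ i → p ≤ i → i < p + d → (∃ λ τ → τ ∈ B × A i ⊆ τ) ⊎ (∃ λ j → i < j × j < p + d × A i ⊆ x j ∷ A j)) →
  Stacked (down (λ i → x i ∷ A i) p d B)
stacked-down x A st p zero _ _ _ _ = st
stacked-down x A {B} st p (suc d) fr fr' sA tri = build (tri p ℕP.≤-refl (ℕP.m<m+n p (s≤s z≤n)))
  where
  f : ℕ → Simplex
  f i = x i ∷ A i
  up : ∀ {i} → i < suc p + d → i < p + suc d
  up {i} = subst (i <_) (sym (ℕP.+-suc p d))
  lo : ∀ {i} → suc p ≤ i → p ≤ i
  lo = ℕP.<⇒≤
  narrow : ∀ {i} → (∃ λ τ → τ ∈ B × A i ⊆ τ) ⊎ (∃ λ j → i < j × j < p + suc d × A i ⊆ f j) →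
    (∃ λ τ → τ ∈ B × A i ⊆ τ) ⊎ (∃ λ j → i < j × j < suc p + d × A i ⊆ f j)
  narrow (inj₁ t) = inj₁ t
  narrow (inj₂ (j , l , m , s)) = inj₂ (j , l , subst (j <_) (ℕP.+-suc p d) m , s)
  rest : Stacked (down f (suc p) d B)
  rest = stacked-down x A st (suc p) d (λ i a b → fr i (lo a) (up b)) (λ i j a b c → fr' i j (lo a) b (up c))
    (λ i a b → sA i (lo a) (up b)) (λ i a b → narrow (tri i (lo a) (up b)))
  p< : p < p + suc d
  p< = ℕP.m<m+n p (s≤s z≤n)
  fresh : Fresh (x p) (down f (suc p) d B)
  fresh k q with ∈-down⁻ f (suc p) d k
  ... | inj₁ b = fr p ℕP.≤-refl p< b q
  ... | inj₂ (i , a , b , refl) = fr' p i ℕP.≤-refl a (up b) q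
  build : (∃ λ τ → τ ∈ B × A p ⊆ τ) ⊎ (∃ λ j → p < j × j < p + suc d × A p ⊆ f j) → Stacked (f p ∷ down f (suc p) d B)
  build (inj₁ (τ , t , s)) = stack rest fresh (sA p ℕP.≤-refl p<) (∈-downˡ f (suc p) d t) s
  build (inj₂ (j , a , b , s)) = stack rest fresh (sA p ℕP.≤-refl p<)
    (∈-downʳ f (suc p) d j a (subst (j <_) (ℕP.+-suc p d) b)) s

fresh-in : ∀ Fs N zs h v → {T (consequence? Fs (length zs) h (v ∷ []) (λ _ → ff′))} → ∀ {B} →
  (∀ p q → ⟦ h ⟧ (N ∷ p ∷ q ∷ zs)) → (∀ {κ} → κ ∈ B → In N Fs κ) →
  ∀ {x} → (∀ p q → ⟦ v ⟧ᵛ (N ∷ p ∷ q ∷ zs) ≡ x) → Fresh x B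
fresh-in Fs N zs h v {c} hyp i e k x∈ with consequence Fs N zs h (v ∷ []) (λ _ → ff′) {c} hyp (i k)
  (λ p q → λ { (here refl) → subst (_∈ _) (sym (e p q)) x∈ })
... | ()

simplex-inst : ∀ zs h t → {T (valid (length zs) h (distinct t))} → ⟦ h ⟧ zs → IsSimplex (length t) (inst t zs)
simplex-inst zs h t {c} p = distinct⁻ t (prove zs h (distinct t) {c} p) , length-map _ t

⊆-inst : ∀ zs h σ τ → {T (valid (length zs) h (sub σ τ))} → ⟦ h ⟧ zs → inst σ zs ⊆ inst τ zs
⊆-inst zs h σ τ {c} p = sub⁻ σ τ (prove zs h (sub σ τ) {c} p)

-- The ball exchanged in the recursion of Δ³_n

-- B₃ₙ,₁ with n = N + 2.
ballF : List Family
ballF =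
  ((# 1 ≼ x₂ ∧ x₂ ↑ 1 ≼ x₁) , pos (x₁ ↑ 2) ∷ pos (x₁ ↑ 1) ∷ pos x₂ ∷ pos (x₂ ↑ 1) ∷ []) ∷
  ((# 1 ≼ x₂ ∧ x₂ ↑ 1 ≼ x₁) , pos (x₁ ↑ 2) ∷ pos (x₁ ↑ 1) ∷ neg′ x₂ ∷ neg′ (x₂ ↑ 1) ∷ []) ∷
  (tt′ , pos (x₁ ↑ 2) ∷ pos (x₁ ↑ 1) ∷ neg′ x₁ ∷ pos (# 1) ∷ []) ∷
  (tt′ , pos (x₁ ↑ 2) ∷ neg′ (x₁ ↑ 1) ∷ pos (# 1) ∷ neg′ x₁ ∷ []) ∷
  (tt′ , neg′ (x₁ ↑ 2) ∷ neg′ (x₁ ↑ 1) ∷ pos (# 1) ∷ neg′ x₁ ∷ []) ∷ []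

ball-in : ∀ {N κ} → 2 ≤ N → κ ∈ B3₁ (2 + N) → In N ballF κ
ball-in {N} 2≤N k with ∈-++⁻ (cone (+ (2 + N)) (B2₁ (1 + N))) k
... | inj₂ (here refl) = there (there (there (there (here (0 , 0 , tt , refl)))))
... | inj₁ l with ∈-cone⁻ l
...   | _ , m , refl with ∈-++⁻ (cone (+ (1 + N)) (B1₁ N)) m
...     | inj₂ (here refl) = there (there (there (here (0 , 0 , tt , refl))))
...     | inj₁ c with ∈-cone⁻ c
...       | _ , e , refl with ∈-minus⁻ (Δ1 N) (B1₀ N) e
...         | e , n with ∈-++⁻ (map (λ j → (+ j) ∷ (+ suc j) ∷ []) (range 1 (N ∸ 1))) e
...           | inj₁ f with ∈-map⁻ (λ j → (+ j) ∷ (+ suc j) ∷ []) f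
...             | j , j∈ , refl = let a , b = ∈-range⁻ 1 (N ∸ 1) j∈ in
                  here (j , 0 , (a , below 2≤N b) , refl)
  where
  below : ∀ {j N} → 2 ≤ N → j ≤ N ∸ 1 → suc j ≤ N
  below (s≤s _) b = s≤s b
-- The edge {N, -1} of the cycle is the facet of `B1₀` and has been deleted.
ball-in {N} 2≤N k | inj₁ l | _ , m , refl | inj₁ c | _ , e , refl | e' , n | inj₂ (here refl) =
  ⊥-elim (n (here λ { (here refl) → there (here refl) ; (there (here refl)) → here refl }))
ball-in {N} 2≤N k | inj₁ l | _ , m , refl | inj₁ c | _ , e , refl | e' , n | inj₂ (there f)
  with ∈-++⁻ (map (λ j → (- (+ j)) ∷ (- (+ suc j)) ∷ []) (range 1 (N ∸ 1))) f
... | inj₂ (here refl) = there (there (here (0 , 0 , tt , refl)))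
... | inj₁ g with ∈-map⁻ (λ j → (- (+ j)) ∷ (- (+ suc j)) ∷ []) g
...   | j , j∈ , refl = let a , b = ∈-range⁻ 1 (N ∸ 1) j∈ in there (here (j , 0 , (a , below 2≤N b) , refl))
  where
  below : ∀ {j N} → 2 ≤ N → j ≤ N ∸ 1 → suc j ≤ N
  below (s≤s _) b = s≤s b

in-ball : ∀ {N κ} → 2 ≤ N → In N ballF κ → κ ∈ B3₁ (2 + N)
in-ball {N} 2≤N = go
  where
  edge : ∀ {ρ} → ρ ∈ Δ1 N → ¬ ρ ⊆ -[1+ 0 ] ∷ + N ∷ [] → + (2 + N) ∷ + (1 + N) ∷ ρ ∈ B3₁ (2 + N)
  edge e n = ∈-++⁺ˡ (∈-cone⁺ (∈-++⁺ˡ (∈-cone⁺ (∈-minus⁺ {L = B1₀ N} e λ { (here s) → n s ; (there ()) }))))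
  up : ∀ {j} → suc j ≤ N → j ≤ N ∸ 1
  up (s≤s b) = b
  go : ∀ {κ} → In N ballF κ → κ ∈ B3₁ (2 + N)
  go (here (j , _ , (a , b) , refl)) = edge (∈-++⁺ˡ (∈-map⁺ _ (∈-range⁺ a (up b)))) λ s →
    case s (here refl) of λ { (there (here refl)) → ℕP.<-irrefl refl b }
  go (there (here (suc j , _ , (a , b) , refl))) =
    edge (∈-++⁺ʳ (map (λ j → (+ j) ∷ (+ suc j) ∷ []) (range 1 (N ∸ 1))) (there (∈-++⁺ˡ (∈-map⁺ _ (∈-range⁺ a (up b)))))) λ s →
    case s (there (here refl)) of λ { (there (here ())) }
  go (there (there (here (_ , _ , _ , refl)))) =
    edge (∈-++⁺ʳ (map (λ j → (+ j) ∷ (+ suc j) ∷ []) (range 1 (N ∸ 1))) (there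
      (∈-++⁺ʳ (map (λ j → (- (+ j)) ∷ (- (+ suc j)) ∷ []) (range 1 (N ∸ 1))) (here refl)))) λ s →
    case s (there (here refl)) of λ { (there (here refl)) → ℕP.<-irrefl refl 2≤N }
  go (there (there (there (here (_ , _ , _ , refl))))) =
    ∈-++⁺ˡ (∈-cone⁺ (∈-++⁺ʳ (cone (+ (1 + N)) (B1₁ N)) (here refl)))
  go (there (there (there (there (here (_ , _ , _ , refl)))))) =
    ∈-++⁺ʳ (cone (+ (2 + N)) (B2₁ (1 + N))) (here refl)

-- A stacking order of B₃ₙ,₁, with n = M + 3.
chainF : List Family
chainF =
  ((# 1 ≼ x₂ ∧ x₂ ≼ x₁) , pos x₂ ∷ pos (x₂ ↑ 1) ∷ pos (x₁ ↑ 3) ∷ pos (x₁ ↑ 2) ∷ []) ∷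
  (tt′ , neg′ (x₁ ↑ 1) ∷ pos (# 1) ∷ pos (x₁ ↑ 3) ∷ pos (x₁ ↑ 2) ∷ []) ∷
  ((# 1 ≼ x₂ ∧ x₂ ≼ x₁) , neg′ x₂ ∷ neg′ (x₂ ↑ 1) ∷ pos (x₁ ↑ 3) ∷ pos (x₁ ↑ 2) ∷ []) ∷
  (tt′ , neg′ (x₁ ↑ 2) ∷ pos (# 1) ∷ neg′ (x₁ ↑ 1) ∷ pos (x₁ ↑ 3) ∷ []) ∷
  (tt′ , neg′ (x₁ ↑ 3) ∷ pos (# 1) ∷ neg′ (x₁ ↑ 1) ∷ neg′ (x₁ ↑ 2) ∷ []) ∷ []

module Chain (M : ℕ) (1≤M : 1 ≤ M) where

  -- Apart from the starting facet f₁ M, the entry listed first, here and in s₂, s₄ and s₅, is the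
  -- vertex that is new when the facet is glued on.
  f₁ f₃ : ℕ → Simplex
  f₁ i = + i ∷ + (1 + i) ∷ + (3 + M) ∷ + (2 + M) ∷ []
  f₃ i = - (+ i) ∷ -[1+ i ] ∷ + (3 + M) ∷ + (2 + M) ∷ []

  s₂ s₄ s₅ : Simplex
  s₂ = -[1+ M ] ∷ + 1 ∷ + (3 + M) ∷ + (2 + M) ∷ []
  s₄ = -[1+ 1 + M ] ∷ + 1 ∷ -[1+ M ] ∷ + (3 + M) ∷ []
  s₅ = -[1+ 2 + M ] ∷ + 1 ∷ -[1+ M ] ∷ -[1+ 1 + M ] ∷ []

  S₀ S₁ S₂ S₃ S₄ S₅ : Cx
  S₀ = f₁ M ∷ []
  S₁ = down f₁ 1 (ℕ.pred M) S₀
  S₂ = s₂ ∷ S₁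
  S₃ = down f₃ 1 M S₂
  S₄ = s₄ ∷ S₃
  S₅ = s₅ ∷ S₄

  last : 1 + ℕ.pred M ≡ M
  last = ℕP.suc-pred M {{ℕ.>-nonZero 1≤M}}

  take : ℕ → List Family
  take k = Data.List.take k chainF

  in₁ : ∀ {κ} → κ ∈ S₁ → In M (take 1) κ
  in₁ k with ∈-down⁻ f₁ 1 (ℕ.pred M) k
  ... | inj₁ (here refl) = here (M , 0 , (1≤M , ℕP.≤-refl) , refl)
  ... | inj₂ (i , a , b , refl) = here (i , 0 , (a , ℕP.<⇒≤ (subst (i <_) last b)) , refl)

  in₂ : ∀ {κ} → κ ∈ S₂ → In M (take 2) κ
  in₂ (here refl) = there (here (0 , 0 , tt , refl))
  in₂ (there k) = AnyP.++⁺ˡ {xs = take 1} (in₁ k)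

  in₃ : ∀ {κ} → κ ∈ S₃ → In M (take 3) κ
  in₃ k with ∈-down⁻ f₃ 1 M k
  ... | inj₁ l = AnyP.++⁺ˡ {xs = take 2} (in₂ l)
  ... | inj₂ (i , a , b , refl) = there (there (here (i , 0 , (a , ℕP.≤-pred b) , refl)))

  in₄ : ∀ {κ} → κ ∈ S₄ → In M (take 4) κ
  in₄ (here refl) = there (there (there (here (0 , 0 , tt , refl))))
  in₄ (there k) = AnyP.++⁺ˡ {xs = take 3} (in₃ k)

  in₅ : ∀ {κ} → κ ∈ S₅ → In M chainF κ
  in₅ (here refl) = there (there (there (there (here (0 , 0 , tt , refl)))))
  in₅ (there k) = AnyP.++⁺ˡ {xs = take 4} (in₄ k)

  f₁∈ : ∀ {i} → 1 ≤ i → i ≤ M → f₁ i ∈ S₁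
  f₁∈ {i} a b with i ℕ.≟ M
  ... | yes refl = ∈-downˡ f₁ 1 (ℕ.pred M) (here refl)
  ... | no n = ∈-downʳ f₁ 1 (ℕ.pred M) i a (subst (i <_) (sym last) (ℕP.≤∧≢⇒< b n))

  stacked₁ : Stacked S₁
  stacked₁ = stacked-down +_ (λ i → + (1 + i) ∷ + (3 + M) ∷ + (2 + M) ∷ [])
    (simplex (simplex-inst (M ∷ []) tt′ (pos x₁ ∷ pos (x₁ ↑ 1) ∷ pos (x₁ ↑ 3) ∷ pos (x₁ ↑ 2) ∷ []) tt))
    1 (ℕ.pred M)
    (λ i a b → λ { (here refl) x∈ → ⊥-elim (prove (M ∷ i ∷ []) (x₂ ↑ 1 ≼ x₁ ∧
       mem (pos x₂) (pos x₁ ∷ pos (x₁ ↑ 1) ∷ pos (x₁ ↑ 3) ∷ pos (x₁ ↑ 2) ∷ [])) ff′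
       (subst (i <_) last b , mem⁺ {M ∷ i ∷ []} (pos x₂) (pos x₁ ∷ pos (x₁ ↑ 1) ∷ pos (x₁ ↑ 3) ∷ pos (x₁ ↑ 2) ∷ []) x∈)) })
    (λ i j a b c x∈ → prove (M ∷ i ∷ j ∷ []) (x₂ ↑ 1 ≼ x₃ ∧ x₃ ↑ 1 ≼ x₁ ∧
       mem (pos x₂) (pos x₃ ∷ pos (x₃ ↑ 1) ∷ pos (x₁ ↑ 3) ∷ pos (x₁ ↑ 2) ∷ [])) ff′
       (b , subst (j <_) last c , mem⁺ {M ∷ i ∷ j ∷ []} (pos x₂) (pos x₃ ∷ pos (x₃ ↑ 1) ∷ pos (x₁ ↑ 3) ∷ pos (x₁ ↑ 2) ∷ []) x∈))
    (λ i a b → simplex-inst (M ∷ i ∷ []) (x₂ ↑ 1 ≼ x₁) (pos (x₂ ↑ 1) ∷ pos (x₁ ↑ 3) ∷ pos (x₁ ↑ 2) ∷ []) (subst (i <_) last b))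
    (λ i a b → tri i (subst (i <_) last b))
    where
    A⊆ : ∀ {i} → + (1 + i) ∷ + (3 + M) ∷ + (2 + M) ∷ [] ⊆ f₁ (suc i)
    A⊆ (here e) = here e
    A⊆ (there p) = there (there p)
    tri : ∀ i → i < M → (∃ λ τ → τ ∈ S₀ × _ ⊆ τ) ⊎ (∃ λ j → i < j × j < 1 + ℕ.pred M × _ ⊆ f₁ j)
    tri i b with suc i ℕ.≟ M
    ... | yes refl = inj₁ (f₁ M , here refl , A⊆)
    ... | no n = inj₂ (suc i , ℕP.≤-refl , subst (suc i <_) (sym last) (ℕP.≤∧≢⇒< b n) , A⊆)

  stacked₂ : Stacked S₂
  stacked₂ = stack stacked₁
    (fresh-in (take 1) M [] tt′ (neg′ (x₁ ↑ 1)) (λ _ _ → tt) in₁ (λ _ _ → refl))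
    (simplex-inst (M ∷ []) tt′ (pos (# 1) ∷ pos (x₁ ↑ 3) ∷ pos (x₁ ↑ 2) ∷ []) tt)
    (f₁∈ {1} (s≤s z≤n) 1≤M) λ { (here e) → here e ; (there p) → there (there p) }

  stacked₃ : Stacked S₃
  stacked₃ = stacked-down (λ i → - (+ i)) (λ i → -[1+ i ] ∷ + (3 + M) ∷ + (2 + M) ∷ []) stacked₂ 1 M
    (λ i a b → fresh-in (take 2) M (i ∷ []) (# 1 ≼ x₄ ∧ x₄ ≼ x₁) (neg′ x₄) (λ _ _ → a , ℕP.≤-pred b) in₂ (λ _ _ → refl))
    (λ i j a b c x∈ → prove (M ∷ i ∷ j ∷ []) (# 1 ≼ x₂ ∧ x₂ ↑ 1 ≼ x₃ ∧
       mem (neg′ x₂) (neg′ x₃ ∷ neg′ (x₃ ↑ 1) ∷ pos (x₁ ↑ 3) ∷ pos (x₁ ↑ 2) ∷ [])) ff′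
       (a , b , mem⁺ {M ∷ i ∷ j ∷ []} (neg′ x₂) (neg′ x₃ ∷ neg′ (x₃ ↑ 1) ∷ pos (x₁ ↑ 3) ∷ pos (x₁ ↑ 2) ∷ []) x∈))
    (λ i a b → simplex-inst (M ∷ i ∷ []) tt′ (neg′ (x₂ ↑ 1) ∷ pos (x₁ ↑ 3) ∷ pos (x₁ ↑ 2) ∷ []) tt)
    (λ i a b → tri i (ℕP.≤-pred b))
    where
    tri : ∀ i → i ≤ M → (∃ λ τ → τ ∈ S₂ × -[1+ i ] ∷ + (3 + M) ∷ + (2 + M) ∷ [] ⊆ τ)
      ⊎ (∃ λ j → i < j × j < 1 + M × -[1+ i ] ∷ + (3 + M) ∷ + (2 + M) ∷ [] ⊆ f₃ j)
    tri i b with i ℕ.≟ M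
    ... | yes refl = inj₁ (s₂ , here refl , λ { (here e) → here e ; (there p) → there (there p) })
    ... | no n = inj₂ (suc i , ℕP.≤-refl , s≤s (ℕP.≤∧≢⇒< b n) , λ { (here e) → here e ; (there p) → there (there p) })

  s₂∈ : s₂ ∈ S₃
  s₂∈ = ∈-downˡ f₃ 1 M (here refl)

  stacked₅ : Stacked S₅
  stacked₅ = stack (stack stacked₃
      (fresh-in (take 3) M [] tt′ (neg′ (x₁ ↑ 2)) (λ _ _ → tt) in₃ (λ _ _ → refl))
      (simplex-inst (M ∷ []) tt′ (pos (# 1) ∷ neg′ (x₁ ↑ 1) ∷ pos (x₁ ↑ 3) ∷ []) tt) s₂∈
      (⊆-inst (M ∷ []) tt′ (pos (# 1) ∷ neg′ (x₁ ↑ 1) ∷ pos (x₁ ↑ 3) ∷ [])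
        (neg′ (x₁ ↑ 1) ∷ pos (# 1) ∷ pos (x₁ ↑ 3) ∷ pos (x₁ ↑ 2) ∷ []) tt))
    (fresh-in (take 4) M [] tt′ (neg′ (x₁ ↑ 3)) (λ _ _ → tt) in₄ (λ _ _ → refl))
    (simplex-inst (M ∷ []) tt′ (pos (# 1) ∷ neg′ (x₁ ↑ 1) ∷ neg′ (x₁ ↑ 2) ∷ []) tt) (here refl)
    (⊆-inst (M ∷ []) tt′ (pos (# 1) ∷ neg′ (x₁ ↑ 1) ∷ neg′ (x₁ ↑ 2) ∷ [])
      (neg′ (x₁ ↑ 2) ∷ pos (# 1) ∷ neg′ (x₁ ↑ 1) ∷ pos (x₁ ↑ 3) ∷ []) tt)

  B : Cx
  B = B3₁ (3 + M)

  B-pure : Pure 4 B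
  B-pure k = simplices (# 2 ≼ x₁) ballF (λ _ → s≤s 1≤M) (ball-in (s≤s 1≤M) k)

  S₅≅B : S₅ ≅ B
  S₅≅B = to , from
    where
    to : ∀ {κ} → κ ∈ S₅ → κ ∈~ B
    to {κ} k with all-cover 1 tt′ chainF ballF
        ((case tt′ then 0 at x₂ , x₃ ∷ []) ∷ (case tt′ then 2 at x₂ , x₃ ∷ []) ∷ (case tt′ then 1 at x₂ , x₃ ∷ []) ∷
         (case tt′ then 3 at x₂ , x₃ ∷ []) ∷ (case tt′ then 4 at x₂ , x₃ ∷ []) ∷ []) (λ _ → tt) (in₅ k)
    ... | τ , i , s = τ , in-ball (s≤s 1≤M) i , s ,
      same-size (stacked-pure stacked₅ k) (B-pure (in-ball (s≤s 1≤M) i)) s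
    S₃∈ : ∀ {κ} → κ ∈ S₃ → κ ∈ S₅
    S₃∈ k = there (there k)
    known : ∀ {σ τ} → σ ∈ S₅ → τ ∈ B → τ ⊆ σ → τ ∈~ S₅
    known {σ} p q s = σ , p , s , same-size (B-pure q) (stacked-pure stacked₅ p) s
    from : ∀ {κ} → κ ∈ B → κ ∈~ S₅
    from k with ball-in (s≤s 1≤M) k
    ... | here (j , _ , (a , b) , refl) = known (S₃∈ (∈-downˡ f₃ 1 M (there (f₁∈ a (ℕP.≤-pred b))))) k
      (⊆-inst (M ∷ j ∷ []) tt′ (pos (x₁ ↑ 3) ∷ pos (x₁ ↑ 2) ∷ pos x₂ ∷ pos (x₂ ↑ 1) ∷ [])
        (pos x₂ ∷ pos (x₂ ↑ 1) ∷ pos (x₁ ↑ 3) ∷ pos (x₁ ↑ 2) ∷ []) tt)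
    ... | there (here (j , _ , (a , b) , refl)) = known (S₃∈ (∈-downʳ f₃ 1 M j a b)) k
      (⊆-inst (M ∷ j ∷ []) tt′ (pos (x₁ ↑ 3) ∷ pos (x₁ ↑ 2) ∷ neg′ x₂ ∷ neg′ (x₂ ↑ 1) ∷ [])
        (neg′ x₂ ∷ neg′ (x₂ ↑ 1) ∷ pos (x₁ ↑ 3) ∷ pos (x₁ ↑ 2) ∷ []) tt)
    ... | there (there (here (_ , _ , _ , refl))) = known (S₃∈ s₂∈) k
      (⊆-inst (M ∷ []) tt′ (pos (x₁ ↑ 3) ∷ pos (x₁ ↑ 2) ∷ neg′ (x₁ ↑ 1) ∷ pos (# 1) ∷ [])
        (neg′ (x₁ ↑ 1) ∷ pos (# 1) ∷ pos (x₁ ↑ 3) ∷ pos (x₁ ↑ 2) ∷ []) tt)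
    ... | there (there (there (here (_ , _ , _ , refl)))) = known (there (here refl)) k
      (⊆-inst (M ∷ []) tt′ (pos (x₁ ↑ 3) ∷ neg′ (x₁ ↑ 2) ∷ pos (# 1) ∷ neg′ (x₁ ↑ 1) ∷ [])
        (neg′ (x₁ ↑ 2) ∷ pos (# 1) ∷ neg′ (x₁ ↑ 1) ∷ pos (x₁ ↑ 3) ∷ []) tt)
    ... | there (there (there (there (here (_ , _ , _ , refl))))) = known (here refl) k
      (⊆-inst (M ∷ []) tt′ (neg′ (x₁ ↑ 3) ∷ neg′ (x₁ ↑ 2) ∷ pos (# 1) ∷ neg′ (x₁ ↑ 1) ∷ [])
        (neg′ (x₁ ↑ 3) ∷ pos (# 1) ∷ neg′ (x₁ ↑ 1) ∷ neg′ (x₁ ↑ 2) ∷ []) tt)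

  stackedB : Stacked B
  stackedB = reorder stacked₅ S₅≅B B-pure

-- The closed form of Δ³_n

-- The facets of Δ³ₙ, n = N + 2, up to sign: those of B₃ₙ,₁ and the facets left
-- over from the earlier steps, where the largest vertex is x₃ + 3.
levelF : List Family
levelF =
  ((# 1 ≼ x₂ ∧ x₂ ↑ 1 ≼ x₃ ∧ x₃ ↑ 1 ≼ x₁) , pos (x₃ ↑ 3) ∷ pos (x₃ ↑ 1) ∷ pos x₂ ∷ pos (x₂ ↑ 1) ∷ []) ∷
  ((# 1 ≼ x₂ ∧ x₂ ↑ 1 ≼ x₃ ∧ x₃ ↑ 1 ≼ x₁) , pos (x₃ ↑ 3) ∷ pos (x₃ ↑ 1) ∷ neg′ x₂ ∷ neg′ (x₂ ↑ 1) ∷ []) ∷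
  ((# 2 ≼ x₃ ∧ x₃ ↑ 1 ≼ x₁) , pos (x₃ ↑ 3) ∷ pos (x₃ ↑ 1) ∷ neg′ x₃ ∷ pos (# 1) ∷ []) ∷
  ((# 2 ≼ x₃ ∧ x₃ ↑ 1 ≼ x₁) , pos (x₃ ↑ 3) ∷ neg′ (x₃ ↑ 2) ∷ pos (# 1) ∷ neg′ x₃ ∷ []) ∷
  ((# 1 ≼ x₃ ∧ x₃ ↑ 1 ≼ x₁) , pos (x₃ ↑ 3) ∷ neg′ (x₃ ↑ 2) ∷ neg′ (x₃ ↑ 1) ∷ neg′ x₃ ∷ []) ∷
  (tt′ , pos (# 4) ∷ neg′ (# 3) ∷ pos (# 2) ∷ pos (# 1) ∷ []) ∷
  (tt′ , pos (# 4) ∷ neg′ (# 3) ∷ pos (# 2) ∷ neg′ (# 1) ∷ []) ∷ []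

halfF : List Family
halfF = levelF ++ ballF

facetF : List Family
facetF = halfF ++ mirror halfF

facetF-neg : ∀ {N τ} → In N facetF τ → In N facetF (map -_ τ)
facetF-neg {N} {τ} i with AnyP.++⁻ halfF i
... | inj₁ j = AnyP.++⁺ʳ halfF (in-mirror j)
... | inj₂ j with in-mirror⁻ halfF j
...   | σ , j' , refl = AnyP.++⁺ˡ (subst (In N halfF) (sym (neg-neg σ)) j')

-- The cone with apex n + 1 over ∂B₃ₙ,₁.
topF : List Family
topF =
  (range₁ , top ∷ pos (x₁ ↑ 1) ∷ pos x₂ ∷ pos (x₂ ↑ 1) ∷ []) ∷
  (range₁ , top ∷ pos (x₁ ↑ 1) ∷ neg′ x₂ ∷ neg′ (x₂ ↑ 1) ∷ []) ∷
  (tt′ , top ∷ pos (x₁ ↑ 1) ∷ neg′ x₁ ∷ pos (# 1) ∷ []) ∷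
  (tt′ , top ∷ neg′ (x₁ ↑ 2) ∷ pos (# 1) ∷ neg′ x₁ ∷ []) ∷
  (tt′ , top ∷ neg′ (x₁ ↑ 2) ∷ neg′ (x₁ ↑ 1) ∷ neg′ x₁ ∷ []) ∷
  (range₁ , top ∷ pos (x₁ ↑ 2) ∷ pos x₂ ∷ pos (x₂ ↑ 1) ∷ []) ∷
  (tt′ , top ∷ pos (x₁ ↑ 2) ∷ pos (x₁ ↑ 1) ∷ pos x₁ ∷ []) ∷
  (range₁ , top ∷ pos (x₁ ↑ 2) ∷ neg′ x₂ ∷ neg′ (x₂ ↑ 1) ∷ []) ∷
  (tt′ , top ∷ pos (x₁ ↑ 2) ∷ neg′ (x₁ ↑ 1) ∷ neg′ x₁ ∷ []) ∷
  (tt′ , top ∷ pos (x₁ ↑ 2) ∷ neg′ (x₁ ↑ 1) ∷ pos (# 1) ∷ []) ∷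
  (tt′ , top ∷ neg′ (x₁ ↑ 2) ∷ neg′ (x₁ ↑ 1) ∷ pos (# 1) ∷ []) ∷
  (tt′ , top ∷ pos (x₁ ↑ 2) ∷ pos (x₁ ↑ 1) ∷ neg′ (# 1) ∷ []) ∷ []
  where
  top : Vertex
  top = pos (x₁ ↑ 3)
  range₁ : Formula
  range₁ = # 1 ≼ x₂ ∧ x₂ ↑ 1 ≼ x₁

T-fst : ∀ a b → T (a && b) → T a
T-fst true b t = tt

T-snd : ∀ a b → T (a && b) → T b
T-snd true b t = t

-- A hint for one ridge of one family. For parameters under `outer` its cone lies in a member of
-- `Ts`; for those under `inner` the ridge lies in a second member of `Bs`, so it is not on the
-- boundary.
record Rule : Set where
  constructor boundary_interior_
  field
    outer inner : List Case

open Rule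

module Ridges (Bs Ts : List Family) (h : Formula) (top : Vertex) where

  exceeds : Family → ℕ → Case → Formula
  exceeds F r (case φ then k at P , Q) = let t = proj₂ (pick k Bs) ⟪ at x₁ P Q ⟫ˢ in
    proj₁ (pick k Bs) ⟪ at x₁ P Q ⟫ ∧ sub (dropAt r (template F)) t ∧ negate (sub t (template F))

  outer? inner? : Family → ℕ → Case → Bool
  outer? F r = case? 5 0 (bound F ∧ h) (top ∷ dropAt r (template F)) Ts
  inner? F r c = valid 5 ((bound F ∧ h) ∧ Case.condition c) (exceeds F r c)

  split : Rule → Formula
  split ρ = disjunction (map Case.condition (outer ρ)) ∨ disjunction (map Case.condition (inner ρ))

  ridge? : Family → ℕ → Rule → Bool
  ridge? F r ρ = valid 5 (bound F ∧ h) (split ρ) && (all (outer? F r) (outer ρ) && all (inner? F r) (inner ρ))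

  rules? : List Family → List (List Rule) → Bool
  rules? [] _ = true
  rules? (F ∷ Fs) ((a ∷ b ∷ c ∷ d ∷ []) ∷ ρs) =
    (length (template F) ≡ᵇ 4) && (ridge? F 0 a && (ridge? F 1 b && (ridge? F 2 c && (ridge? F 3 d && rules? Fs ρs))))
  rules? _ _ = false

  module Sound (N : ℕ) (hyp : ∀ xs → ⟦ h ⟧ (N ∷ xs)) where

    -- The two ways to see a ridge: it is coned by a member of Ts, or it lies
    -- in a member of Bs other than τ.
    Seen : Simplex → Simplex → Simplex → Set
    Seen τ ρ vρ = (∃ λ τ' → In N Ts τ' × vρ ⊆ τ') ⊎ (∃ λ κ → In N Bs κ × ρ ⊆ κ × ¬ κ ⊆ τ)

    inner-sound : ∀ F τ r c → T (inner? F r c) → (i : Is N F τ) → ⟦ Case.condition c ⟧ (N ∷ parameters i) →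
      ∃ λ κ → In N Bs κ × inst (dropAt r (template F)) (N ∷ parameters i) ⊆ κ × ¬ κ ⊆ τ
    inner-sound F τ r c@(case φ then k at P , Q) t i d
      with prove (N ∷ parameters i) ((bound F ∧ h) ∧ φ) (exceeds F r c) {t} ((proj₁ (bound-holds i) , hyp _) , d)
    ... | b , s , n = inst t' xs , pick-in k Bs (instance-of (pick k Bs) x₁ P Q b) ,
      sub⁻ {xs} (dropAt r (template F)) t' s ,
      λ s' → negate-sound {xs} (sub t' (template F)) n
        (sub⁺ {xs} t' (template F) (subst (inst t' xs ⊆_) (proj₂ (bound-holds i)) s'))
      where
      xs = N ∷ parameters i
      t' = proj₂ (pick k Bs) ⟪ at x₁ P Q ⟫ˢ

    ridge-sound : ∀ F τ r ρ → T (ridge? F r ρ) → (i : Is N F τ) →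
      Seen τ (inst (dropAt r (template F)) (N ∷ parameters i)) (inst (top ∷ dropAt r (template F)) (N ∷ parameters i))
    ridge-sound F τ r ρ t i = choose (prove xs (bound F ∧ h) (split ρ) {T-fst _ _ t} (proj₁ (bound-holds i) , hyp _))
      where
      xs = N ∷ parameters i
      o : T (all (outer? F r) (outer ρ))
      o = T-fst _ _ (T-snd (valid 5 (bound F ∧ h) (split ρ)) _ t)
      n : T (all (inner? F r) (inner ρ))
      n = T-snd (all (outer? F r) (outer ρ)) _ (T-snd (valid 5 (bound F ∧ h) (split ρ)) _ t)
      choose-outer : ∀ os → T (all (outer? F r) os) → ⟦ disjunction (map Case.condition os) ⟧ xs →
        ∃ λ τ' → In N Ts τ' × inst (top ∷ dropAt r (template F)) xs ⊆ τ'
      choose-outer (c ∷ cs) a (inj₂ d) = choose-outer cs (T-snd (outer? F r c) _ a) d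
      choose-outer (c ∷ cs) a (inj₁ d) = case-covers N (parameters i) 0 (bound F ∧ h) (top ∷ dropAt r (template F)) Ts c
        (T-fst (outer? F r c) _ a) (proj₁ (bound-holds i) , hyp _) d
      choose-inner : ∀ is → T (all (inner? F r) is) → ⟦ disjunction (map Case.condition is) ⟧ xs →
        ∃ λ κ → In N Bs κ × inst (dropAt r (template F)) xs ⊆ κ × ¬ κ ⊆ τ
      choose-inner (c ∷ cs) a (inj₂ d) = choose-inner cs (T-snd (inner? F r c) _ a) d
      choose-inner (c ∷ cs) a (inj₁ d) = inner-sound F τ r c (T-fst (inner? F r c) _ a) i d
      choose : ⟦ split ρ ⟧ xs → Seen τ (inst (dropAt r (template F)) xs) (inst (top ∷ dropAt r (template F)) xs)
      choose (inj₁ d) = inj₁ (choose-outer (outer ρ) o d)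
      choose (inj₂ d) = inj₂ (choose-inner (inner ρ) n d)

    rules-sound : ∀ Fs ρs → T (rules? Fs ρs) → ∀ {τ x v} → (∀ xs → ⟦ top ⟧ᵛ (N ∷ xs) ≡ v) → In N Fs τ → x ∈ τ →
      Seen τ (del x τ) (v ∷ del x τ)
    rules-sound (F ∷ Fs) ((a ∷ b ∷ c ∷ d ∷ []) ∷ ρs) t {τ} {x} {v} top≡ i x∈ = go i
      where
      l : T (length (template F) ≡ᵇ 4)
      l = T-fst _ _ t
      t₀ : T (ridge? F 0 a && (ridge? F 1 b && (ridge? F 2 c && (ridge? F 3 d && rules? Fs ρs))))
      t₀ = T-snd (length (template F) ≡ᵇ 4) _ t
      t₁ : T (ridge? F 1 b && (ridge? F 2 c && (ridge? F 3 d && rules? Fs ρs)))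
      t₁ = T-snd (ridge? F 0 a) _ t₀
      t₂ : T (ridge? F 2 c && (ridge? F 3 d && rules? Fs ρs))
      t₂ = T-snd (ridge? F 1 b) _ t₁
      t₃ : T (ridge? F 3 d && rules? Fs ρs)
      t₃ = T-snd (ridge? F 2 c) _ t₂
      module _ (i : Is N F τ) where
        xs = N ∷ parameters i
        Fx = inst (template F) xs
        narrow : ∀ {υ} → del x Fx ⊆ υ → del x τ ⊆ υ
        narrow {υ} = subst (λ σ → del x σ ⊆ υ) (sym (proj₂ (bound-holds i)))
        ∷-⊆ : ∀ {υ} r → del x Fx ⊆ inst (dropAt r (template F)) xs →
          inst (top ∷ dropAt r (template F)) xs ⊆ υ → v ∷ del x τ ⊆ υ
        ∷-⊆ r s s' (here refl) = s' (here (sym (top≡ _)))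
        ∷-⊆ r s s' (there p) = s' (there (narrow s p))
        transport : ∀ r → del x Fx ⊆ inst (dropAt r (template F)) xs →
          Seen τ (inst (dropAt r (template F)) xs) (inst (top ∷ dropAt r (template F)) xs) → Seen τ (del x τ) (v ∷ del x τ)
        transport r s (inj₁ (τ' , j , s₁)) = inj₁ (τ' , j , ∷-⊆ r s s₁)
        transport r s (inj₂ (κ , j , s₁ , n)) = inj₂ (κ , j , (λ p → s₁ (narrow s p)) , n)
        conclude : ∀ r ρ → T (ridge? F r ρ) → del x Fx ⊆ inst (dropAt r (template F)) xs → Seen τ (del x τ) (v ∷ del x τ)
        conclude r ρ t s = transport r s (ridge-sound F τ r ρ t i)
        index : ∀ r → r < 4 → del x Fx ⊆ inst (dropAt r (template F)) xs → Seen τ (del x τ) (v ∷ del x τ)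
        index 0 _ s = conclude 0 a (T-fst (ridge? F 0 a) _ t₀) s
        index 1 _ s = conclude 1 b (T-fst (ridge? F 1 b) _ t₁) s
        index 2 _ s = conclude 2 c (T-fst (ridge? F 2 c) _ t₂) s
        index 3 _ s = conclude 3 d (T-fst (ridge? F 3 d) _ t₃) s
        index (suc (suc (suc (suc _)))) (s≤s (s≤s (s≤s (s≤s ())))) s
      go : In N (F ∷ Fs) τ → Seen τ (del x τ) (v ∷ del x τ)
      go (there i) = rules-sound Fs ρs (T-snd (ridge? F 3 d) _ t₃) top≡ i x∈
      go (here i) = let r , r< , s = remove-index (λ v → ⟦ v ⟧ᵛ (N ∷ parameters i)) (template F) (subst (x ∈_) (proj₂ (bound-holds i)) x∈)
        in index i r (ℕP.≤-trans (ℕP.≤ᵇ⇒≤ (suc r) (length (template F)) r<) (ℕP.≤-reflexive (ℕP.≡ᵇ⇒≡ (length (template F)) 4 l))) s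

always : ℕ → Term → List Case
always k P = case tt′ then k at P , # 0 ∷ []

-- For each member of ballF and each of its vertices: the ridge opposite to the
-- vertex is coned by a member of topF or lies in another facet.
rules : List (List Rule)
rules =
  ((boundary always 0 x₂ interior []) ∷ (boundary always 5 x₂ interior []) ∷
   (boundary (case x₁ ≼ x₂ ↑ 1 then 6 at # 0 , # 0 ∷ []) interior (case x₂ ↑ 2 ≼ x₁ then 0 at x₂ ↑ 1 , # 0 ∷ [])) ∷
   (boundary [] interior (case x₂ ≼ # 1 then 2 at # 0 , # 0 ∷ case # 2 ≼ x₂ then 0 at x₄ , # 0 ∷ [])) ∷ []) ∷
  ((boundary always 1 x₂ interior []) ∷ (boundary always 7 x₂ interior []) ∷
   (boundary [] interior (case x₁ ≼ x₂ ↑ 1 then 2 at # 0 , # 0 ∷ case x₂ ↑ 2 ≼ x₁ then 1 at x₂ ↑ 1 , # 0 ∷ [])) ∷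
   (boundary (case x₂ ≼ # 1 then 11 at # 0 , # 0 ∷ []) interior (case # 2 ≼ x₂ then 1 at x₄ , # 0 ∷ [])) ∷ []) ∷
  ((boundary always 2 (# 0) interior []) ∷ (boundary [] interior always 3 (# 0)) ∷
   (boundary [] interior always 0 (# 1)) ∷ (boundary [] interior always 1 x₅) ∷ []) ∷
  ((boundary [] interior always 4 (# 0)) ∷ (boundary [] interior always 2 (# 0)) ∷
   (boundary always 8 (# 0) interior []) ∷ (boundary always 9 (# 0) interior []) ∷ []) ∷
  ((boundary [] interior always 3 (# 0)) ∷ (boundary always 3 (# 0) interior []) ∷
   (boundary always 4 (# 0) interior []) ∷ (boundary always 10 (# 0) interior []) ∷ []) ∷ []

-- The converse of the rules. If every member of the families that contains the ridge is contained
-- in σ, equal size makes it equal to σ, so the ridge lies in one facet only.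
ridge : ∀ {B} Gs N zs h σ r → {T (consequence? Gs (length zs) h (dropAt r σ) (λ t → sub t σ))} →
  {T (suc r ≤ᵇ length σ)} → {T (valid (3 + length zs) h (distinct σ))} →
  Pure 4 B → (∀ {κ} → κ ∈ B → In N Gs κ) → (∀ p q → ⟦ h ⟧ (N ∷ p ∷ q ∷ zs)) →
  ∀ {τ ρ} → (∀ p q → inst σ (N ∷ p ∷ q ∷ zs) ≡ τ) → (∀ p q → inst (dropAt r σ) (N ∷ p ∷ q ∷ zs) ≡ ρ) →
  τ ∈~ B → ρ ∈~ ∂ B
ridge {B} Gs N zs h σ r {c} {l} {u} pure inG hyp {τ} {ρ} eq eq' (τ' , τ'∈ , e)
  with index-remove (λ v → ⟦ v ⟧ᵛ (N ∷ 0 ∷ 0 ∷ zs)) σ r l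
         (distinct⁻ σ (prove (N ∷ 0 ∷ 0 ∷ zs) h (distinct σ) {u} (hyp 0 0)))
... | x , x∈ , e' = ∈~-resp ρ≈ (bd⁺ τ'∈ (proj₁ e (subst (x ∈_) (eq 0 0) x∈)) only)
  where
  ρ≈ : ρ ≈ del x τ'
  ρ≈ = ≈-trans (≈-sym (subst₂ (λ t ρ → del x t ≈ ρ) (eq 0 0) (eq' 0 0) e')) (remove-≈ x e)
  only : Only B (del x τ') τ'
  only {κ} k s with consequence Gs N zs h (dropAt r σ) (λ t → sub t σ) {c} hyp (inG k)
    (λ p q → subst (_⊆ κ) (sym (eq' p q)) (s ∘ proj₁ ρ≈))
  ... | p , q , t , κ≡ , w = κ⊆ , same-size (pure k) (pure τ'∈) κ⊆
    where
    κ⊆ : κ ⊆ τ'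
    κ⊆ = proj₁ e ∘ subst₂ _⊆_ (sym κ≡) (eq p q) (sub⁻ t σ w)

-- Both directions are needed: `facet-in` to refute faces of Δ³_n, `in-facet` to find B(I) among its
-- facets. An inclusion suffices in the first, as all facets have four vertices.
record Closed (N : ℕ) (K : Cx) : Set where
  field
    facet-in : ∀ {κ} → κ ∈ K → ∃ λ τ → In N facetF τ × κ ⊆ τ
    in-facet : ∀ {τ} → In N facetF τ → τ ∈~ K

open Closed

half-simplices : ∀ {N τ} → 2 ≤ N → In N halfF τ → IsSimplex 4 τ
half-simplices 2≤N = simplices (# 2 ≼ x₁) halfF (λ _ → 2≤N)

facet-simplices : ∀ {N τ} → 2 ≤ N → In N facetF τ → IsSimplex 4 τ
facet-simplices 2≤N i with AnyP.++⁻ halfF i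
... | inj₁ j = half-simplices 2≤N j
... | inj₂ j with in-mirror⁻ halfF j
...   | σ , j' , refl = isSimplex-neg (half-simplices 2≤N j')

open Closed

level-ball-apart : ∀ {N σ τ} → 2 ≤ N → In N levelF σ → In N ballF τ → ¬ σ ⊆ τ
level-ball-apart 2≤N = families-apart levelF ballF (# 2 ≼ x₁) (λ _ → 2≤N)

level-neg-apart : ∀ {N σ τ} → 2 ≤ N → In N levelF σ → In N (mirror ballF) τ → ¬ σ ⊆ τ
level-neg-apart 2≤N = families-apart levelF (mirror ballF) (# 2 ≼ x₁) (λ _ → 2≤N)

module Build (M : ℕ) (1≤M : 1 ≤ M) {K : Cx} (S : Sphere (3 + M) K) (C : Closed (1 + M) K) where

  open Chain M 1≤M using (B; B-pure; stackedB)

  N : ℕ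
  N = 1 + M

  2≤N : 2 ≤ N
  2≤N = s≤s 1≤M

  B⊆K : ∀ {κ} → κ ∈ B → κ ∈~ K
  B⊆K k = in-facet C (AnyP.++⁺ˡ {xs = halfF} (AnyP.++⁺ʳ levelF (ball-in 2≤N k)))

  disjoint : ∀ {κ λ'} → κ ∈ B → λ' ∈ B → ¬ κ ≈ map -_ λ'
  disjoint k l (s , _) = families-apart ballF (mirror ballF) (# 2 ≼ x₁) (λ _ → 2≤N)
    (ball-in 2≤N k) (in-mirror (ball-in 2≤N l)) s

  cover : ∀ {v} → InV (2 + N) v → ∃ λ κ → κ ∈ B × v ∈ κ
  cover {+ zero} (n , _) = ⊥-elim (n refl)
  cover {+ suc i} (_ , l) with suc i ℕ.≤? M
  ... | yes a = _ , in-ball 2≤N (here (suc i , 0 , (s≤s z≤n , s≤s a) , refl)) , there (there (here refl))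
  ... | no a with suc i ℕ.≟ N
  ...   | yes refl = _ , in-ball 2≤N (here (M , 0 , (1≤M , ℕP.≤-refl) , refl)) , there (there (there (here refl)))
  ...   | no b with suc i ℕ.≟ 1 + N
  ...     | yes refl = _ , in-ball 2≤N (there (there (here (0 , 0 , tt , refl)))) , there (here refl)
  ...     | no c with ℕP.≤-antisym l (ℕP.≤∧≢⇒< (ℕP.≤∧≢⇒< (ℕP.≰⇒> a) (b ∘ sym)) (c ∘ sym))
  ...       | refl = _ , in-ball 2≤N (there (there (here (0 , 0 , tt , refl)))) , here refl
  cover { -[1+ i ]} (_ , l) with suc i ℕ.≤? M
  ... | yes a = _ , in-ball 2≤N (there (here (suc i , 0 , (s≤s z≤n , s≤s a) , refl))) , there (there (here refl))
  ... | no a with suc i ℕ.≟ N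
  ...   | yes refl = _ , in-ball 2≤N (there (here (M , 0 , (1≤M , ℕP.≤-refl) , refl))) , there (there (there (here refl)))
  ...   | no b with suc i ℕ.≟ 1 + N
  ...     | yes refl = _ , in-ball 2≤N (there (there (there (here (0 , 0 , tt , refl))))) , there (here refl)
  ...     | no c with ℕP.≤-antisym l (ℕP.≤∧≢⇒< (ℕP.≤∧≢⇒< (ℕP.≰⇒> a) (b ∘ sym)) (c ∘ sym))
  ...       | refl = _ , in-ball 2≤N (there (there (there (there (here (0 , 0 , tt , refl)))))) , here refl

  bd-neg≅ : bd (neg B) ≅ ∂ (neg B)
  bd-neg≅ = subst (_≅ ∂ (neg B)) (∂≡bd (neg B)) ≅-refl

  bd-neg-pure : Pure 3 (bd (neg B))
  bd-neg-pure = subst (Pure 3) (∂≡bd (neg B)) (bd-pure (stacked-pure (stacked-neg stackedB)))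

  open Step S stackedB B⊆K disjoint cover bd-neg≅ bd-neg-pure public
    using (D; D≡; D⁻; D-old; D-top; D-symmetric; stepped; D-good)

  old-cases : List (List Case)
  old-cases = map (λ k → case tt′ then k at x₂ , x₃ ∷ []) (0 ∷ 1 ∷ 2 ∷ 3 ∷ 4 ∷ 5 ∷ 6 ∷ [])

  old-in : ∀ {τ} → In N levelF τ → ∃ λ τ' → In (1 + N) halfF τ' × τ ⊆ τ'
  old-in = all-cover 1 tt′ levelF halfF old-cases (λ _ → tt)

  -- The first five cone families become left-over facets with x₃ = N; the others belong to the next
  -- ball or its antipode. Counting from 0, positions 7 to 11 of `facetF` are `ballF`, and 23 is the
  -- mirror of its last member.
  top-in : ∀ {τ} → In N topF τ → ∃ λ τ' → In (1 + N) facetF τ' × τ ⊆ τ'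
  top-in = all-cover 1 (# 2 ≼ x₁) topF facetF
    ((case tt′ then 0 at x₂ , x₁ ∷ []) ∷ (case tt′ then 1 at x₂ , x₁ ∷ []) ∷ (case tt′ then 2 at # 0 , x₁ ∷ []) ∷
     (case tt′ then 3 at # 0 , x₁ ∷ []) ∷ (case tt′ then 4 at # 0 , x₁ ∷ []) ∷ (case tt′ then 7 at x₂ , # 0 ∷ []) ∷
     (case tt′ then 7 at x₁ , # 0 ∷ []) ∷ (case tt′ then 8 at x₂ , # 0 ∷ []) ∷ (case tt′ then 8 at x₁ , # 0 ∷ []) ∷
     (case tt′ then 9 at # 0 , # 0 ∷ []) ∷ (case tt′ then 10 at # 0 , # 0 ∷ []) ∷ (case tt′ then 23 at # 0 , # 0 ∷ []) ∷ [])
    (λ _ → 2≤N)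

  half-old : ∀ {κ τ} → κ ∈ K → ¬ Face B κ → In N halfF τ → κ ⊆ τ → ∃ λ τ' → In (1 + N) halfF τ' × κ ⊆ τ'
  half-old k n i s with AnyP.++⁻ levelF i
  ... | inj₁ j = let τ' , j' , s' = old-in j in τ' , j' , (λ p → s' (s p))
  ... | inj₂ j = ⊥-elim (n (face⁺ (in-ball 2≤N j) s))

  -- A boundary ridge lies in one facet only, which excludes the second alternative of `Seen`.
  cone-in : ∀ {ρ} → ρ ∈ ∂ B → ∃ λ τ' → In (1 + N) facetF τ' × + (3 + N) ∷ ρ ⊆ τ'
  cone-in r with bd⁻ B r
  ... | τ , t , x , x∈ , refl , only with Ridges.Sound.rules-sound ballF topF (# 2 ≼ x₁) (pos (x₁ ↑ 3)) N (λ _ → 2≤N) ballF rules tt (λ _ → refl) (ball-in 2≤N t) x∈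
  ...   | inj₂ (κ , j , s , n) = ⊥-elim (n (proj₁ (only (in-ball 2≤N j) s)))
  ...   | inj₁ (τ' , j , s) = let τ'' , j' , s' = top-in j in τ'' , j' , s' ∘ s

  top-facet : ∀ {τ} → In N topF τ → τ ∈~ D
  top-facet = go
    where
    rid : ∀ zs h σ r {c} {l} {u} → (∀ p q → ⟦ h ⟧ (N ∷ p ∷ q ∷ zs)) → ∀ {τ ρ} →
      (∀ p q → inst σ (N ∷ p ∷ q ∷ zs) ≡ τ) → (∀ p q → inst (dropAt r σ) (N ∷ p ∷ q ∷ zs) ≡ ρ) → In N ballF τ → + (3 + N) ∷ ρ ∈~ D
    rid zs h σ r {c} {l} {u} hyp eq eq' i =
      D-top (ridge ballF N zs (# 2 ≼ x₁ ∧ h) σ r {c} {l} {u} B-pure (ball-in 2≤N) (λ p q → 2≤N , hyp p q) eq eq' (∈⇒∈~ (in-ball 2≤N i)))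
    b₀ b₁ b₂ b₃ b₄ : List Vertex
    b₀ = pos (x₁ ↑ 2) ∷ pos (x₁ ↑ 1) ∷ pos x₄ ∷ pos (x₄ ↑ 1) ∷ []
    b₁ = pos (x₁ ↑ 2) ∷ pos (x₁ ↑ 1) ∷ neg′ x₄ ∷ neg′ (x₄ ↑ 1) ∷ []
    b₂ = pos (x₁ ↑ 2) ∷ pos (x₁ ↑ 1) ∷ neg′ x₁ ∷ pos (# 1) ∷ []
    b₃ = pos (x₁ ↑ 2) ∷ neg′ (x₁ ↑ 1) ∷ pos (# 1) ∷ neg′ x₁ ∷ []
    b₄ = neg′ (x₁ ↑ 2) ∷ neg′ (x₁ ↑ 1) ∷ pos (# 1) ∷ neg′ x₁ ∷ []
    range₄ : Formula
    range₄ = # 1 ≼ x₄ ∧ x₄ ↑ 1 ≼ x₁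
    i₂ : In N ballF _
    i₂ = there (there (here (0 , 0 , tt , refl)))
    i₃ : In N ballF _
    i₃ = there (there (there (here (0 , 0 , tt , refl))))
    i₄ : In N ballF _
    i₄ = there (there (there (there (here (0 , 0 , tt , refl)))))
    go : ∀ {τ} → In N topF τ → τ ∈~ D
    go (here (j , _ , b , refl)) = rid (j ∷ []) range₄ b₀ 0 (λ _ _ → b) (λ _ _ → refl) (λ _ _ → refl) (here (j , 0 , b , refl))
    go (there (here (j , _ , b , refl))) = rid (j ∷ []) range₄ b₁ 0 (λ _ _ → b) (λ _ _ → refl) (λ _ _ → refl) (there (here (j , 0 , b , refl)))
    go (there (there (here (_ , _ , _ , refl)))) = rid [] tt′ b₂ 0 (λ _ _ → tt) (λ _ _ → refl) (λ _ _ → refl) i₂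
    go (there (there (there (here (_ , _ , _ , refl))))) = rid [] tt′ b₄ 1 (λ _ _ → tt) (λ _ _ → refl) (λ _ _ → refl) i₄
    go (there (there (there (there (here (_ , _ , _ , refl)))))) = rid [] tt′ b₄ 2 (λ _ _ → tt) (λ _ _ → refl) (λ _ _ → refl) i₄
    go (there (there (there (there (there (here (j , _ , b , refl))))))) =
      rid (j ∷ []) range₄ b₀ 1 (λ _ _ → b) (λ _ _ → refl) (λ _ _ → refl) (here (j , 0 , b , refl))
    go (there (there (there (there (there (there (here (_ , _ , _ , refl)))))))) =
      rid (M ∷ []) (x₁ ≼ x₄ ↑ 1 ∧ x₄ ↑ 1 ≼ x₁) b₀ 2 (λ _ _ → ℕP.≤-refl , ℕP.≤-refl) (λ _ _ → refl) (λ _ _ → refl)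
        (here (M , 0 , (1≤M , ℕP.≤-refl) , refl))
    go (there (there (there (there (there (there (there (here (j , _ , b , refl))))))))) =
      rid (j ∷ []) range₄ b₁ 1 (λ _ _ → b) (λ _ _ → refl) (λ _ _ → refl) (there (here (j , 0 , b , refl)))
    go (there (there (there (there (there (there (there (there (here (_ , _ , _ , refl)))))))))) =
      rid [] tt′ b₃ 2 (λ _ _ → tt) (λ _ _ → refl) (λ _ _ → refl) i₃
    go (there (there (there (there (there (there (there (there (there (here (_ , _ , _ , refl))))))))))) =
      rid [] tt′ b₃ 3 (λ _ _ → tt) (λ _ _ → refl) (λ _ _ → refl) i₃
    go (there (there (there (there (there (there (there (there (there (there (here (_ , _ , _ , refl)))))))))))) =
      rid [] tt′ b₄ 3 (λ _ _ → tt) (λ _ _ → refl) (λ _ _ → refl) i₄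
    go (there (there (there (there (there (there (there (there (there (there (there (here (_ , _ , _ , refl))))))))))))) =
      rid (1 ∷ []) (x₄ ≼ # 1 ∧ # 1 ≼ x₄) b₁ 3 (λ _ _ → ℕP.≤-refl , ℕP.≤-refl) (λ _ _ → refl) (λ _ _ → refl)
        (there (here (1 , 0 , (ℕP.≤-refl , 2≤N) , refl)))

  D-neg : ∀ {κ} → κ ∈~ D → map -_ κ ∈~ D
  D-neg (κ' , k , e) = ∈~-resp (neg-≈ e) (D-symmetric k)

  level-facet : ∀ {τ} → In N levelF τ → τ ∈~ D
  level-facet {τ} i = from (in-facet C (AnyP.++⁺ˡ {xs = halfF} (AnyP.++⁺ˡ {xs = levelF} i)))
    where
    off : ∀ {κ} → τ ≈ κ → ¬ Face B κ
    off e F = let β , b , s = face⁻ F in level-ball-apart 2≤N i (ball-in 2≤N b) (λ p → s (proj₁ e p))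
    off⁻ : ∀ {κ} → τ ≈ κ → ¬ Face (neg B) κ
    off⁻ e F = let β , b , s = face⁻ F ; β' , b' , e' = ∈-negᶜ⁻ b in
      level-neg-apart 2≤N i (in-mirror (ball-in 2≤N b')) (subst (τ ⊆_) e' (λ p → s (proj₁ e p)))
    from : τ ∈~ K → τ ∈~ D
    from (κ , k , e) = κ , D-old k (off e) (off⁻ e) , e

  private
    split : ℕ → ℕ → Term → List Case
    split k l P = case x₃ ↑ 1 ≼ x₁ then k at x₂ , x₃ ∷ case x₁ ≼ x₃ then l at P , # 0 ∷ []

    -- Inverts `old-in` and `top-in`: a left-over facet with x₃ < N was left over before, one with
    -- x₃ = N is a new cone, and the next ball consists of new cones. Positions 7 to 18 are `topF`,
    -- and 30 is the mirror of its last member.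
    half-cases : List (List Case)
    half-cases =
      (split 0 7 x₂) ∷ (split 1 8 x₂) ∷ (split 2 9 (# 0)) ∷ (split 3 10 (# 0)) ∷ (split 4 11 (# 0)) ∷
      (case tt′ then 5 at # 0 , # 0 ∷ []) ∷ (case tt′ then 6 at # 0 , # 0 ∷ []) ∷
      (case x₂ ↑ 1 ≼ x₁ then 12 at x₂ , # 0 ∷ case x₁ ≼ x₂ then 13 at # 0 , # 0 ∷ []) ∷
      (case x₂ ↑ 1 ≼ x₁ then 14 at x₂ , # 0 ∷ case x₁ ≼ x₂ then 15 at # 0 , # 0 ∷ []) ∷
      (case tt′ then 16 at # 0 , # 0 ∷ []) ∷ (case tt′ then 17 at # 0 , # 0 ∷ []) ∷ (case tt′ then 30 at # 0 , # 0 ∷ []) ∷ []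

    half-in : ∀ {τ} → In (1 + N) halfF τ → ∃ λ τ' → In N (levelF ++ topF ++ mirror topF) τ' × τ ⊆ τ'
    half-in i = all-cover 0 (# 2 ≼ x₁) (map (shifted 1) halfF) (levelF ++ topF ++ mirror topF) half-cases
      (λ _ → 2≤N) (in-shifted 1 halfF i)

    target : ∀ {τ'} → In N (levelF ++ topF ++ mirror topF) τ' → τ' ∈~ D
    target j = [ level-facet , (λ b → [ top-facet , mirrored-top ]′ (AnyP.++⁻ topF b)) ]′ (AnyP.++⁻ levelF j)
      where
      mirrored-top : ∀ {τ'} → In N (mirror topF) τ' → τ' ∈~ D
      mirrored-top d = let σ , d' , e = in-mirror⁻ topF d in subst (_∈~ D) (sym e) (D-neg (top-facet d'))

  half-facet : ∀ {τ} → In (1 + N) halfF τ → τ ∈~ D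
  half-facet {τ} i = enlarge (proj₂ (proj₂ (half-in i))) (target (proj₁ (proj₂ (half-in i))))
    where
    enlarge : ∀ {τ'} → τ ⊆ τ' → τ' ∈~ D → τ ∈~ D
    enlarge s (κ , k , e) = κ , k , (λ p → proj₁ e (s p)) ,
      same-size (half-simplices (ℕP.m≤n⇒m≤1+n 2≤N) i) (proj₁ D-good k) (λ p → proj₁ e (s p))

  closed : Closed (1 + N) D
  closed = record { facet-in = f ; in-facet = g }
    where
    mirrored : ∀ {κ τ} → map -_ κ ⊆ τ → κ ⊆ map -_ τ
    mirrored s p = ∈-neg⁺′ (s (∈-neg⁺ p))
    In′ : Simplex → Set
    In′ κ = ∃ λ τ → In (1 + N) facetF τ × κ ⊆ τ
    negative : ∀ {κ} → In′ (map -_ κ) → In′ κ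
    negative (τ , i , s) = map -_ τ , facetF-neg i , mirrored s
    old : ∀ {κ τ} → κ ∈ K → ¬ Face B κ → κ ⊆ τ → In N halfF τ → In′ κ
    old k n s i = let τ' , j , s' = half-old k n i s in τ' , AnyP.++⁺ˡ {xs = halfF} j , s'
    old⁻ : ∀ {κ τ} → κ ∈ K → ¬ Face (neg B) κ → κ ⊆ τ → In N (mirror halfF) τ → In′ κ
    old⁻ {κ} k n s i = let σ , j , e = in-mirror⁻ halfF i in halves (subst (κ ⊆_) e s) (AnyP.++⁻ levelF j)
      where
      halves : ∀ {σ} → κ ⊆ map -_ σ → In N levelF σ ⊎ In N ballF σ → In′ κ
      halves s (inj₁ l) = let τ' , i' , s' = old-in l in map -_ τ' , AnyP.++⁺ʳ halfF (in-mirror i') , (λ p → neg-⊆ s' (s p))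
      halves s (inj₂ b) = ⊥-elim (n (face⁺ (∈-negᶜ⁺ (in-ball 2≤N b)) s))
    cone⁻ : ∀ {ρ} → ρ ∈ bd (neg B) → In′ (-[1+ 2 + N ] ∷ ρ)
    cone⁻ {ρ} r = let ρ' , r' , e = proj₂ (neg-bd B) (subst (ρ ∈_) (sym (∂≡bd (neg B))) r)
                      ρ'' , r'' , e' = ∈-negᶜ⁻ r'
                      τ , i , s = cone-in r''
                  in negative (τ , i , λ
                    { (here refl) → s (here refl)
                    ; (there p) → s (there (neg-⊆′ {_} {ρ''} (subst (ρ ⊆_) e' (proj₁ e)) p)) })
    f′ : ∀ {κ} → (κ ∈ K × ¬ Face B κ × ¬ Face (neg B) κ) ⊎
      (∃ λ ρ → ρ ∈ ∂ B × κ ≡ + (3 + N) ∷ ρ) ⊎ (∃ λ ρ → ρ ∈ bd (neg B) × κ ≡ -[1+ 2 + N ] ∷ ρ) → In′ κ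
    f′ (inj₁ (k , n , n')) = let τ , i , s = facet-in C k in [ old k n s , old⁻ k n' s ]′ (AnyP.++⁻ halfF i)
    f′ (inj₂ (inj₁ (ρ , r , refl))) = cone-in r
    f′ (inj₂ (inj₂ (ρ , r , refl))) = cone⁻ r
    f : ∀ {κ} → κ ∈ D → In′ κ
    f p = f′ (D⁻ p)
    g : ∀ {τ} → In (1 + N) facetF τ → τ ∈~ D
    g i = [ half-facet , (λ j → let σ , j' , e = in-mirror⁻ halfF j in subst (_∈~ D) (sym e) (D-neg (half-facet j'))) ]′ (AnyP.++⁻ halfF i)

private
  constant : ℤ → Vertex
  constant (+ n) = pos (# n)
  constant -[1+ n ] = neg′ (# (suc n))

  inst-constant : ∀ σ xs → inst (map constant σ) xs ≡ σ
  inst-constant [] xs = refl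
  inst-constant (+ n ∷ σ) xs = cong₂ _∷_ (cong +_ (ℕP.+-identityʳ n)) (inst-constant σ xs)
  inst-constant (-[1+ n ] ∷ σ) xs = cong₂ _∷_ (cong -[1+_] (ℕP.+-identityʳ n)) (inst-constant σ xs)

  crossF : List Family
  crossF = map (λ κ → tt′ , map constant κ) (cross 4)

  in-cross : ∀ {N κ} L → In N (map (λ κ → tt′ , map constant κ) L) κ → κ ∈ L
  in-cross (σ ∷ L) (here (_ , _ , _ , e)) = here (trans e (inst-constant σ _))
  in-cross (σ ∷ L) (there i) = there (in-cross L i)

  cross-in : ∀ {N κ} L → κ ∈ L → In N (map (λ κ → tt′ , map constant κ) L) κ
  cross-in (σ ∷ L) (here refl) = here (0 , 0 , tt , sym (inst-constant σ _))
  cross-in (σ ∷ L) (there i) = there (cross-in L i)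

  N=2 : Formula
  N=2 = # 2 ≼ x₁ ∧ x₁ ≼ # 2

  -- For N = 2 every family with constrained parameters is empty or forces them to be 1, so trying
  -- the value 1 finds all sixteen facets.
  search : List Family → Family → List Case
  search Gs F = filterᵇ (case? 5 0 (bound F ∧ N=2) (template F) Gs) (map (λ k → case tt′ then k at # 1 , # 1) (upTo (length Gs)))

cross-closed : Closed 2 (cross 4)
cross-closed = record { facet-in = f ; in-facet = g }
  where
  two : ∀ xs → ⟦ N=2 ⟧ (2 ∷ xs)
  two _ = ℕP.≤-refl , ℕP.≤-refl
  f : ∀ {κ} → κ ∈ cross 4 → ∃ λ τ → In 2 facetF τ × κ ⊆ τ
  f k = all-cover 0 N=2 crossF facetF (map (search facetF) crossF) two (cross-in (cross 4) k)
  g : ∀ {τ} → In 2 facetF τ → τ ∈~ cross 4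
  g i with all-cover 0 N=2 facetF crossF (map (search crossF) facetF) two i
  ... | κ , j , s = κ , in-cross (cross 4) j , s ,
    same-size (facet-simplices ℕP.≤-refl i) (proj₁ (Sphere.good cross-Sphere) (in-cross (cross 4) j)) s

Δ3-sphere : ∀ k → Sphere (4 + k) (Δ3 (4 + k)) × Closed (2 + k) (Δ3 (4 + k))
Δ3-sphere zero = cross-Sphere , cross-closed
Δ3-sphere (suc k) = let S , C = Δ3-sphere k in
  subst (λ D → Sphere (5 + k) D × Closed (3 + k) D) (Build.D≡ (suc k) (s≤s z≤n) S C)
    (Build.stepped (suc k) (s≤s z≤n) S C , Build.closed (suc k) (s≤s z≤n) S C)

-- The facets of B(I) and their gluing order

neg-+ : ∀ a b → - (+ (a + b)) ℤ.+ + a ≡ - (+ b)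
neg-+ a b = trans (ℤP.+-comm (- (+ (a + b))) (+ a))
  (trans (cong (λ x → + a ℤ.+ x) (trans (cong -_ (ℤP.pos-+ a b)) (ℤP.neg-distrib-+ (+ a) (+ b))))
  (trans (sym (ℤP.+-assoc (+ a) (- (+ a)) (- (+ b))))
  (trans (cong (λ x → x ℤ.+ - (+ b)) (ℤP.+-inverseʳ (+ a))) (ℤP.+-identityˡ _))))

pos-- : ∀ a b → + (a + b) ℤ.- + a ≡ + b
pos-- a b = trans (sym (trans (ℤP.neg-distrib-+ (- (+ (a + b))) (+ a))
  (cong (λ x → x ℤ.- + a) (ℤP.neg-involutive (+ (a + b))))))
  (trans (cong -_ (neg-+ a b)) (ℤP.neg-involutive (+ b)))

+-shift : ∀ i d → i + (2 + d) ≡ 2 + (i + d)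
+-shift i d = trans (ℕP.+-suc i (1 + d)) (cong suc (ℕP.+-suc i d))

-- With n = N + 2, an index i of I enters as d = N - i, and a parameter m as
-- μ = n - m - 1, so that no subtraction is left in the facets of B(I).
module Facets (N : ℕ) where

  f₁ f₂ f₃ f₄ : Simplex
  f₁ = + 1 ∷ + 2 ∷ + (1 + N) ∷ + (2 + N) ∷ []
  f₂ = + 1 ∷ - (+ N) ∷ + (1 + N) ∷ + (2 + N) ∷ []
  f₃ = + 1 ∷ - (+ N) ∷ -[1+ N ] ∷ + (2 + N) ∷ []
  f₄ = + 1 ∷ - (+ N) ∷ -[1+ N ] ∷ -[1+ 1 + N ] ∷ []

  f₀ f₅ f₆ : ℕ → Simplex
  f₀ i = + 1 ∷ + 2 ∷ + i ∷ + (2 + i) ∷ []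
  f₅ μ = - (+ μ) ∷ -[1+ μ ] ∷ + (1 + N) ∷ + (2 + N) ∷ []
  f₆ d = + 1 ∷ - (+ d) ∷ + (1 + d) ∷ + (3 + d) ∷ []

  f₇ : ℕ → ℕ → Simplex
  f₇ d μ = - (+ μ) ∷ -[1+ μ ] ∷ + (1 + d) ∷ + (3 + d) ∷ []

  -- The default 0 is N - (n - 2), in accordance with the convention i_{p+1} = n - 2.
  hd : List ℕ → ℕ
  hd [] = 0
  hd (d ∷ _) = d

  data Block : List ℕ → Simplex → Set where
    start : ∀ {d ds} → Block (d ∷ ds) (f₆ d)
    run   : ∀ {d ds μ} → hd ds < μ → μ < d → Block (d ∷ ds) (f₇ d μ)
    next  : ∀ {d ds κ} → Block ds κ → Block (d ∷ ds) κ

  data Facet (ds : List ℕ) : Simplex → Set where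
    low : ∀ {i} → 3 ≤ i → i ≤ N → Facet ds (f₀ i)
    m₁ : Facet ds f₁
    m₂ : Facet ds f₂
    m₃ : Facet ds f₃
    m₄ : Facet ds f₄
    run₀ : ∀ {μ} → hd ds < μ → μ < N → Facet ds (f₅ μ)
    block : ∀ {κ} → Block ds κ → Facet ds κ

  private
    n : ℕ
    n = 2 + N

    quad : ℤ → ℤ → ℤ → ℤ → Simplex
    quad a b x y = a ∷ b ∷ x ∷ y ∷ []

    run-eq : ∀ m μ (x y : ℤ) → m + μ ≡ 1 + N →
      quad (- z n ℤ.+ z m ℤ.+ z 1) (- z n ℤ.+ z m) x y ≡ quad (- (+ μ)) -[1+ μ ] x y
    run-eq m μ x y e = cong₂ (λ a b → quad a b x y) (trans (cong (λ x → x ℤ.+ + 1) v) (neg-+ 1 μ)) v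
      where
      v : - z n ℤ.+ z m ≡ -[1+ μ ]
      v = trans (cong (λ k → - (+ k) ℤ.+ + m) (trans (cong suc (sym e)) (sym (ℕP.+-suc m μ)))) (neg-+ m (suc μ))

    low-eq : ∀ i d → i + d ≡ N → z n ℤ.- z i ℤ.- z 1 ≡ + (1 + d)
    low-eq i d refl = trans (cong (λ x → x ℤ.- + 1) (trans (cong (λ k → + k ℤ.- + i) (sym (+-shift i d))) (pos-- i (2 + d)))) (pos-- 1 (1 + d))

    high-eq : ∀ i d → i + d ≡ N → z n ℤ.- z i ℤ.+ z 1 ≡ + (3 + d)
    high-eq i d refl = trans (cong (λ x → x ℤ.+ + 1) (trans (cong (λ k → + k ℤ.- + i) (sym (+-shift i d))) (pos-- i (2 + d))))
      (cong +_ (ℕP.+-comm (2 + d) 1))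

    start-eq : ∀ i d → i + d ≡ N →
      quad (z 1) (- z n ℤ.+ z i ℤ.+ z 2) (z n ℤ.- z i ℤ.- z 1) (z n ℤ.- z i ℤ.+ z 1) ≡ f₆ d
    start-eq i d e = trans
      (cong (λ a → quad (+ 1) a _ _) (trans (cong (λ x → x ℤ.+ + 2) v) (neg-+ 2 d)))
      (cong₂ (λ a b → quad (+ 1) (- (+ d)) a b) (low-eq i d e) (high-eq i d e))
      where
      v : - z n ℤ.+ z i ≡ -[1+ 1 + d ]
      v = trans (cong (λ k → - (+ k) ℤ.+ + i) (trans (cong (λ k → 2 + k) (sym e)) (sym (+-shift i d)))) (neg-+ i (2 + d))

    blockL : ℕ → ℕ → Cx
    blockL i i' =
      (z 1 ∷ (- z n ℤ.+ z i ℤ.+ z 2) ∷ (z n ℤ.- z i ℤ.- z 1) ∷ (z n ℤ.- z i ℤ.+ z 1) ∷ [])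
      ∷ map (λ m → (- z n ℤ.+ z m ℤ.+ z 1) ∷ (- z n ℤ.+ z m) ∷ (z n ℤ.- z i ℤ.- z 1) ∷ (z n ℤ.- z i ℤ.+ z 1) ∷ [])
            (range (i ℕ.+ 2) i')

    block-eq : ∀ i d m μ → i + d ≡ N → m + μ ≡ 1 + N →
      quad (- z n ℤ.+ z m ℤ.+ z 1) (- z n ℤ.+ z m) (z n ℤ.- z i ℤ.- z 1) (z n ℤ.- z i ℤ.+ z 1) ≡ f₇ d μ
    block-eq i d m μ e e' = trans (run-eq m μ _ _ e')
      (cong₂ (λ a b → quad (- (+ μ)) -[1+ μ ] a b) (low-eq i d e) (high-eq i d e))

    blockFacet : ℕ → ℕ → Simplex
    blockFacet i m = (- z n ℤ.+ z m ℤ.+ z 1) ∷ (- z n ℤ.+ z m) ∷ (z n ℤ.- z i ℤ.- z 1) ∷ (z n ℤ.- z i ℤ.+ z 1) ∷ []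

    runFacet : ℕ → Simplex
    runFacet m = (- z n ℤ.+ z m ℤ.+ z 1) ∷ (- z n ℤ.+ z m) ∷ z (n ∸ 1) ∷ z n ∷ []

    μ-of : ∀ {m} → m ≤ N → m + (1 + N ∸ m) ≡ 1 + N
    μ-of m≤ = ℕP.m+[n∸m]≡n (ℕP.m≤n⇒m≤1+n m≤)

    -- m ↦ 1 + N ∸ m reverses order.
    flip-< : ∀ {a b c e} → a + b ≡ 1 + N → c + e ≡ N → a ≤ c → e < b
    flip-< {a} {b} {c} {e} p q l = ℕP.+-cancelˡ-≤ c (suc e) b
      (subst (_≤ c + b) (sym (trans (ℕP.+-suc c e) (trans (cong suc q) (sym p)))) (ℕP.+-monoˡ-≤ b l))

    flip-<′ : ∀ {a b c e} → a + b ≡ 1 + N → c + e ≡ N → c + 2 ≤ a → b < e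
    flip-<′ {a} {b} {c} {e} p q l = ℕP.+-cancelˡ-≤ (1 + c) (suc b) e
      (subst₂ _≤_ (trans (cong (λ x → x + b) (ℕP.+-comm c 2)) (cong suc (sym (ℕP.+-suc c b)))) (trans p (cong suc (sym q))) (ℕP.+-monoˡ-≤ b l))

    unflip : ∀ {a b c e} → a + b ≡ 1 + N → c + e ≡ N → e < b → a ≤ c
    unflip {a} {b} {c} {e} p q l = ℕP.≮⇒≥ λ c<a → ℕP.<⇒≱ l (ℕP.+-cancelˡ-≤ c b e
      (ℕP.≤-pred (subst (suc c + b ≤_) (trans p (cong suc (sym q))) (ℕP.+-monoˡ-≤ b c<a))))

    unflip′ : ∀ {a b c e} → a + b ≡ 1 + N → c + e ≡ N → b < e → c + 2 ≤ a
    unflip′ {a} {b} {c} {e} p q l = ℕP.≮⇒≥ λ a<c+2 → ℕP.<⇒≱ l (ℕP.+-cancelˡ-≤ c e b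
      (ℕP.≤-pred (subst (_≤ suc c + b) (trans p (cong suc (sym q)))
        (ℕP.+-monoˡ-≤ b (ℕP.≤-pred (subst (a <_) (ℕP.+-comm c 2) a<c+2))))))

    co : ∀ {i} → i ≤ N → i + (N ∸ i) ≡ N
    co = ℕP.m+[n∸m]≡n

    co′ : ∀ {d} → d ≤ 1 + N → (1 + N ∸ d) + d ≡ 1 + N
    co′ = ℕP.m∸n+n≡m

    blockL⁻ : ∀ {i i' κ} → i ≤ N → i' ≤ N → κ ∈ blockL i i' →
      κ ≡ f₆ (N ∸ i) ⊎ ∃ λ μ → N ∸ i' < μ × μ < N ∸ i × κ ≡ f₇ (N ∸ i) μ
    blockL⁻ {i} i≤ i'≤ (here refl) = inj₁ (start-eq i (N ∸ i) (co i≤))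
    blockL⁻ {i} {i'} i≤ i'≤ (there k) with ∈-map⁻ (blockFacet i) k
    ... | m , m∈ , refl = let a , b = ∈-range⁻ (i + 2) i' m∈ ; m≤ = ℕP.≤-trans b i'≤ in
      inj₂ (1 + N ∸ m , flip-< (μ-of m≤) (co i'≤) b , flip-<′ (μ-of m≤) (co i≤) a ,
        block-eq i (N ∸ i) m (1 + N ∸ m) (co i≤) (μ-of m≤))

    blockL⁺ : ∀ {i i' μ} → i ≤ N → i' ≤ N → N ∸ i' < μ → μ < N ∸ i → f₇ (N ∸ i) μ ∈ blockL i i'
    blockL⁺ {i} {i'} {μ} i≤ i'≤ a b = there (subst (_∈ map (blockFacet i) (range (i + 2) i'))
      (block-eq i (N ∸ i) (1 + N ∸ μ) μ (co i≤) (co′ μ≤))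
      (∈-map⁺ (blockFacet i) (∈-range⁺ (unflip′ (co′ μ≤) (co i≤) b) (unflip (co′ μ≤) (co i'≤) a))))
      where
      μ≤ : μ ≤ 1 + N
      μ≤ = ℕP.<⇒≤ (ℕP.<-≤-trans b (ℕP.≤-trans (ℕP.m∸n≤m N i) (ℕP.n≤1+n N)))

    first≤ : ∀ {I} → All (_≤ N) I → first n I ≤ N
    first≤ [] = ℕP.≤-refl
    first≤ (p ∷ _) = p

    hd-first : ∀ I → hd (map (N ∸_) I) ≡ N ∸ first n I
    hd-first [] = sym (ℕP.n∸n≡0 N)
    hd-first (i ∷ I) = refl

    pairs-cons : ∀ i I → pairs n (i ∷ I) ≡ (i , first n I) ∷ pairs n I
    pairs-cons i [] = refl
    pairs-cons i (j ∷ I) = refl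

    InBlock : Simplex → ℕ × ℕ → Set
    InBlock κ p = κ ∈ blockL (proj₁ p) (proj₂ p)

    pairs⁻ : ∀ {I κ} → All (_≤ N) I → Any (InBlock κ) (pairs n I) → Block (map (N ∸_) I) κ
    pairs⁻ {i ∷ I} {κ} (p ∷ ps) k with subst (Any (InBlock κ)) (pairs-cons i I) k
    ... | there l = next (pairs⁻ ps l)
    ... | here l with blockL⁻ p (first≤ ps) l
    ...   | inj₁ refl = start
    ...   | inj₂ (μ , a , b , refl) = run (subst (_< μ) (sym (hd-first I)) a) b

    pairs⁺ : ∀ {I κ} → All (_≤ N) I → Block (map (N ∸_) I) κ → Any (InBlock κ) (pairs n I)
    pairs⁺ {i ∷ I} {κ} (p ∷ ps) b = subst (Any (InBlock κ)) (sym (pairs-cons i I)) (go b)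
      where
      go : Block (map (N ∸_) (i ∷ I)) κ → Any (InBlock κ) ((i , first n I) ∷ pairs n I)
      go start = here (here (sym (start-eq i (N ∸ i) (co p))))
      go (run {μ = μ} a b) = here (blockL⁺ p (first≤ ps) (subst (_< μ) (hd-first I) a) b)
      go (next b) = there (pairs⁺ ps b)

    m₂-eq : quad (z 1) (- z n ℤ.+ z 2) (z (n ∸ 1)) (z n) ≡ f₂
    m₂-eq = cong (λ a → quad (+ 1) a (+ (1 + N)) (+ (2 + N))) (neg-+ 2 N)

    m₃-eq : quad (z 1) (- z n ℤ.+ z 2) (- z n ℤ.+ z 1) (z n) ≡ f₃
    m₃-eq = cong₂ (λ a b → quad (+ 1) a b (+ (2 + N))) (neg-+ 2 N) (neg-+ 1 (1 + N))

    m₄-eq : quad (z 1) (- z n ℤ.+ z 2) (- z n ℤ.+ z 1) (- z n) ≡ f₄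
    m₄-eq = cong₂ (λ a b → quad (+ 1) a b -[1+ 1 + N ]) (neg-+ 2 N) (neg-+ 1 (1 + N))

    low-list : Cx
    low-list = map (λ i → z 1 ∷ z 2 ∷ z i ∷ z (i ℕ.+ 2) ∷ []) (range 3 (n ∸ 2))

    runs : List ℕ → Cx
    runs I = map (λ m → (- z n ℤ.+ z m ℤ.+ z 1) ∷ (- z n ℤ.+ z m) ∷ z (n ∸ 1) ∷ z n ∷ []) (range 2 (first n I))

    low⁺ : ∀ {i} → 3 ≤ i → i ≤ N → f₀ i ∈ low-list
    low⁺ {i} a b = subst (_∈ low-list) (cong (λ k → quad (+ 1) (+ 2) (+ i) (+ k)) (ℕP.+-comm i 2)) (∈-map⁺ _ (∈-range⁺ a b))

  BI⁻ : ∀ {I κ} → All (_≤ N) I → κ ∈ BI (2 + N) I → Facet (map (N ∸_) I) κ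
  BI⁻ {I} ps k with ∈-++⁻ low-list k
  ... | inj₁ l with ∈-map⁻ _ l
  ...   | i , i∈ , refl = let a , b = ∈-range⁻ 3 N i∈ in
    subst (Facet _) (cong (λ k → quad (+ 1) (+ 2) (+ i) (+ k)) (ℕP.+-comm 2 i)) (low a b)
  BI⁻ ps k | inj₂ (here refl) = m₁
  BI⁻ ps k | inj₂ (there (here refl)) = subst (Facet _) (sym m₂-eq) m₂
  BI⁻ ps k | inj₂ (there (there (here refl))) = subst (Facet _) (sym m₃-eq) m₃
  BI⁻ ps k | inj₂ (there (there (there (here refl)))) = subst (Facet _) (sym m₄-eq) m₄
  BI⁻ {I} ps k | inj₂ (there (there (there (there l)))) with ∈-++⁻ (runs I) l
  ... | inj₂ q = block (pairs⁻ ps (∈-concatMap⁻ (λ p → blockL (proj₁ p) (proj₂ p)) {xs = pairs n I} q))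
  ... | inj₁ q with ∈-map⁻ runFacet q
  ...   | m , m∈ , refl = let a , b = ∈-range⁻ 2 (first n I) m∈ ; m≤ = ℕP.≤-trans b (first≤ ps) in
    subst (Facet _) (sym (run-eq m (1 + N ∸ m) (+ (1 + N)) (+ n) (μ-of m≤)))
      (run₀ (subst (_< 1 + N ∸ m) (sym (hd-first I)) (flip-< (μ-of m≤) (co (first≤ ps)) b)) (flip-<′ (μ-of m≤) refl a))

  BI⁺ : ∀ {I κ} → All (_≤ N) I → Facet (map (N ∸_) I) κ → κ ∈ BI (2 + N) I
  BI⁺ ps (low a b) = ∈-++⁺ˡ (low⁺ a b)
  BI⁺ ps m₁ = ∈-++⁺ʳ low-list (here refl)
  BI⁺ ps m₂ = ∈-++⁺ʳ low-list (there (here (sym m₂-eq)))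
  BI⁺ ps m₃ = ∈-++⁺ʳ low-list (there (there (here (sym m₃-eq))))
  BI⁺ ps m₄ = ∈-++⁺ʳ low-list (there (there (there (here (sym m₄-eq)))))
  BI⁺ {I} ps (run₀ {μ} a b) = ∈-++⁺ʳ low-list (there (there (there (there (∈-++⁺ˡ
    (subst (_∈ runs I) (run-eq (1 + N ∸ μ) μ (+ (1 + N)) (+ n) (co′ (ℕP.m≤n⇒m≤1+n (ℕP.<⇒≤ b))))
      (∈-map⁺ runFacet (∈-range⁺ (unflip′ (co′ (ℕP.m≤n⇒m≤1+n (ℕP.<⇒≤ b))) refl b)
        (unflip (co′ (ℕP.m≤n⇒m≤1+n (ℕP.<⇒≤ b))) (co (first≤ ps)) (subst (_< μ) (hd-first I) a))))))))))
  BI⁺ {I} ps (block b) = ∈-++⁺ʳ low-list (there (there (there (there (∈-++⁺ʳ (runs I)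
    (∈-concatMap⁺ (λ p → blockL (proj₁ p) (proj₂ p)) (pairs⁺ ps b)))))))

-- An over-approximation of B(I) that does not depend on I.
ballIF : List Family
ballIF =
  ((# 3 ≼ x₂ ∧ x₂ ≼ x₁) , pos (# 1) ∷ pos (# 2) ∷ pos x₂ ∷ pos (x₂ ↑ 2) ∷ []) ∷
  (tt′ , pos (# 1) ∷ pos (# 2) ∷ pos (x₁ ↑ 1) ∷ pos (x₁ ↑ 2) ∷ []) ∷
  (tt′ , pos (# 1) ∷ neg′ x₁ ∷ pos (x₁ ↑ 1) ∷ pos (x₁ ↑ 2) ∷ []) ∷
  (tt′ , pos (# 1) ∷ neg′ x₁ ∷ neg′ (x₁ ↑ 1) ∷ pos (x₁ ↑ 2) ∷ []) ∷
  (tt′ , pos (# 1) ∷ neg′ x₁ ∷ neg′ (x₁ ↑ 1) ∷ neg′ (x₁ ↑ 2) ∷ []) ∷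
  ((# 1 ≼ x₂ ∧ x₂ ↑ 1 ≼ x₁) , neg′ x₂ ∷ neg′ (x₂ ↑ 1) ∷ pos (x₁ ↑ 1) ∷ pos (x₁ ↑ 2) ∷ []) ∷
  ((# 4 ≼ x₂ ∧ x₂ ↑ 3 ≼ x₁) , pos (# 1) ∷ neg′ x₂ ∷ pos (x₂ ↑ 1) ∷ pos (x₂ ↑ 3) ∷ []) ∷
  ((# 1 ≼ x₂ ∧ x₂ ↑ 1 ≼ x₃ ∧ # 4 ≼ x₃ ∧ x₃ ↑ 3 ≼ x₁) , neg′ x₂ ∷ neg′ (x₂ ↑ 1) ∷ pos (x₃ ↑ 1) ∷ pos (x₃ ↑ 3) ∷ []) ∷ []

-- The part of the gluing order that is the same for all I; the runs and blocks of I follow in `T₅`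
-- and `blocks`. After the starting facet, the first entry is the new vertex.
chainIF : List Family
chainIF =
  (tt′ , pos (# 1) ∷ pos (# 2) ∷ pos (x₁ ↑ 1) ∷ pos (x₁ ↑ 2) ∷ []) ∷
  ((# 3 ≼ x₂ ∧ x₂ ≼ x₁) , pos x₂ ∷ pos (# 1) ∷ pos (# 2) ∷ pos (x₂ ↑ 2) ∷ []) ∷
  (tt′ , neg′ x₁ ∷ pos (# 1) ∷ pos (x₁ ↑ 1) ∷ pos (x₁ ↑ 2) ∷ []) ∷
  (tt′ , neg′ (x₁ ↑ 1) ∷ pos (# 1) ∷ neg′ x₁ ∷ pos (x₁ ↑ 2) ∷ []) ∷
  (tt′ , neg′ (x₁ ↑ 2) ∷ pos (# 1) ∷ neg′ x₁ ∷ neg′ (x₁ ↑ 1) ∷ []) ∷ []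

-- The condition on the numbers d = N - i: increasing i makes them decrease, i ≤ n - 6 becomes d ≥
-- 4, and i ≥ 3 becomes d < N - 2.
Desc : ℕ → List ℕ → Set
Desc b [] = ⊤
Desc b (d ∷ ds) = 4 ≤ d × d < b × Desc d ds

module Stacking (N : ℕ) (8≤N : 8 ≤ N) where

  open Facets N

  g₀ : ℕ → Simplex
  g₀ i = + i ∷ + 1 ∷ + 2 ∷ + (2 + i) ∷ []

  g₂ g₃ g₄ : Simplex
  g₂ = - (+ N) ∷ + 1 ∷ + (1 + N) ∷ + (2 + N) ∷ []
  g₃ = -[1+ N ] ∷ + 1 ∷ - (+ N) ∷ + (2 + N) ∷ []
  g₄ = -[1+ 1 + N ] ∷ + 1 ∷ - (+ N) ∷ -[1+ N ] ∷ []

  g₆ : ℕ → Simplex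
  g₆ d = - (+ d) ∷ + 1 ∷ + (1 + d) ∷ + (3 + d) ∷ []

  T₀ T₁ T₂ T₃ T₄ : Cx
  T₀ = f₁ ∷ []
  T₁ = down g₀ 3 (N ∸ 2) T₀
  T₂ = g₂ ∷ T₁
  T₃ = g₃ ∷ T₂
  T₄ = g₄ ∷ T₃

  take : ℕ → List Family
  take k = Data.List.take k chainIF

  2≤N : 2 ≤ N
  2≤N = ℕP.≤-trans (s≤s (s≤s z≤n)) 8≤N

  3+ : 3 + (N ∸ 2) ≡ 1 + N
  3+ = cong suc (ℕP.m+[n∸m]≡n 2≤N)

  in₁ : ∀ {κ} → κ ∈ T₁ → In N (take 2) κ
  in₁ k with ∈-down⁻ g₀ 3 (N ∸ 2) k
  ... | inj₁ (here refl) = here (0 , 0 , tt , refl)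
  ... | inj₂ (i , a , b , refl) = there (here (i , 0 , (a , ℕP.≤-pred (subst (i <_) 3+ b)) , refl))

  in₂ : ∀ {κ} → κ ∈ T₂ → In N (take 3) κ
  in₂ (here refl) = there (there (here (0 , 0 , tt , refl)))
  in₂ (there k) = AnyP.++⁺ˡ {xs = take 2} (in₁ k)

  in₃ : ∀ {κ} → κ ∈ T₃ → In N (take 4) κ
  in₃ (here refl) = there (there (there (here (0 , 0 , tt , refl))))
  in₃ (there k) = AnyP.++⁺ˡ {xs = take 3} (in₂ k)

  in₄ : ∀ {κ} → κ ∈ T₄ → In N chainIF κ
  in₄ (here refl) = there (there (there (there (here (0 , 0 , tt , refl)))))
  in₄ (there k) = AnyP.++⁺ˡ {xs = take 4} (in₃ k)

  g₀∈ : ∀ {i} → 3 ≤ i → i ≤ N → g₀ i ∈ T₁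
  g₀∈ {i} a b = ∈-downʳ g₀ 3 (N ∸ 2) i a (subst (i <_) (sym 3+) (s≤s b))

  private
    large : ∀ xs → ⟦ # 8 ≼ x₁ ⟧ (N ∷ xs)
    large _ = 8≤N

  stacked₁ : Stacked T₁
  stacked₁ = stacked-down +_ (λ i → + 1 ∷ + 2 ∷ + (2 + i) ∷ [])
    (simplex (simplex-inst (N ∷ []) (# 8 ≼ x₁) (pos (# 1) ∷ pos (# 2) ∷ pos (x₁ ↑ 1) ∷ pos (x₁ ↑ 2) ∷ []) 8≤N))
    3 (N ∸ 2)
    (λ i a b → fresh-in (take 1) N (i ∷ []) (# 3 ≼ x₄ ∧ x₄ ≼ x₁) (pos x₄)
      (λ _ _ → a , ℕP.≤-pred (subst (i <_) 3+ b)) (λ { (here refl) → here (0 , 0 , tt , refl) }) (λ _ _ → refl))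
    (λ i j a b c x∈ → prove (N ∷ i ∷ j ∷ []) (# 3 ≼ x₂ ∧ x₂ ↑ 1 ≼ x₃ ∧
       mem (pos x₂) (pos x₃ ∷ pos (# 1) ∷ pos (# 2) ∷ pos (x₃ ↑ 2) ∷ [])) ff′
       (a , b , mem⁺ {N ∷ i ∷ j ∷ []} (pos x₂) (pos x₃ ∷ pos (# 1) ∷ pos (# 2) ∷ pos (x₃ ↑ 2) ∷ []) x∈))
    (λ i a b → simplex-inst (N ∷ i ∷ []) (# 3 ≼ x₂) (pos (# 1) ∷ pos (# 2) ∷ pos (x₂ ↑ 2) ∷ []) a)
    (λ i a b → tri i (ℕP.≤-pred (subst (i <_) 3+ b)))
    where
    A⊆ : ∀ {i} → + 1 ∷ + 2 ∷ + (2 + i) ∷ [] ⊆ g₀ (2 + i)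
    A⊆ (here e) = there (here e)
    A⊆ (there (here e)) = there (there (here e))
    A⊆ (there (there (here e))) = here e
    tri : ∀ i → i ≤ N → (∃ λ τ → τ ∈ T₀ × + 1 ∷ + 2 ∷ + (2 + i) ∷ [] ⊆ τ) ⊎
      (∃ λ j → i < j × j < 3 + (N ∸ 2) × + 1 ∷ + 2 ∷ + (2 + i) ∷ [] ⊆ g₀ j)
    tri i b with 2 + i ℕ.≤? N
    ... | yes l = inj₂ (2 + i , ℕP.n≤1+n (suc i) , subst (2 + i <_) (sym 3+) (s≤s l) , A⊆)
    -- For i = N - 1 and i = N the vertex i + 2 is n - 1 or n, so the base lies in the starting
    -- facet.
    ... | no n = inj₁ (f₁ , here refl , ⊆-inst (N ∷ i ∷ []) (x₂ ≼ x₁ ∧ x₁ ↑ 1 ≼ x₂ ↑ 2)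
            (pos (# 1) ∷ pos (# 2) ∷ pos (x₂ ↑ 2) ∷ []) (pos (# 1) ∷ pos (# 2) ∷ pos (x₁ ↑ 1) ∷ pos (x₁ ↑ 2) ∷ [])
            (b , ℕP.≰⇒> n))

  stacked₄ : Stacked T₄
  stacked₄ = stack (stack (stack stacked₁
      (fresh-in (take 2) N [] (# 8 ≼ x₁) (neg′ x₁) (λ _ _ → 8≤N) in₁ (λ _ _ → refl))
      (simplex-inst (N ∷ []) (# 8 ≼ x₁) (pos (# 1) ∷ pos (x₁ ↑ 1) ∷ pos (x₁ ↑ 2) ∷ []) 8≤N)
      (∈-downˡ g₀ 3 (N ∸ 2) (here refl))
      (λ { (here e) → here e ; (there p) → there (there p) }))
      (fresh-in (take 3) N [] (# 8 ≼ x₁) (neg′ (x₁ ↑ 1)) (λ _ _ → 8≤N) in₂ (λ _ _ → refl))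
      (simplex-inst (N ∷ []) (# 8 ≼ x₁) (pos (# 1) ∷ neg′ x₁ ∷ pos (x₁ ↑ 2) ∷ []) 8≤N) (here refl)
      (⊆-inst (N ∷ []) tt′ (pos (# 1) ∷ neg′ x₁ ∷ pos (x₁ ↑ 2) ∷ []) (neg′ x₁ ∷ pos (# 1) ∷ pos (x₁ ↑ 1) ∷ pos (x₁ ↑ 2) ∷ []) tt))
    (fresh-in (take 4) N [] (# 8 ≼ x₁) (neg′ (x₁ ↑ 2)) (λ _ _ → 8≤N) in₃ (λ _ _ → refl))
    (simplex-inst (N ∷ []) (# 8 ≼ x₁) (pos (# 1) ∷ neg′ x₁ ∷ neg′ (x₁ ↑ 1) ∷ []) 8≤N) (here refl)
    (⊆-inst (N ∷ []) tt′ (pos (# 1) ∷ neg′ x₁ ∷ neg′ (x₁ ↑ 1) ∷ []) (neg′ (x₁ ↑ 1) ∷ pos (# 1) ∷ neg′ x₁ ∷ pos (x₁ ↑ 2) ∷ []) tt)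

  hd-< : ∀ {b} ds → 0 < b → Desc b ds → hd ds < b
  hd-< [] p _ = p
  hd-< (d ∷ ds) _ (_ , l , _) = l

  -- The part of a run of facets below the facet indexed by d ∈ {d', …, b}.
  span : ℕ → List ℕ → ℕ
  span b ds = b ∸ suc (hd ds)

  span-eq : ∀ {b} ds → hd ds < b → suc (hd ds) + span b ds ≡ b
  span-eq ds l = ℕP.m+[n∸m]≡n l

  -- The blocks continue the descent through the negative vertices. The facet g₆ d brings -d and is
  -- glued along {1, d+1, d+3} to {1, 2, d+1, d+3}; the run after it brings -(d-1), ..., -(d'+1),
  -- where d' is the next entry, or 0 if there is none.
  blocks : List ℕ → Cx → Cx
  blocks [] B = B
  blocks (d ∷ ds) B = blocks ds (down (f₇ d) (suc (hd ds)) (span d ds) (g₆ d ∷ B))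

  T₅ : List ℕ → Cx
  T₅ ds = down f₅ (suc (hd ds)) (span N ds) T₄

  -- A run of facets {-μ, -(μ+1), y, w}, stacked with decreasing μ.
  stacked-run : ∀ y w {B} ds b → + y ≢ + w → hd ds < b → Stacked B → (∀ {x} → 1 ≤ x → x < b → Fresh (- (+ x)) B) →
    (∃ λ τ → τ ∈ B × - (+ b) ∷ + suc y ∷ + suc w ∷ [] ⊆ τ) →
    Stacked (down (λ μ → - (+ μ) ∷ -[1+ μ ] ∷ + suc y ∷ + suc w ∷ []) (suc (hd ds)) (span b ds) B)
  stacked-run y w ds b y≢w l st fr base = stacked-down (λ μ → - (+ μ)) (λ μ → -[1+ μ ] ∷ + suc y ∷ + suc w ∷ []) st
    (suc (hd ds)) (span b ds)
    (λ i p q → fr (ℕP.≤-trans (s≤s z≤n) p) (subst (i <_) (span-eq ds l) q))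
    (λ i j p q r x∈ → prove (i ∷ j ∷ y ∷ w ∷ []) (# 1 ≼ x₁ ∧ x₁ ↑ 1 ≼ x₂ ∧
       mem (neg′ x₁) (neg′ x₂ ∷ neg′ (x₂ ↑ 1) ∷ pos (x₃ ↑ 1) ∷ pos (x₄ ↑ 1) ∷ [])) ff′
       (ℕP.≤-trans (s≤s z≤n) p , q , mem⁺ {i ∷ j ∷ y ∷ w ∷ []} (neg′ x₁) (neg′ x₂ ∷ neg′ (x₂ ↑ 1) ∷ pos (x₃ ↑ 1) ∷ pos (x₄ ↑ 1) ∷ []) x∈))
    (λ i p q → unique-∷ (λ { (there (here ())) ; (here ()) }) (unique-∷ (λ { (here e) → y≢w (ℤP.+-injective e ▸) }) (unique-∷ (λ ()) [])) , refl)
    (λ i p q → tri i (subst (i <_) (span-eq ds l) q))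
    where
    _▸ : ∀ {a c} → suc a ≡ suc c → + a ≡ + c
    refl ▸ = refl
    tri : ∀ i → i < b → (∃ λ τ → τ ∈ _ × -[1+ i ] ∷ + suc y ∷ + suc w ∷ [] ⊆ τ) ⊎
      (∃ λ j → i < j × j < suc (hd ds) + span b ds × -[1+ i ] ∷ + suc y ∷ + suc w ∷ [] ⊆ - (+ j) ∷ -[1+ j ] ∷ + suc y ∷ + suc w ∷ [])
    tri i q with suc i ℕ.≟ b
    ... | yes refl = inj₁ base
    ... | no n = inj₂ (suc i , ℕP.≤-refl , subst (suc i <_) (sym (span-eq ds l)) (ℕP.≤∧≢⇒< q n) ,
            λ { (here e) → here e ; (there p) → there (there p) })

  run-fresh : ∀ {x μ y w} → 1 ≤ x → x < μ → - (+ x) ∉ - (+ μ) ∷ -[1+ μ ] ∷ + y ∷ + w ∷ []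
  run-fresh {x} {μ} {y} {w} a b x∈ = prove (x ∷ μ ∷ y ∷ w ∷ []) (# 1 ≼ x₁ ∧ x₁ ↑ 1 ≼ x₂ ∧
    mem (neg′ x₁) (neg′ x₂ ∷ neg′ (x₂ ↑ 1) ∷ pos x₃ ∷ pos x₄ ∷ [])) ff′
    (a , b , mem⁺ {x ∷ μ ∷ y ∷ w ∷ []} (neg′ x₁) (neg′ x₂ ∷ neg′ (x₂ ↑ 1) ∷ pos x₃ ∷ pos x₄ ∷ []) x∈)

  g₆-fresh : ∀ {x d} → 1 ≤ x → x < d → - (+ x) ∉ g₆ d
  g₆-fresh {x} {d} a b x∈ = prove (x ∷ d ∷ []) (# 1 ≼ x₁ ∧ x₁ ↑ 1 ≼ x₂ ∧
    mem (neg′ x₁) (neg′ x₂ ∷ pos (# 1) ∷ pos (x₂ ↑ 1) ∷ pos (x₂ ↑ 3) ∷ [])) ff′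
    (a , b , mem⁺ {x ∷ d ∷ []} (neg′ x₁) (neg′ x₂ ∷ pos (# 1) ∷ pos (x₂ ↑ 1) ∷ pos (x₂ ↑ 3) ∷ []) x∈)

  stacked-blocks : ∀ {B} b ds → Desc b ds → Stacked B → (∀ {x} → 1 ≤ x → x ≤ hd ds → Fresh (- (+ x)) B) →
    (∀ {d} → d ∈ ds → g₀ (1 + d) ∈ B) → Stacked (blocks ds B)
  stacked-blocks b [] _ st _ _ = st
  stacked-blocks {B} b (d ∷ ds) (4≤d , d<b , desc) st fr tri =
    stacked-blocks d ds desc (stacked-run d (2 + d) ds d (λ ()) l st' fr' (g₆ d , here refl , sub′)) fr'' (λ e → ∈-downˡ (f₇ d) _ (span d ds) (there (tri (there e))))
    where
    1≤d : 1 ≤ d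
    1≤d = ℕP.≤-trans (s≤s z≤n) 4≤d
    l : hd ds < d
    l = hd-< ds 1≤d desc
    sub′ : - (+ d) ∷ + suc d ∷ + (3 + d) ∷ [] ⊆ g₆ d
    sub′ (here e) = here e
    sub′ (there p) = there (there p)
    st' : Stacked (g₆ d ∷ B)
    st' = stack st (fr 1≤d ℕP.≤-refl)
      (simplex-inst (d ∷ []) (# 4 ≼ x₁) (pos (# 1) ∷ pos (x₁ ↑ 1) ∷ pos (x₁ ↑ 3) ∷ []) 4≤d)
      (tri (here refl))
      (⊆-inst (d ∷ []) tt′ (pos (# 1) ∷ pos (x₁ ↑ 1) ∷ pos (x₁ ↑ 3) ∷ []) (pos (x₁ ↑ 1) ∷ pos (# 1) ∷ pos (# 2) ∷ pos (x₁ ↑ 3) ∷ []) tt)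
    fr' : ∀ {x} → 1 ≤ x → x < d → Fresh (- (+ x)) (g₆ d ∷ B)
    fr' a b (here refl) x∈ = g₆-fresh a b x∈
    fr' a b (there k) x∈ = fr a (ℕP.<⇒≤ b) k x∈
    fr'' : ∀ {x} → 1 ≤ x → x ≤ hd ds → Fresh (- (+ x)) (down (f₇ d) (suc (hd ds)) (span d ds) (g₆ d ∷ B))
    fr'' a b k x∈ with ∈-down⁻ (f₇ d) (suc (hd ds)) (span d ds) k
    ... | inj₁ k' = fr' a (ℕP.≤-<-trans b l) k' x∈
    ... | inj₂ (μ , p , _ , refl) = run-fresh a (ℕP.≤-<-trans b p) x∈

  T₄-fresh : ∀ {x} → 1 ≤ x → x < N → Fresh (- (+ x)) T₄
  T₄-fresh {x} a b = fresh-in chainIF N (x ∷ []) (# 1 ≼ x₄ ∧ x₄ ↑ 1 ≼ x₁) (neg′ x₄) (λ _ _ → a , b) in₄ (λ _ _ → refl)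

  module _ (ds : List ℕ) (desc : Desc (N ∸ 2) ds) where

    desc-N : Desc N ds
    desc-N = relax ds desc
      where
      relax : ∀ ds → Desc (N ∸ 2) ds → Desc N ds
      relax [] _ = tt
      relax (d ∷ ds) (a , b , c) = a , ℕP.<-≤-trans b (ℕP.m∸n≤m N 2) , c

    hd<N : hd ds < N
    hd<N = hd-< ds (ℕP.≤-trans (s≤s z≤n) 8≤N) desc-N

    below : ∀ {b} ds → Desc b ds → ∀ {d} → d ∈ ds → 4 ≤ d × d < b
    below (d ∷ ds) (a , b , c) (here refl) = a , b
    below (d ∷ ds) (a , b , c) (there p) = let a' , b' = below ds c p in a' , ℕP.<-trans b' b

    small : ∀ {d} → d ∈ ds → 4 ≤ d × 3 + d ≤ N
    small p = let a , b = below ds desc p in a ,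
      subst (_ ≤_) (ℕP.m+[n∸m]≡n 2≤N) (s≤s (s≤s b))

    stacked-T : Stacked (blocks ds (T₅ ds))
    stacked-T = stacked-blocks N ds desc-N
      (stacked-run N (1 + N) ds N (λ ()) hd<N stacked₄ T₄-fresh (g₂ , there (there (here refl)) , λ { (here e) → here e ; (there p) → there (there p) }))
      fr
      (λ p → let a , b = small p in ∈-downˡ f₅ _ (span N ds) (there (there (there
        (g₀∈ (ℕP.≤-trans (s≤s (s≤s (s≤s z≤n))) (s≤s a)) (ℕP.≤-trans (ℕP.n≤1+n _) (ℕP.≤-trans (ℕP.n≤1+n _) b)))))))
      where
      fr : ∀ {x} → 1 ≤ x → x ≤ hd ds → Fresh (- (+ x)) (T₅ ds)
      fr a b k x∈ with ∈-down⁻ f₅ (suc (hd ds)) (span N ds) k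
      ... | inj₁ k' = T₄-fresh a (ℕP.≤-<-trans b hd<N) k' x∈
      ... | inj₂ (μ , p , _ , refl) = run-fresh a (ℕP.≤-<-trans b p) x∈

    facet-family : ∀ {κ} → Facet ds κ → In N ballIF κ
    facet-family (low a b) = here (_ , 0 , (a , b) , refl)
    facet-family m₁ = there (here (0 , 0 , tt , refl))
    facet-family m₂ = there (there (here (0 , 0 , tt , refl)))
    facet-family m₃ = there (there (there (here (0 , 0 , tt , refl))))
    facet-family m₄ = there (there (there (there (here (0 , 0 , tt , refl)))))
    facet-family (run₀ a b) = there (there (there (there (there (here (_ , 0 , (ℕP.≤-trans (s≤s z≤n) a , b) , refl))))))
    facet-family (block b) = go small b
      where
      go : ∀ {ds κ} → (∀ {d} → d ∈ ds → 4 ≤ d × 3 + d ≤ N) → Block ds κ → In N ballIF κ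
      go sm start = there (there (there (there (there (there (here (_ , 0 , sm (here refl) , refl)))))))
      go sm (run {d} {_} {μ} a b) = there (there (there (there (there (there (there (here (μ , d ,
        (ℕP.≤-trans (s≤s z≤n) a , b , sm (here refl)) , refl))))))))
      go sm (next b) = go (λ p → sm (there p)) b

    facet-simplex : ∀ {κ} → Facet ds κ → IsSimplex 4 κ
    facet-simplex f = simplices (# 8 ≼ x₁) ballIF large (facet-family f)

    private
      swap : ∀ {a b c d : ℤ} → a ∷ b ∷ c ∷ d ∷ [] ≈ b ∷ a ∷ c ∷ d ∷ []
      swap = s , s
        where
        s : ∀ {a b : ℤ} {υ} → a ∷ b ∷ υ ⊆ b ∷ a ∷ υ
        s (here e) = there (here e)
        s (there (here e)) = here e
        s (there (there p)) = there (there p)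
      rot : ∀ {a b c d : ℤ} → c ∷ a ∷ b ∷ d ∷ [] ≈ a ∷ b ∷ c ∷ d ∷ []
      rot = (λ { (here e) → there (there (here e)) ; (there (here e)) → here e ; (there (there (here e))) → there (here e)
               ; (there (there (there p))) → there (there (there p)) }) ,
            (λ { (here e) → there (here e) ; (there (here e)) → there (there (here e)) ; (there (there (here e))) → here e
               ; (there (there (there p))) → there (there (there p)) })
      cyc : ∀ {a b c d : ℤ} → d ∷ a ∷ b ∷ c ∷ [] ≈ a ∷ b ∷ c ∷ d ∷ []
      cyc = (λ { (here e) → there (there (there (here e))) ; (there (here e)) → here e ; (there (there (here e))) → there (here e)
               ; (there (there (there (here e)))) → there (there (here e)) }) ,
            (λ { (here e) → there (here e) ; (there (here e)) → there (there (here e)) ; (there (there (here e))) → there (there (there (here e)))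
               ; (there (there (there (here e)))) → here e })

    Listed : Simplex → Set
    Listed κ = ∃ λ τ → Facet ds τ × κ ≈ τ

    T₄-listed : ∀ {κ} → κ ∈ T₄ → Listed κ
    T₄-listed (here refl) = _ , m₄ , cyc
    T₄-listed (there (here refl)) = _ , m₃ , rot
    T₄-listed (there (there (here refl))) = _ , m₂ , swap
    T₄-listed (there (there (there k))) with ∈-down⁻ g₀ 3 (N ∸ 2) k
    ... | inj₁ (here refl) = _ , m₁ , ≈-refl
    ... | inj₂ (i , a , b , refl) = _ , low a (ℕP.≤-pred (subst (i <_) 3+ b)) , rot

    blocks-listed : ∀ {b} es {B} → Desc b es → (∀ {κ} → Block es κ → Facet ds κ) → (∀ {κ} → κ ∈ B → Listed κ) →
      ∀ {κ} → κ ∈ blocks es B → Listed κ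
    blocks-listed [] _ _ h k = h k
    blocks-listed (d ∷ es) {B} (4≤d , _ , desc) f h = blocks-listed es desc (f ∘ next) h'
      where
      h' : ∀ {κ} → κ ∈ down (f₇ d) (suc (hd es)) (span d es) (g₆ d ∷ B) → Listed κ
      h' k with ∈-down⁻ (f₇ d) (suc (hd es)) (span d es) k
      ... | inj₁ (here refl) = _ , f start , swap
      ... | inj₁ (there k') = h k'
      ... | inj₂ (μ , a , b , refl) = _ , f (run a (subst (μ <_) (span-eq es (hd-< es (ℕP.≤-trans (s≤s z≤n) 4≤d) desc)) b)) , ≈-refl

    T-listed : ∀ {κ} → κ ∈ blocks ds (T₅ ds) → Listed κ
    T-listed = blocks-listed ds desc block h
      where
      h : ∀ {κ} → κ ∈ T₅ ds → Listed κ
      h k with ∈-down⁻ f₅ (suc (hd ds)) (span N ds) k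
      ... | inj₁ k' = T₄-listed k'
      ... | inj₂ (μ , a , b , refl) = _ , run₀ a (subst (μ <_) (span-eq ds hd<N) b) , ≈-refl

    blocks-keep : ∀ es {B κ} → κ ∈ B → κ ∈ blocks es B
    blocks-keep [] k = k
    blocks-keep (d ∷ es) k = blocks-keep es (∈-downˡ (f₇ d) _ (span d es) (there k))

    block-in-T : ∀ {b} es {B} → Desc b es → ∀ {κ} → Block es κ → κ ∈~ blocks es B
    block-in-T (d ∷ es) _ start = g₆ d , blocks-keep es (∈-downˡ (f₇ d) _ (span d es) (here refl)) , swap
    block-in-T (d ∷ es) (4≤d , _ , desc) (run a b) = ∈⇒∈~ (blocks-keep es (∈-downʳ (f₇ d) _ (span d es) _ a
      (subst (_ <_) (sym (span-eq es (hd-< es (ℕP.≤-trans (s≤s z≤n) 4≤d) desc))) b)))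
    block-in-T (d ∷ es) (_ , _ , desc) (next b) = block-in-T es desc b

    in-T : ∀ {κ} → Facet ds κ → κ ∈~ blocks ds (T₅ ds)
    in-T f = go f
      where
      keep : ∀ {κ} → κ ∈~ T₄ → κ ∈~ blocks ds (T₅ ds)
      keep (τ , k , e) = τ , blocks-keep ds (∈-downˡ f₅ _ (span N ds) k) , e
      go : ∀ {κ} → Facet ds κ → κ ∈~ blocks ds (T₅ ds)
      go (low a b) = keep (_ , there (there (there (g₀∈ a b))) , ≈-sym rot)
      go m₁ = keep (_ , there (there (there (∈-downˡ g₀ 3 (N ∸ 2) (here refl)))) , ≈-refl)
      go m₂ = keep (_ , there (there (here refl)) , swap)
      go m₃ = keep (_ , there (here refl) , ≈-sym rot)
      go m₄ = keep (_ , here refl , ≈-sym cyc)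
      go (run₀ a b) = ∈⇒∈~ (blocks-keep ds (∈-downʳ f₅ _ (span N ds) _ a (subst (_ <_) (sym (span-eq ds hd<N)) b)))
      go (block b) = block-in-T ds desc b

-- Every facet of B(I) is a facet of Δ³_n of the unmirrored half. The facet {1, 2, i, i+2} is left
-- over with x₃ = i - 1, the predecessor supplied as `x₄`.
ball-cases : List (List Case)
ball-cases =
  (case tt′ then 0 at # 1 , x₄ ∷ []) ∷ (case tt′ then 7 at # 1 , # 0 ∷ []) ∷ (case tt′ then 9 at # 0 , # 0 ∷ []) ∷
  (case tt′ then 10 at # 0 , # 0 ∷ []) ∷ (case tt′ then 11 at # 0 , # 0 ∷ []) ∷ (case tt′ then 8 at x₂ , # 0 ∷ []) ∷
  (case tt′ then 2 at # 0 , x₂ ∷ []) ∷ (case tt′ then 1 at x₂ , x₃ ∷ []) ∷ []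

complement-desc : ∀ {N} I → 8 ≤ N → StrictInc I → All (λ i → 3 ≤ i × i ≤ N ∸ 4) I → Desc (N ∸ 2) (map (N ∸_) I)
complement-desc {N} [] _ _ _ = tt
complement-desc {N} (i ∷ I) 8≤N inc ((3≤i , i≤) ∷ ps) = big , small , rest I inc ps
  where
  4≤N : 4 ≤ N
  4≤N = ℕP.≤-trans (s≤s (s≤s (s≤s (s≤s z≤n)))) 8≤N
  big : 4 ≤ N ∸ i
  big = subst (_≤ N ∸ i) (ℕP.m∸[m∸n]≡n 4≤N) (ℕP.∸-monoʳ-≤ N i≤)
  small : N ∸ i < N ∸ 2
  small = ℕP.∸-monoʳ-< 3≤i (ℕP.≤-trans i≤ (ℕP.m∸n≤m N 4))
  rest : ∀ I → StrictInc (i ∷ I) → All (λ i → 3 ≤ i × i ≤ N ∸ 4) I → Desc (N ∸ i) (map (N ∸_) I)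
  rest [] _ _ = tt
  rest (j ∷ I) (i<j ∷ inc) ps@((_ , j≤) ∷ _) = let a , b , c = complement-desc (j ∷ I) 8≤N inc ps in
    a , ℕP.∸-monoʳ-< i<j (ℕP.≤-trans j≤ (ℕP.m∸n≤m N 4)) , c

-- The complexes Δ(I) as exchanges of B(I) in Δ³_n

module Delta (t : ℕ) (7≤t : 7 ≤ t) (K : Cx) (S : Sphere (3 + t) K) (C : Closed (1 + t) K)
  (I : List ℕ) (inI : InI (3 + t) I) where

  N : ℕ
  N = 1 + t

  8≤N : 8 ≤ N
  8≤N = s≤s 7≤t

  open Stacking N 8≤N public
  open Facets N public

  ds : List ℕ
  ds = map (N ∸_) I

  desc : Desc (N ∸ 2) ds
  desc = complement-desc I 8≤N (proj₁ inI) (proj₁ (proj₂ inI))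

  I≤N : All (_≤ N) I
  I≤N = All.map (λ p → ℕP.≤-trans (proj₂ p) (ℕP.m∸n≤m N 4)) (proj₁ (proj₂ inI))

  B : Cx
  B = BI (2 + N) I

  facet : ∀ {κ} → κ ∈ B → Facet ds κ
  facet = BI⁻ I≤N

  facet∈ : ∀ {κ} → Facet ds κ → κ ∈ B
  facet∈ = BI⁺ I≤N

  family : ∀ {κ} → κ ∈ B → In N ballIF κ
  family p = facet-family ds desc (facet p)

  B-pure : Pure 4 B
  B-pure p = facet-simplex ds desc (facet p)

  stackedB : Stacked B
  stackedB = reorder (stacked-T ds desc) ((λ p → let τ , f , e = T-listed ds desc p in τ , facet∈ f , e) ,
    (λ p → in-T ds desc (facet p))) B-pure

  B⊆K : ∀ {κ} → κ ∈ B → κ ∈~ K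
  B⊆K {κ} p with all-cover 0 (# 8 ≼ x₁) ballIF facetF ball-cases (λ _ → 8≤N) (family p)
  ... | τ , i , s = ∈~-resp (s , same-size (B-pure p) (facet-simplices (ℕP.≤-trans (s≤s (s≤s z≤n)) 8≤N) i) s) (Closed.in-facet C i)

  disjoint : ∀ {κ λ'} → κ ∈ B → λ' ∈ B → ¬ κ ≈ map -_ λ'
  disjoint p q (s , _) = families-apart ballIF (mirror ballIF) (# 8 ≼ x₁) (λ _ → 8≤N) (family p) (in-mirror (family q)) s

  -- The entries d cut 1, ..., N-1 into intervals: -d itself lies in the facet f₆ d, and the numbers
  -- strictly between consecutive entries are swept by a run.
  negative : ∀ μ → 1 ≤ μ → μ < N → ∃ λ κ → Facet ds κ × - (+ μ) ∈ κ
  negative μ a b with hd ds ℕ.<? μ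
  ... | yes l = _ , run₀ l b , here refl
  ... | no n = let κ , q , m = go ds desc (ℕP.≮⇒≥ n) in κ , block q , m
    where
    go : ∀ {b} es → Desc b es → μ ≤ hd es → ∃ λ κ → Block es κ × - (+ μ) ∈ κ
    go [] _ l = ⊥-elim (ℕP.<⇒≱ a l)
    go (d ∷ es) (_ , _ , desc) l with μ ℕ.≟ d
    ... | yes refl = _ , start , there (here refl)
    ... | no m with hd es ℕ.<? μ
    ...   | yes h = _ , run h (ℕP.≤∧≢⇒< l m) , here refl
    ...   | no h = let κ , q , x = go es desc (ℕP.≮⇒≥ h) in κ , next q , x

  cover : ∀ {v} → InV (2 + N) v → ∃ λ κ → κ ∈ B × v ∈ κ
  cover {v} i = let κ , f , m = go v i in κ , facet∈ f , m
    where
    go : ∀ v → InV (2 + N) v → ∃ λ κ → Facet ds κ × v ∈ κ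
    go (+ 0) (n , _) = ⊥-elim (n refl)
    go (+ 1) _ = _ , m₁ , here refl
    go (+ 2) _ = _ , m₁ , there (here refl)
    go (+ suc (suc (suc i))) (_ , l) with 3 + i ℕ.≤? N
    ... | yes a = _ , low (s≤s (s≤s (s≤s z≤n))) a , there (there (here refl))
    ... | no a with 3 + i ℕ.≟ 1 + N
    ...   | yes refl = _ , m₁ , there (there (here refl))
    ...   | no b with ℕP.≤-antisym l (ℕP.≤∧≢⇒< (ℕP.≰⇒> a) (b ∘ sym))
    ...     | refl = _ , m₁ , there (there (there (here refl)))
    go -[1+ i ] (_ , l) with suc i ℕ.<? N
    ... | yes a = negative (suc i) (s≤s z≤n) a
    ... | no a with suc i ℕ.≟ N
    ...   | yes refl = _ , m₂ , there (here refl)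
    ...   | no b with suc i ℕ.≟ 1 + N
    ...     | yes refl = _ , m₃ , there (there (here refl))
    ...     | no c with ℕP.≤-antisym l (ℕP.≤∧≢⇒< (ℕP.≤∧≢⇒< (ℕP.≮⇒≥ a) (b ∘ sym)) (c ∘ sym))
    ...       | refl = _ , m₄ , there (there (there (here refl)))

  neg-bd≅ : neg (bd B) ≅ ∂ (neg B)
  neg-bd≅ = subst (λ P → neg P ≅ ∂ (neg B)) (∂≡bd B) (neg-bd B)

  neg-∂-pure : Pure 3 (neg (∂ B))
  neg-∂-pure p = let ρ , r , e = ∈-negᶜ⁻ p in
    subst (IsSimplex 3) (sym e) (isSimplex-neg (bd-pure (stacked-pure stackedB) r))

  neg-bd-pure : Pure 3 (neg (bd B))
  neg-bd-pure = subst (λ P → Pure 3 (neg P)) (∂≡bd B) neg-∂-pure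

  open Step S stackedB B⊆K disjoint cover neg-bd≅ neg-bd-pure public
    hiding (thinK; thinB; K₁; K₂)

-- Edges whose link contains almost all vertices

inside : ℕ → Vertex → Formula
inside c (pos t) = # 1 ≼ t ∧ t ≼ x₁ ↑ c
inside c (neg′ t) = # 1 ≼ t ∧ t ≼ x₁ ↑ c

insideL : ℕ → List Vertex → Formula
insideL c [] = tt′
insideL c (v ∷ σ) = inside c v ∧ insideL c σ

inside-InV : ∀ {c N zs} v → ⟦ inside c v ⟧ (N ∷ zs) → InV (c + N) (⟦ v ⟧ᵛ (N ∷ zs))
inside-InV {c} {N} {zs} (pos (i , d)) (a , b) = (λ e → ℕP.n≮0 (subst (1 ≤_) (ℤP.+-injective e) a)) ,
  subst (λ k → _ ≤ k + N) (ℕP.+-identityʳ c) b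
inside-InV {c} {N} {zs} (neg′ (i , d)) (a , b) =
  (λ e → ℕP.n≮0 (subst (1 ≤_) (ℤP.+-injective (ℤP.neg-injective {+ (d + var (N ∷ zs) i)} {+ 0} e)) a)) ,
  subst (_≤ c + N) (sym (ℤP.∣-i∣≡∣i∣ (+ (d + var (N ∷ zs) i)))) (subst (λ k → _ ≤ k + N) (ℕP.+-identityʳ c) b)

insideL-InV : ∀ {c N zs} σ → ⟦ insideL c σ ⟧ (N ∷ zs) → ∀ {u} → u ∈ inst σ (N ∷ zs) → InV (c + N) u
insideL-InV (v ∷ σ) (a , b) (here refl) = inside-InV v a
insideL-InV (v ∷ σ) (a , b) (there p) = insideL-InV σ b p

away : Vertex → Vertex → Formula
away v w = negate (v ≐ w) ∧ negate (v ≐ negateᵛ w)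

neg-inst : ∀ w xs → ⟦ negateᵛ w ⟧ᵛ xs ≡ - ⟦ w ⟧ᵛ xs
neg-inst (pos t) xs = refl
neg-inst (neg′ t) xs = sym (ℤP.neg-involutive _)

Away : ℤ → ℤ → Set
Away a x = a ≢ x × a ≢ - x

away-sound : ∀ {xs} v w → ⟦ away v w ⟧ xs → Away (⟦ v ⟧ᵛ xs) (⟦ w ⟧ᵛ xs)
away-sound {xs} v w (a , b) = negate-sound (v ≐ w) a , λ e → negate-sound (v ≐ negateᵛ w) b (trans e (sym (neg-inst w xs)))

-- All but at most one of the vertices a ≠ ±x, ±y span a triangle with x and y.
Big : ℕ → Cx → ℤ → ℤ → Set
Big m K x y = ∀ {a b} → InV m a → InV m b → Away a x → Away a y → Away b x → Away b y → a ≢ b →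
  ¬ Face K (x ∷ y ∷ a ∷ []) → ¬ Face K (x ∷ y ∷ b ∷ []) → ⊥

big-sym : ∀ {m K x y} → Big m K x y → Big m K y x
big-sym big i j ax ay bx by n f g = big i j ay ax by bx n (f ∘ face-⊆ sw) (g ∘ face-⊆ sw)
  where
  sw : ∀ {x y a : ℤ} → y ∷ x ∷ a ∷ [] ⊆ x ∷ y ∷ a ∷ []
  sw (here e) = there (here e)
  sw (there (here e)) = here e
  sw (there (there p)) = there (there p)

neg-≡ : ∀ {x y} → - x ≡ y → x ≡ - y
neg-≡ {x} e = trans (sym (ℤP.neg-involutive x)) (cong -_ e)

big-neg : ∀ {m K x y} → Sphere m K → Big m K x y → Big m K (- x) (- y)
big-neg {m} {K} {x} {y} S big {a} {b} i j ax ay bx by n f g = big (InV-neg i) (InV-neg j) (flip-away ax) (flip-away ay)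
  (flip-away bx) (flip-away by) (n ∘ ℤP.neg-injective) (f ∘ down′ a) (g ∘ down′ b)
  where
  flip-away : ∀ {a x} → Away a (- x) → Away (- a) x
  flip-away (p , q) = (λ e → p (neg-≡ e)) , (λ e → q (trans (neg-≡ e) refl))
  down′ : ∀ a → Face K (x ∷ y ∷ - a ∷ []) → Face K (- x ∷ - y ∷ a ∷ [])
  down′ a F = subst (λ a → Face K (- x ∷ - y ∷ a ∷ [])) (ℤP.neg-involutive a) (sphere-symmetric S F)

face-consequence : ∀ Fs N zs h σ g → {T (consequence? Fs (length zs) h σ (λ _ → g))} →
  (∀ p q → ⟦ h ⟧ (N ∷ p ∷ q ∷ zs)) → ∀ {K} → (∀ {κ} → κ ∈ K → ∃ λ τ → In N Fs τ × κ ⊆ τ) →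
  ∀ {σ₀} → (∀ p q → inst σ (N ∷ p ∷ q ∷ zs) ≡ σ₀) → Face K σ₀ → ∃₂ λ p q → ⟦ g ⟧ (N ∷ p ∷ q ∷ zs)
face-consequence Fs N zs h σ g {c} hyp {K} K-in {σ₀} e F = conclude (consequence Fs N zs h σ (λ _ → g) {c} hyp i s)
  where
  κ τ : Simplex
  κ = proj₁ (face⁻ F)
  τ = proj₁ (K-in (proj₁ (proj₂ (face⁻ F))))
  i : In N Fs τ
  i = proj₁ (proj₂ (K-in (proj₁ (proj₂ (face⁻ F)))))
  s : ∀ p q → inst σ (N ∷ p ∷ q ∷ zs) ⊆ τ
  s p q = subst (_⊆ τ) (sym (e p q)) (proj₂ (proj₂ (K-in (proj₁ (proj₂ (face⁻ F))))) ∘ proj₂ (proj₂ (face⁻ F)))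
  conclude : (∃₂ λ p q → ∃ λ t → τ ≡ inst t (N ∷ p ∷ q ∷ zs) × ⟦ g ⟧ (N ∷ p ∷ q ∷ zs)) → ∃₂ λ p q → ⟦ g ⟧ (N ∷ p ∷ q ∷ zs)
  conclude (p , q , _ , _ , w) = p , q , w

found : ∀ Fs N zs h σ c → {T (valid (3 + length zs) h (distinct σ))} → {T (length σ ≡ᵇ 4)} →
  {T (case? (3 + length zs) 0 h σ Fs c)} → ⟦ h ⟧ (N ∷ 0 ∷ 0 ∷ zs) → ⟦ Case.condition c ⟧ (N ∷ 0 ∷ 0 ∷ zs) →
  ∀ {K} → Pure 4 K → (∀ {τ} → In N Fs τ → τ ∈~ K) → ∃ λ κ → κ ∈ K × inst σ (N ∷ 0 ∷ 0 ∷ zs) ≈ κ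
found Fs N zs h σ c {d} {l} {t} hyp cond {K} pure in-K = conclude (case-covers N (0 ∷ 0 ∷ zs) 0 h σ Fs c t hyp cond)
  where
  xs = N ∷ 0 ∷ 0 ∷ zs
  conclude : (∃ λ τ → In N Fs τ × inst σ xs ⊆ τ) → ∃ λ κ → κ ∈ K × inst σ xs ≈ κ
  conclude (τ , i , s) with in-K i
  ... | κ , k , e = κ , k , proj₁ e ∘ s ,
    same-size (distinct⁻ σ (prove xs h (distinct σ) {d} hyp) , trans (length-map _ σ) (ℕP.≡ᵇ⇒≡ (length σ) 4 l)) (pure k) (proj₁ e ∘ s)

-- Testing faces of a complex L obtained from K by exchanging ±B, where the
-- facets of K, B and -B are described by Fs, Bs and Gs.
module Tests (Fs Bs Gs : List Family) (N : ℕ) (K B L : Cx)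
  (K-in : ∀ {κ} → κ ∈ K → ∃ λ τ → In N Fs τ × κ ⊆ τ) (in-K : ∀ {τ} → In N Fs τ → τ ∈~ K) (K-pure : Pure 4 K)
  (B-family : ∀ {κ} → κ ∈ B → In N Bs κ) (B-pure : Pure 4 B)
  (negB-in : ∀ {κ} → κ ∈ neg B → ∃ λ τ → In N Gs τ × κ ⊆ τ)
  (face-old : ∀ {σ} → (∀ {u} → u ∈ σ → InV (2 + N) u) → Face L σ → Face K σ)
  (face-top : ∀ {σ} → (∀ {u} → u ∈ σ → InV (2 + N) u) → Face L (+ (3 + N) ∷ σ) → Face B σ)
  (old-face : ∀ {σ} κ → κ ∈ K → σ ≈ κ → ¬ Face B σ → ¬ Face (neg B) σ → Face L σ)
  (cone-face : ∀ {ρ} → ρ ∈~ ∂ B → + (3 + N) ∷ ρ ∈~ L) where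

  B-in : ∀ {κ} → κ ∈ B → ∃ λ τ → In N Bs τ × κ ⊆ τ
  B-in k = _ , B-family k , id

  -- σ lives over N, two dummies, and zs.
  module _ (zs : List ℕ) (h : Formula) (hyp : ∀ p q → ⟦ h ⟧ (N ∷ p ∷ q ∷ zs)) where

    private
      xs : List ℕ
      xs = N ∷ 0 ∷ 0 ∷ zs

      vertices-of : ∀ σ → T (valid (3 + length zs) h (insideL 2 σ)) → ∀ {σ₀} → (∀ p q → inst σ (N ∷ p ∷ q ∷ zs) ≡ σ₀) →
        ∀ {u} → u ∈ σ₀ → InV (2 + N) u
      vertices-of σ v e {u} u∈ = insideL-InV {2} σ (prove xs h (insideL 2 σ) {v} (hyp 0 0)) (subst (u ∈_) (sym (e 0 0)) u∈)

    face-implies : ∀ σ g → {T (valid (3 + length zs) h (insideL 2 σ))} → {T (consequence? Fs (length zs) h σ (λ _ → g))} →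
      ∀ {σ₀} → (∀ p q → inst σ (N ∷ p ∷ q ∷ zs) ≡ σ₀) → Face L σ₀ → ∃₂ λ p q → ⟦ g ⟧ (N ∷ p ∷ q ∷ zs)
    face-implies σ g {v} {c} e F = face-consequence Fs N zs h σ g {c} hyp K-in e (face-old (vertices-of σ v e) F)

    top-implies : ∀ σ g → {T (valid (3 + length zs) h (insideL 2 σ))} → {T (consequence? Bs (length zs) h σ (λ _ → g))} →
      ∀ {σ₀} → (∀ p q → inst σ (N ∷ p ∷ q ∷ zs) ≡ σ₀) → Face L (+ (3 + N) ∷ σ₀) → ∃₂ λ p q → ⟦ g ⟧ (N ∷ p ∷ q ∷ zs)
    top-implies σ g {v} {c} e F = face-consequence Bs N zs h σ g {c} hyp B-in e (face-top (vertices-of σ v e) F)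

    face-K : ∀ σ c → {T (valid (3 + length zs) h (distinct σ))} → {T (length σ ≡ᵇ 4)} → {T (case? (3 + length zs) 0 h σ Fs c)} →
      {T (consequence? Bs (length zs) h σ (λ _ → ff′))} → {T (consequence? Gs (length zs) h σ (λ _ → ff′))} →
      ⟦ Case.condition c ⟧ xs → ∀ {σ₀} → (∀ p q → inst σ (N ∷ p ∷ q ∷ zs) ≡ σ₀) → Face L σ₀
    face-K σ c {d} {l} {t} {b} {b'} cond {σ₀} e = subst (Face L) (e 0 0)
      (old-face (proj₁ place) (proj₁ (proj₂ place)) (proj₂ (proj₂ place))
        (λ F → proj₂ (proj₂ (face-consequence Bs N zs h σ ff′ {b} hyp B-in (λ p q → trans (e p q) (sym (e 0 0))) F)))
        (λ F → proj₂ (proj₂ (face-consequence Gs N zs h σ ff′ {b'} hyp negB-in (λ p q → trans (e p q) (sym (e 0 0))) F))))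
      where
      place : ∃ λ κ → κ ∈ K × inst σ xs ≈ κ
      place = found Fs N zs h σ c {d} {l} {t} (hyp 0 0) cond K-pure in-K

    face-ridge : ∀ σ r → {T (consequence? Bs (length zs) h (dropAt r σ) (λ t → sub t σ))} → {T (suc r ≤ᵇ length σ)} →
      {T (valid (3 + length zs) h (distinct σ))} → ∀ {τ ρ} → (∀ p q → inst σ (N ∷ p ∷ q ∷ zs) ≡ τ) →
      (∀ p q → inst (dropAt r σ) (N ∷ p ∷ q ∷ zs) ≡ ρ) → τ ∈ B → Face L (+ (3 + N) ∷ ρ)
    face-ridge σ r {c} {l} {u} e e' f = face~ (cone-face (ridge Bs N zs h σ r {c} {l} {u} B-pure B-family hyp e e' (∈⇒∈~ f))) id

    separated : Vertex → Vertex → Vertex → Vertex → Formula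
    separated x y a b = inside 3 a ∧ inside 3 b ∧ away a x ∧ away a y ∧ away b x ∧ away b y ∧ negate (a ≐ b)

    not-big : ∀ x y a b → {T (valid (3 + length zs) h (separated x y a b))} → Big (3 + N) L (⟦ x ⟧ᵛ xs) (⟦ y ⟧ᵛ xs) →
      ¬ Face L (inst (x ∷ y ∷ a ∷ []) xs) → ¬ Face L (inst (x ∷ y ∷ b ∷ []) xs) → ⊥
    not-big x y a b {v} big = apply (prove xs h (separated x y a b) {v} (hyp 0 0))
      where
      apply : ⟦ separated x y a b ⟧ xs → ¬ Face L (inst (x ∷ y ∷ a ∷ []) xs) → ¬ Face L (inst (x ∷ y ∷ b ∷ []) xs) → ⊥
      apply (i , j , ax , ay , bx , by , n) = big (inside-InV {3} a i) (inside-InV {3} b j) (away-sound a x ax) (away-sound a y ay)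
        (away-sound b x bx) (away-sound b y by) (negate-sound (a ≐ b) n)

    not-big-K : ∀ x y a b → {T (valid (3 + length zs) h (separated x y a b))} →
      {T (valid (3 + length zs) h (insideL 2 (x ∷ y ∷ a ∷ [])))} → {T (consequence? Fs (length zs) h (x ∷ y ∷ a ∷ []) (λ _ → ff′))} →
      {T (valid (3 + length zs) h (insideL 2 (x ∷ y ∷ b ∷ [])))} → {T (consequence? Fs (length zs) h (x ∷ y ∷ b ∷ []) (λ _ → ff′))} →
      (∀ t p q → inst (x ∷ y ∷ t ∷ []) (N ∷ p ∷ q ∷ zs) ≡ ⟦ x ⟧ᵛ xs ∷ ⟦ y ⟧ᵛ xs ∷ ⟦ t ⟧ᵛ (N ∷ p ∷ q ∷ zs) ∷ []) →
      (∀ p q → ⟦ a ⟧ᵛ (N ∷ p ∷ q ∷ zs) ≡ ⟦ a ⟧ᵛ xs) → (∀ p q → ⟦ b ⟧ᵛ (N ∷ p ∷ q ∷ zs) ≡ ⟦ b ⟧ᵛ xs) →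
      ¬ Big (3 + N) L (⟦ x ⟧ᵛ xs) (⟦ y ⟧ᵛ xs)
    not-big-K x y a b {s} {ia} {ca} {ib} {cb} e ea eb big = not-big x y a b {s} big
      (λ F → proj₂ (proj₂ (face-implies (x ∷ y ∷ a ∷ []) ff′ {ia} {ca} (λ p q → trans (e a p q) (cong (λ t → _ ∷ _ ∷ t ∷ []) (ea p q))) F)))
      (λ F → proj₂ (proj₂ (face-implies (x ∷ y ∷ b ∷ []) ff′ {ib} {cb} (λ p q → trans (e b p q) (cong (λ t → _ ∷ _ ∷ t ∷ []) (eb p q))) F)))

    not-big-top : ∀ y a b → {T (valid (3 + length zs) h (separated (pos (x₁ ↑ 3)) y a b))} →
      {T (valid (3 + length zs) h (insideL 2 (y ∷ a ∷ [])))} → {T (consequence? Bs (length zs) h (y ∷ a ∷ []) (λ _ → ff′))} →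
      {T (valid (3 + length zs) h (insideL 2 (y ∷ b ∷ [])))} → {T (consequence? Bs (length zs) h (y ∷ b ∷ []) (λ _ → ff′))} →
      (∀ p q → inst (y ∷ a ∷ []) (N ∷ p ∷ q ∷ zs) ≡ inst (y ∷ a ∷ []) xs) →
      (∀ p q → inst (y ∷ b ∷ []) (N ∷ p ∷ q ∷ zs) ≡ inst (y ∷ b ∷ []) xs) →
      ¬ Big (3 + N) L (+ (3 + N)) (⟦ y ⟧ᵛ xs)
    not-big-top y a b {s} {ia} {ca} {ib} {cb} ea eb big = not-big (pos (x₁ ↑ 3)) y a b {s} big
      (λ F → proj₂ (proj₂ (top-implies (y ∷ a ∷ []) ff′ {ia} {ca} ea F)))
      (λ F → proj₂ (proj₂ (top-implies (y ∷ b ∷ []) ff′ {ib} {cb} eb F)))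

module Faces (t : ℕ) (7≤t : 7 ≤ t) (K : Cx) (S : Sphere (3 + t) K) (C : Closed (1 + t) K)
  (I : List ℕ) (inI : InI (3 + t) I) where

  open Delta t 7≤t K S C I inI public

  private
    negB-in : ∀ {κ} → κ ∈ neg B → ∃ λ τ → In N (mirror ballIF) τ × κ ⊆ τ
    negB-in {κ} p = κ , subst (In N (mirror ballIF)) (sym (proj₂ (proj₂ (∈-negᶜ⁻ p)))) (in-mirror (family (proj₁ (proj₂ (∈-negᶜ⁻ p))))) , id

    old-face : ∀ {σ} κ → κ ∈ K → σ ≈ κ → ¬ Face B σ → ¬ Face (neg B) σ → Face D σ
    old-face κ k e n n' = face⁺ (D-old k (n ∘ face-⊆ (proj₁ e)) (n' ∘ face-⊆ (proj₁ e))) (proj₁ e)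

  open Tests facetF ballIF (mirror ballIF) N K B D (Closed.facet-in C) (Closed.in-facet C) (proj₁ (Sphere.good S))
    family B-pure negB-in face-old face-top old-face D-top public

module Bigness (t : ℕ) (7≤t : 7 ≤ t) (K : Cx) (S : Sphere (3 + t) K) (C : Closed (1 + t) K)
  (I : List ℕ) (inI : InI (3 + t) I) where

  open Faces t 7≤t K S C I inI public

  infix 5 _≃_
  private
    _≃_ : Term → Term → Formula
    t ≃ u = t ≼ u ∧ u ≼ t

    ordered : Formula
    ordered = # 8 ≼ x₁ ∧ # 1 ≼ x₄ ∧ x₄ ↑ 1 ≼ x₅ ∧ x₅ ≼ x₁ ↑ 2

    ≤≥ : ∀ {a b} → a ≤ b × b ≤ a → a ≡ b
    ≤≥ (p , q) = ℕP.≤-antisym p q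

  private
    pp-split : Formula
    pp-split =
      (# 4 ≼ x₄ ∧ x₄ ↑ 3 ≼ x₅) ∨
      (# 5 ≼ x₄ ∧ (x₅ ≃ x₄ ↑ 1) ∧ x₅ ≼ x₁ ↑ 1) ∨
      ((x₄ ≃ # 4) ∧ (x₅ ≃ # 5)) ∨
      ((x₄ ≃ # 3) ∧ (x₅ ≃ # 4)) ∨
      ((x₄ ≃ # 1) ∧ # 3 ≼ x₅ ∧ x₅ ↑ 2 ≼ x₁) ∨
      ((x₄ ≃ # 1) ∧ x₁ ≼ x₅ ↑ 1) ∨
      (# 2 ≼ x₄ ∧ (x₅ ≃ x₄ ↑ 2) ∧ x₅ ↑ 1 ≼ x₁) ∨
      ((x₅ ≃ x₄ ↑ 2) ∧ (x₅ ≃ x₁)) ∨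
      ((x₄ ≃ # 3) ∧ # 6 ≼ x₅) ∨
      ((x₄ ≃ # 2) ∧ # 5 ≼ x₅ ∧ x₅ ↑ 1 ≼ x₁) ∨
      ((x₄ ≃ # 2) ∧ x₁ ≼ x₅) ∨
      ((x₄ ≃ x₁ ↑ 1) ∧ (x₅ ≃ x₁ ↑ 2)) ∨
      ((x₄ ≃ # 1) ∧ (x₅ ≃ # 2)) ∨
      ((x₅ ≃ x₁ ↑ 1) ∧ (x₅ ≃ x₄ ↑ 2)) ∨
      ((x₄ ≃ # 2) ∧ (x₅ ≃ # 3)) ∨
      ((x₄ ≃ x₁) ∧ (x₅ ≃ x₁ ↑ 2))

  -- In the first eleven cases two vertices span no triangle with the edge already in Δ³_n. The
  -- three edges treated separately owe a missing triangle to the exchange, and the last two cases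
  -- are the exceptions allowed by the conclusion.
  big-pp : ∀ p q → 1 ≤ p → p < q → q ≤ 2 + N → Big (3 + N) D (+ p) (+ q) → (p ≡ 2 × q ≡ 3) ⊎ (p ≡ N × q ≡ 2 + N)
  big-pp p q a b c big = go (prove (N ∷ 0 ∷ 0 ∷ p ∷ q ∷ []) ordered pp-split base)
    where
    base : 8 ≤ N × 1 ≤ p × p < q × q ≤ 2 + N
    base = 8≤N , a , b , c
    -- The triangles {n-1, n, 1} and {n-1, n, -N} are interior to B(I) and vanish with it.
    top-edge : q ≡ 2 + N → p ≡ 1 + N → ⊥
    top-edge refl refl = not-big [] (# 8 ≼ x₁) (λ _ _ → 8≤N) (pos (x₁ ↑ 1)) (pos (x₁ ↑ 2)) (pos (# 1)) (neg′ x₁) big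
      (λ F → interior (simplex-inst (N ∷ []) (# 8 ≼ x₁) (pos (x₁ ↑ 1) ∷ pos (x₁ ↑ 2) ∷ pos (# 1) ∷ []) 8≤N) (facet∈ m₁) (facet∈ m₂)
        (⊆-inst (N ∷ []) tt′ (pos (x₁ ↑ 1) ∷ pos (x₁ ↑ 2) ∷ pos (# 1) ∷ []) (pos (# 1) ∷ pos (# 2) ∷ pos (x₁ ↑ 1) ∷ pos (x₁ ↑ 2) ∷ []) tt)
        (⊆-inst (N ∷ []) tt′ (pos (x₁ ↑ 1) ∷ pos (x₁ ↑ 2) ∷ pos (# 1) ∷ []) (pos (# 1) ∷ neg′ x₁ ∷ pos (x₁ ↑ 1) ∷ pos (x₁ ↑ 2) ∷ []) tt)
        (λ e → prove (N ∷ []) (# 8 ≼ x₁ ∧ mem (pos (# 2)) (pos (# 1) ∷ neg′ x₁ ∷ pos (x₁ ↑ 1) ∷ pos (x₁ ↑ 2) ∷ [])) ff′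
          (8≤N , mem⁺ {N ∷ []} (pos (# 2)) (pos (# 1) ∷ neg′ x₁ ∷ pos (x₁ ↑ 1) ∷ pos (x₁ ↑ 2) ∷ []) (proj₁ e (there (here refl))))) F)
      (λ F → interior (simplex-inst (N ∷ []) (# 8 ≼ x₁) (pos (x₁ ↑ 1) ∷ pos (x₁ ↑ 2) ∷ neg′ x₁ ∷ []) 8≤N) (facet∈ m₂)
        -- The run over {n-1, n} contains μ = N - 1 for every I, because all d are smaller.
        (facet∈ (run₀ {μ = t} (ℕP.<-≤-trans (hd-< ds (ℕP.≤-trans (s≤s z≤n) (ℕP.∸-monoˡ-≤ 1 7≤t)) desc) (ℕP.m∸n≤m t 1)) ℕP.≤-refl))
        (⊆-inst (N ∷ []) tt′ (pos (x₁ ↑ 1) ∷ pos (x₁ ↑ 2) ∷ neg′ x₁ ∷ []) (pos (# 1) ∷ neg′ x₁ ∷ pos (x₁ ↑ 1) ∷ pos (x₁ ↑ 2) ∷ []) tt)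
        (⊆-inst (t ∷ []) tt′ (pos (x₁ ↑ 2) ∷ pos (x₁ ↑ 3) ∷ neg′ (x₁ ↑ 1) ∷ []) (neg′ x₁ ∷ neg′ (x₁ ↑ 1) ∷ pos (x₁ ↑ 2) ∷ pos (x₁ ↑ 3) ∷ []) tt)
        (λ e → prove (t ∷ []) (mem (pos (# 1)) (neg′ x₁ ∷ neg′ (x₁ ↑ 1) ∷ pos (x₁ ↑ 2) ∷ pos (x₁ ↑ 3) ∷ [])) ff′
          (mem⁺ {t ∷ []} (pos (# 1)) (neg′ x₁ ∷ neg′ (x₁ ↑ 1) ∷ pos (x₁ ↑ 2) ∷ pos (x₁ ↑ 3) ∷ []) (proj₁ e (here refl)))) F)
    -- The facets {1, 2, i, i+2} with i and i+2 share {1, 2, i+2}, which is therefore interior to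
    -- B(I); i = 3 and i = 4 lose the vertices 5 and 6.
    edge-12 : p ≡ 1 → q ≡ 2 → ⊥
    edge-12 refl refl = not-big [] (# 8 ≼ x₁) (λ _ _ → 8≤N) (pos (# 1)) (pos (# 2)) (pos (# 5)) (pos (# 6)) big
      (λ F → interior (toWitness {a? = isSimplex? 3 (+ 1 ∷ + 2 ∷ + 5 ∷ [])} tt) (facet∈ (low {i = 3} ℕP.≤-refl (ℕP.≤-trans (ℕP.m≤m+n 3 5) 8≤N)))
        (facet∈ (low {i = 5} (ℕP.m≤m+n 3 2) (ℕP.≤-trans (ℕP.m≤m+n 5 3) 8≤N)))
        (subᵇ⇒⊆ (+ 1 ∷ + 2 ∷ + 5 ∷ []) (f₀ 3) tt) (subᵇ⇒⊆ (+ 1 ∷ + 2 ∷ + 5 ∷ []) (f₀ 5) tt) (λ e → case proj₁ e (there (there (here refl))) of λ { (here ()) ; (there (here ())) ; (there (there (here ()))) ; (there (there (there (here ())))) }) F)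
      (λ F → interior (toWitness {a? = isSimplex? 3 (+ 1 ∷ + 2 ∷ + 6 ∷ [])} tt) (facet∈ (low {i = 4} (ℕP.m≤m+n 3 1) (ℕP.≤-trans (ℕP.m≤m+n 4 4) 8≤N)))
        (facet∈ (low {i = 6} (ℕP.m≤m+n 3 3) (ℕP.≤-trans (ℕP.m≤m+n 6 2) 8≤N)))
        (subᵇ⇒⊆ (+ 1 ∷ + 2 ∷ + 6 ∷ []) (f₀ 4) tt) (subᵇ⇒⊆ (+ 1 ∷ + 2 ∷ + 6 ∷ []) (f₀ 6) tt) (λ e → case proj₁ e (there (there (here refl))) of λ { (here ()) ; (there (here ())) ; (there (there (here ()))) ; (there (there (there (here ())))) }) F)
    -- The second missing vertex is the new one, -(n+1): its link is that of n+1 negated, and the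
    -- edge {n-1, n-3} negated is no edge of B(I).
    near-top : q ≡ 1 + N → q ≡ 2 + p → ⊥
    near-top refl refl = not-big (t ∷ []) (x₄ ↑ 1 ≼ x₁ ∧ # 7 ≼ x₄ ∧ x₁ ≼ x₄ ↑ 1) (λ _ _ → base′) (pos x₄) (pos (x₁ ↑ 1)) (neg′ x₁) (neg′ (x₁ ↑ 3)) big
      (λ F → proj₂ (proj₂ (face-implies (t ∷ []) (x₄ ↑ 1 ≼ x₁ ∧ # 7 ≼ x₄ ∧ x₁ ≼ x₄ ↑ 1) (λ _ _ → base′) (pos x₄ ∷ pos (x₁ ↑ 1) ∷ neg′ x₁ ∷ []) ff′ (λ _ _ → refl) F)))
      (λ F → proj₂ (proj₂ (top-implies (t ∷ []) (x₄ ↑ 1 ≼ x₁ ∧ # 7 ≼ x₄ ∧ x₁ ≼ x₄ ↑ 1) (λ _ _ → base′) (neg′ x₄ ∷ neg′ (x₁ ↑ 1) ∷ []) ff′ (λ _ _ → refl)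
        (face-⊆ (λ { (here e) → there (there (here e)) ; (there (here e)) → here e ; (there (there (here e))) → there (here e) }) (D-face-neg F)))))
      where
      base′ : 1 + t ≤ N × 7 ≤ t × N ≤ 1 + t
      base′ = ℕP.≤-refl , 7≤t , ℕP.≤-refl
    go : ⟦ pp-split ⟧ (N ∷ 0 ∷ 0 ∷ p ∷ q ∷ []) → (p ≡ 2 × q ≡ 3) ⊎ (p ≡ N × q ≡ 2 + N)
    go (inj₁ h) = ⊥-elim (not-big-K (p ∷ q ∷ []) (ordered ∧ # 4 ≼ x₄ ∧ x₄ ↑ 3 ≼ x₅) (λ _ _ → base , h)
      (pos x₄) (pos x₅) (pos (# 2)) (neg′ (# 2)) (λ _ _ _ → refl) (λ _ _ → refl) (λ _ _ → refl) big)
    go (inj₂ (inj₁ h)) = ⊥-elim (not-big-K (p ∷ q ∷ []) (ordered ∧ # 5 ≼ x₄ ∧ (x₅ ≃ x₄ ↑ 1) ∧ x₅ ≼ x₁ ↑ 1) (λ _ _ → base , h)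
      (pos x₄) (pos x₅) (pos (# 2)) (neg′ (# 2)) (λ _ _ _ → refl) (λ _ _ → refl) (λ _ _ → refl) big)
    go (inj₂ (inj₂ (inj₁ h))) = ⊥-elim (not-big-K (p ∷ q ∷ []) (ordered ∧ (x₄ ≃ # 4) ∧ (x₅ ≃ # 5)) (λ _ _ → base , h)
      (pos x₄) (pos x₅) (pos (# 1)) (neg′ (# 1)) (λ _ _ _ → refl) (λ _ _ → refl) (λ _ _ → refl) big)
    go (inj₂ (inj₂ (inj₂ (inj₁ h)))) = ⊥-elim (not-big-K (p ∷ q ∷ []) (ordered ∧ (x₄ ≃ # 3) ∧ (x₅ ≃ # 4)) (λ _ _ → base , h)
      (pos x₄) (pos x₅) (pos (# 1)) (neg′ (# 1)) (λ _ _ _ → refl) (λ _ _ → refl) (λ _ _ → refl) big)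
    go (inj₂ (inj₂ (inj₂ (inj₂ (inj₁ h))))) = ⊥-elim (not-big-K (p ∷ q ∷ []) (ordered ∧ (x₄ ≃ # 1) ∧ # 3 ≼ x₅ ∧ x₅ ↑ 2 ≼ x₁) (λ _ _ → base , h)
      (pos x₄) (pos x₅) (pos (x₅ ↑ 4)) (neg′ (x₅ ↑ 4)) (λ _ _ _ → refl) (λ _ _ → refl) (λ _ _ → refl) big)
    go (inj₂ (inj₂ (inj₂ (inj₂ (inj₂ (inj₁ h)))))) = ⊥-elim (not-big-K (p ∷ q ∷ []) (ordered ∧ (x₄ ≃ # 1) ∧ x₁ ≼ x₅ ↑ 1) (λ _ _ → base , h)
      (pos x₄) (pos x₅) (pos (# 3)) (neg′ (# 3)) (λ _ _ _ → refl) (λ _ _ → refl) (λ _ _ → refl) big)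
    go (inj₂ (inj₂ (inj₂ (inj₂ (inj₂ (inj₂ (inj₁ h))))))) = ⊥-elim (not-big-K (p ∷ q ∷ []) (ordered ∧ # 2 ≼ x₄ ∧ (x₅ ≃ x₄ ↑ 2) ∧ x₅ ↑ 1 ≼ x₁) (λ _ _ → base , h)
      (pos x₄) (pos x₅) (pos (x₅ ↑ 3)) (neg′ (x₅ ↑ 3)) (λ _ _ _ → refl) (λ _ _ → refl) (λ _ _ → refl) big)
    go (inj₂ (inj₂ (inj₂ (inj₂ (inj₂ (inj₂ (inj₂ (inj₁ h)))))))) = ⊥-elim (not-big-K (p ∷ q ∷ []) (ordered ∧ (x₅ ≃ x₄ ↑ 2) ∧ (x₅ ≃ x₁)) (λ _ _ → base , h)
      (pos x₄) (pos x₅) (pos (x₁ ↑ 1)) (neg′ (x₁ ↑ 2)) (λ _ _ _ → refl) (λ _ _ → refl) (λ _ _ → refl) big)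
    go (inj₂ (inj₂ (inj₂ (inj₂ (inj₂ (inj₂ (inj₂ (inj₂ (inj₁ h))))))))) = ⊥-elim (not-big-K (p ∷ q ∷ []) (ordered ∧ (x₄ ≃ # 3) ∧ # 6 ≼ x₅) (λ _ _ → base , h)
      (pos x₄) (pos x₅) (pos (# 1)) (neg′ (# 2)) (λ _ _ _ → refl) (λ _ _ → refl) (λ _ _ → refl) big)
    go (inj₂ (inj₂ (inj₂ (inj₂ (inj₂ (inj₂ (inj₂ (inj₂ (inj₂ (inj₁ h)))))))))) = ⊥-elim (not-big-K (p ∷ q ∷ []) (ordered ∧ (x₄ ≃ # 2) ∧ # 5 ≼ x₅ ∧ x₅ ↑ 1 ≼ x₁) (λ _ _ → base , h)
      (pos x₄) (pos x₅) (pos (x₅ ↑ 3)) (neg′ (x₅ ↑ 3)) (λ _ _ _ → refl) (λ _ _ → refl) (λ _ _ → refl) big)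
    go (inj₂ (inj₂ (inj₂ (inj₂ (inj₂ (inj₂ (inj₂ (inj₂ (inj₂ (inj₂ (inj₁ h))))))))))) = ⊥-elim (not-big-K (p ∷ q ∷ []) (ordered ∧ (x₄ ≃ # 2) ∧ x₁ ≼ x₅) (λ _ _ → base , h)
      (pos x₄) (pos x₅) (pos (# 4)) (neg′ (# 4)) (λ _ _ _ → refl) (λ _ _ → refl) (λ _ _ → refl) big)
    go (inj₂ (inj₂ (inj₂ (inj₂ (inj₂ (inj₂ (inj₂ (inj₂ (inj₂ (inj₂ (inj₂ (inj₁ h)))))))))))) = ⊥-elim (top-edge (≤≥ (proj₂ h)) (≤≥ (proj₁ h)))
    go (inj₂ (inj₂ (inj₂ (inj₂ (inj₂ (inj₂ (inj₂ (inj₂ (inj₂ (inj₂ (inj₂ (inj₂ (inj₁ h))))))))))))) = ⊥-elim (edge-12 (≤≥ (proj₁ h)) (≤≥ (proj₂ h)))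
    go (inj₂ (inj₂ (inj₂ (inj₂ (inj₂ (inj₂ (inj₂ (inj₂ (inj₂ (inj₂ (inj₂ (inj₂ (inj₂ (inj₁ h)))))))))))))) = ⊥-elim (near-top (≤≥ (proj₁ h)) (≤≥ (proj₂ h)))
    go (inj₂ (inj₂ (inj₂ (inj₂ (inj₂ (inj₂ (inj₂ (inj₂ (inj₂ (inj₂ (inj₂ (inj₂ (inj₂ (inj₂ (inj₁ h))))))))))))))) = inj₁ (≤≥ (proj₁ h) , ≤≥ (proj₂ h))
    go (inj₂ (inj₂ (inj₂ (inj₂ (inj₂ (inj₂ (inj₂ (inj₂ (inj₂ (inj₂ (inj₂ (inj₂ (inj₂ (inj₂ (inj₂ h))))))))))))))) = inj₂ (≤≥ (proj₁ h) , ≤≥ (proj₂ h))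

  private
    pn-split : Formula
    pn-split =
      (# 4 ≼ x₄ ∧ x₄ ↑ 3 ≼ x₅) ∨
      (# 5 ≼ x₄ ∧ (x₅ ≃ x₄ ↑ 1)) ∨
      ((x₄ ≃ # 4) ∧ (x₅ ≃ # 5)) ∨
      ((x₄ ≃ # 3) ∧ (x₅ ≃ # 4)) ∨
      ((x₄ ≃ # 2) ∧ (x₅ ≃ # 3)) ∨
      ((x₄ ≃ # 1) ∧ x₅ ↑ 2 ≼ x₁) ∨
      ((x₄ ≃ # 1) ∧ x₁ ≼ x₅ ↑ 1) ∨
      (# 2 ≼ x₄ ∧ (x₅ ≃ x₄ ↑ 2) ∧ x₅ ↑ 1 ≼ x₁) ∨
      ((x₅ ≃ x₄ ↑ 2) ∧ x₁ ≼ x₅) ∨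
      ((x₄ ≃ # 3) ∧ # 6 ≼ x₅) ∨
      ((x₄ ≃ # 2) ∧ # 5 ≼ x₅ ∧ x₅ ↑ 1 ≼ x₁) ∨
      ((x₄ ≃ # 2) ∧ x₁ ≼ x₅)

  -- For mixed signs the exchange is irrelevant: every case names two triangles missing from Δ³_n.
  big-pn : ∀ p q → 1 ≤ p → p < q → q ≤ 2 + N → Big (3 + N) D (+ p) (- (+ q)) → ⊥
  big-pn p q a b c big = go (prove (N ∷ 0 ∷ 0 ∷ p ∷ q ∷ []) ordered pn-split base)
    where
    base : 8 ≤ N × 1 ≤ p × p < q × q ≤ 2 + N
    base = 8≤N , a , b , c
    go : ⟦ pn-split ⟧ (N ∷ 0 ∷ 0 ∷ p ∷ q ∷ []) → ⊥
    go (inj₁ h) = ⊥-elim (not-big-K (p ∷ q ∷ []) (ordered ∧ # 4 ≼ x₄ ∧ x₄ ↑ 3 ≼ x₅) (λ _ _ → base , h)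
      (pos x₄) (neg′ x₅) (pos (# 2)) (neg′ (# 2)) (λ _ _ _ → refl) (λ _ _ → refl) (λ _ _ → refl) big)
    go (inj₂ (inj₁ h)) = ⊥-elim (not-big-K (p ∷ q ∷ []) (ordered ∧ # 5 ≼ x₄ ∧ (x₅ ≃ x₄ ↑ 1)) (λ _ _ → base , h)
      (pos x₄) (neg′ x₅) (pos (# 2)) (neg′ (# 2)) (λ _ _ _ → refl) (λ _ _ → refl) (λ _ _ → refl) big)
    go (inj₂ (inj₂ (inj₁ h))) = ⊥-elim (not-big-K (p ∷ q ∷ []) (ordered ∧ (x₄ ≃ # 4) ∧ (x₅ ≃ # 5)) (λ _ _ → base , h)
      (pos x₄) (neg′ x₅) (pos (# 8)) (neg′ (# 8)) (λ _ _ _ → refl) (λ _ _ → refl) (λ _ _ → refl) big)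
    go (inj₂ (inj₂ (inj₂ (inj₁ h)))) = ⊥-elim (not-big-K (p ∷ q ∷ []) (ordered ∧ (x₄ ≃ # 3) ∧ (x₅ ≃ # 4)) (λ _ _ → base , h)
      (pos x₄) (neg′ x₅) (pos (# 7)) (neg′ (# 7)) (λ _ _ _ → refl) (λ _ _ → refl) (λ _ _ → refl) big)
    go (inj₂ (inj₂ (inj₂ (inj₂ (inj₁ h))))) = ⊥-elim (not-big-K (p ∷ q ∷ []) (ordered ∧ (x₄ ≃ # 2) ∧ (x₅ ≃ # 3)) (λ _ _ → base , h)
      (pos x₄) (neg′ x₅) (pos (# 6)) (neg′ (# 6)) (λ _ _ _ → refl) (λ _ _ → refl) (λ _ _ → refl) big)
    go (inj₂ (inj₂ (inj₂ (inj₂ (inj₂ (inj₁ h)))))) = ⊥-elim (not-big-K (p ∷ q ∷ []) (ordered ∧ (x₄ ≃ # 1) ∧ x₅ ↑ 2 ≼ x₁) (λ _ _ → base , h)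
      (pos x₄) (neg′ x₅) (pos (x₅ ↑ 4)) (neg′ (x₅ ↑ 4)) (λ _ _ _ → refl) (λ _ _ → refl) (λ _ _ → refl) big)
    go (inj₂ (inj₂ (inj₂ (inj₂ (inj₂ (inj₂ (inj₁ h))))))) = ⊥-elim (not-big-K (p ∷ q ∷ []) (ordered ∧ (x₄ ≃ # 1) ∧ x₁ ≼ x₅ ↑ 1) (λ _ _ → base , h)
      (pos x₄) (neg′ x₅) (pos (# 3)) (neg′ (# 3)) (λ _ _ _ → refl) (λ _ _ → refl) (λ _ _ → refl) big)
    go (inj₂ (inj₂ (inj₂ (inj₂ (inj₂ (inj₂ (inj₂ (inj₁ h)))))))) = ⊥-elim (not-big-K (p ∷ q ∷ []) (ordered ∧ # 2 ≼ x₄ ∧ (x₅ ≃ x₄ ↑ 2) ∧ x₅ ↑ 1 ≼ x₁) (λ _ _ → base , h)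
      (pos x₄) (neg′ x₅) (pos (x₅ ↑ 3)) (neg′ (x₅ ↑ 3)) (λ _ _ _ → refl) (λ _ _ → refl) (λ _ _ → refl) big)
    go (inj₂ (inj₂ (inj₂ (inj₂ (inj₂ (inj₂ (inj₂ (inj₂ (inj₁ h))))))))) = ⊥-elim (not-big-K (p ∷ q ∷ []) (ordered ∧ (x₅ ≃ x₄ ↑ 2) ∧ x₁ ≼ x₅) (λ _ _ → base , h)
      (pos x₄) (neg′ x₅) (pos (# 2)) (neg′ (# 2)) (λ _ _ _ → refl) (λ _ _ → refl) (λ _ _ → refl) big)
    go (inj₂ (inj₂ (inj₂ (inj₂ (inj₂ (inj₂ (inj₂ (inj₂ (inj₂ (inj₁ h)))))))))) = ⊥-elim (not-big-K (p ∷ q ∷ []) (ordered ∧ (x₄ ≃ # 3) ∧ # 6 ≼ x₅) (λ _ _ → base , h)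
      (pos x₄) (neg′ x₅) (pos (# 1)) (neg′ (# 2)) (λ _ _ _ → refl) (λ _ _ → refl) (λ _ _ → refl) big)
    go (inj₂ (inj₂ (inj₂ (inj₂ (inj₂ (inj₂ (inj₂ (inj₂ (inj₂ (inj₂ (inj₁ h))))))))))) = ⊥-elim (not-big-K (p ∷ q ∷ []) (ordered ∧ (x₄ ≃ # 2) ∧ # 5 ≼ x₅ ∧ x₅ ↑ 1 ≼ x₁) (λ _ _ → base , h)
      (pos x₄) (neg′ x₅) (pos (x₅ ↑ 3)) (neg′ (x₅ ↑ 3)) (λ _ _ _ → refl) (λ _ _ → refl) (λ _ _ → refl) big)
    go (inj₂ (inj₂ (inj₂ (inj₂ (inj₂ (inj₂ (inj₂ (inj₂ (inj₂ (inj₂ (inj₂ h))))))))))) = ⊥-elim (not-big-K (p ∷ q ∷ []) (ordered ∧ (x₄ ≃ # 2) ∧ x₁ ≼ x₅) (λ _ _ → base , h)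
      (pos x₄) (neg′ x₅) (pos (# 4)) (neg′ (# 4)) (λ _ _ _ → refl) (λ _ _ → refl) (λ _ _ → refl) big)

-- The data of Δ(I) used to compare two complexes

Pair : ℕ → ℤ → ℤ → Set
Pair t x y = (x ≡ + 2 × y ≡ + 3) ⊎ (x ≡ + (1 + t) × y ≡ + (3 + t))

Either : ℕ → ℤ → ℤ → Set
Either t x y = Pair t x y ⊎ Pair t y x

-- The facts about Δ(I), with n = t + 3, that determine I.
record Profile (t : ℕ) (D : Cx) (ds : List ℕ) : Set where
  N : ℕ
  N = 1 + t
  Link : ℤ → ℤ → Set
  Link a b = Face D (+ N ∷ + (2 + N) ∷ a ∷ b ∷ [])
  Link₂₃ : ℤ → ℤ → Set
  Link₂₃ a b = Face D (+ 2 ∷ + 3 ∷ a ∷ b ∷ [])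
  field
    sphere : Sphere (3 + N) D
    special : ∀ {x y} → InV (3 + N) x → InV (3 + N) y → Away x y → Big (3 + N) D x y → Either t x y ⊎ Either t (- x) (- y)
    link-top-1 : Link (+ (3 + N)) (+ 1)
    link-top-2 : Link (+ (3 + N)) (+ 2)
    link-bot : Link (+ (1 + N)) -[1+ 2 + N ]
    link-bot-1 : Link -[1+ 0 ] -[1+ 2 + N ]
    link⁺ : ∀ j → 2 ≤ j → j < t → Link (+ j) (+ suc j)
    link⁻ : ∀ j → 1 ≤ j → j < t → Link (- (+ j)) -[1+ j ]
    link-t : Link (+ t) (+ (1 + N))
    link-1 : Link (+ 1) (- (+ t))
    link₂₃-top-1 : Link₂₃ (+ 1) (+ (3 + N))
    link₂₃-top-5 : Link₂₃ (+ 5) (+ (3 + N))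
    link₂₃-1 : Link₂₃ (+ 1) -[1+ 3 ]
    link₂₃-6 : Link₂₃ -[1+ 5 ] -[1+ 3 ]
    link₂₃-86 : Link₂₃ (+ 8) (+ 6)
    triangle-1 : Face D (+ t ∷ + (1 + N) ∷ + 1 ∷ [])
    triangle-2 : ∀ u → t ≡ suc u → Face D (+ 2 ∷ + u ∷ + N ∷ [])
    no-triangle-2 : ∀ u → t ≡ suc u → ¬ Face D (+ 2 ∷ + u ∷ + (2 + N) ∷ [])
    no-triangle₂₃ : ¬ Face D (+ 2 ∷ + 3 ∷ -[1+ 0 ] ∷ [])
    no-triangle₁₄₅ : ¬ Face D (-[1+ 3 ] ∷ + 1 ∷ -[1+ 4 ] ∷ [])
    no-link : ¬ Face D (+ N ∷ + (2 + N) ∷ -[1+ N ] ∷ [])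
    in-link : ∀ {a} → InV (3 + N) a → Away a (+ N) → Away a (+ (2 + N)) → a ≢ -[1+ N ] → Face D (+ N ∷ + (2 + N) ∷ a ∷ [])
    link-big : Big (3 + N) D (+ N) (+ (2 + N))
    top-in : ∀ {d} → d ∈ ds → Face D (+ (3 + N) ∷ + 1 ∷ - (+ d) ∷ [])
    in-top : ∀ {d} → 4 ≤ d → 3 + d ≤ N → Face D (+ (3 + N) ∷ + 1 ∷ - (+ d) ∷ []) → d ∈ ds

module Special (t : ℕ) (7≤t : 7 ≤ t) (K : Cx) (S : Sphere (3 + t) K) (C : Closed (1 + t) K)
  (I : List ℕ) (inI : InI (3 + t) I) where

  open Bigness t 7≤t K S C I inI public

  -- By `face-top` the third vertex must be a neighbour of p in B(I), so two non-neighbours suffice.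
  -- Inside B(I) the vertices 3 and 4 meet no p ≥ 7, and the small p do not meet the most negative
  -- vertices.
  big-top⁺ : ∀ p → 1 ≤ p → p ≤ 2 + N → ¬ Big (3 + N) D (+ (3 + N)) (+ p)
  big-top⁺ p a b with p ℕ.≤? 6
  ... | no c = not-big-top (p ∷ []) (# 8 ≼ x₁ ∧ # 7 ≼ x₄ ∧ x₄ ≼ x₁ ↑ 2) (λ _ _ → 8≤N , ℕP.≰⇒> c , b)
    (pos x₄) (pos (# 3)) (pos (# 4)) (λ _ _ → refl) (λ _ _ → refl)
  ... | yes c with 2 ℕ.≤? p
  ...   | yes d = not-big-top (p ∷ []) (# 8 ≼ x₁ ∧ # 2 ≼ x₄ ∧ x₄ ≼ # 6) (λ _ _ → 8≤N , d , c)
    (pos x₄) (neg′ (x₁ ↑ 1)) (neg′ (x₁ ↑ 2)) (λ _ _ → refl) (λ _ _ → refl)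
  ...   | no d = not-big-top (p ∷ []) (# 8 ≼ x₁ ∧ # 1 ≼ x₄ ∧ x₄ ≼ # 1) (λ _ _ → 8≤N , a , ℕP.≤-pred (ℕP.≰⇒> d))
    (pos x₄) (neg′ (# 2)) (neg′ (# 3)) (λ _ _ → refl) (λ _ _ → refl)

  big-top⁻ : ∀ p → 1 ≤ p → p ≤ 2 + N → ¬ Big (3 + N) D (+ (3 + N)) (- (+ p))
  big-top⁻ p a b with p ℕ.<? N
  ... | yes c = not-big-top (p ∷ []) (# 8 ≼ x₁ ∧ # 1 ≼ x₄ ∧ x₄ ↑ 1 ≼ x₁) (λ _ _ → 8≤N , a , c)
    (neg′ x₄) (neg′ (x₁ ↑ 1)) (neg′ (x₁ ↑ 2)) (λ _ _ → refl) (λ _ _ → refl)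
  ... | no c = not-big-top (p ∷ []) (# 8 ≼ x₁ ∧ x₁ ≼ x₄ ∧ x₄ ≼ x₁ ↑ 2) (λ _ _ → 8≤N , ℕP.≮⇒≥ c , b)
    (neg′ x₄) (pos (# 3)) (pos (# 4)) (λ _ _ → refl) (λ _ _ → refl)

  big-top : ∀ {w} → InV (2 + N) w → ¬ Big (3 + N) D (+ (3 + N)) w
  big-top {+ zero} (n , _) _ = n refl
  big-top {+ suc p} (_ , b) = big-top⁺ (suc p) (s≤s z≤n) b
  big-top { -[1+ p ]} (_ , b) = big-top⁻ (suc p) (s≤s z≤n) b

  private
    signs : ∀ p q → 1 ≤ p → p ≤ 2 + N → 1 ≤ q → q ≤ 2 + N → p ≢ q → Big (3 + N) D (+ p) (+ q) → Either t (+ p) (+ q)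
    signs p q a b c d n big with ℕP.<-cmp p q
    ... | Relation.Binary.tri≈ _ e _ = ⊥-elim (n e)
    ... | Relation.Binary.tri< l _ _ = inj₁ (pair (big-pp p q a l d big))
      where
      pair : (p ≡ 2 × q ≡ 3) ⊎ (p ≡ N × q ≡ 2 + N) → Pair t (+ p) (+ q)
      pair (inj₁ (refl , refl)) = inj₁ (refl , refl)
      pair (inj₂ (refl , refl)) = inj₂ (refl , refl)
    ... | Relation.Binary.tri> _ _ l = inj₂ (pair (big-pp q p c l b (big-sym big)))
      where
      pair : (q ≡ 2 × p ≡ 3) ⊎ (q ≡ N × p ≡ 2 + N) → Pair t (+ q) (+ p)
      pair (inj₁ (refl , refl)) = inj₁ (refl , refl)
      pair (inj₂ (refl , refl)) = inj₂ (refl , refl)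

    mixed : ∀ p q → 1 ≤ p → p ≤ 2 + N → 1 ≤ q → q ≤ 2 + N → p ≢ q → ¬ Big (3 + N) D (+ p) (- (+ q))
    mixed p q a b c d n big with ℕP.<-cmp p q
    ... | Relation.Binary.tri≈ _ e _ = n e
    ... | Relation.Binary.tri< l _ _ = big-pn p q a l d big
    ... | Relation.Binary.tri> _ _ l = big-pn q p c l b
      (subst (λ x → Big (3 + N) D x (- (+ p))) (ℤP.neg-involutive (+ q)) (big-neg stepped (big-sym big)))

  special : ∀ {x y} → InV (3 + N) x → InV (3 + N) y → Away x y → Big (3 + N) D x y → Either t x y ⊎ Either t (- x) (- y)
  special {x} {y} i j (n , n') big with InV-split i | InV-split j
  ... | inj₂ (inj₁ refl) | inj₁ j' = ⊥-elim (big-top j' big)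
  ... | inj₂ (inj₂ refl) | inj₁ j' = ⊥-elim (big-top (InV-neg j') (big-neg stepped big))
  ... | inj₁ i' | inj₂ (inj₁ refl) = ⊥-elim (big-top i' (big-sym big))
  ... | inj₁ i' | inj₂ (inj₂ refl) = ⊥-elim (big-top (InV-neg i') (big-neg stepped (big-sym big)))
  ... | inj₂ (inj₁ refl) | inj₂ (inj₁ refl) = ⊥-elim (n refl)
  ... | inj₂ (inj₁ refl) | inj₂ (inj₂ refl) = ⊥-elim (n' refl)
  ... | inj₂ (inj₂ refl) | inj₂ (inj₁ refl) = ⊥-elim (n' refl)
  ... | inj₂ (inj₂ refl) | inj₂ (inj₂ refl) = ⊥-elim (n refl)
  ... | inj₁ i' | inj₁ j' = go x y i' j' n n' big
    where
    go : ∀ x y → InV (2 + N) x → InV (2 + N) y → x ≢ y → x ≢ - y → Big (3 + N) D x y → Either t x y ⊎ Either t (- x) (- y)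
    go (+ zero) y (a , _) _ _ _ _ = ⊥-elim (a refl)
    go (+ suc p) (+ zero) _ (a , _) _ _ _ = ⊥-elim (a refl)
    go -[1+ p ] (+ zero) _ (a , _) _ _ _ = ⊥-elim (a refl)
    go (+ suc p) (+ suc q) (_ , b) (_ , d) n n' big =
      inj₁ (signs (suc p) (suc q) (s≤s z≤n) b (s≤s z≤n) d (λ e → n (cong +_ e)) big)
    go (+ suc p) -[1+ q ] (_ , b) (_ , d) n n' big =
      ⊥-elim (mixed (suc p) (suc q) (s≤s z≤n) b (s≤s z≤n) d (λ e → n' (cong +_ e)) big)
    go -[1+ p ] (+ suc q) (_ , b) (_ , d) n n' big =
      ⊥-elim (mixed (suc p) (suc q) (s≤s z≤n) b (s≤s z≤n) d (λ e → n' (cong (λ k → - (+ k)) e)) (big-neg stepped big))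
    go -[1+ p ] -[1+ q ] (_ , b) (_ , d) n n' big =
      inj₂ (signs (suc p) (suc q) (s≤s z≤n) b (s≤s z≤n) d (λ e → n (cong (λ k → - (+ k)) e)) (big-neg stepped big))

  -- The link of the edge {n-2, n}.
  Link : ℤ → ℤ → Set
  Link a b = Face D (+ N ∷ + (2 + N) ∷ a ∷ b ∷ [])

  private
    pr : ∀ {n} → 1 ≤ n → suc (ℕ.pred n) ≡ n
    pr {n} p = ℕP.suc-pred n {{ℕ.>-nonZero p}}

    N=t : Formula
    N=t = # 7 ≼ x₄ ∧ x₁ ≼ x₄ ↑ 1 ∧ x₄ ↑ 1 ≼ x₁

    N=t-holds : 7 ≤ t × N ≤ 1 + t × 1 + t ≤ N
    N=t-holds = 7≤t , ℕP.≤-refl , ℕP.≤-refl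

    move₁ : ∀ {v a b c : ℤ} → b ∷ c ∷ v ∷ a ∷ [] ⊆ v ∷ a ∷ b ∷ c ∷ []
    move₁ (here e) = there (there (here e))
    move₁ (there (here e)) = there (there (there (here e)))
    move₁ (there (there (here e))) = here e
    move₁ (there (there (there (here e)))) = there (here e)

    low-N : Facet ds (f₀ N)
    low-N = low (ℕP.≤-trans (s≤s (s≤s (s≤s z≤n))) 8≤N) ℕP.≤-refl

  -- With the seven that follow, this gives the whole link of {n-2, n}: the cycle (n+1, 2, 3, ...,
  -- n-3, n-1, -(n+1), -1, ..., -(n-3), 1), which misses only -(n-1). The edges at ±(n+1) come from
  -- the cones, the others from Δ³_n.
  link-top-1 : Link (+ (3 + N)) (+ 1)
  link-top-1 = face-⊆ move₁ (face-ridge [] (# 8 ≼ x₁) (λ _ _ → 8≤N)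
    (pos (# 1) ∷ pos (# 2) ∷ pos x₁ ∷ pos (x₁ ↑ 2) ∷ []) 1 (λ _ _ → refl) (λ _ _ → refl) (facet∈ low-N))

  link-top-2 : Link (+ (3 + N)) (+ 2)
  link-top-2 = face-⊆ move₁ (face-ridge [] (# 8 ≼ x₁) (λ _ _ → 8≤N)
    (pos (# 1) ∷ pos (# 2) ∷ pos x₁ ∷ pos (x₁ ↑ 2) ∷ []) 0 (λ _ _ → refl) (λ _ _ → refl) (facet∈ low-N))

  link-bot : Link (+ (1 + N)) -[1+ 2 + N ]
  link-bot = face-⊆ (λ { (here e) → there (here e) ; (there (here e)) → there (there (there (here e)))
      ; (there (there (here e))) → there (there (here e)) ; (there (there (there (here e)))) → here e })
    (D-face-neg (face-ridge [] (# 8 ≼ x₁) (λ _ _ → 8≤N)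
      (pos (# 1) ∷ neg′ x₁ ∷ neg′ (x₁ ↑ 1) ∷ neg′ (x₁ ↑ 2) ∷ []) 0 (λ _ _ → refl) (λ _ _ → refl) (facet∈ m₄)))

  link-bot-1 : Link -[1+ 0 ] -[1+ 2 + N ]
  link-bot-1 = face-⊆ (λ { (here e) → there (there (here e)) ; (there (here e)) → there (there (there (here e)))
      ; (there (there (here e))) → there (here e) ; (there (there (there (here e)))) → here e })
    (D-face-neg (face-ridge [] (# 8 ≼ x₁) (λ _ _ → 8≤N)
      (pos (# 1) ∷ neg′ x₁ ∷ neg′ (x₁ ↑ 1) ∷ neg′ (x₁ ↑ 2) ∷ []) 2 (λ _ _ → refl) (λ _ _ → refl) (facet∈ m₄)))

  link⁺ : ∀ j → 2 ≤ j → j < t → Link (+ j) (+ suc j)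
  link⁺ j a b = face-K (t ∷ j ∷ []) (N=t ∧ # 2 ≼ x₅ ∧ x₅ ↑ 1 ≼ x₄) (λ _ _ → N=t-holds , a , b)
    (pos x₁ ∷ pos (x₁ ↑ 2) ∷ pos x₅ ∷ pos (x₅ ↑ 1) ∷ []) (case tt′ then 0 at x₅ , x₄) tt (λ _ _ → refl)

  link⁻ : ∀ j → 1 ≤ j → j < t → Link (- (+ j)) -[1+ j ]
  link⁻ j a b = face-K (t ∷ j ∷ []) (N=t ∧ # 1 ≼ x₅ ∧ x₅ ↑ 1 ≼ x₄) (λ _ _ → N=t-holds , a , b)
    (pos x₁ ∷ pos (x₁ ↑ 2) ∷ neg′ x₅ ∷ neg′ (x₅ ↑ 1) ∷ []) (case tt′ then 1 at x₅ , x₄) tt (λ _ _ → refl)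

  link-t : Link (+ t) (+ (1 + N))
  link-t = face-K (t ∷ []) N=t (λ _ _ → N=t-holds)
    (pos x₁ ∷ pos (x₁ ↑ 2) ∷ pos x₄ ∷ pos (x₁ ↑ 1) ∷ []) (case tt′ then 7 at x₄ , # 0) tt (λ _ _ → refl)

  link-1 : Link (+ 1) (- (+ t))
  link-1 = face-K (t ∷ []) N=t (λ _ _ → N=t-holds)
    (pos x₁ ∷ pos (x₁ ↑ 2) ∷ pos (# 1) ∷ neg′ x₄ ∷ []) (case tt′ then 2 at # 0 , x₄) tt (λ _ _ → refl)

  Link₂₃ : ℤ → ℤ → Set
  Link₂₃ a b = Face D (+ 2 ∷ + 3 ∷ a ∷ b ∷ [])

  -- Part of the link of {2, 3}, enough to exclude it as an image: the path 5, n+1, 1, -4, -6 and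
  -- the edge {8, 6}.
  link₂₃-top-1 : Link₂₃ (+ 1) (+ (3 + N))
  link₂₃-top-1 = face-⊆ (λ { (here e) → there (there (here e)) ; (there (here e)) → there (there (there (here e)))
      ; (there (there (here e))) → there (here e) ; (there (there (there (here e)))) → here e })
    (face-ridge [] (# 8 ≼ x₁) (λ _ _ → 8≤N) (pos (# 1) ∷ pos (# 2) ∷ pos (# 3) ∷ pos (# 5) ∷ []) 3
      (λ _ _ → refl) (λ _ _ → refl) (facet∈ (low ℕP.≤-refl (ℕP.≤-trans (ℕP.m≤m+n 3 5) 8≤N))))

  link₂₃-top-5 : Link₂₃ (+ 5) (+ (3 + N))
  link₂₃-top-5 = face-⊆ (λ { (here e) → there (here e) ; (there (here e)) → there (there (here e))
      ; (there (there (here e))) → there (there (there (here e))) ; (there (there (there (here e)))) → here e })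
    (face-ridge [] (# 8 ≼ x₁) (λ _ _ → 8≤N) (pos (# 1) ∷ pos (# 2) ∷ pos (# 3) ∷ pos (# 5) ∷ []) 0
      (λ _ _ → refl) (λ _ _ → refl) (facet∈ (low ℕP.≤-refl (ℕP.≤-trans (ℕP.m≤m+n 3 5) 8≤N))))

  link₂₃-1 : Link₂₃ (+ 1) -[1+ 3 ]
  link₂₃-1 = face-K [] (# 8 ≼ x₁) (λ _ _ → 8≤N) (pos (# 2) ∷ pos (# 3) ∷ pos (# 1) ∷ neg′ (# 4) ∷ [])
    (case tt′ then 16 at # 0 , # 1) tt (λ _ _ → refl)

  link₂₃-6 : Link₂₃ -[1+ 5 ] -[1+ 3 ]
  link₂₃-6 = face-K [] (# 8 ≼ x₁) (λ _ _ → 8≤N) (pos (# 2) ∷ pos (# 3) ∷ neg′ (# 6) ∷ neg′ (# 4) ∷ [])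
    (case tt′ then 13 at # 2 , # 3) tt (λ _ _ → refl)

  link₂₃-86 : Link₂₃ (+ 8) (+ 6)
  link₂₃-86 = face-K [] (# 8 ≼ x₁) (λ _ _ → 8≤N) (pos (# 2) ∷ pos (# 3) ∷ pos (# 8) ∷ pos (# 6) ∷ [])
    (case tt′ then 0 at # 2 , # 5) tt (λ _ _ → refl)

  triangle-1 : Face D (+ t ∷ + (1 + N) ∷ + 1 ∷ [])
  triangle-1 = face-⊆ (λ { (here e) → there (here e) ; (there (here e)) → here e ; (there (there (here e))) → there (there (there (here e))) })
    (face-K (ℕ.pred t ∷ t ∷ []) (# 6 ≼ x₄ ∧ x₅ ≼ x₄ ↑ 1 ∧ x₄ ↑ 1 ≼ x₅ ∧ x₁ ≼ x₅ ↑ 1 ∧ x₅ ↑ 1 ≼ x₁)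
      (λ _ _ → ℕP.≤-pred (ℕP.≤-trans 7≤t (ℕP.≤-reflexive (sym e))) , ℕP.≤-reflexive (sym e) , ℕP.≤-reflexive e , ℕP.≤-refl , ℕP.≤-refl)
      (pos (x₁ ↑ 1) ∷ pos x₅ ∷ neg′ x₄ ∷ pos (# 1) ∷ []) (case tt′ then 2 at # 0 , x₄) tt (λ _ _ → refl))
    where
    e : suc (ℕ.pred t) ≡ t
    e = pr (ℕP.≤-trans (s≤s z≤n) 7≤t)

  triangle-2 : ∀ u → t ≡ suc u → Face D (+ 2 ∷ + u ∷ + N ∷ [])
  triangle-2 u refl = face-⊆ (λ { (here e) → there (there (here e)) ; (there (here e)) → there (here e) ; (there (there (here e))) → here e })
    (face-K (u ∷ ℕ.pred u ∷ []) (# 6 ≼ x₄ ∧ x₄ ≼ x₅ ↑ 1 ∧ x₅ ↑ 1 ≼ x₄ ∧ x₁ ≼ x₄ ↑ 2 ∧ x₄ ↑ 2 ≼ x₁)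
      (λ _ _ → ℕP.≤-pred 7≤t , ℕP.≤-reflexive (sym e) , ℕP.≤-reflexive e , ℕP.≤-refl , ℕP.≤-refl)
      (pos x₁ ∷ pos x₄ ∷ pos (# 2) ∷ pos (# 3) ∷ []) (case tt′ then 0 at # 2 , x₅) tt (λ _ _ → refl))
    where
    e : suc (ℕ.pred u) ≡ u
    e = pr (ℕP.≤-trans (s≤s z≤n) (ℕP.≤-pred 7≤t))

  no-triangle-2 : ∀ u → t ≡ suc u → ¬ Face D (+ 2 ∷ + u ∷ + (2 + N) ∷ [])
  no-triangle-2 u refl F = proj₂ (proj₂ (face-implies (u ∷ []) (# 6 ≼ x₄ ∧ x₁ ≼ x₄ ↑ 2 ∧ x₄ ↑ 2 ≼ x₁)
    (λ _ _ → ℕP.≤-pred 7≤t , ℕP.≤-refl , ℕP.≤-refl) (pos (# 2) ∷ pos x₄ ∷ pos (x₁ ↑ 2) ∷ []) ff′ (λ _ _ → refl) F))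

  no-triangle₂₃ : ¬ Face D (+ 2 ∷ + 3 ∷ -[1+ 0 ] ∷ [])
  no-triangle₂₃ F = proj₂ (proj₂ (face-implies [] (# 8 ≼ x₁) (λ _ _ → 8≤N) (pos (# 2) ∷ pos (# 3) ∷ neg′ (# 1) ∷ []) ff′ (λ _ _ → refl) F))

  no-triangle₁₄₅ : ¬ Face D (-[1+ 3 ] ∷ + 1 ∷ -[1+ 4 ] ∷ [])
  no-triangle₁₄₅ F = proj₂ (proj₂ (face-implies [] (# 8 ≼ x₁) (λ _ _ → 8≤N) (neg′ (# 4) ∷ pos (# 1) ∷ neg′ (# 5) ∷ []) ff′ (λ _ _ → refl) F))

  no-link : ¬ Face D (+ N ∷ + (2 + N) ∷ -[1+ N ] ∷ [])
  no-link F = proj₂ (proj₂ (face-implies [] (# 8 ≼ x₁) (λ _ _ → 8≤N) (pos x₁ ∷ pos (x₁ ↑ 2) ∷ neg′ (x₁ ↑ 1) ∷ []) ff′ (λ _ _ → refl) F))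

  private
    drop-last : ∀ {a b c d : ℤ} → a ∷ b ∷ c ∷ [] ⊆ a ∷ b ∷ c ∷ d ∷ []
    drop-last (here e) = here e
    drop-last (there (here e)) = there (here e)
    drop-last (there (there (here e))) = there (there (here e))

    drop-third : ∀ {a b c d : ℤ} → a ∷ b ∷ d ∷ [] ⊆ a ∷ b ∷ c ∷ d ∷ []
    drop-third (here e) = here e
    drop-third (there (here e)) = there (here e)
    drop-third (there (there (here e))) = there (there (there (here e)))

  in-link : ∀ {a} → InV (3 + N) a → Away a (+ N) → Away a (+ (2 + N)) → a ≢ -[1+ N ] → Face D (+ N ∷ + (2 + N) ∷ a ∷ [])
  in-link {+ zero} (n , _) _ _ _ = ⊥-elim (n refl)
  in-link {+ suc zero} _ _ _ _ = face-⊆ drop-last link-1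
  in-link {+ suc (suc i)} (_ , l) (p , _) (q , _) _ with 2 + i ℕ.<? t
  ... | yes a = face-⊆ drop-last (link⁺ (2 + i) (s≤s (s≤s z≤n)) a)
  ... | no a with 2 + i ℕ.≟ t
  ...   | yes refl = face-⊆ drop-last link-t
  ...   | no b with 2 + i ℕ.≟ 1 + N
  ...     | yes refl = face-⊆ drop-third link-t
  ...     | no c with ℕP.≤-antisym l (ℕP.≤∧≢⇒< (ℕP.≤∧≢⇒< (ℕP.≤∧≢⇒< (ℕP.≤∧≢⇒< (ℕP.≮⇒≥ a) (b ∘ sym)) (λ e → p (cong +_ (sym e)))) (c ∘ sym)) (λ e → q (cong +_ (sym e))))
  ...       | refl = face-⊆ drop-last link-top-1
  in-link { -[1+ i ]} (_ , l) (_ , p) (_ , q) r with suc i ℕ.<? t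
  ... | yes a = face-⊆ drop-last (link⁻ (suc i) (s≤s z≤n) a)
  ... | no a with suc i ℕ.≟ t
  ...   | yes refl = face-⊆ drop-third link-1
  ...   | no b with ℕP.≤-antisym l (ℕP.≤∧≢⇒< (ℕP.≤∧≢⇒< (ℕP.≤∧≢⇒< (ℕP.≤∧≢⇒< (ℕP.≮⇒≥ a) (b ∘ sym)) (λ e → p (cong (λ k → - (+ k)) (sym e))))
                     (λ e → r (cong (λ k → - (+ k)) (sym e)))) (λ e → q (cong (λ k → - (+ k)) (sym e))))
  ...     | refl = face-⊆ drop-third link-bot

  link-big : Big (3 + N) D (+ N) (+ (2 + N))
  link-big {a} {b} i j ax ay bx by n f g with a ≟ -[1+ N ]
  ... | no m = f (in-link i ax ay m)
  ... | yes refl = g (in-link j bx by (n ∘ sym))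

  -- The edge {1, -d} belongs to the facet f₆ d, and a stacked ball has no interior edges, so the
  -- cone over the boundary sees it.
  top-in : ∀ {d} → d ∈ ds → Face D (+ (3 + N) ∷ + 1 ∷ - (+ d) ∷ [])
  top-in {d} p = from-edge (stacked-edge stackedB (thin-mono B⊆K (proj₂ (Sphere.good S))) (facet∈ (block (at-start p))) (here refl) (there (here refl)))
    where
    at-start : ∀ {ds} → d ∈ ds → Block ds (f₆ d)
    at-start (here refl) = start
    at-start (there p) = next (at-start p)
    from-edge : (∃ λ ρ → ρ ∈ ∂ B × + 1 ∈ ρ × - (+ d) ∈ ρ) → Face D (+ (3 + N) ∷ + 1 ∷ - (+ d) ∷ [])
    from-edge (ρ , r , a , b) = face~ (D-top (∈⇒∈~ r)) λ
      { (here e) → here e ; (there (here refl)) → there a ; (there (there (here refl))) → there b }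

  -- In this range of d only a block start f₆ contains 1 together with -d: the other facets through
  -- 1 have no negative vertex above -N, and the runs avoid 1.
  in-top : ∀ {d} → 4 ≤ d → 3 + d ≤ N → Face D (+ (3 + N) ∷ + 1 ∷ - (+ d) ∷ []) → d ∈ ds
  in-top {d} a b F = from-face (face⁻ (face-top verts F))
    where
    verts : ∀ {u} → u ∈ + 1 ∷ - (+ d) ∷ [] → InV (2 + N) u
    verts (here refl) = (λ ()) , s≤s z≤n
    verts (there (here refl)) = InV-neg ((λ e → ℕP.n≮0 (subst (4 ≤_) (ℤP.+-injective e) a)) ,
      ℕP.≤-trans (ℕP.≤-trans (ℕP.m≤n+m d 3) b) (ℕP.m≤n+m N 2))
    kill : ∀ τ → {T (valid 2 (# 4 ≼ x₂ ∧ x₂ ↑ 3 ≼ x₁ ∧ mem (neg′ x₂) τ) ff′)} → - (+ d) ∈ inst τ (N ∷ d ∷ []) → ⊥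
    kill τ {c} p = prove (N ∷ d ∷ []) (# 4 ≼ x₂ ∧ x₂ ↑ 3 ≼ x₁ ∧ mem (neg′ x₂) τ) ff′ {c} (a , b , mem⁺ {N ∷ d ∷ []} (neg′ x₂) τ p)
    kill′ : ∀ i τ → {T (valid 3 (# 4 ≼ x₂ ∧ mem (neg′ x₂) τ) ff′)} → - (+ d) ∈ inst τ (N ∷ d ∷ i ∷ []) → ⊥
    kill′ i τ {c} p = prove (N ∷ d ∷ i ∷ []) (# 4 ≼ x₂ ∧ mem (neg′ x₂) τ) ff′ {c} (a , mem⁺ {N ∷ d ∷ i ∷ []} (neg′ x₂) τ p)
    blk : ∀ {ds κ} → (∀ {d} → d ∈ ds → 4 ≤ d) → Block ds κ → + 1 ∈ κ → - (+ d) ∈ κ → d ∈ ds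
    blk big (start {d'}) p q = here (sub⇒ (prove (d ∷ d' ∷ []) (# 4 ≼ x₁ ∧ mem (neg′ x₁) τ) (x₁ ≼ x₂ ∧ x₂ ≼ x₁)
      (a , mem⁺ {d ∷ d' ∷ []} (neg′ x₁) τ q)))
      where
      τ : List Vertex
      τ = pos (# 1) ∷ neg′ x₂ ∷ pos (x₂ ↑ 1) ∷ pos (x₂ ↑ 3) ∷ []
      sub⇒ : d ≤ d' × d' ≤ d → d ≡ d'
      sub⇒ (u , w) = ℕP.≤-antisym u w
    blk big (run {d'} {_} {μ} _ _) p q = ⊥-elim (prove (μ ∷ d' ∷ []) (# 4 ≼ x₂ ∧ mem (pos (# 1)) (neg′ x₁ ∷ neg′ (x₁ ↑ 1) ∷ pos (x₂ ↑ 1) ∷ pos (x₂ ↑ 3) ∷ [])) ff′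
      (big (here refl) , mem⁺ {μ ∷ d' ∷ []} (pos (# 1)) (neg′ x₁ ∷ neg′ (x₁ ↑ 1) ∷ pos (x₂ ↑ 1) ∷ pos (x₂ ↑ 3) ∷ []) p))
    blk big (next f) p q = there (blk (λ p → big (there p)) f p q)
    go : ∀ {κ} → Facet ds κ → + 1 ∈ κ → - (+ d) ∈ κ → d ∈ ds
    go (low {i} _ _) p q = ⊥-elim (kill′ i (pos (# 1) ∷ pos (# 2) ∷ pos x₃ ∷ pos (x₃ ↑ 2) ∷ []) q)
    go m₁ p q = ⊥-elim (kill (pos (# 1) ∷ pos (# 2) ∷ pos (x₁ ↑ 1) ∷ pos (x₁ ↑ 2) ∷ []) q)
    go m₂ p q = ⊥-elim (kill (pos (# 1) ∷ neg′ x₁ ∷ pos (x₁ ↑ 1) ∷ pos (x₁ ↑ 2) ∷ []) q)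
    go m₃ p q = ⊥-elim (kill (pos (# 1) ∷ neg′ x₁ ∷ neg′ (x₁ ↑ 1) ∷ pos (x₁ ↑ 2) ∷ []) q)
    go m₄ p q = ⊥-elim (kill (pos (# 1) ∷ neg′ x₁ ∷ neg′ (x₁ ↑ 1) ∷ neg′ (x₁ ↑ 2) ∷ []) q)
    go (run₀ {μ} _ _) p q = ⊥-elim (prove (N ∷ μ ∷ []) (# 8 ≼ x₁ ∧ mem (pos (# 1)) (neg′ x₂ ∷ neg′ (x₂ ↑ 1) ∷ pos (x₁ ↑ 1) ∷ pos (x₁ ↑ 2) ∷ [])) ff′
      (8≤N , mem⁺ {N ∷ μ ∷ []} (pos (# 1)) (neg′ x₂ ∷ neg′ (x₂ ↑ 1) ∷ pos (x₁ ↑ 1) ∷ pos (x₁ ↑ 2) ∷ []) p))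
    go (block f) p q = blk (λ p → proj₁ (small ds desc p)) f p q
    from-face : (∃ λ κ → κ ∈ B × + 1 ∷ - (+ d) ∷ [] ⊆ κ) → d ∈ ds
    from-face (κ , k , s) = go (facet k) (s (here refl)) (s (there (here refl)))

  profile : Profile t D ds
  profile = record
    { sphere = stepped ; special = special ; link-top-1 = link-top-1 ; link-top-2 = link-top-2 ; link-bot = link-bot
    ; link-bot-1 = link-bot-1 ; link⁺ = link⁺ ; link⁻ = link⁻ ; link-t = link-t ; link-1 = link-1
    ; link₂₃-top-1 = link₂₃-top-1 ; link₂₃-top-5 = link₂₃-top-5 ; link₂₃-1 = link₂₃-1 ; link₂₃-6 = link₂₃-6
    ; link₂₃-86 = link₂₃-86 ; triangle-1 = triangle-1 ; triangle-2 = triangle-2 ; no-triangle-2 = no-triangle-2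
    ; no-triangle₂₃ = no-triangle₂₃ ; no-triangle₁₄₅ = no-triangle₁₄₅ ; no-link = no-link ; in-link = in-link
    ; link-big = link-big ; top-in = top-in ; in-top = in-top }

-- Rigidity of isomorphisms

no-fifth : ∀ {κ A u w} → IsSimplex 4 κ → IsSimplex 3 A → u ∉ A → w ∉ A → u ≢ w → u ∈ κ → w ∈ κ → ¬ A ⊆ κ
no-fifth {κ} {A} {u} {w} sκ sA u∉ w∉ n pu pw s = ℕP.<⇒≱ {4} {5} ℕP.≤-refl
  (subst₂ _≤_ (cong (λ l → 2 + l) (proj₂ sA)) (proj₂ sκ) (unique-⊆-length {u ∷ w ∷ A} {κ}
    (unique-∷ (λ { (here e) → n e ; (there x) → u∉ x }) (unique-∷ w∉ (proj₁ sA)))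
    λ { (here refl) → pu ; (there (here refl)) → pw ; (there (there x)) → s x }))

-- Thinness in terms of apexes: three different apexes over A would put a fifth vertex into one of
-- the facets.
third : ∀ {K A p q s} → Good K → IsSimplex 3 A → p ∉ A → q ∉ A → s ∉ A → s ≢ p →
  Face K (p ∷ A) → Face K (q ∷ A) → Face K (s ∷ A) → q ≡ p ⊎ q ≡ s
third {K} {A} {p} {q} {s} (pure , thin) sA p∉ q∉ s∉ s≢p F G H with q ≟ p | q ≟ s
... | yes e | _ = inj₁ e
... | no _ | yes e = inj₂ e
... | no q≢p | no q≢s with face⁻ F | face⁻ G | face⁻ H
...   | κ , k , a | λ' , l , b | μ , m , c with thin sA k l m (a ∘ there) (b ∘ there) (c ∘ there)
...     | inj₁ e = ⊥-elim (no-fifth (pure k) sA q∉ p∉ q≢p (proj₂ e (b (here refl))) (a (here refl)) (a ∘ there))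
...     | inj₂ (inj₁ e) = ⊥-elim (no-fifth (pure l) sA q∉ s∉ q≢s (b (here refl)) (proj₂ e (c (here refl))) (b ∘ there))
...     | inj₂ (inj₂ e) = ⊥-elim (no-fifth (pure k) sA s∉ p∉ s≢p (proj₂ e (c (here refl))) (a (here refl)) (a ∘ there))

module Isomorphisms {m : ℕ} {X Y : Cx} (SX : Sphere m X) (SY : Sphere m Y) where

  record Iso (f : ℤ → ℤ) : Set where
    field
      g : ℤ → ℤ
      gf : ∀ x → g (f x) ≡ x
      fg : ∀ y → f (g y) ≡ y
      fwd : ∀ σ → Face X σ → Face Y (map f σ)
      bwd : ∀ σ → Face Y (map f σ) → Face X σ

  -- Composition with the antipodal map, which removes the sign ambiguity in the rigidity argument.
  negated : ∀ {f} → Iso f → Iso (λ x → - f x)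
  negated {f} i = record
    { g = λ y → g (- y)
    ; gf = λ x → trans (cong g (ℤP.neg-involutive (f x))) (gf x)
    ; fg = λ y → trans (cong -_ (fg (- y))) (ℤP.neg-involutive y)
    ; fwd = λ σ F → subst (Face Y) (sym (map-∘ σ)) (sphere-symmetric SY (fwd σ F))
    ; bwd = λ σ F → bwd σ (subst (Face Y) (neg-neg (map f σ)) (sphere-symmetric SY (subst (Face Y) (map-∘ σ) F))) }
    where open Iso i

  module Properties {f : ℤ → ℤ} (i : Iso f) where
    open Iso i public

    injective : ∀ {x y} → f x ≡ f y → x ≡ y
    injective {x} {y} e = trans (sym (gf x)) (trans (cong g e) (gf y))

    f-InV : ∀ {v} → InV m v → InV m (f v)
    f-InV {v} p = proj₁ (neighborly-onVertexSet SY (f v)) (fwd (v ∷ []) (proj₂ (neighborly-onVertexSet SX v) p))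

    g-InV : ∀ {v} → InV m v → InV m (g v)
    g-InV {v} p = proj₁ (neighborly-onVertexSet SX (g v)) (bwd (g v ∷ [])
      (subst (λ u → Face Y (u ∷ [])) (sym (fg v)) (proj₂ (neighborly-onVertexSet SY v) p)))

    -- Antipodal pairs are the only missing edges.
    f-neg : ∀ {v} → InV m v → f (- v) ≡ - f v
    f-neg {v} p with f v ≟ - f (- v)
    ... | yes e = trans (sym (ℤP.neg-involutive _)) (cong -_ (sym e))
    ... | no n = ⊥-elim (proj₂ (sphere-cs SX) (v ∷ - v ∷ [])
      (bwd (v ∷ - v ∷ []) (Sphere.neighborly SY (f-InV p) (f-InV (InV-neg p)) n)) v (here refl) (there (here refl)))

    away-g : ∀ {a x} → InV m x → Away a (f x) → Away (g a) x
    away-g {a} {x} p (n , n') = (λ e → n (trans (sym (fg a)) (cong f e))) ,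
      (λ e → n' (trans (sym (fg a)) (trans (cong f e) (f-neg p))))

    big-image : ∀ {x y} → InV m x → InV m y → Big m X x y → Big m Y (f x) (f y)
    big-image {x} {y} px py big {a} {b} ia ib ax ay bx by n F G = big (g-InV ia) (g-InV ib) (away-g px ax) (away-g py ay)
      (away-g px bx) (away-g py by) (λ e → n (trans (sym (fg a)) (trans (cong f e) (fg b))))
      (F ∘ image a) (G ∘ image b)
      where
      image : ∀ a → Face X (x ∷ y ∷ g a ∷ []) → Face Y (f x ∷ f y ∷ a ∷ [])
      image a H = subst (λ u → Face Y (f x ∷ f y ∷ u ∷ [])) (fg a) (fwd (x ∷ y ∷ g a ∷ []) H)

    -- One step along the link of an edge: if p and u are the neighbours of c, every neighbour of f
    -- c in the image link is f p or f u.
    turn : ∀ {x y c p u} {x' y' c' q} → Unique (p ∷ u ∷ x ∷ y ∷ c ∷ []) →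
      Face X (x ∷ y ∷ p ∷ c ∷ []) → Face X (x ∷ y ∷ u ∷ c ∷ []) → f x ≡ x' → f y ≡ y' → f c ≡ c' →
      Face Y (x' ∷ y' ∷ q ∷ c' ∷ []) → q ∉ x' ∷ y' ∷ c' ∷ [] → q ≡ f p ⊎ q ≡ f u
    turn {x} {y} {c} {p} {u} {q = q} (up ∷ uu ∷ ux ∷ uy ∷ uc) F G refl refl refl H q∉ = third (Sphere.good SY) (image (ux ∷ uy ∷ uc) , refl)
      (unique-head (image (All.tail up ∷ ux ∷ uy ∷ uc))) q∉ (unique-head (image (uu ∷ ux ∷ uy ∷ uc))) (λ e → All.head up (sym (injective e)))
      (turned (fwd _ F)) (turned H) (turned (fwd _ G))
      where
      image : ∀ {σ} → Unique σ → Unique (map f σ)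
      image [] = []
      image (a ∷ s) = AllP.map⁺ (All.map (λ n e → n (injective e)) a) ∷ image s
      turned : ∀ {a b p c} → Face Y (a ∷ b ∷ p ∷ c ∷ []) → Face Y (p ∷ a ∷ b ∷ c ∷ [])
      turned = face-⊆ λ { (here e) → there (there (here e)) ; (there (here e)) → here e ; (there (there (here e))) → there (here e)
                        ; (there (there (there e))) → there (there (there e)) }

module Compare (t : ℕ) (7≤t : 7 ≤ t) {X Y : Cx} {ds es : List ℕ} (PX : Profile t X ds) (PY : Profile t Y es) where

  private
    module X = Profile PX
    module Y = Profile PY

  N : ℕ
  N = 1 + t

  open Isomorphisms X.sphere Y.sphere

  private
    top bot : ℤ
    top = + (3 + N)
    bot = -[1+ 2 + N ]

    uniq : ∀ zs h σ → {T (valid (length zs) h (distinct σ))} → ⟦ h ⟧ zs → Unique (inst σ zs)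
    uniq zs h σ {c} p = proj₁ (simplex-inst zs h σ {c} p)

    out : ∀ zs h v σ → {T (valid (length zs) h (distinct (v ∷ σ)))} → ⟦ h ⟧ zs → ⟦ v ⟧ᵛ zs ∉ inst σ zs
    out zs h v σ {c} p = unique-head (uniq zs h (v ∷ σ) {c} p)

    pos-InV : ∀ {j} → 1 ≤ j → j ≤ 3 + N → InV (3 + N) (+ j)
    pos-InV a b = (λ e → ℕP.n≮0 (subst (1 ≤_) (ℤP.+-injective e) a)) , b

    bot-InV : InV (3 + N) bot
    bot-InV = (λ ()) , ℕP.≤-refl

    minus-one : InV (3 + N) -[1+ 0 ]
    minus-one = (λ ()) , s≤s z≤n

    swap-last : ∀ {a b p c : ℤ} → a ∷ b ∷ p ∷ c ∷ [] ⊆ a ∷ b ∷ c ∷ p ∷ []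
    swap-last (here e) = here e
    swap-last (there (here e)) = there (here e)
    swap-last (there (there (here e))) = there (there (there (here e)))
    swap-last (there (there (there (here e)))) = there (there (here e))

    swap-edge : ∀ {a b : ℤ} {σ} → a ∷ b ∷ σ ⊆ b ∷ a ∷ σ
    swap-edge (here e) = there (here e)
    swap-edge (there (here e)) = here e
    swap-edge (there (there p)) = there (there p)

    unique-swap : ∀ {p u a b c : ℤ} → Unique (p ∷ u ∷ a ∷ b ∷ c ∷ []) → Unique (p ∷ u ∷ b ∷ a ∷ c ∷ [])
    unique-swap ((pu ∷ pa ∷ pb ∷ pc ∷ []) ∷ (ua ∷ ub ∷ uc ∷ []) ∷ (ab ∷ ac ∷ []) ∷ (bc ∷ []) ∷ _) =
      (pu ∷ pb ∷ pa ∷ pc ∷ []) ∷ (ub ∷ ua ∷ uc ∷ []) ∷ ((ab ∘ sym) ∷ bc ∷ []) ∷ (ac ∷ []) ∷ [] ∷ []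

    vN vN1 vN2 vtop vbot : Vertex
    vN = pos (x₁ ↑ 1)
    vN1 = pos (x₁ ↑ 2)
    vN2 = pos (x₁ ↑ 3)
    vtop = pos (x₁ ↑ 4)
    vbot = neg′ (x₁ ↑ 4)

    7≤x₁ : Formula
    7≤x₁ = # 7 ≼ x₁

  Fixes : (ℤ → ℤ) → Set
  Fixes f = ∀ v → InV (3 + N) v → f v ≡ v

  -- The ordered pair (x, y) is (n-2, n) or (n, n-2); the hypotheses translate between the two
  -- orders, so that one argument serves both.
  module Ends {f : ℤ → ℤ} (i : Iso f) (x y : ℤ)
    (uq : ∀ {p u c} → Unique (p ∷ u ∷ + N ∷ + (2 + N) ∷ c ∷ []) → Unique (p ∷ u ∷ x ∷ y ∷ c ∷ []))
    (xl : ∀ {σ} → Face X (+ N ∷ + (2 + N) ∷ σ) → Face X (x ∷ y ∷ σ))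
    (lx : ∀ {σ} → Face X (x ∷ y ∷ σ) → Face X (+ N ∷ + (2 + N) ∷ σ))
    (x-InV : InV (3 + N) x) (y-InV : InV (3 + N) y)
    (ax : Away -[1+ N ] x) (ay : Away -[1+ N ] y)
    (ends : ∀ {a} → Away a x → Away a y → Away a (+ N) × Away a (+ (2 + N))) where

    open Properties i

    step : ∀ {x' y' p u c c' q} → f x ≡ x' → f y ≡ y' → Unique (p ∷ u ∷ + N ∷ + (2 + N) ∷ c ∷ []) →
      X.Link p c → X.Link u c → f c ≡ c' → Face Y (x' ∷ y' ∷ q ∷ c' ∷ []) → q ∉ x' ∷ y' ∷ c' ∷ [] → q ≡ f p ⊎ q ≡ f u
    step fx fy U F G fc H q∉ = turn (uq U) (xl F) (xl G) fx fy fc H q∉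

    other : ∀ {q a b : ℤ} → q ≡ a ⊎ q ≡ b → q ≢ a → b ≡ q
    other (inj₁ e) n = ⊥-elim (n e)
    other (inj₂ e) n = sym e

    negate-value : ∀ {v w} → InV (3 + N) v → f v ≡ w → f (- v) ≡ - w
    negate-value p refl = f-neg p

    module Same (fx : f x ≡ + N) (fy : f y ≡ + (2 + N)) where

      -- Apart from the ends and their antipodes, -(n-1) is the only vertex missing from the link,
      -- on both sides, so it is fixed.
      f-N1 : f (+ (1 + N)) ≡ + (1 + N)
      f-N1 with f -[1+ N ] ≟ -[1+ N ]
      ... | yes e = negate-value ((λ ()) , ℕP.m≤n+m (1 + N) 2) e
      ... | no n = ⊥-elim (X.no-link (lx (bwd (x ∷ y ∷ -[1+ N ] ∷ [])
              (subst₂ (λ a b → Face Y (a ∷ b ∷ f -[1+ N ] ∷ [])) (sym fx) (sym fy)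
                (Y.in-link (f-InV ((λ ()) , ℕP.m≤n+m (1 + N) 2)) (awayf fx x-InV ax) (awayf fy y-InV ay) n)))))
        where
        awayf : ∀ {x x'} → f x ≡ x' → InV (3 + N) x → Away -[1+ N ] x → Away (f -[1+ N ]) x'
        awayf refl p (n , n') = (λ e → n (injective e)) , (λ e → n' (injective (trans e (sym (f-neg p)))))

      -- The neighbours of n-1 on the cycle are -(n+1) and n-3, so they are fixed or interchanged.
      across-N1 : (f bot ≡ bot × f (+ t) ≡ + t) ⊎ (f bot ≡ + t × f (+ t) ≡ bot)
      across-N1 = choose (go (face-⊆ swap-last Y.link-bot) bot∉) (go Y.link-t t∉)
        where
        go : ∀ {q} → Face Y (+ N ∷ + (2 + N) ∷ q ∷ + (1 + N) ∷ []) → q ∉ + N ∷ + (2 + N) ∷ + (1 + N) ∷ [] → q ≡ f bot ⊎ q ≡ f (+ t)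
        go = step fx fy (uniq (t ∷ []) 7≤x₁ (vbot ∷ pos x₁ ∷ vN ∷ vN2 ∷ vN1 ∷ []) 7≤t) (face-⊆ swap-last X.link-bot) X.link-t f-N1
        bot∉ : bot ∉ + N ∷ + (2 + N) ∷ + (1 + N) ∷ []
        bot∉ = out (t ∷ []) 7≤x₁ vbot (vN ∷ vN2 ∷ vN1 ∷ []) 7≤t
        t∉ : + t ∉ + N ∷ + (2 + N) ∷ + (1 + N) ∷ []
        t∉ = out (t ∷ []) 7≤x₁ (pos x₁) (vN ∷ vN2 ∷ vN1 ∷ []) 7≤t
        choose : bot ≡ f bot ⊎ bot ≡ f (+ t) → + t ≡ f bot ⊎ + t ≡ f (+ t) → _
        choose (inj₁ e) (inj₁ e') = case trans e (sym e') of λ ()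
        choose (inj₁ e) (inj₂ e') = inj₁ (sym e , sym e')
        choose (inj₂ e) (inj₁ e') = inj₂ (sym e' , sym e)
        choose (inj₂ e) (inj₂ e') = case trans e (sym e') of λ ()

      -- Once the neighbour bot of n - 1 is fixed, the whole link of {n-2, n} is.
      module Fixed (f-bot : f bot ≡ bot) (f-t : f (+ t) ≡ + t) where

        -- The successor on the cycle, which after n-3 jumps over n-2, an end of the edge.
        next : ℕ → ℤ
        next j with j ℕ.≟ t
        ... | yes _ = + (1 + N)
        ... | no _ = + suc j

        next-link : ∀ {D ds} (P : Profile t D ds) j → 2 ≤ j → j ≤ t → Profile.Link P (next j) (+ j)
        next-link P j a b with j ℕ.≟ t
        ... | yes refl = face-⊆ swap-last (Profile.link-t P)
        ... | no n = face-⊆ swap-last (Profile.link⁺ P j a (ℕP.≤∧≢⇒< b n))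

        -- Walks down the cycle from t. The neighbours of j + 1 are j and its successor; the latter
        -- is already fixed, so by injectivity j must be fixed too.
        f-range : ∀ d j → 2 ≤ j → j + d ≡ t → f (+ j) ≡ + j × f (next j) ≡ next j
        f-range zero j a e with j ℕ.≟ t
        ... | yes refl = f-t , f-N1
        ... | no n = ⊥-elim (n (trans (sym (ℕP.+-identityʳ j)) e))
        f-range (suc d) j a e = f-j , f-next
          where
          j<t : j < t
          j<t = subst (j <_) e (ℕP.m<m+n j (s≤s z≤n))
          IH : f (+ suc j) ≡ + suc j × f (next (suc j)) ≡ next (suc j)
          IH = f-range d (suc j) (ℕP.m≤n⇒m≤1+n a) (trans (sym (ℕP.+-suc j d)) e)
          next-cases : (next (suc j) ≡ + (1 + N) × suc j ≡ t) ⊎ (next (suc j) ≡ + (2 + j) × suc j < t)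
          next-cases with suc j ℕ.≟ t
          ... | yes e' = inj₁ (refl , e')
          ... | no n = inj₂ (refl , ℕP.≤∧≢⇒< j<t n)
          U : Unique (next (suc j) ∷ + j ∷ + N ∷ + (2 + N) ∷ + suc j ∷ [])
          U with next-cases
          ... | inj₁ (e' , _) = subst (λ v → Unique (v ∷ + j ∷ + N ∷ + (2 + N) ∷ + suc j ∷ [])) (sym e')
                  (uniq (t ∷ j ∷ []) (x₂ ↑ 1 ≼ x₁) (vN1 ∷ pos x₂ ∷ vN ∷ vN2 ∷ pos (x₂ ↑ 1) ∷ []) j<t)
          ... | inj₂ (e' , l) = subst (λ v → Unique (v ∷ + j ∷ + N ∷ + (2 + N) ∷ + suc j ∷ [])) (sym e')
                  (uniq (t ∷ j ∷ []) (x₂ ↑ 2 ≼ x₁) (pos (x₂ ↑ 2) ∷ pos x₂ ∷ vN ∷ vN2 ∷ pos (x₂ ↑ 1) ∷ []) l)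
          f-j : f (+ j) ≡ + j
          f-j = other (step fx fy U (next-link PX (suc j) (ℕP.m≤n⇒m≤1+n a) j<t) (X.link⁺ j a j<t) (proj₁ IH) (Y.link⁺ j a j<t)
            (out (t ∷ j ∷ []) (x₂ ↑ 1 ≼ x₁) (pos x₂) (vN ∷ vN2 ∷ pos (x₂ ↑ 1) ∷ []) j<t))
            (λ e' → All.head (proj₁ (uncons U)) (trans (sym (proj₂ IH)) (sym e')))
            where
            uncons : ∀ {x : ℤ} {σ} → Unique (x ∷ σ) → All (x ≢_) σ × Unique σ
            uncons (a ∷ u) = a , u
          f-next : f (next j) ≡ next j
          f-next with j ℕ.≟ t
          ... | yes refl = ⊥-elim (ℕP.<-irrefl refl j<t)
          ... | no _ = proj₁ IH

        f-low : ∀ j → 2 ≤ j → j ≤ t → f (+ j) ≡ + j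
        f-low j a b = proj₁ (f-range (t ∸ j) j a (ℕP.m+[n∸m]≡n b))

        2≤t : 2 ≤ t
        2≤t = ℕP.≤-trans (s≤s (s≤s z≤n)) 7≤t

        f-top : f top ≡ top
        f-top = negate-value bot-InV f-bot

        f-1 : f (+ 1) ≡ + 1
        f-1 = other (step fx fy (uniq (t ∷ []) 7≤x₁ (pos (# 2) ∷ pos (# 1) ∷ vN ∷ vN2 ∷ vtop ∷ []) 7≤t)
          (face-⊆ swap-last X.link-top-2) (face-⊆ swap-last X.link-top-1) f-top (face-⊆ swap-last Y.link-top-1)
          (out (t ∷ []) 7≤x₁ (pos (# 1)) (vN ∷ vN2 ∷ vtop ∷ []) 7≤t))
          (λ e → case trans e (f-low 2 ℕP.≤-refl 2≤t) of λ ())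

        fixes : f (+ N) ≡ + N → f (+ (2 + N)) ≡ + (2 + N) → Fixes f
        fixes fN fN2 = go
          where
          up : ∀ j → 1 ≤ j → j ≤ 3 + N → f (+ j) ≡ + j
          up j a b with j ℕ.≤? t
          up (suc zero) _ _ | yes _ = f-1
          up (suc (suc j)) _ _ | yes l = f-low (2 + j) (s≤s (s≤s z≤n)) l
          up j a b | no l with j ℕ.≟ N | j ℕ.≟ 1 + N | j ℕ.≟ 2 + N
          ... | yes refl | _ | _ = fN
          ... | no _ | yes refl | _ = f-N1
          ... | no _ | no _ | yes refl = fN2
          ... | no u | no w | no z' with ℕP.≤-antisym b (ℕP.≤∧≢⇒< (ℕP.≤∧≢⇒< (ℕP.≤∧≢⇒< (ℕP.≰⇒> l) (u ∘ sym)) (w ∘ sym)) (z' ∘ sym))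
          ...   | refl = f-top
          go : ∀ v → InV (3 + N) v → f v ≡ v
          go (+ zero) (n , _) = ⊥-elim (n refl)
          go (+ suc j) (_ , b) = up (suc j) (s≤s z≤n) b
          go -[1+ j ] (_ , b) = negate-value {+ suc j} (pos-InV (s≤s z≤n) b) (up (suc j) (s≤s z≤n) b)

        -- The cycle alone cannot exclude that n-2 and n are interchanged. With u = n-4, the
        -- triangle {2, n-4, n-2} does: it is a face, whereas {2, n-4, n} is not.
        unswapped : f (+ N) ≡ + (2 + N) → ⊥
        unswapped e = go t refl
          where
          go : ∀ s → t ≡ s → ⊥
          go zero refl = ℕP.n≮0 7≤t
          go (suc u) q = Y.no-triangle-2 u q (subst₂ (λ a b → Face Y (f (+ 2) ∷ a ∷ b ∷ [])) (f-low u 2≤u u≤t) e (fwd _ (X.triangle-2 u q)) ▹)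
            where
            2≤u : 2 ≤ u
            2≤u = ℕP.≤-trans (s≤s (s≤s z≤n)) (ℕP.≤-pred (subst (7 ≤_) q 7≤t))
            u≤t : u ≤ t
            u≤t = subst (u ≤_) (sym q) (ℕP.n≤1+n u)
            _▹ : ∀ {σ} → Face Y (f (+ 2) ∷ σ) → Face Y (+ 2 ∷ σ)
            _▹ {σ} = subst (λ a → Face Y (a ∷ σ)) (f-low 2 ℕP.≤-refl 2≤t)

      -- Otherwise the link would be reflected, which contradicts the position of
      -- the antipodal pairs in it.
      reflected : f bot ≡ + t → f (+ t) ≡ bot → ⊥
      reflected f-bot f-t = go t refl
        where
        go : ∀ s → t ≡ s → ⊥
        go zero refl = ℕP.n≮0 7≤t
        go (suc zero) refl = case 7≤t of λ { (s≤s ()) }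
        go (suc (suc u)) refl = [ (λ e → case trans e f-1 of λ ()) , (λ e → positive u (trans e f-2)) ]′
          (step fx fy (uniq (t ∷ []) 7≤x₁ (pos (# 1) ∷ pos (# 2) ∷ vN ∷ vN2 ∷ vtop ∷ []) 7≤t)
            (face-⊆ swap-last X.link-top-1) (face-⊆ swap-last X.link-top-2) (negate-value bot-InV f-bot) Y.link-1
            (out (t ∷ []) 7≤x₁ (pos (# 1)) (vN ∷ vN2 ∷ neg′ x₁ ∷ []) 7≤t))
          where
          positive : ∀ u → + 1 ≢ - (+ u)
          positive zero ()
          positive (suc u) ()
          5≤u : 5 ≤ u
          5≤u = ℕP.≤-pred (ℕP.≤-pred 7≤t)
          f-m1 : f -[1+ 0 ] ≡ + (1 + u)
          f-m1 = other (step fx fy (uniq (t ∷ []) 7≤x₁ (vN1 ∷ neg′ (# 1) ∷ vN ∷ vN2 ∷ vbot ∷ []) 7≤t)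
            X.link-bot X.link-bot-1 f-bot (Y.link⁺ (1 + u) (s≤s (ℕP.≤-trans (s≤s z≤n) 5≤u)) ℕP.≤-refl)
            (out (u ∷ []) (# 5 ≼ x₁) (pos (x₁ ↑ 1)) (pos (x₁ ↑ 3) ∷ pos (x₁ ↑ 5) ∷ pos (x₁ ↑ 2) ∷ []) 5≤u))
            (λ e → uniq-≢ (trans e f-N1))
            where
            uniq-≢ : + (1 + u) ≢ + (4 + u)
            uniq-≢ e = All.head (head (uniq (u ∷ []) tt′ (pos (x₁ ↑ 1) ∷ pos (x₁ ↑ 4) ∷ []) tt)) e
              where
              head : ∀ {x : ℤ} {σ} → Unique (x ∷ σ) → All (x ≢_) σ
              head (a ∷ _) = a
          f-m2 : f -[1+ 1 ] ≡ + u
          f-m2 = other (step fx fy (uniq (t ∷ []) 7≤x₁ (vbot ∷ neg′ (# 2) ∷ vN ∷ vN2 ∷ neg′ (# 1) ∷ []) 7≤t)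
            (face-⊆ swap-last X.link-bot-1) (face-⊆ swap-last (X.link⁻ 1 ℕP.≤-refl (s≤s (s≤s z≤n)))) f-m1
            (Y.link⁺ u (ℕP.≤-trans (s≤s (s≤s z≤n)) 5≤u) (ℕP.n≤1+n (suc u)))
            (out (u ∷ []) (# 5 ≼ x₁) (pos x₁) (pos (x₁ ↑ 3) ∷ pos (x₁ ↑ 5) ∷ pos (x₁ ↑ 1) ∷ []) 5≤u))
            (λ e → case trans e f-bot of λ e' → ℕP.<-irrefl (ℤP.+-injective e') (s≤s (ℕP.n≤1+n u)))
          f-1 : f (+ 1) ≡ -[1+ u ]
          f-1 = negate-value minus-one f-m1
          f-2 : f (+ 2) ≡ - (+ u)
          f-2 = negate-value { -[1+ 1 ]} ((λ ()) , s≤s (s≤s z≤n)) f-m2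

    module Short (fx : f x ≡ + 2) (fy : f y ≡ + 3) where

      -- The link of {2, 3} misses -1 and that of {n-2, n} misses only -(n-1), so these two
      -- correspond.
      f-N1 : f (+ (1 + N)) ≡ + 1
      f-N1 with g -[1+ 0 ] ≟ -[1+ N ]
      ... | yes e = negate-value { -[1+ N ]} ((λ ()) , ℕP.m≤n+m (1 + N) 2) (trans (cong f (sym e)) (fg -[1+ 0 ]))
      ... | no n = ⊥-elim (Y.no-triangle₂₃ (subst₂ (λ a b → Face Y (a ∷ b ∷ -[1+ 0 ] ∷ [])) fx fy
              (subst (λ a → Face Y (f x ∷ f y ∷ a ∷ [])) (fg -[1+ 0 ])
                (fwd (x ∷ y ∷ g -[1+ 0 ] ∷ []) (xl (X.in-link (g-InV minus-one) (proj₁ away-xy) (proj₂ away-xy) n))))))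
        where
        away-xy : Away (g -[1+ 0 ]) (+ N) × Away (g -[1+ 0 ]) (+ (2 + N))
        away-xy = ends (away-g x-InV (subst (Away -[1+ 0 ]) (sym fx) ((λ ()) , (λ ()))))
                       (away-g y-InV (subst (Away -[1+ 0 ]) (sym fy) ((λ ()) , (λ ()))))

      across-N1 : (f bot ≡ top × f (+ t) ≡ -[1+ 3 ]) ⊎ (f bot ≡ -[1+ 3 ] × f (+ t) ≡ top)
      across-N1 = choose
        (go (face-⊆ swap-last Y.link₂₃-top-1) (out (t ∷ []) 7≤x₁ vtop (pos (# 2) ∷ pos (# 3) ∷ pos (# 1) ∷ []) 7≤t))
        (go (face-⊆ swap-last Y.link₂₃-1) (out [] tt′ (neg′ (# 4)) (pos (# 2) ∷ pos (# 3) ∷ pos (# 1) ∷ []) tt))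
        where
        go : ∀ {q} → Face Y (+ 2 ∷ + 3 ∷ q ∷ + 1 ∷ []) → q ∉ + 2 ∷ + 3 ∷ + 1 ∷ [] → q ≡ f bot ⊎ q ≡ f (+ t)
        go = step fx fy (uniq (t ∷ []) 7≤x₁ (vbot ∷ pos x₁ ∷ vN ∷ vN2 ∷ vN1 ∷ []) 7≤t) (face-⊆ swap-last X.link-bot) X.link-t f-N1
        choose : top ≡ f bot ⊎ top ≡ f (+ t) → -[1+ 3 ] ≡ f bot ⊎ -[1+ 3 ] ≡ f (+ t) → _
        choose (inj₁ e) (inj₁ e') = case trans e (sym e') of λ ()
        choose (inj₁ e) (inj₂ e') = inj₁ (sym e , sym e')
        choose (inj₂ e) (inj₁ e') = inj₂ (sym e' , sym e)
        choose (inj₂ e) (inj₂ e') = case trans e (sym e') of λ ()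

      U-m1 : Unique (+ (1 + N) ∷ -[1+ 0 ] ∷ + N ∷ + (2 + N) ∷ bot ∷ [])
      U-m1 = uniq (t ∷ []) 7≤x₁ (vN1 ∷ neg′ (# 1) ∷ vN ∷ vN2 ∷ vbot ∷ []) 7≤t

      -- The neighbour -1 of -(n+1) must go to 5, so 1 goes to -5, and the face {n-3, n-1, 1} would
      -- become the non-face {1, -4, -5}.
      first-way : f bot ≡ top → f (+ t) ≡ -[1+ 3 ] → ⊥
      first-way f-bot f-t = Y.no-triangle₁₄₅ (subst₂ (λ a b → Face Y (a ∷ b ∷ -[1+ 4 ] ∷ [])) f-t f-N1
          (subst (λ c → Face Y (f (+ t) ∷ f (+ (1 + N)) ∷ c ∷ [])) f-1 (fwd _ X.triangle-1)))
        where
        f-1 : f (+ 1) ≡ -[1+ 4 ]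
        f-1 = negate-value minus-one (other (step fx fy U-m1 X.link-bot X.link-bot-1 f-bot Y.link₂₃-top-5
          (out (t ∷ []) 7≤x₁ (pos (# 5)) (pos (# 2) ∷ pos (# 3) ∷ vtop ∷ []) 7≤t)) (λ e → case trans e f-N1 of λ ()))

      -- Now -1 goes to -6, so 1 goes to 6. The neighbour 8 of 6 would have to be the image of n+1
      -- or of -(n-3), but these go to 4 and -(n+1).
      second-way : f bot ≡ -[1+ 3 ] → f (+ t) ≡ top → ⊥
      second-way f-bot f-t = [ (λ e → case trans e (negate-value bot-InV f-bot) of λ ()) ,
                               (λ e → case trans e (negate-value (pos-InV (ℕP.≤-trans (s≤s z≤n) 7≤t) (ℕP.m≤n+m t 4)) f-t) of λ ()) ]′
          (step fx fy (uniq (t ∷ []) 7≤x₁ (vtop ∷ neg′ x₁ ∷ vN ∷ vN2 ∷ pos (# 1) ∷ []) 7≤t)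
            X.link-top-1 (face-⊆ swap-last X.link-1) f-1 Y.link₂₃-86
            (out [] tt′ (pos (# 8)) (pos (# 2) ∷ pos (# 3) ∷ pos (# 6) ∷ []) tt))
        where
        f-1 : f (+ 1) ≡ + 6
        f-1 = negate-value minus-one (other (step fx fy U-m1 X.link-bot X.link-bot-1 f-bot Y.link₂₃-6
          (out [] tt′ (neg′ (# 6)) (pos (# 2) ∷ pos (# 3) ∷ neg′ (# 4) ∷ []) tt)) (λ e → case trans e f-N1 of λ ()))

      impossible : ⊥
      impossible = [ (λ p → first-way (proj₁ p) (proj₂ p)) , (λ p → second-way (proj₁ p) (proj₂ p)) ]′ across-N1

  private
    N-InV : InV (3 + N) (+ N)
    N-InV = pos-InV (s≤s z≤n) (ℕP.m≤n+m N 3)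

    N2-InV : InV (3 + N) (+ (2 + N))
    N2-InV = pos-InV (s≤s z≤n) (ℕP.n≤1+n (2 + N))

    away-N : Away -[1+ N ] (+ N)
    away-N = (λ ()) , λ e → ℕP.1+n≢n (ℤP.-[1+-injective e)

    away-N2 : Away -[1+ N ] (+ (2 + N))
    away-N2 = (λ ()) , λ e → ℕP.1+n≢n (sym (ℤP.-[1+-injective e))

    module Straight {f} (i : Iso f) = Ends i (+ N) (+ (2 + N)) id id id N-InV N2-InV away-N away-N2 _,_
    module Swapped {f} (i : Iso f) = Ends i (+ (2 + N)) (+ N) unique-swap (face-⊆ swap-edge) (face-⊆ swap-edge) N2-InV N-InV
      away-N2 away-N (λ a b → b , a)

  rigid⁺ : ∀ {f} → Iso f → Either t (f (+ N)) (f (+ (2 + N))) → Fixes f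
  rigid⁺ i (inj₁ (inj₁ (a , b))) = ⊥-elim (Straight.Short.impossible i a b)
  rigid⁺ i (inj₂ (inj₁ (a , b))) = ⊥-elim (Swapped.Short.impossible i a b)
  rigid⁺ i (inj₁ (inj₂ (a , b))) = [ (λ p → Straight.Same.Fixed.fixes i a b (proj₁ p) (proj₂ p) a b) ,
    (λ p → ⊥-elim (Straight.Same.reflected i a b (proj₁ p) (proj₂ p))) ]′ (Straight.Same.across-N1 i a b)
  rigid⁺ i (inj₂ (inj₂ (a , b))) = ⊥-elim ([ (λ p → Swapped.Same.Fixed.unswapped i a b (proj₁ p) (proj₂ p) b) ,
    (λ p → Swapped.Same.reflected i a b (proj₁ p) (proj₂ p)) ]′ (Swapped.Same.across-N1 i a b))

  -- The image of {n-2, n} is again an edge with almost full link, hence one of the special edges up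
  -- to a global sign; a negative sign is removed by `negated`.
  rigid : ∀ {f} → Iso f → ∃ λ f' → Iso f' × Fixes f'
  rigid {f} i = [ (λ e → f , i , rigid⁺ i e) , (λ e → _ , negated i , rigid⁺ (negated i) e) ]′
    (Y.special (f-InV N-InV) (f-InV N2-InV) apart-xy (big-image N-InV N2-InV X.link-big))
    where
    open Properties i
    apart-xy : Away (f (+ N)) (f (+ (2 + N)))
    apart-xy = (λ e → ℕP.m≢1+n+m N {1} (ℤP.+-injective (injective e))) ,
               (λ e → case injective (trans e (sym (f-neg N2-InV))) of λ ())

  -- After normalisation the isomorphism fixes every vertex, so the face {n+1, 1, -d} that witnesses
  -- d is carried to the same face of Y.
  determined : Isomorphic X Y → ∀ {d} → 4 ≤ d → 3 + d ≤ N → d ∈ ds → d ∈ es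
  determined (f , g , gf , fg , F) {d} a b p = carry (rigid {f} (record { g = g ; gf = gf ; fg = fg ; fwd = λ σ → proj₁ (F σ) ; bwd = λ σ → proj₂ (F σ) }))
    where
    carry : (∃ λ f' → Iso f' × Fixes f') → d ∈ es
    carry (f' , i , fix) = Y.in-top a b (subst₂ (λ u w → Face Y (u ∷ w ∷ - (+ d) ∷ [])) (fix _ (pos-InV (s≤s z≤n) ℕP.≤-refl)) (fix _ (pos-InV ℕP.≤-refl (s≤s z≤n)))
      (subst (λ w → Face Y (f' top ∷ f' (+ 1) ∷ w ∷ [])) (fix _ (InV-neg (pos-InV (ℕP.≤-trans (s≤s z≤n) a) (ℕP.≤-trans (ℕP.m≤n+m d 3) (ℕP.≤-trans b (ℕP.m≤n+m N 3))))))
        (Iso.fwd i _ (X.top-in p))))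

-- Recovering I and counting the complexes

iso-sym : ∀ {K L} → Isomorphic K L → Isomorphic L K
iso-sym {K} {L} (f , g , gf , fg , F) = g , f , fg , gf , λ σ →
  (λ h → proj₂ (F (map g σ)) (subst (Face L) (sym (back σ)) h)) ,
  (λ h → subst (Face L) (back σ) (proj₁ (F (map g σ)) h))
  where
  back : ∀ σ → map f (map g σ) ≡ σ
  back [] = refl
  back (x ∷ σ) = cong₂ _∷_ (fg x) (back σ)

strict-head : ∀ {i j I} → StrictInc (i ∷ I) → j ∈ I → i < j
strict-head {I = _ ∷ _} (l ∷ _) (here refl) = l
strict-head {I = _ ∷ _} (l ∷ s) (there p) = ℕP.<-trans l (strict-head s p)

strict-tail : ∀ {i I} → StrictInc (i ∷ I) → StrictInc I
strict-tail [ _ ] = []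
strict-tail (_ ∷ s) = s

strict-≡ : ∀ {I J} → StrictInc I → StrictInc J → (∀ {i} → i ∈ I → i ∈ J) → (∀ {i} → i ∈ J → i ∈ I) → I ≡ J
strict-≡ {[]} {[]} _ _ _ _ = refl
strict-≡ {[]} {j ∷ J} _ _ _ g with g (here refl)
... | ()
strict-≡ {i ∷ I} {[]} _ _ f _ with f (here refl)
... | ()
strict-≡ {i ∷ I} {j ∷ J} s u f g = cong₂ _∷_ i≡j (strict-≡ (strict-tail s) (strict-tail u) f' g')
  where
  i≡j : i ≡ j
  i≡j with f (here refl) | g (here refl)
  ... | here e | _ = e
  ... | there _ | here e = sym e
  ... | there p | there q = ⊥-elim (ℕP.<-asym (strict-head u p) (strict-head s q))
  f' : ∀ {k} → k ∈ I → k ∈ J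
  f' p with f (there p)
  ... | there q = q
  ... | here e = ⊥-elim (ℕP.<-irrefl (trans i≡j (sym e)) (strict-head s p))
  g' : ∀ {k} → k ∈ J → k ∈ I
  g' p with g (there p)
  ... | there q = q
  ... | here e = ⊥-elim (ℕP.<-irrefl (trans (sym i≡j) (sym e)) (strict-head u p))

Δ3-data : ∀ t → 7 ≤ t → Sphere (3 + t) (Δ3 (3 + t)) × Closed (1 + t) (Δ3 (3 + t))
Δ3-data (suc k) _ = Δ3-sphere k

ΔI-profile : ∀ t → 7 ≤ t → ∀ I → InI (3 + t) I → Profile t (ΔI (3 + t) I) (map (1 + t ∸_) I)
ΔI-profile t 7≤t I inI = subst (λ D → Profile t D (map (1 + t ∸_) I)) Δ.D≡ Δ.profile
  where module Δ = Special t 7≤t (Δ3 (3 + t)) (proj₁ (Δ3-data t 7≤t)) (proj₂ (Δ3-data t 7≤t)) I inI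

isomorphic-⊆ : ∀ t → 7 ≤ t → ∀ I J → InI (3 + t) I → InI (3 + t) J →
  Isomorphic (ΔI (3 + t) I) (ΔI (3 + t) J) → ∀ {i} → i ∈ I → i ∈ J
isomorphic-⊆ t 7≤t I J inI inJ iso {i} p = back (Compare.determined t 7≤t (ΔI-profile t 7≤t I inI) (ΔI-profile t 7≤t J inJ) iso
    4≤d 3+d≤N (∈-map⁺ (λ i → 1 + t ∸ i) p))
  where
  N = 1 + t
  4≤t : 4 ≤ N
  4≤t = ℕP.≤-trans (s≤s (s≤s (s≤s (s≤s z≤n)))) (ℕP.≤-trans 7≤t (ℕP.n≤1+n t))
  bounds : ∀ {j J} → InI (3 + t) J → j ∈ J → 3 ≤ j × j ≤ N ∸ 4
  bounds inJ q = All.lookup (proj₁ (proj₂ inJ)) q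
  ≤N : ∀ {j J} → InI (3 + t) J → j ∈ J → j ≤ N
  ≤N inJ q = ℕP.≤-trans (proj₂ (bounds inJ q)) (ℕP.m∸n≤m N 4)
  4≤d : 4 ≤ N ∸ i
  4≤d = subst (_≤ N ∸ i) (ℕP.m∸[m∸n]≡n 4≤t) (ℕP.∸-monoʳ-≤ N (proj₂ (bounds inI p)))
  3+d≤N : 3 + (N ∸ i) ≤ N
  3+d≤N = subst (3 + (N ∸ i) ≤_) (ℕP.m+[n∸m]≡n (≤N inI p)) (ℕP.+-monoˡ-≤ (N ∸ i) (proj₁ (bounds inI p)))
  back : N ∸ i ∈ map (N ∸_) J → i ∈ J
  back q with ∈-map⁻ (λ j → N ∸ j) q
  ... | j , j∈ , e = subst (_∈ J) (sym (ℕP.∸-cancelˡ-≡ (≤N inI p) (≤N inJ j∈) e)) j∈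

non-isomorphic : ∀ t → 7 ≤ t → ∀ I J → InI (3 + t) I → InI (3 + t) J → I ≢ J → ¬ Isomorphic (ΔI (3 + t) I) (ΔI (3 + t) J)
non-isomorphic t 7≤t I J inI inJ n iso = n (strict-≡ (proj₁ inI) (proj₁ inJ)
  (isomorphic-⊆ t 7≤t I J inI inJ iso) (isomorphic-⊆ t 7≤t J I inJ inI (iso-sym iso)))

sublists : ℕ → ℕ → List (List ℕ)
sublists a zero = [] ∷ []
sublists a (suc k) = sublists (suc a) k ++ map (a ∷_) (sublists (suc a) k)

sublists-length : ∀ a k → length (sublists a k) ≡ 2 ^ k
sublists-length a zero = refl
sublists-length a (suc k) = trans (length-++ (sublists (suc a) k))
  (cong₂ _+_ (sublists-length (suc a) k) (trans (length-map (a ∷_) (sublists (suc a) k))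
    (trans (sublists-length (suc a) k) (sym (ℕP.+-identityʳ (2 ^ k))))))

Within : ℕ → ℕ → List ℕ → Set
Within a b I = StrictInc I × All (λ i → a ≤ i × i < b) I

sublists-within : ∀ a k → All (Within a (a + k)) (sublists a k)
sublists-within a zero = ([] , []) ∷ []
sublists-within a (suc k) = AllP.++⁺ (All.map weaken IH) (AllP.map⁺ (All.map extend IH))
  where
  IH : All (Within (suc a) (a + suc k)) (sublists (suc a) k)
  IH = subst (λ b → All (Within (suc a) b) (sublists (suc a) k)) (sym (ℕP.+-suc a k)) (sublists-within (suc a) k)
  loosen : ∀ {b I} → All (λ i → suc a ≤ i × i < b) I → All (λ i → a ≤ i × i < b) I
  loosen = All.map (λ (p , q) → ℕP.<⇒≤ p , q)
  weaken : ∀ {I} → Within (suc a) (a + suc k) I → Within a (a + suc k) I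
  weaken (s , w) = s , loosen w
  extend : ∀ {I} → Within (suc a) (a + suc k) I → Within a (a + suc k) (a ∷ I)
  extend {[]} _ = [ a ] , (ℕP.≤-refl , ℕP.m<m+n a (s≤s z≤n)) ∷ []
  extend {i ∷ I} (s , w@((p , _) ∷ _)) = (p ∷ s) , (ℕP.≤-refl , ℕP.m<m+n a (s≤s z≤n)) ∷ loosen w

sublists-distinct : ∀ a k → AllPairs _≢_ (sublists a k)
sublists-distinct a zero = [] ∷ []
sublists-distinct a (suc k) = AllPairsP.++⁺ IH
  (AllPairsP.map⁺ (Data.List.Relation.Unary.AllPairs.map (λ n e → n (cons-injective e)) IH))
  (All.map (λ w → AllP.map⁺ (All.tabulate (λ _ → new w))) (sublists-within (suc a) k))
  where
  IH : AllPairs _≢_ (sublists (suc a) k)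
  IH = sublists-distinct (suc a) k
  cons-injective : ∀ {I J} → a ∷ I ≡ a ∷ J → I ≡ J
  cons-injective refl = refl
  new : ∀ {I J b} → Within (suc a) b I → I ≢ a ∷ J
  new (_ , ((p , _) ∷ _)) refl = ℕP.<-irrefl refl p

lookup-pairs : ∀ {A : Set} {R : A → A → Set} → (∀ {x y} → R x y → R y x) → ∀ {xs} → AllPairs R xs →
  (i j : Fin (length xs)) → i ≢ j → R (lookup xs i) (lookup xs j)
lookup-pairs s (a ∷ r) Fin.zero Fin.zero n = ⊥-elim (n refl)
lookup-pairs s (a ∷ r) Fin.zero (Fin.suc j) n = All.lookup a (∈-lookup j)
lookup-pairs s (a ∷ r) (Fin.suc i) Fin.zero n = s (All.lookup a (∈-lookup i))
lookup-pairs s (a ∷ r) (Fin.suc i) (Fin.suc j) n = lookup-pairs s r i j (n ∘ cong Fin.suc)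

pairs-with : ∀ {A : Set} {P : A → Set} {R Q : A → A → Set} → (∀ {x y} → P x → P y → R x y → Q x y) →
  ∀ {xs} → All P xs → AllPairs R xs → AllPairs Q xs
pairs-with f [] [] = []
pairs-with f (p ∷ ps) (r ∷ rs) = All.zipWith (λ (q , s) → f p q s) (ps , r) ∷ pairs-with f ps rs

-- The sets {3} ∪ S with S ⊆ {5, …, n-6} already give 2^(n-10) complexes.
module Collection (t : ℕ) (7≤t : 7 ≤ t) where

  k : ℕ
  k = t ∸ 7

  k-eq : 7 + k ≡ t
  k-eq = ℕP.m+[n∸m]≡n 7≤t

  sets : List (List ℕ)
  sets = sublists 5 k

  Spheres : List Cx
  Spheres = map (λ I → ΔI (3 + t) (3 ∷ I)) sets

  indices : ∀ {I} → Within 5 (5 + k) I → InI (3 + t) (3 ∷ I)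
  indices {I} w = subst (λ t → InI (3 + t) (3 ∷ I)) k-eq (indices′ w)
    where
    indices′ : ∀ {I} → Within 5 (5 + k) I → InI (10 + k) (3 ∷ I)
    indices′ {[]} _ = [ 3 ] , (ℕP.≤-refl , ℕP.m≤m+n 3 (suc k)) ∷ [] , tt
    indices′ {i ∷ I} (s , w@((p , _) ∷ _)) = (ℕP.≤-trans (s≤s (s≤s (s≤s (s≤s z≤n)))) p ∷ s) ,
      (ℕP.≤-refl , ℕP.m≤m+n 3 (suc k)) ∷ All.map (λ (a , b) → ℕP.≤-trans (ℕP.m≤m+n 3 2) a , ℕP.≤-pred b) w ,
      -- The element after 3 is at least 5, which is the gap condition.
      p

  enough : 1 * 2 ^ (3 + t) ≤ 1024 * length Spheres
  enough = ℕP.≤-reflexive (trans (ℕP.*-identityˡ (2 ^ (3 + t))) (trans (cong (λ t → 2 ^ (3 + t)) (sym k-eq)) (trans (ℕP.^-distribˡ-+-* 2 10 k)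
    (cong (1024 *_) (sym (trans (length-map (λ I → ΔI (3 + t) (3 ∷ I)) sets) (sublists-length 5 k)))))))

  distinct-spheres : AllPairs (λ K L → ¬ Isomorphic K L) Spheres
  distinct-spheres = AllPairsP.map⁺ (pairs-with (λ {I} {J} p q n → non-isomorphic t 7≤t (3 ∷ I) (3 ∷ J) (indices p) (indices q)
    (λ e → n (tails e))) (sublists-within 5 k) (sublists-distinct 5 k))
    where
    tails : ∀ {I J} → 3 ∷ I ≡ 3 ∷ J → I ≡ J
    tails refl = refl

  Nice : Cx → Set
  Nice K = OnVertexSet (3 + t + 1) K × CentrallySymmetric K × CsNeighborly 2 (3 + t + 1) K × CombinatorialSphere 3 K

  nice : ∀ {I} → InI (3 + t) I → Nice (ΔI (3 + t) I)
  nice {I} inI = neighborly-onVertexSet S , sphere-cs S , sphere-neighborly (proj₁ (proj₂ (face⁻ (Profile.link-top-1 P)))) S , Sphere.sphere S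
    where
    P : Profile t (ΔI (3 + t) I) (map (1 + t ∸_) I)
    P = ΔI-profile t 7≤t I inI
    S : Sphere (3 + t + 1) (ΔI (3 + t) I)
    S = subst (λ m → Sphere m (ΔI (3 + t) I)) (ℕP.+-comm 1 (3 + t)) (Profile.sphere P)

  all-nice : All Nice Spheres
  all-nice = AllP.map⁺ (All.map (λ w → nice (indices w)) (sublists-within 5 k))

theorem7p9 : ((n : ℕ) → 10 ≤ n → (I J : List ℕ) → InI n I → InI n J → I ≢ J →
    ¬ Isomorphic (ΔI n I) (ΔI n J))
    ×
    Σ ℕ λ a → Σ ℕ λ b → 1 ≤ a × 1 ≤ b ×
    ((n : ℕ) → 10 ≤ n → Σ (List Cx) λ Ks →
    (a * 2 ^ n ≤ b * length Ks) ×
    ((i j : Fin (length Ks)) → i ≢ j → ¬ Isomorphic (lookup Ks i) (lookup Ks j)) ×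
    ((i : Fin (length Ks)) →
    OnVertexSet (n + 1) (lookup Ks i) ×
    CentrallySymmetric (lookup Ks i) ×
    CsNeighborly 2 (n + 1) (lookup Ks i) ×
    CombinatorialSphere 3 (lookup Ks i)))
theorem7p9 =
  (λ { (suc (suc (suc t))) (s≤s (s≤s (s≤s 7≤t))) → non-isomorphic t 7≤t }) ,
  -- The constant is c = 1/1024: with 3 fixed and 4 omitted, n - 10 elements remain free.
  1 , 1024 , s≤s z≤n , s≤s z≤n , λ { (suc (suc (suc t))) (s≤s (s≤s (s≤s 7≤t))) → let open Collection t 7≤t in
    Spheres , enough , lookup-pairs (λ n → n ∘ iso-sym) distinct-spheres , λ i → All.lookup all-nice (∈-lookup i) }
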